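{- Let $n$ be a positive integer with $n\equiv 1\pmod 4$, and let $M=(n-1)/2$ or $M=n-1$. Then \[ \sum_{k=0}^{M}[6k+1]\frac{(q;q^2)_k^2(q^2;q^4)_k(q;q^4)_k^2}{(q^2;q^2)_k^2(q^4;q^4)_k^3}q^{2k} \equiv [n]\frac{(q^2;q^4)_{(n-1)/4}^2}{(q^4;q^4)_{(n-1)/4}^2}\bigg\{1+[n]^2(2-q^n)\sum_{j=1}^{(n-1)/2}\frac{(-1)^{j+1}q^{2j}}{[2j]^2}\bigg\}\pmod{[n]\Phi_n(q)^4}. \]
   Context: For a complex number $x$ and integer $n\ge 0$, $(x;q)_n=\prod_{j=0}^{n-1}(1-xq^j)$ (with $(x;q)_0=1$). $[r]=(1-q^r)/(1-q)$ denotes the $q$-integer, and $\Phi_n(q)$ is the $n$-th cyclotomic polynomial in $q$. A congruence $A(q)\equiv B(q)\pmod{P(q)}$ between rational functions in $q$ whose denominators are coprime to the polynomial $P(q)$ means that $A(q)-B(q)$ is a rational function whose numerator is divisible by $P(q)$ and whose denominator is coprime to $P(q)$. -}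

module Defs where

open import Data.Nat as ℕ using (ℕ; zero; suc; _∸_)
open import Data.Nat.Divisibility using (_∣?_)
open import Data.Integer as ℤ using (ℤ; +_; -[1+_])
open import Data.List using (List; []; _∷_; map; foldr; filter; upTo)
open import Data.List.Relation.Unary.All using (All)
open import Data.Product using (_×_; _,_; Σ; ∃; ∃-syntax; proj₁; proj₂)
open import Relation.Binary.PropositionalEquality using (_≡_; _≢_)
open import Relation.Nullary using (¬_)

-- Polynomials in q with integer coefficients: coefficient lists,
-- lowest degree first.  Equality is up to trailing zeros.

Poly : Set
Poly = List ℤ

infixl 6 _⊕_ _⊖_
infixl 7 _⊗_

_⊕_ : Poly → Poly → Poly
[] ⊕ g = g
(a ∷ f) ⊕ [] = a ∷ f
(a ∷ f) ⊕ (b ∷ g) = (a ℤ.+ b) ∷ (f ⊕ g)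

pneg : Poly → Poly
pneg = map (λ a → ℤ.- a)

_⊖_ : Poly → Poly → Poly
f ⊖ g = f ⊕ pneg g

_⊗_ : Poly → Poly → Poly
[] ⊗ g = []
(a ∷ f) ⊗ g = map (a ℤ.*_) g ⊕ (+ 0 ∷ (f ⊗ g))

C : ℤ → Poly
C c = c ∷ []

one : Poly
one = C (+ 1)

X^ : ℕ → Poly
X^ zero = one
X^ (suc k) = + 0 ∷ X^ k

_^ᵖ_ : Poly → ℕ → Poly
f ^ᵖ zero = one
f ^ᵖ suc k = f ⊗ (f ^ᵖ k)

IsZero : Poly → Set
IsZero f = All (_≡ + 0) f

infix 4 _≃_
_≃_ : Poly → Poly → Set
f ≃ g = IsZero (f ⊖ g)

prodᵖ : List Poly → Poly
prodᵖ = foldr _⊗_ one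

prodRange : ℕ → (ℕ → Poly) → Poly
prodRange zero f = one
prodRange (suc k) f = prodRange k f ⊗ f k

qint : ℕ → Poly
qint zero = []
qint (suc r) = qint r ⊕ X^ r

qpoch : ℕ → ℕ → ℕ → Poly
qpoch s t k = prodRange k (λ j → one ⊖ X^ (s ℕ.+ t ℕ.* j))

-- Cyclotomic polynomials, characterised by  ∏_{d ∣ m} Φ_d = q^m - 1
-- for every m ≥ 1 (this determines the family uniquely).

divisors : ℕ → List ℕ
divisors m = filter (_∣? m) (map suc (upTo m))

IsCyclotomicFamily : (ℕ → Poly) → Set
IsCyclotomicFamily Φ = ∀ m → prodᵖ (map Φ (divisors (suc m))) ≃ X^ (suc m) ⊖ one

Frac : Set
Frac = Poly × Poly

num den : Frac → Poly
num = proj₁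
den = proj₂

fromPoly : Poly → Frac
fromPoly f = f , one

infixl 6 _+ᶠ_
infixl 7 _*ᶠ_

_+ᶠ_ : Frac → Frac → Frac
(a , b) +ᶠ (c , d) = (a ⊗ d ⊕ c ⊗ b) , (b ⊗ d)

_*ᶠ_ : Frac → Frac → Frac
(a , b) *ᶠ (c , d) = (a ⊗ c) , (b ⊗ d)

sumᶠ : ℕ → ℕ → (ℕ → Frac) → Frac
sumᶠ a b f = go (suc b ∸ a)
  where
  go : ℕ → Frac
  go zero = fromPoly []
  go (suc i) = go i +ᶠ f (a ℕ.+ i)

-- Congruence of rational functions modulo a polynomial P:
-- A - B = N / D with P ∣ N and D coprime to P (in ℚ[q]; since the
-- coefficients may be cleared, coprimality is expressed by a Bézout
-- identity u D + v P = c with c a nonzero integer).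

CongMod : Frac → Frac → Poly → Set
CongMod A B P =
  ∃[ N ] ∃[ D ] ∃[ K ] ∃[ u ] ∃[ v ] ∃[ c ]
    ( (¬ IsZero D)
    × (N ⊗ (den A ⊗ den B) ≃ (num A ⊗ den B ⊖ num B ⊗ den A) ⊗ D)
    × (N ≃ P ⊗ K)
    × (u ⊗ D ⊕ v ⊗ P ≃ C c)
    × (c ≢ + 0) )

lhsTerm : ℕ → Frac
lhsTerm k =
  ( qint (6 ℕ.* k ℕ.+ 1) ⊗ (qpoch 1 2 k ^ᵖ 2) ⊗ qpoch 2 4 k ⊗ (qpoch 1 4 k ^ᵖ 2) ⊗ X^ (2 ℕ.* k)
  , (qpoch 2 2 k ^ᵖ 2) ⊗ (qpoch 4 4 k ^ᵖ 3) )

LHS : ℕ → Frac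
LHS M = sumᶠ 0 M lhsTerm

innerTerm : ℕ → Frac
innerTerm j = (C (ℤ.-1ℤ ℤ.^ (suc j)) ⊗ X^ (2 ℕ.* j)) , (qint (2 ℕ.* j) ^ᵖ 2)

-- right-hand side for n, with m = (n-1)/4
RHS : ℕ → ℕ → Frac
RHS n m =
  (fromPoly (qint n) *ᶠ ((qpoch 2 4 m ^ᵖ 2) , (qpoch 4 4 m ^ᵖ 2)))
  *ᶠ ( fromPoly one
     +ᶠ fromPoly ((qint n ^ᵖ 2) ⊗ (C (+ 2) ⊖ X^ n)) *ᶠ sumᶠ 1 (2 ℕ.* m) innerTerm )

-- The k-th summand is deformed by parameters a, b, c: the series with s = a + 1/a and t = b + 1/b
-- gives back the original sum at a = b = c = 1.  For b = qⁿ, c = 1 it is a terminating case of the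
-- Gasper–Rahman quadratic summation, with a closed form H(s); for a = qⁿ, b = c = 1 it terminates
-- as well, with value H(2).  For c = qⁿ the same quadratic summation applies for b = 1 and b = qⁿ,
-- and the value has a factor [n].
--
-- Modulo Φₙ⁵ the deformed sum is interpolated.  Put u = qⁿ + q⁻ⁿ - 2, which is divisible by Φₙ².
-- The mixed second difference of the series in (s, t) between 2 and 2 + u is divisible by u²,
-- hence by Φₙ⁴, and moving c from 1 to qⁿ changes it by a multiple of (1 - qⁿ) u².  At c = qⁿ it is
-- divisible by Φₙ⁵ because of the extra factor [n]; so it is at c = 1, where it expresses the original
-- sum as 2 H(2) - H(2 + u).  Expanding H(2 + u) to first order in u yields the harmonic sum.
--
-- For a proper divisor d > 1 of n both sides vanish modulo Φ_d: the sum splits into blocks of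
-- length d (and one half block), each proportional to the first one, where b may be replaced by
-- q^(n′) with n′ ∈ {d, 3d} and n′ ≡ 1 (mod 4).  The Chinese remainder theorem over the divisors of n
-- combines these congruences.

module Submission where

-- The summation formulas hold in every field with an element q that is not a root of unity. They
-- are proved there and then specialised to the fraction field of the polynomials, so each
-- nonvanishing condition becomes an inequality between exponents of q, and divisibility by Φₙ is
-- measured in a subring of that field.
--
-- The parameters enter through s and t because a and b move by 1 - qⁿ, of order one in Φₙ, while s
-- and t move by (1 - qⁿ)²/qⁿ, of order two. This is the obstacle at c = qⁿ: the recurrence for the
-- quadratic sum yields factors containing b itself. Multiplying the factor of index i by that of
-- index 2m - 1 - i makes it symmetric in b and 1/b, hence rational in t; only then can the mixed
-- difference be estimated for the closed form as well.
--
-- Differences are never expanded. Functions on the corners of the parameter cube whose increments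
-- are divisible by the steps are closed under sums, products and inverses of units, so the series
-- is such a function as soon as its parameters are.
--
-- The recurrence moves z through q⁴, q⁸, ... with d fixed, although d is tied to the last z; its
-- product is therefore disentangled afterwards by reversing the order of half of its factors.

-- Polynomial identities in commutative rings by reflection

module RingSolver where

  open import Algebra.Bundles using (CommutativeRing)
  import Algebra.Properties.Ring as RingProperties
  import Algebra.Properties.Semiring.Exp as Exp
  import Algebra.Properties.Semiring.Mult as Mult
  open import Data.Bool using (Bool; true; false; _∧_)
  open import Data.Fin using (Fin; zero; suc)
  open import Data.Integer as ℤ using (ℤ; +_; -[1+_]; +[1+_])
  import Data.Integer.Properties as ℤ
  open import Data.List using (List; []; _∷_)
  open import Data.Nat as ℕ using (ℕ; zero; suc)
  import Data.Nat.Properties as ℕ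
  open import Data.Product using (_×_; _,_; proj₁; proj₂)
  open import Data.Vec as Vec using (Vec; []; _∷_; lookup; allFin)
  open import Data.Vec.N-ary using (N-ary; _$ⁿ_; curryⁿ; curryⁿ-cong; Eq)
  open import Level using (0ℓ)
  open import Relation.Binary.PropositionalEquality as ≡ using (_≡_)
  import Relation.Binary.Reasoning.Setoid as SetoidReasoning

  -- Dense recursive polynomials in n variables over ℤ.  Normal forms are computed without reference to
  -- the ring and compared by a Boolean, which keeps identities in many variables feasible.
  MPoly : ℕ → Set
  MPoly zero    = ℤ
  MPoly (suc n) = List (MPoly n)

  constᴹ : ∀ n → ℤ → MPoly n
  constᴹ zero    c = c
  constᴹ (suc n) c = constᴹ n c ∷ []

  zeroᴹ : ∀ n → MPoly n
  zeroᴹ zero    = + 0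
  zeroᴹ (suc n) = []

  varᴹ : ∀ {n} → Fin n → MPoly n
  varᴹ {suc n} zero    = zeroᴹ n ∷ constᴹ n (+ 1) ∷ []
  varᴹ         (suc i) = varᴹ i ∷ []

  addᴹ : ∀ n → MPoly n → MPoly n → MPoly n
  addᴹ zero    a       b       = a ℤ.+ b
  addᴹ (suc n) []      g       = g
  addᴹ (suc n) (a ∷ f) []      = a ∷ f
  addᴹ (suc n) (a ∷ f) (b ∷ g) = addᴹ n a b ∷ addᴹ (suc n) f g

  negᴹ : ∀ n → MPoly n → MPoly n
  negᴹ zero    a       = ℤ.- a
  negᴹ (suc n) []      = []
  negᴹ (suc n) (a ∷ f) = negᴹ n a ∷ negᴹ (suc n) f

  mutual
    mulᴹ : ∀ n → MPoly n → MPoly n → MPoly n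
    mulᴹ zero    a       b       = a ℤ.* b
    mulᴹ (suc n) []      g       = []
    mulᴹ (suc n) (a ∷ f) []      = []
    mulᴹ (suc n) (a ∷ f) (b ∷ g) = addᴹ (suc n) (scaleᴹ n a (b ∷ g)) (zeroᴹ n ∷ mulᴹ (suc n) f (b ∷ g))

    scaleᴹ : ∀ n → MPoly n → MPoly (suc n) → MPoly (suc n)
    scaleᴹ n a []      = []
    scaleᴹ n a (b ∷ g) = mulᴹ n a b ∷ scaleᴹ n a g

  -- Addition keeps cancelled coefficients, so the zero polynomial has many representatives; the
  -- test accepts all of them.
  isZeroᴹ : ∀ n → MPoly n → Bool
  isZeroᴹ zero    (+ zero)  = true
  isZeroᴹ zero    +[1+ _ ]  = false
  isZeroᴹ zero    -[1+ _ ]  = false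
  isZeroᴹ (suc n) []        = true
  isZeroᴹ (suc n) (a ∷ f)   = isZeroᴹ n a ∧ isZeroᴹ (suc n) f

  infixl 6 _:+_ _:-_
  infixl 7 _:*_
  infixr 8 _:^_
  infix  4 _:=_

  data Expr (n : ℕ) : Set where
    var       : Fin n → Expr n
    con       : ℤ → Expr n
    _:+_ _:*_ : Expr n → Expr n → Expr n
    :-_       : Expr n → Expr n
    _:^_      : Expr n → ℕ → Expr n

  _:-_ : ∀ {n} → Expr n → Expr n → Expr n
  e :- e′ = e :+ (:- e′)

  _:=_ : ∀ {n} → Expr n → Expr n → Expr n × Expr n
  _:=_ = _,_

  :0 :1 : ∀ {n} → Expr n
  :0 = con (+ 0)
  :1 = con (+ 1)

  powᴹ : ∀ n → MPoly n → ℕ → MPoly n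
  powᴹ n p zero    = constᴹ n (+ 1)
  powᴹ n p (suc k) = mulᴹ n p (powᴹ n p k)

  normalise : ∀ {n} → Expr n → MPoly n
  normalise         (var i)   = varᴹ i
  normalise {n}     (con c)   = constᴹ n c
  normalise {n} (e :+ e′)     = addᴹ n (normalise e) (normalise e′)
  normalise {n} (e :* e′)     = mulᴹ n (normalise e) (normalise e′)
  normalise {n} (:- e)        = negᴹ n (normalise e)
  normalise {n} (e :^ k)      = powᴹ n (normalise e) k

  close : ∀ n → N-ary n (Expr n) (Expr n × Expr n) → Expr n × Expr n
  close n f = f $ⁿ Vec.map var (allFin n)

  valid : ∀ n → N-ary n (Expr n) (Expr n × Expr n) → Bool
  valid n f = isZeroᴹ n (addᴹ n (normalise (proj₁ (close n f))) (negᴹ n (normalise (proj₂ (close n f)))))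

  module Solver (R : CommutativeRing 0ℓ 0ℓ) where

    open CommutativeRing R
    open RingProperties ring
    open Exp semiring using (_^_; ^-congˡ)
    open Mult semiring using (×-homo-+; ×1-homo-*) renaming (_×_ to _·_)
    open SetoidReasoning setoid

    -- The separate cases for 1 and -1 make `:1` denote `1#` itself and not `1# + 0#`, so that
    -- solved identities match the goals definitionally.
    fromℤ : ℤ → Carrier
    fromℤ (+ zero)  = 0#
    fromℤ (+ suc zero) = 1#
    fromℤ (+ n)     = n · 1#
    fromℤ -[1+ zero ] = - 1#
    fromℤ -[1+ n ]  = - (suc n · 1#)

    fromℤ-+ve : ∀ n → fromℤ (+ n) ≈ n · 1#
    fromℤ-+ve zero          = refl
    fromℤ-+ve (suc zero)    = sym (+-identityʳ 1#)
    fromℤ-+ve (suc (suc n)) = refl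

    fromℤ-neg : ∀ i → fromℤ (ℤ.- i) ≈ - fromℤ i
    fromℤ-neg (+ zero)        = sym -0#≈0#
    fromℤ-neg (+ suc zero)    = refl
    fromℤ-neg +[1+ suc n ]    = refl
    fromℤ-neg -[1+ zero ]     = sym (-‿involutive 1#)
    fromℤ-neg -[1+ suc n ]    = sym (-‿involutive _)

    fromℤ-⊖ : ∀ m n → fromℤ (m ℤ.⊖ n) ≈ m · 1# + - (n · 1#)
    fromℤ-⊖ m       zero    = trans (fromℤ-+ve m) (sym (trans (+-congˡ -0#≈0#) (+-identityʳ _)))
    fromℤ-⊖ zero    (suc n) = trans (fromℤ-neg (+ suc n))
      (trans (-‿cong (fromℤ-+ve (suc n))) (sym (+-identityˡ _)))
    fromℤ-⊖ (suc m) (suc n) = begin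
      fromℤ (suc m ℤ.⊖ suc n)                  ≡⟨ ≡.cong fromℤ (ℤ.[1+m]⊖[1+n]≡m⊖n m n) ⟩
      fromℤ (m ℤ.⊖ n)                          ≈⟨ fromℤ-⊖ m n ⟩
      m · 1# + - (n · 1#)                      ≈⟨ +-congʳ (+-identityʳ _) ⟨
      m · 1# + 0# + - (n · 1#)                 ≈⟨ +-congʳ (+-congˡ (-‿inverseʳ 1#)) ⟨
      m · 1# + (1# + - 1#) + - (n · 1#)        ≈⟨ +-congʳ (+-assoc _ _ _) ⟨
      m · 1# + 1# + - 1# + - (n · 1#)          ≈⟨ +-assoc _ _ _ ⟩
      m · 1# + 1# + (- 1# + - (n · 1#))        ≈⟨ +-cong (+-comm _ _) (-‿+-comm _ _) ⟩
      (1# + m · 1#) + - (1# + n · 1#)          ∎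

    fromℤ-+ : ∀ i j → fromℤ (i ℤ.+ j) ≈ fromℤ i + fromℤ j
    fromℤ-+ (+ m) (+ n) = begin
      fromℤ (+ (m ℕ.+ n))       ≈⟨ fromℤ-+ve (m ℕ.+ n) ⟩
      (m ℕ.+ n) · 1#            ≈⟨ ×-homo-+ 1# m n ⟩
      m · 1# + n · 1#           ≈⟨ +-cong (fromℤ-+ve m) (fromℤ-+ve n) ⟨
      fromℤ (+ m) + fromℤ (+ n) ∎
    fromℤ-+ (+ m) -[1+ n ] = trans (fromℤ-⊖ m (suc n))
      (sym (+-cong (fromℤ-+ve m) (trans (fromℤ-neg (+ suc n)) (-‿cong (fromℤ-+ve (suc n))))))
    fromℤ-+ -[1+ m ] (+ n) = trans (fromℤ-⊖ n (suc m))
      (trans (+-comm _ _)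
        (sym (+-cong (trans (fromℤ-neg (+ suc m)) (-‿cong (fromℤ-+ve (suc m)))) (fromℤ-+ve n))))
    fromℤ-+ -[1+ m ] -[1+ n ] = begin
      fromℤ -[1+ suc (m ℕ.+ n) ]                  ≡⟨ ≡.cong (λ k → fromℤ -[1+ k ]) (ℕ.+-suc m n) ⟨
      fromℤ (ℤ.- (+ suc m ℤ.+ + suc n))           ≈⟨ fromℤ-neg (+ suc m ℤ.+ + suc n) ⟩
      - fromℤ (+ suc m ℤ.+ + suc n)               ≈⟨ -‿cong (fromℤ-+ (+ suc m) (+ suc n)) ⟩
      - (fromℤ (+ suc m) + fromℤ (+ suc n))       ≈⟨ -‿+-comm _ _ ⟨
      - fromℤ (+ suc m) + - fromℤ (+ suc n)       ≈⟨ +-cong (fromℤ-neg (+ suc m)) (fromℤ-neg (+ suc n)) ⟨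
      fromℤ -[1+ m ] + fromℤ -[1+ n ]             ∎

    fromℤ-*ve : ∀ m n → fromℤ (+ m ℤ.* + n) ≈ fromℤ (+ m) * fromℤ (+ n)
    fromℤ-*ve m n = begin
      fromℤ (+ m ℤ.* + n)       ≡⟨ ≡.cong fromℤ (ℤ.pos-* m n) ⟨
      fromℤ (+ (m ℕ.* n))       ≈⟨ fromℤ-+ve (m ℕ.* n) ⟩
      (m ℕ.* n) · 1#            ≈⟨ ×1-homo-* m n ⟩
      (m · 1#) * (n · 1#)       ≈⟨ *-cong (fromℤ-+ve m) (fromℤ-+ve n) ⟨
      fromℤ (+ m) * fromℤ (+ n) ∎

    fromℤ-* : ∀ i j → fromℤ (i ℤ.* j) ≈ fromℤ i * fromℤ j
    fromℤ-* (+ m)    (+ n)    = fromℤ-*ve m n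
    fromℤ-* (+ m)    -[1+ n ] = begin
      fromℤ (+ m ℤ.* -[1+ n ])              ≡⟨ ≡.cong fromℤ (ℤ.neg-distribʳ-* (+ m) (+ suc n)) ⟨
      fromℤ (ℤ.- (+ m ℤ.* + suc n))         ≈⟨ fromℤ-neg (+ m ℤ.* + suc n) ⟩
      - fromℤ (+ m ℤ.* + suc n)             ≈⟨ -‿cong (fromℤ-*ve m (suc n)) ⟩
      - (fromℤ (+ m) * fromℤ (+ suc n))     ≈⟨ -‿distribʳ-* _ _ ⟩
      fromℤ (+ m) * - fromℤ (+ suc n)       ≈⟨ *-congˡ (fromℤ-neg (+ suc n)) ⟨
      fromℤ (+ m) * fromℤ -[1+ n ]          ∎
    fromℤ-* -[1+ m ] j = begin
      fromℤ (-[1+ m ] ℤ.* j)                ≡⟨ ≡.cong fromℤ (ℤ.neg-distribˡ-* (+ suc m) j) ⟨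
      fromℤ (ℤ.- (+ suc m ℤ.* j))           ≈⟨ fromℤ-neg (+ suc m ℤ.* j) ⟩
      - fromℤ (+ suc m ℤ.* j)               ≈⟨ -‿cong (pos-* j) ⟩
      - (fromℤ (+ suc m) * fromℤ j)         ≈⟨ -‿distribˡ-* _ _ ⟩
      - fromℤ (+ suc m) * fromℤ j           ≈⟨ *-congʳ (fromℤ-neg (+ suc m)) ⟨
      fromℤ -[1+ m ] * fromℤ j              ∎
      where
      pos-* : ∀ j → fromℤ (+ suc m ℤ.* j) ≈ fromℤ (+ suc m) * fromℤ j
      pos-* (+ n)    = fromℤ-*ve (suc m) n
      pos-* -[1+ n ] = fromℤ-* (+ suc m) -[1+ n ]

    Env : ℕ → Set
    Env = Vec Carrier

    eval : ∀ n → MPoly n → Env n → Carrier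
    eval zero    c       []      = fromℤ c
    eval (suc n) []      (x ∷ ρ) = 0#
    eval (suc n) (a ∷ f) (x ∷ ρ) = eval n a ρ + x * eval (suc n) f (x ∷ ρ)

    eval-const : ∀ n c ρ → eval n (constᴹ n c) ρ ≈ fromℤ c
    eval-const zero    c []      = refl
    eval-const (suc n) c (x ∷ ρ) =
      trans (+-cong (eval-const n c ρ) (zeroʳ x)) (+-identityʳ _)

    eval-zero : ∀ n ρ → eval n (zeroᴹ n) ρ ≈ 0#
    eval-zero zero    []      = refl
    eval-zero (suc n) (x ∷ ρ) = refl

    eval-var : ∀ {n} (i : Fin n) ρ → eval n (varᴹ i) ρ ≈ lookup ρ i
    eval-var {suc n} zero (x ∷ ρ) = begin
      eval n (zeroᴹ n) ρ + x * (eval n (constᴹ n (+ 1)) ρ + x * 0#)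
        ≈⟨ +-cong (eval-zero n ρ) (*-congˡ (+-cong (eval-const n (+ 1) ρ) (zeroʳ x))) ⟩
      0# + x * (1# + 0#)  ≈⟨ +-identityˡ _ ⟩
      x * (1# + 0#)       ≈⟨ *-congˡ (+-identityʳ 1#) ⟩
      x * 1#              ≈⟨ *-identityʳ x ⟩
      x                   ∎
    eval-var (suc i) (x ∷ ρ) = trans (+-cong (eval-var i ρ) (zeroʳ x)) (+-identityʳ _)

    +-interchange : ∀ a b c d → (a + b) + (c + d) ≈ (a + c) + (b + d)
    +-interchange a b c d = begin
      (a + b) + (c + d) ≈⟨ +-assoc a b _ ⟩
      a + (b + (c + d)) ≈⟨ +-congˡ (+-assoc b c d) ⟨
      a + ((b + c) + d) ≈⟨ +-congˡ (+-congʳ (+-comm b c)) ⟩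
      a + ((c + b) + d) ≈⟨ +-congˡ (+-assoc c b d) ⟩
      a + (c + (b + d)) ≈⟨ +-assoc a c _ ⟨
      (a + c) + (b + d) ∎

    *-swapˡ : ∀ a b c → a * (b * c) ≈ b * (a * c)
    *-swapˡ a b c = trans (sym (*-assoc a b c)) (trans (*-congʳ (*-comm a b)) (*-assoc b a c))

    eval-add : ∀ n f g ρ → eval n (addᴹ n f g) ρ ≈ eval n f ρ + eval n g ρ
    eval-add zero    a       b       []      = fromℤ-+ a b
    eval-add (suc n) []      g       (x ∷ ρ) = sym (+-identityˡ _)
    eval-add (suc n) (a ∷ f) []      (x ∷ ρ) = sym (+-identityʳ _)
    eval-add (suc n) (a ∷ f) (b ∷ g) (x ∷ ρ) = begin
      eval n (addᴹ n a b) ρ + x * eval (suc n) (addᴹ (suc n) f g) (x ∷ ρ)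
        ≈⟨ +-cong (eval-add n a b ρ) (trans (*-congˡ (eval-add (suc n) f g (x ∷ ρ))) (distribˡ _ _ _)) ⟩
      (eval n a ρ + eval n b ρ) + (x * eval (suc n) f (x ∷ ρ) + x * eval (suc n) g (x ∷ ρ))
        ≈⟨ +-interchange _ _ _ _ ⟩
      (eval n a ρ + x * eval (suc n) f (x ∷ ρ)) + (eval n b ρ + x * eval (suc n) g (x ∷ ρ)) ∎

    eval-neg : ∀ n f ρ → eval n (negᴹ n f) ρ ≈ - eval n f ρ
    eval-neg zero    a       []      = fromℤ-neg a
    eval-neg (suc n) []      (x ∷ ρ) = sym -0#≈0#
    eval-neg (suc n) (a ∷ f) (x ∷ ρ) =
      trans (+-cong (eval-neg n a ρ) (trans (*-congˡ (eval-neg (suc n) f (x ∷ ρ))) (sym (-‿distribʳ-* _ _))))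
            (-‿+-comm _ _)

    mutual
      eval-mul : ∀ n f g ρ → eval n (mulᴹ n f g) ρ ≈ eval n f ρ * eval n g ρ
      eval-mul zero    a       b []      = fromℤ-* a b
      eval-mul (suc n) []      g (x ∷ ρ) = sym (zeroˡ _)
      eval-mul (suc n) (a ∷ f) [] (x ∷ ρ) = sym (zeroʳ _)
      eval-mul (suc n) (a ∷ f) (b ∷ g′) (x ∷ ρ) = begin
        eval (suc n) (addᴹ (suc n) (scaleᴹ n a g) (zeroᴹ n ∷ mulᴹ (suc n) f g)) (x ∷ ρ)
          ≈⟨ eval-add (suc n) (scaleᴹ n a g) (zeroᴹ n ∷ mulᴹ (suc n) f g) (x ∷ ρ) ⟩
        eval (suc n) (scaleᴹ n a g) (x ∷ ρ) + (eval n (zeroᴹ n) ρ + x * eval (suc n) (mulᴹ (suc n) f g) (x ∷ ρ))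
          ≈⟨ +-cong (eval-scale n a g x ρ) (+-cong (eval-zero n ρ) (*-congˡ (eval-mul (suc n) f g (x ∷ ρ)))) ⟩
        eval n a ρ * G + (0# + x * (eval (suc n) f (x ∷ ρ) * G))
          ≈⟨ +-congˡ (trans (+-identityˡ _) (sym (*-assoc x _ G))) ⟩
        eval n a ρ * G + (x * eval (suc n) f (x ∷ ρ)) * G
          ≈⟨ distribʳ G _ _ ⟨
        (eval n a ρ + x * eval (suc n) f (x ∷ ρ)) * G ∎
        where
        g = b ∷ g′
        G = eval (suc n) g (x ∷ ρ)

      eval-scale : ∀ n a g x ρ → eval (suc n) (scaleᴹ n a g) (x ∷ ρ) ≈ eval n a ρ * eval (suc n) g (x ∷ ρ)
      eval-scale n a []      x ρ = sym (zeroʳ _)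
      eval-scale n a (b ∷ g) x ρ = begin
        eval n (mulᴹ n a b) ρ + x * eval (suc n) (scaleᴹ n a g) (x ∷ ρ)
          ≈⟨ +-cong (eval-mul n a b ρ) (*-congˡ (eval-scale n a g x ρ)) ⟩
        eval n a ρ * eval n b ρ + x * (eval n a ρ * eval (suc n) g (x ∷ ρ))
          ≈⟨ +-congˡ (*-swapˡ x _ _) ⟩
        eval n a ρ * eval n b ρ + eval n a ρ * (x * eval (suc n) g (x ∷ ρ))
          ≈⟨ distribˡ _ _ _ ⟨
        eval n a ρ * (eval n b ρ + x * eval (suc n) g (x ∷ ρ)) ∎

    eval-pow : ∀ n f k ρ → eval n (powᴹ n f k) ρ ≈ eval n f ρ ^ k
    eval-pow n f zero    ρ = eval-const n (+ 1) ρ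
    eval-pow n f (suc k) ρ = trans (eval-mul n f (powᴹ n f k) ρ) (*-congˡ (eval-pow n f k ρ))

    eval-isZero : ∀ n f ρ → isZeroᴹ n f ≡ true → eval n f ρ ≈ 0#
    eval-isZero zero    (+ zero) []      _ = refl
    eval-isZero (suc n) []       (x ∷ ρ) _ = refl
    eval-isZero (suc n) (a ∷ f)  (x ∷ ρ) p with isZeroᴹ n a in eq
    ... | true = trans (+-cong (eval-isZero n a ρ eq)
                               (trans (*-congˡ (eval-isZero (suc n) f (x ∷ ρ) p)) (zeroʳ x)))
                       (+-identityʳ 0#)

    ⟦_⟧ : ∀ {n} → Expr n → Env n → Carrier
    ⟦ var i ⟧   ρ = lookup ρ i
    ⟦ con c ⟧   ρ = fromℤ c
    ⟦ e :+ e′ ⟧ ρ = ⟦ e ⟧ ρ + ⟦ e′ ⟧ ρ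
    ⟦ e :* e′ ⟧ ρ = ⟦ e ⟧ ρ * ⟦ e′ ⟧ ρ
    ⟦ :- e ⟧    ρ = - ⟦ e ⟧ ρ
    ⟦ e :^ k ⟧  ρ = ⟦ e ⟧ ρ ^ k

    normalise-correct : ∀ {n} (e : Expr n) ρ → eval n (normalise e) ρ ≈ ⟦ e ⟧ ρ
    normalise-correct (var i)   ρ = eval-var i ρ
    normalise-correct {n} (con c) ρ = eval-const n c ρ
    normalise-correct {n} (e :+ e′) ρ =
      trans (eval-add n (normalise e) (normalise e′) ρ) (+-cong (normalise-correct e ρ) (normalise-correct e′ ρ))
    normalise-correct {n} (e :* e′) ρ =
      trans (eval-mul n (normalise e) (normalise e′) ρ) (*-cong (normalise-correct e ρ) (normalise-correct e′ ρ))
    normalise-correct {n} (:- e) ρ = trans (eval-neg n (normalise e) ρ) (-‿cong (normalise-correct e ρ))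
    normalise-correct {n} (e :^ k) ρ = trans (eval-pow n (normalise e) k ρ) (^-congˡ k (normalise-correct e ρ))

    prove : ∀ {n} (e e′ : Expr n) → isZeroᴹ n (addᴹ n (normalise e) (negᴹ n (normalise e′))) ≡ true →
            ∀ ρ → ⟦ e ⟧ ρ ≈ ⟦ e′ ⟧ ρ
    prove {n} e e′ p ρ = x∙y⁻¹≈ε⇒x≈y _ _ (begin
      ⟦ e ⟧ ρ + - ⟦ e′ ⟧ ρ
        ≈⟨ +-cong (normalise-correct e ρ) (-‿cong (normalise-correct e′ ρ)) ⟨
      eval n (normalise e) ρ + - eval n (normalise e′) ρ
        ≈⟨ +-congˡ (eval-neg n (normalise e′) ρ) ⟨
      eval n (normalise e) ρ + eval n (negᴹ n (normalise e′)) ρ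
        ≈⟨ eval-add n (normalise e) _ ρ ⟨
      eval n (addᴹ n (normalise e) (negᴹ n (normalise e′))) ρ
        ≈⟨ eval-isZero n _ ρ p ⟩
      0# ∎)

    solve : ∀ n (f : N-ary n (Expr n) (Expr n × Expr n)) → valid n f ≡ true →
            Eq n _≈_ (curryⁿ ⟦ proj₁ (close n f) ⟧) (curryⁿ ⟦ proj₂ (close n f) ⟧)
    solve n f p = curryⁿ-cong _≈_ ⟦ proj₁ (close n f) ⟧ ⟦ proj₂ (close n f) ⟧
      (prove (proj₁ (close n f)) (proj₂ (close n f)) p)

-- Fields, finite sums and finite products

module FieldTheory where

  open RingSolver
  open import Algebra.Bundles using (CommutativeRing)
  import Algebra.Properties.Ring as RingProperties
  import Algebra.Properties.Semiring.Exp as Exp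
  open import Data.Nat as ℕ using (ℕ; zero; suc; _<_)
  import Data.Nat.Properties as ℕ
  open import Level using (0ℓ)
  open import Relation.Binary.PropositionalEquality as ≡ using (_≡_)
  import Relation.Binary.Reasoning.Setoid as SetoidReasoning
  open import Relation.Nullary using (¬_)

  -- Inversion is total and unconstrained at zero: quotients can be written down first, and the
  -- denominators are examined only where they are cancelled.
  record Field : Set₁ where
    infix 9 _⁻¹
    field
      commutativeRing : CommutativeRing 0ℓ 0ℓ
    open CommutativeRing commutativeRing using (Carrier; _≈_; _*_; 0#; 1#)
    field
      _⁻¹        : Carrier → Carrier
      ⁻¹-cong    : ∀ {x y} → x ≈ y → x ⁻¹ ≈ y ⁻¹
      ⁻¹-inverse : ∀ {x} → ¬ x ≈ 0# → x * x ⁻¹ ≈ 1#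
      1≉0        : ¬ 1# ≈ 0#

  module FieldProperties (F : Field) where

    open Field F using (_⁻¹; ⁻¹-cong; ⁻¹-inverse; 1≉0) public
    open CommutativeRing (Field.commutativeRing F) public
      renaming (Carrier to K)
    open RingProperties ring using (-0#≈0#; x∙y⁻¹≈ε⇒x≈y; x≈y⇒x∙y⁻¹≈ε) public
    open Exp semiring using (_^_; ^-homo-*; ^-congˡ; ^-congʳ; ^-assocʳ) public
    open Solver (Field.commutativeRing F) public
      using (solve; fromℤ; fromℤ-+ve; fromℤ-neg; *-swapˡ; +-interchange)
    open SetoidReasoning setoid public

    infixl 7 _÷_
    _÷_ : K → K → K
    x ÷ y = x * y ⁻¹

    NonZero : K → Set
    NonZero x = ¬ x ≈ 0#

    NonZero-resp : ∀ {x y} → x ≈ y → NonZero x → NonZero y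
    NonZero-resp x≈y x≉0 y≈0 = x≉0 (trans x≈y y≈0)

    *-cancelˡ : ∀ {d x y} → NonZero d → d * x ≈ d * y → x ≈ y
    *-cancelˡ {d} {x} {y} d≉0 dx≈dy = begin
      x                ≈⟨ expand x ⟩
      d ⁻¹ * (d * x)   ≈⟨ *-congˡ dx≈dy ⟩
      d ⁻¹ * (d * y)   ≈⟨ expand y ⟨
      y                ∎
      where
      expand : ∀ x → x ≈ d ⁻¹ * (d * x)
      expand x = begin
        x                ≈⟨ *-identityˡ x ⟨
        1# * x           ≈⟨ *-congʳ (⁻¹-inverse d≉0) ⟨
        d * d ⁻¹ * x     ≈⟨ solve 3 (λ d i x → d :* i :* x := i :* (d :* x)) ≡.refl d (d ⁻¹) x ⟩
        d ⁻¹ * (d * x)   ∎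

    *-cancelʳ : ∀ {d x y} → NonZero d → x * d ≈ y * d → x ≈ y
    *-cancelʳ d≉0 xd≈yd = *-cancelˡ d≉0 (trans (*-comm _ _) (trans xd≈yd (*-comm _ _)))

    *-NonZero : ∀ {x y} → NonZero x → NonZero y → NonZero (x * y)
    *-NonZero x≉0 y≉0 xy≈0 = y≉0 (*-cancelˡ x≉0 (trans xy≈0 (sym (zeroʳ _))))

    *-NonZero⁻ˡ : ∀ {x y} → NonZero (x * y) → NonZero x
    *-NonZero⁻ˡ xy≉0 x≈0 = xy≉0 (trans (*-congʳ x≈0) (zeroˡ _))

    ⁻¹-NonZero : ∀ {x} → NonZero x → NonZero (x ⁻¹)
    ⁻¹-NonZero x≉0 x⁻¹≈0 = 1≉0 (trans (sym (⁻¹-inverse x≉0)) (trans (*-congˡ x⁻¹≈0) (zeroʳ _)))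

    neg-NonZero : ∀ {x} → NonZero x → NonZero (- x)
    neg-NonZero x≉0 -x≈0 = x≉0 (trans (solve 1 (λ x → x := :- (:- x)) ≡.refl _) (trans (-‿cong -x≈0) -0#≈0#))

    ^-NonZero : ∀ {x} n → NonZero x → NonZero (x ^ n)
    ^-NonZero zero    _   = 1≉0
    ^-NonZero (suc n) x≉0 = *-NonZero x≉0 (^-NonZero n x≉0)

    ÷-cong : ∀ {x x′ y y′} → x ≈ x′ → y ≈ y′ → x ÷ y ≈ x′ ÷ y′
    ÷-cong p r = *-cong p (⁻¹-cong r)

    ÷-cancel : ∀ {x y} → NonZero y → x ÷ y * y ≈ x
    ÷-cancel {x} {y} y≉0 = begin
      x * y ⁻¹ * y   ≈⟨ solve 3 (λ x i y → x :* i :* y := x :* (y :* i)) ≡.refl x (y ⁻¹) y ⟩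
      x * (y * y ⁻¹) ≈⟨ *-congˡ (⁻¹-inverse y≉0) ⟩
      x * 1#         ≈⟨ *-identityʳ x ⟩
      x              ∎

    ÷-intro : ∀ {x y d} → NonZero d → x * d ≈ y → x ≈ y ÷ d
    ÷-intro d≉0 xd≈y = *-cancelʳ d≉0 (trans xd≈y (sym (÷-cancel d≉0)))

    ÷-cross : ∀ {a b c d} → NonZero b → NonZero d → a * d ≈ c * b → a ÷ b ≈ c ÷ d
    ÷-cross {a} {b} {c} {d} b≉0 d≉0 ad≈cb = ÷-intro d≉0 (begin
      a * b ⁻¹ * d   ≈⟨ solve 3 (λ a i d → a :* i :* d := a :* d :* i) ≡.refl a (b ⁻¹) d ⟩
      a * d * b ⁻¹   ≈⟨ *-congʳ ad≈cb ⟩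
      c * b * b ⁻¹   ≈⟨ *-assoc c b _ ⟩
      c * (b * b ⁻¹) ≈⟨ *-congˡ (⁻¹-inverse b≉0) ⟩
      c * 1#         ≈⟨ *-identityʳ c ⟩
      c              ∎)

    ⁻¹-unique : ∀ {x y} → NonZero x → x * y ≈ 1# → y ≈ x ⁻¹
    ⁻¹-unique x≉0 xy≈1 = *-cancelˡ x≉0 (trans xy≈1 (sym (⁻¹-inverse x≉0)))

    ⁻¹-distrib-* : ∀ {x y} → NonZero x → NonZero y → x ⁻¹ * y ⁻¹ ≈ (x * y) ⁻¹
    ⁻¹-distrib-* {x} {y} x≉0 y≉0 = ⁻¹-unique (*-NonZero x≉0 y≉0) (begin
      x * y * (x ⁻¹ * y ⁻¹)
        ≈⟨ solve 4 (λ x y i j → x :* y :* (i :* j) := (x :* i) :* (y :* j)) ≡.refl x y _ _ ⟩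
      (x * x ⁻¹) * (y * y ⁻¹) ≈⟨ *-cong (⁻¹-inverse x≉0) (⁻¹-inverse y≉0) ⟩
      1# * 1#                 ≈⟨ *-identityˡ 1# ⟩
      1#                      ∎)

    ÷-*-÷ : ∀ {a b c d} → NonZero b → NonZero d → (a ÷ b) * (c ÷ d) ≈ (a * c) ÷ (b * d)
    ÷-*-÷ {a} {b} {c} {d} b≉0 d≉0 = begin
      a * b ⁻¹ * (c * d ⁻¹)   ≈⟨ solve 4 (λ a i c j → a :* i :* (c :* j) := a :* c :* (i :* j)) ≡.refl a _ c _ ⟩
      a * c * (b ⁻¹ * d ⁻¹)   ≈⟨ *-congˡ (⁻¹-distrib-* b≉0 d≉0) ⟩
      a * c * (b * d) ⁻¹      ∎

    sum prod : (ℕ → K) → ℕ → K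
    sum f zero     = 0#
    sum f (suc n)  = sum f n + f n
    prod f zero    = 1#
    prod f (suc n) = prod f n * f n

    sum-cong : ∀ {f g} n → (∀ i → i < n → f i ≈ g i) → sum f n ≈ sum g n
    sum-cong zero    _  = refl
    sum-cong (suc n) eq = +-cong (sum-cong n (λ i i<n → eq i (ℕ.m<n⇒m<1+n i<n))) (eq n ℕ.≤-refl)

    prod-cong : ∀ {f g} n → (∀ i → i < n → f i ≈ g i) → prod f n ≈ prod g n
    prod-cong zero    _  = refl
    prod-cong (suc n) eq = *-cong (prod-cong n (λ i i<n → eq i (ℕ.m<n⇒m<1+n i<n))) (eq n ℕ.≤-refl)

    sum-+ : ∀ f g n → sum (λ i → f i + g i) n ≈ sum f n + sum g n
    sum-+ f g zero    = sym (+-identityˡ 0#)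
    sum-+ f g (suc n) = trans (+-congʳ (sum-+ f g n)) (+-interchange _ _ _ _)

    sum-*ˡ : ∀ c f n → sum (λ i → c * f i) n ≈ c * sum f n
    sum-*ˡ c f zero    = sym (zeroʳ c)
    sum-*ˡ c f (suc n) = trans (+-congʳ (sum-*ˡ c f n)) (sym (distribˡ _ _ _))

    sum-neg : ∀ f n → sum (λ i → - f i) n ≈ - sum f n
    sum-neg f zero    = sym -0#≈0#
    sum-neg f (suc n) = trans (+-congʳ (sum-neg f n)) (solve 2 (λ a b → :- a :+ :- b := :- (a :+ b)) ≡.refl _ _)

    sum-split : ∀ f m n → sum f (m ℕ.+ n) ≈ sum f m + sum (λ i → f (m ℕ.+ i)) n
    sum-split f m zero    = trans (reflexive (≡.cong (sum f) (ℕ.+-identityʳ m))) (sym (+-identityʳ _))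
    sum-split f m (suc n) = begin
      sum f (m ℕ.+ suc n)                                 ≡⟨ ≡.cong (sum f) (ℕ.+-suc m n) ⟩
      sum f (m ℕ.+ n) + f (m ℕ.+ n)                       ≈⟨ +-congʳ (sum-split f m n) ⟩
      sum f m + sum (λ i → f (m ℕ.+ i)) n + f (m ℕ.+ n)   ≈⟨ +-assoc _ _ _ ⟩
      sum f m + (sum (λ i → f (m ℕ.+ i)) n + f (m ℕ.+ n)) ∎

    prod-split : ∀ f m n → prod f (m ℕ.+ n) ≈ prod f m * prod (λ i → f (m ℕ.+ i)) n
    prod-split f m zero    = trans (reflexive (≡.cong (prod f) (ℕ.+-identityʳ m))) (sym (*-identityʳ _))
    prod-split f m (suc n) = begin
      prod f (m ℕ.+ suc n)                                  ≡⟨ ≡.cong (prod f) (ℕ.+-suc m n) ⟩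
      prod f (m ℕ.+ n) * f (m ℕ.+ n)                        ≈⟨ *-congʳ (prod-split f m n) ⟩
      prod f m * prod (λ i → f (m ℕ.+ i)) n * f (m ℕ.+ n)   ≈⟨ *-assoc _ _ _ ⟩
      prod f m * (prod (λ i → f (m ℕ.+ i)) n * f (m ℕ.+ n)) ∎

    prod-* : ∀ f g n → prod (λ i → f i * g i) n ≈ prod f n * prod g n
    prod-* f g zero    = sym (*-identityˡ 1#)
    prod-* f g (suc n) = trans (*-congʳ (prod-* f g n))
      (solve 4 (λ a b c d → a :* b :* (c :* d) := a :* c :* (b :* d)) ≡.refl _ _ _ _)

    prod-NonZero : ∀ {f} n → (∀ i → i < n → NonZero (f i)) → NonZero (prod f n)
    prod-NonZero zero    _   = 1≉0
    prod-NonZero (suc n) f≉0 = *-NonZero (prod-NonZero n (λ i i<n → f≉0 i (ℕ.m<n⇒m<1+n i<n))) (f≉0 n ℕ.≤-refl)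

    prod-unroll : ∀ f n → prod f (suc n) ≈ f 0 * prod (λ i → f (suc i)) n
    prod-unroll f zero    = *-comm 1# (f 0)
    prod-unroll f (suc n) = trans (*-congʳ (prod-unroll f n)) (*-assoc _ _ _)

    prod-reverse : ∀ f n → prod f n ≈ prod (λ i → f (n ℕ.∸ suc i)) n
    prod-reverse f zero    = refl
    prod-reverse f (suc n) = begin
      prod f n * f n                                    ≈⟨ *-comm _ _ ⟩
      f n * prod f n                                    ≈⟨ *-congˡ (prod-reverse f n) ⟩
      f n * prod (λ i → f (n ℕ.∸ suc i)) n              ≈⟨ prod-unroll (λ i → f (n ℕ.∸ i)) n ⟨
      prod (λ i → f (n ℕ.∸ i)) n * f (n ℕ.∸ n)          ∎

    telescope : ∀ (f G : ℕ → K) n → (∀ k → k < n → f k ≈ G (suc k) - G k) → sum f n ≈ G n - G 0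
    telescope f G zero    _  = sym (-‿inverseʳ (G 0))
    telescope f G (suc n) eq = begin
      sum f n + f n                        ≈⟨ +-cong (telescope f G n (λ k k<n → eq k (ℕ.m<n⇒m<1+n k<n))) (eq n ℕ.≤-refl) ⟩
      (G n - G 0) + (G (suc n) - G n)      ≈⟨ solve 3 (λ a b c → (a :- b) :+ (c :- a) := c :- b) ≡.refl (G n) (G 0) (G (suc n)) ⟩
      G (suc n) - G 0                      ∎

-- Two hypergeometric summations by WZ pairs

module Summation where

  open RingSolver
  open FieldTheory
  open import Data.Nat as ℕ using (ℕ; zero; suc; _<_; _≤_; s≤s)
  import Data.Nat.Properties as ℕ
  open import Relation.Binary.PropositionalEquality as ≡ using (_≡_)

  module Hypergeometric (F : Field) where

    open FieldProperties F

    hyper : (N D : ℕ → K) → ℕ → K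
    hyper N D = prod (λ j → N j ÷ D j)

    hyper-step : ∀ N D k → NonZero (D k) → hyper N D (suc k) * D k ≈ hyper N D k * N k
    hyper-step N D k D≉0 = trans (*-assoc _ _ _) (*-congˡ (÷-cancel D≉0))

    -- Induction on the term ratios, with all divisions cross-multiplied. It serves to express the
    -- quotient of the weights for z and q⁴z as a rational function of x.
    hyper-ratio : ∀ {N D N′ D′} (A B : ℕ → K) n →
      A 0 ≈ B 0 →
      (∀ k → k < n → NonZero (D k)) → (∀ k → k < n → NonZero (D′ k)) → (∀ k → k < n → NonZero (A k)) →
      (∀ k → k < n → (N k * A (suc k)) * (D′ k * B k) ≈ (N′ k * B (suc k)) * (D k * A k)) →
      ∀ k → k ≤ n → hyper N D k * A k ≈ hyper N′ D′ k * B k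
    hyper-ratio A B n A₀≈B₀ D≉0 D′≉0 A≉0 eq zero _ = *-congˡ A₀≈B₀
    hyper-ratio {N} {D} {N′} {D′} A B n A₀≈B₀ D≉0 D′≉0 A≉0 eq (suc k) k<n =
      *-cancelʳ (*-NonZero (*-NonZero (D≉0 k k<n) (D′≉0 k k<n)) (A≉0 k k<n)) (begin
        W⁺ * A⁺ * (D k * D′ k * A k)
          ≈⟨ solve 5 (λ w a d d′ a₀ → w :* a :* (d :* d′ :* a₀) := (w :* d) :* (a :* d′ :* a₀)) ≡.refl W⁺ A⁺ (D k) (D′ k) (A k) ⟩
        (W⁺ * D k) * (A⁺ * D′ k * A k)
          ≈⟨ *-congʳ (hyper-step N D k (D≉0 k k<n)) ⟩
        (W * N k) * (A⁺ * D′ k * A k)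
          ≈⟨ solve 5 (λ w n a d′ a₀ → (w :* n) :* (a :* d′ :* a₀) := (w :* a₀) :* (n :* a :* d′)) ≡.refl W (N k) A⁺ (D′ k) (A k) ⟩
        (W * A k) * (N k * A⁺ * D′ k)
          ≈⟨ *-congʳ (hyper-ratio A B n A₀≈B₀ D≉0 D′≉0 A≉0 eq k (ℕ.<⇒≤ k<n)) ⟩
        (W′ * B k) * (N k * A⁺ * D′ k)
          ≈⟨ solve 5 (λ w n a d′ b → (w :* b) :* (n :* a :* d′) := w :* ((n :* a) :* (d′ :* b))) ≡.refl W′ (N k) A⁺ (D′ k) (B k) ⟩
        W′ * ((N k * A⁺) * (D′ k * B k))
          ≈⟨ *-congˡ (eq k k<n) ⟩
        W′ * ((N′ k * B⁺) * (D k * A k))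
          ≈⟨ solve 5 (λ w n b d a → w :* ((n :* b) :* (d :* a)) := (w :* n) :* (b :* d :* a)) ≡.refl W′ (N′ k) B⁺ (D k) (A k) ⟩
        (W′ * N′ k) * (B⁺ * D k * A k)
          ≈⟨ *-congʳ (hyper-step N′ D′ k (D′≉0 k k<n)) ⟨
        (W′⁺ * D′ k) * (B⁺ * D k * A k)
          ≈⟨ solve 5 (λ w b d d′ a → (w :* d′) :* (b :* d :* a) := w :* b :* (d :* d′ :* a)) ≡.refl W′⁺ B⁺ (D k) (D′ k) (A k) ⟩
        W′⁺ * B⁺ * (D k * D′ k * A k) ∎)
      where
      W = hyper N D k
      W⁺ = hyper N D (suc k)
      W′ = hyper N′ D′ k
      W′⁺ = hyper N′ D′ (suc k)
      A⁺ = A (suc k)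
      B⁺ = B (suc k)

  module Nodes (F : Field) (q : FieldProperties.K F) where

    open FieldProperties F

    -- The value is q^(2k). With this recursion, passing from k to k + 1 replaces x by q²x
    -- definitionally, which is the form used by all factor identities below.
    X : ℕ → K
    X zero    = 1#
    X (suc k) = q ^ 2 * X k

    -- At x = q^(2k) this is 1 - q^(6k+1), that is, (1 - q)[6k+1].
    κ : K → K
    κ x = 1# - q * x ^ 3

  -- The terminating case of the Gasper–Rahman quadratic summation, by a WZ pair:
  -- passing from z to q⁴z multiplies the sum by ratio z.
  module Quadratic (F : Field) (q s d : FieldProperties.K F) where

    open FieldProperties F
    open Hypergeometric F
    open Nodes F q

    -- These factors of the term ratio are free of z, so they stay opaque when the weights for z and
    -- q⁴z are compared.
    common₁ common₂ : K → K
    common₁ x = (1# - q * x) * (1# - s * q * x + q ^ 2 * x ^ 2) * (1# - d * x ^ 2)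
    common₂ x = (1# - q ^ 4 * x ^ 2) * (1# - s * q ^ 4 * x ^ 2 + q ^ 8 * x ^ 4) * (d - q ^ 3 * x)

    -- With x = q^(2k) the quotient is the term ratio of the Gasper-Rahman summation in base q² with
    -- leading parameter q, the pair qa, q/a where s = a + 1/a, and the parameters d, q⁴/z, z/d in
    -- base q⁴. The very-well-poised factor is left to `κ`.
    num den : K → K → K
    num z x = q ^ 3 * common₁ x * ((z - q ^ 4 * x ^ 2) * (d - z * x ^ 2))
    den z x = common₂ x * ((q - z * x) * (z - q ^ 3 * d * x))

    weight : K → ℕ → K
    weight z = hyper (λ j → num z (X j)) (λ j → den z (X j))

    ratioNum ratioDen ratio : K → K
    ratioNum z = (q - z) * (1# - q * z) * (d ^ 2 - s * z * d + z ^ 2)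
    ratioDen z = (q * z - d) * (z - q * d) * (1# - s * z + z ^ 2)
    ratio z = ratioNum z ÷ ratioDen z

    -- By `top`, z = q^(4n): the factor z - q⁴x² of the numerator vanishes at k = n - 1, so the sum
    -- for z has n terms and the sum for q⁴z has n + 1.
    record Step (z : K) (n : ℕ) : Set where
      field
        q≉0    : NonZero q
        x≉0    : ∀ k → NonZero (X k)
        z-1≉0  : NonZero (z - 1#)
        u≉0    : NonZero (1# - s * z + z ^ 2)
        g₁≉0   : NonZero (q * z - d)
        g₂≉0   : NonZero (z - q * d)
        q-z≉0  : NonZero (q - z)
        1-qz≉0 : NonZero (1# - q * z)
        den≉0  : ∀ k → k < n → NonZero (den z (X k))
        den′≉0 : ∀ k → k ≤ n → NonZero (den (q ^ 4 * z) (X k))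
        f₂≉0   : ∀ k → k ≤ suc n → NonZero (d - z * X k ^ 2)
        f₈≉0   : ∀ k → k ≤ suc n → NonZero (q * z - d * X k)
        f₉≉0   : ∀ k → k ≤ n → NonZero (z - q * d * X k)
        top    : z - X n ^ 2 ≈ 0#

    module _ {z : K} {n : ℕ} (S : Step z n) where

      open Step S

      private
        z′ = q ^ 4 * z
        W = weight z
        W′ = weight z′

        c b₀ g u v : K
        c = (q - z) * (1# - q * z)
        b₀ = d - z
        g = (q * z - d) * (z - q * d)
        u = 1# - s * z + z ^ 2
        v = d ^ 2 - s * z * d + z ^ 2

        a b : K → K
        a x = (z - 1#) * ((d - z * x ^ 2) * (q * z - d * x) * (z - q * d * x))
        b x = b₀ * ((z - x ^ 2) * (q - z * x) * (1# - q * z * x))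

      -- Replacing z by q⁴z only shifts the q-shifted factorials that contain z, so all but a few
      -- boundary factors of the two products cancel.
      weight-ratio : ∀ k → k ≤ n → W k * (a (X k) * c) ≈ W′ k * (b (X k) * g)
      weight-ratio = hyper-ratio (λ k → a (X k) * c) (λ k → b (X k) * g) n
        (solve 3 (λ z q d →
            (z :- :1) :* ((d :- z :* :1 :^ 2) :* (q :* z :- d :* :1) :* (z :- q :* d :* :1)) :* ((q :- z) :* (:1 :- q :* z))
              := (d :- z) :* ((z :- :1 :^ 2) :* (q :- z :* :1) :* (:1 :- q :* z :* :1)) :* ((q :* z :- d) :* (z :- q :* d)))
          ≡.refl z q d)
        den≉0 (λ k k<n → den′≉0 k (ℕ.<⇒≤ k<n))
        (λ k k<n → a-c≉0 k (ℕ.<⇒≤ k<n))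
        (λ k _ → identity (X k))
        where
        a-c≉0 : ∀ k → k ≤ n → NonZero (a (X k) * c)
        a-c≉0 k k≤n = *-NonZero
          (*-NonZero z-1≉0 (*-NonZero (*-NonZero (f₂≉0 k (ℕ.m≤n⇒m≤1+n k≤n)) (f₈≉0 k (ℕ.m≤n⇒m≤1+n k≤n))) (f₉≉0 k k≤n)))
          (*-NonZero q-z≉0 1-qz≉0)
        identity : ∀ x →
          (num z x * (a (q ^ 2 * x) * c)) * (den z′ x * (b x * g)) ≈
          (num z′ x * (b (q ^ 2 * x) * g)) * (den z x * (a x * c))
        identity x = begin
          (q ^ 3 * P * (f₁ * f₂) * ((z - 1#) * A⁺ * c)) * (E * e′ * (b₀ * (f₃ * f₅ * f₁₀) * g))
            ≈⟨ *-cong (*-congˡ (*-congʳ (*-congˡ A⁺≈))) (*-congʳ (*-congˡ e′≈)) ⟩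
          (q ^ 3 * P * (f₁ * f₂) * ((z - 1#) * (q * (f₄ * f₉ * f₆)) * c)) * (E * (q ^ 4 * (f₇ * f₈)) * (b₀ * (f₃ * f₅ * f₁₀) * g))
            -- The ten factors are variables here. The shifts of x and z permute them up to powers
            -- of q, so both sides are one monomial in two orders and nothing is multiplied out.
            ≈⟨ solve 17 (λ q P z₁ c E b₀ g f₁ f₂ f₃ f₄ f₅ f₆ f₇ f₈ f₉ f₁₀ →
                 (q :^ 3 :* P :* (f₁ :* f₂) :* (z₁ :* (q :* (f₄ :* f₉ :* f₆)) :* c)) :* (E :* (q :^ 4 :* (f₇ :* f₈)) :* (b₀ :* (f₃ :* f₅ :* f₁₀) :* g))
                 := (q :^ 3 :* P :* (q :^ 4 :* (f₃ :* f₄)) :* (b₀ :* (q :* (f₁ :* f₁₀ :* f₇)) :* g)) :* (E :* (f₅ :* f₆) :* (z₁ :* (f₂ :* f₈ :* f₉) :* c)))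
                 ≡.refl q P (z - 1#) c E b₀ g f₁ f₂ f₃ f₄ f₅ f₆ f₇ f₈ f₉ f₁₀ ⟩
          (q ^ 3 * P * (q ^ 4 * (f₃ * f₄)) * (b₀ * (q * (f₁ * f₁₀ * f₇)) * g)) * (E * (f₅ * f₆) * ((z - 1#) * (f₂ * f₈ * f₉) * c))
            ≈⟨ *-congʳ (*-cong (*-congˡ n′≈) (*-congʳ (*-congˡ B⁺≈))) ⟨
          (q ^ 3 * P * n′ * (b₀ * B⁺ * g)) * (E * (f₅ * f₆) * ((z - 1#) * (f₂ * f₈ * f₉) * c)) ∎
          where
          P = common₁ x
          E = common₂ x
          f₁ = z - q ^ 4 * x ^ 2
          f₂ = d - z * x ^ 2
          f₃ = z - x ^ 2
          f₄ = d - q ^ 4 * z * x ^ 2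
          f₅ = q - z * x
          f₆ = z - q ^ 3 * d * x
          f₇ = 1# - q ^ 3 * z * x
          f₈ = q * z - d * x
          f₉ = z - q * d * x
          f₁₀ = 1# - q * z * x
          n′ = (z′ - q ^ 4 * x ^ 2) * (d - z′ * x ^ 2)
          e′ = (q - z′ * x) * (z′ - q ^ 3 * d * x)
          A⁺ = (d - z * (q ^ 2 * x) ^ 2) * (q * z - d * (q ^ 2 * x)) * (z - q * d * (q ^ 2 * x))
          B⁺ = (z - (q ^ 2 * x) ^ 2) * (q - z * (q ^ 2 * x)) * (1# - q * z * (q ^ 2 * x))
          n′≈ : n′ ≈ q ^ 4 * (f₃ * f₄)
          n′≈ = solve 4 (λ q z d x →
            (q :^ 4 :* z :- q :^ 4 :* x :^ 2) :* (d :- q :^ 4 :* z :* x :^ 2)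
              := q :^ 4 :* ((z :- x :^ 2) :* (d :- q :^ 4 :* z :* x :^ 2))) ≡.refl q z d x
          e′≈ : e′ ≈ q ^ 4 * (f₇ * f₈)
          e′≈ = solve 4 (λ q z d x →
            (q :- q :^ 4 :* z :* x) :* (q :^ 4 :* z :- q :^ 3 :* d :* x)
              := q :^ 4 :* ((:1 :- q :^ 3 :* z :* x) :* (q :* z :- d :* x))) ≡.refl q z d x
          A⁺≈ : A⁺ ≈ q * (f₄ * f₉ * f₆)
          A⁺≈ = solve 4 (λ q z d x →
            (d :- z :* (q :^ 2 :* x) :^ 2) :* (q :* z :- d :* (q :^ 2 :* x)) :* (z :- q :* d :* (q :^ 2 :* x))
              := q :* ((d :- q :^ 4 :* z :* x :^ 2) :* (z :- q :* d :* x) :* (z :- q :^ 3 :* d :* x))) ≡.refl q z d x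
          B⁺≈ : B⁺ ≈ q * (f₁ * f₁₀ * f₇)
          B⁺≈ = solve 3 (λ q z x →
            (z :- (q :^ 2 :* x) :^ 2) :* (q :- z :* (q :^ 2 :* x)) :* (:1 :- q :* z :* (q :^ 2 :* x))
              := q :* ((z :- q :^ 4 :* x :^ 2) :* (:1 :- q :* z :* x) :* (:1 :- q :^ 3 :* z :* x))) ≡.refl q z x

      private
        h : K → K
        h x = (1# - q * z * x) * ((1# - x ^ 2) * (1# - s * x ^ 2 + x ^ 4) * (d - q * x))

        antiDen : K → K
        antiDen x = u * (z - 1#) * (x * ((d - z * x ^ 2) * (q * z - d * x)))

        -- The companion of the WZ pair: the change of the summand from z to q⁴z is the forward
        -- difference of this function in k. The factor `h` vanishes at x = 1, and at q²x it
        -- contains `common₂ x`, which cancels the denominator of the next weight.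
        anti : ℕ → K
        anti k = (z * (z ^ 2 - d) * W′ k * h (X k)) ÷ antiDen (X k)

      private module AntiStep (k : ℕ) (k≤n : k ≤ n) where
        x = X k
        zz = z * (z ^ 2 - d)
        P = common₁ x
        E = common₂ x
        f₂ = d - z * x ^ 2
        f₃ = z - x ^ 2
        f₄ = d - q ^ 4 * z * x ^ 2
        f₇ = 1# - q ^ 3 * z * x
        f₈ = q * z - d * x
        f₉ = z - q * d * x
        z₁ = z - 1#
        A = a x
        B = b x

        f₂′≉0 = f₂≉0 k (ℕ.m≤n⇒m≤1+n k≤n)
        f₈′≉0 = f₈≉0 k (ℕ.m≤n⇒m≤1+n k≤n)

        A≉0 : NonZero A
        A≉0 = *-NonZero z-1≉0 (*-NonZero (*-NonZero f₂′≉0 f₈′≉0) (f₉≉0 k k≤n))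

        uxA≉0 : NonZero (u * x * A)
        uxA≉0 = *-NonZero (*-NonZero u≉0 (x≉0 k)) A≉0

        -- Every term of the WZ equation is this common factor times a polynomial, so the equation
        -- reduces to a polynomial identity.
        w = W′ k ÷ (u * x * A)

        W′≈ : W′ k ≈ w * (u * x * A)
        W′≈ = sym (÷-cancel uxA≉0)

        rW≈ : ratio z * W k ≈ w * (v * x * B)
        rW≈ = *-cancelʳ (*-NonZero (*-NonZero (*-NonZero g₁≉0 g₂≉0) u≉0) A≉0) (begin
          (c * v ÷ (g * u)) * W k * (g * u * A)
            ≈⟨ solve 6 (λ r W g u A c → r :* W :* (g :* u :* A) := r :* (g :* u) :* (W :* A)) ≡.refl (c * v ÷ (g * u)) (W k) g u A c ⟩
          (c * v ÷ (g * u)) * (g * u) * (W k * A)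
            ≈⟨ *-congʳ (÷-cancel (*-NonZero (*-NonZero g₁≉0 g₂≉0) u≉0)) ⟩
          c * v * (W k * A)
            ≈⟨ solve 4 (λ c v W A → c :* v :* (W :* A) := v :* (W :* (A :* c))) ≡.refl c v (W k) A ⟩
          v * (W k * (A * c))
            ≈⟨ *-congˡ (weight-ratio k k≤n) ⟩
          v * (W′ k * (B * g))
            ≈⟨ *-congˡ (*-congʳ W′≈) ⟩
          v * (w * (u * x * A) * (B * g))
            ≈⟨ solve 7 (λ v w u x A B g → v :* (w :* (u :* x :* A) :* (B :* g)) := w :* (v :* x :* B) :* (g :* u :* A)) ≡.refl v w u x A B g ⟩
          w * (v * x * B) * (g * u * A) ∎)

        anti≈ : anti k ≈ w * (zz * (h x * f₉))
        anti≈ = sym (÷-intro (*-NonZero (*-NonZero u≉0 z-1≉0) (*-NonZero (x≉0 k) (*-NonZero f₂′≉0 f₈′≉0))) (begin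
          w * (zz * (h x * f₉)) * (u * z₁ * (x * (f₂ * f₈)))
            ≈⟨ solve 9 (λ w zz h f₉ u z₁ x f₂ f₈ → w :* (zz :* (h :* f₉)) :* (u :* z₁ :* (x :* (f₂ :* f₈)))
                 := zz :* (w :* (u :* x :* (z₁ :* (f₂ :* f₈ :* f₉)))) :* h) ≡.refl w zz (h x) f₉ u z₁ x f₂ f₈ ⟩
          zz * (w * (u * x * A)) * h x
            ≈⟨ *-congʳ (*-congˡ W′≈) ⟨
          zz * W′ k * h x ∎))

        anti⁺≈ : anti (suc k) ≈ w * (zz * (P * (f₃ * f₂)))
        anti⁺≈ = sym (÷-intro (*-NonZero (*-NonZero u≉0 z-1≉0)
                   (*-NonZero (x≉0 (suc k)) (*-NonZero (f₂≉0 (suc k) (s≤s k≤n)) (f₈≉0 (suc k) (s≤s k≤n)))))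
          (*-cancelʳ (den′≉0 k k≤n) (begin
          w * (zz * (P * (f₃ * f₂))) * (u * z₁ * (q ^ 2 * x * d⁺)) * (E * e′)
            ≈⟨ *-cong (*-congˡ (*-congˡ (*-congˡ d⁺≈))) (*-congˡ e′≈) ⟩
          w * (zz * (P * (f₃ * f₂))) * (u * z₁ * (q ^ 2 * x * (q * (f₄ * f₉)))) * (E * (q ^ 4 * (f₇ * f₈)))
            ≈⟨ solve 14 (λ w zz P f₂ f₃ f₄ f₇ f₈ f₉ u z₁ q x E →
                 w :* (zz :* (P :* (f₃ :* f₂))) :* (u :* z₁ :* (q :^ 2 :* x :* (q :* (f₄ :* f₉)))) :* (E :* (q :^ 4 :* (f₇ :* f₈)))
                 := zz :* (w :* (u :* x :* (z₁ :* (f₂ :* f₈ :* f₉))) :* (q :^ 3 :* P :* (q :^ 4 :* (f₃ :* f₄)))) :* (f₇ :* E))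
                 ≡.refl w zz P f₂ f₃ f₄ f₇ f₈ f₉ u z₁ q x E ⟩
          zz * (w * (u * x * A) * (q ^ 3 * P * (q ^ 4 * (f₃ * f₄)))) * (f₇ * E)
            ≈⟨ *-cong (*-congˡ (*-cong W′≈ (*-congˡ n′≈))) h⁺≈ ⟨
          zz * (W′ k * (q ^ 3 * P * n′)) * h (q ^ 2 * x)
            ≈⟨ *-congʳ (*-congˡ (hyper-step _ _ k (den′≉0 k k≤n))) ⟨
          zz * (W′ (suc k) * (E * e′)) * h (q ^ 2 * x)
            ≈⟨ solve 4 (λ zz W D h → zz :* (W :* D) :* h := zz :* W :* h :* D) ≡.refl zz (W′ (suc k)) (E * e′) (h (q ^ 2 * x)) ⟩
          zz * W′ (suc k) * h (q ^ 2 * x) * (E * e′) ∎)))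
          where
          n′ = (z′ - q ^ 4 * x ^ 2) * (d - z′ * x ^ 2)
          e′ = (q - z′ * x) * (z′ - q ^ 3 * d * x)
          d⁺ = (d - z * (q ^ 2 * x) ^ 2) * (q * z - d * (q ^ 2 * x))
          n′≈ : n′ ≈ q ^ 4 * (f₃ * f₄)
          n′≈ = solve 4 (λ q z d x →
            (q :^ 4 :* z :- q :^ 4 :* x :^ 2) :* (d :- q :^ 4 :* z :* x :^ 2)
              := q :^ 4 :* ((z :- x :^ 2) :* (d :- q :^ 4 :* z :* x :^ 2))) ≡.refl q z d x
          e′≈ : e′ ≈ q ^ 4 * (f₇ * f₈)
          e′≈ = solve 4 (λ q z d x →
            (q :- q :^ 4 :* z :* x) :* (q :^ 4 :* z :- q :^ 3 :* d :* x)
              := q :^ 4 :* ((:1 :- q :^ 3 :* z :* x) :* (q :* z :- d :* x))) ≡.refl q z d x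
          d⁺≈ : d⁺ ≈ q * (f₄ * f₉)
          d⁺≈ = solve 4 (λ q z d x →
            (d :- z :* (q :^ 2 :* x) :^ 2) :* (q :* z :- d :* (q :^ 2 :* x))
              := q :* ((d :- q :^ 4 :* z :* x :^ 2) :* (z :- q :* d :* x))) ≡.refl q z d x
          h⁺≈ : h (q ^ 2 * x) ≈ f₇ * E
          h⁺≈ = solve 5 (λ q z d s x →
            (:1 :- q :* z :* (q :^ 2 :* x)) :* ((:1 :- (q :^ 2 :* x) :^ 2) :* (:1 :- s :* (q :^ 2 :* x) :^ 2 :+ (q :^ 2 :* x) :^ 4) :* (d :- q :* (q :^ 2 :* x)))
              := (:1 :- q :^ 3 :* z :* x) :* ((:1 :- q :^ 4 :* x :^ 2) :* (:1 :- s :* q :^ 4 :* x :^ 2 :+ q :^ 8 :* x :^ 4) :* (d :- q :^ 3 :* x))) ≡.refl q z d s x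

        anti-step : κ x * W′ k - ratio z * (κ x * W k) ≈ anti (suc k) - anti k
        anti-step = begin
          κ x * W′ k - ratio z * (κ x * W k)
            ≈⟨ +-congˡ (-‿cong (*-swapˡ _ _ _)) ⟩
          κ x * W′ k - κ x * (ratio z * W k)
            ≈⟨ +-cong (*-congˡ W′≈) (-‿cong (*-congˡ rW≈)) ⟩
          κ x * (w * (u * x * A)) - κ x * (w * (v * x * B))
            ≈⟨ solve 7 (λ k w x u A v B → k :* (w :* (u :* x :* A)) :- k :* (w :* (v :* x :* B)) := w :* (k :* x :* (u :* A :- v :* B))) ≡.refl (κ x) w x u A v B ⟩
          w * (κ x * x * (u * A - v * B))
            ≈⟨ *-congˡ (identity x z d s q) ⟩
          w * (zz * (P * (f₃ * f₂) - h x * f₉))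
            ≈⟨ solve 4 (λ w zz a b → w :* (zz :* (a :- b)) := w :* (zz :* a) :- w :* (zz :* b)) ≡.refl w zz (P * (f₃ * f₂)) (h x * f₉) ⟩
          w * (zz * (P * (f₃ * f₂))) - w * (zz * (h x * f₉))
            ≈⟨ +-cong anti⁺≈ (-‿cong anti≈) ⟨
          anti (suc k) - anti k ∎
          where
          -- This identity in five variables carries the content of the summation; what surrounds it
          -- is the clearing of denominators.
          identity = solve 5 (λ x z d s q →
            (:1 :- q :* x :^ 3) :* x :*
              ((:1 :- s :* z :+ z :^ 2) :* ((z :- :1) :* ((d :- z :* x :^ 2) :* (q :* z :- d :* x) :* (z :- q :* d :* x)))
               :- (d :^ 2 :- s :* z :* d :+ z :^ 2) :* ((d :- z) :* ((z :- x :^ 2) :* (q :- z :* x) :* (:1 :- q :* z :* x))))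
            := z :* (z :^ 2 :- d) :*
              ((:1 :- q :* x) :* (:1 :- s :* q :* x :+ q :^ 2 :* x :^ 2) :* (:1 :- d :* x :^ 2) :* ((z :- x :^ 2) :* (d :- z :* x :^ 2))
               :- (:1 :- q :* z :* x) :* ((:1 :- x :^ 2) :* (:1 :- s :* x :^ 2 :+ x :^ 4) :* (d :- q :* x)) :* (z :- q :* d :* x)))
            ≡.refl

      private
        anti₀≈0 : anti 0 ≈ 0#
        anti₀≈0 = begin
          (z * (z ^ 2 - d) * W′ 0 * h 1#) ÷ antiDen 1#
            ≈⟨ *-congʳ (*-congˡ (solve 4 (λ q z d s → (:1 :- q :* z :* :1) :* ((:1 :- :1 :^ 2) :* (:1 :- s :* :1 :^ 2 :+ :1 :^ 4) :* (d :- q :* :1)) := :0) ≡.refl q z d s)) ⟩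
          (z * (z ^ 2 - d) * W′ 0 * 0#) ÷ antiDen 1#
            ≈⟨ solve 2 (λ a i → a :* :0 :* i := :0) ≡.refl (z * (z ^ 2 - d) * W′ 0) (antiDen 1# ⁻¹) ⟩
          0# ∎

        anti-top≈0 : anti (suc n) ≈ 0#
        anti-top≈0 = begin
          anti (suc n)                         ≈⟨ anti⁺≈ ⟩
          w * (zz * (P * (f₃ * f₂)))           ≈⟨ *-congˡ (*-congˡ (*-congˡ (*-congʳ top))) ⟩
          w * (zz * (P * (0# * f₂)))           ≈⟨ solve 4 (λ w z p f → w :* (z :* (p :* (:0 :* f))) := :0) ≡.refl w zz P f₂ ⟩
          0# ∎
          where open AntiStep n ℕ.≤-refl

        weight-top≈0 : W n ≈ 0#
        weight-top≈0 = *-cancelʳ (*-NonZero A≉0 (*-NonZero q-z≉0 1-qz≉0)) (begin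
          W n * (A * c)                        ≈⟨ weight-ratio n ℕ.≤-refl ⟩
          W′ n * (b₀ * (f₃ * _ * _) * g)       ≈⟨ *-congˡ (*-congʳ (*-congˡ (*-congʳ (*-congʳ top)))) ⟩
          W′ n * (b₀ * (0# * _ * _) * g)       ≈⟨ solve 7 (λ w b e f g a c → w :* (b :* (:0 :* e :* f) :* g) := :0 :* (a :* c)) ≡.refl (W′ n) b₀ _ _ g A c ⟩
          0# * (A * c)                         ∎)
          where open AntiStep n ℕ.≤-refl

      -- The WZ equation is summed over 0 ≤ k ≤ n. The companion is zero at 0 because of `h` and at
      -- n + 1 because of the factor z - X n², and the weight for z is zero at k = n, which leaves n
      -- terms on the right.
      sum-step : sum (λ k → κ (X k) * W′ k) (suc n) ≈ ratio z * sum (λ k → κ (X k) * W k) n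
      sum-step = begin
        sum T′ (suc n)
          ≈⟨ solve 2 (λ a b → a := (a :- b) :+ b) ≡.refl _ (ratio z * sum T (suc n)) ⟩
        (sum T′ (suc n) - ratio z * sum T (suc n)) + ratio z * sum T (suc n)
          ≈⟨ +-congʳ difference≈0 ⟩
        0# + ratio z * (sum T n + κ (X n) * W n)
          ≈⟨ +-congˡ (*-congˡ (+-congˡ (*-congˡ weight-top≈0))) ⟩
        0# + ratio z * (sum T n + κ (X n) * 0#)
          ≈⟨ solve 3 (λ r t k → :0 :+ r :* (t :+ k :* :0) := r :* t) ≡.refl (ratio z) (sum T n) (κ (X n)) ⟩
        ratio z * sum T n ∎
        where
        T T′ : ℕ → K
        T k = κ (X k) * W k
        T′ k = κ (X k) * W′ k
        difference≈0 : sum T′ (suc n) - ratio z * sum T (suc n) ≈ 0#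
        difference≈0 = begin
          sum T′ (suc n) - ratio z * sum T (suc n)
            ≈⟨ +-congˡ (-‿cong (sum-*ˡ (ratio z) T (suc n))) ⟨
          sum T′ (suc n) - sum (λ k → ratio z * T k) (suc n)
            ≈⟨ +-congˡ (sum-neg _ (suc n)) ⟨
          sum T′ (suc n) + sum (λ k → - (ratio z * T k)) (suc n)
            ≈⟨ sum-+ T′ _ (suc n) ⟨
          sum (λ k → T′ k - ratio z * T k) (suc n)
            ≈⟨ telescope _ anti (suc n) (λ k k<1+n → AntiStep.anti-step k (ℕ.≤-pred k<1+n)) ⟩
          anti (suc n) - anti 0
            ≈⟨ +-cong anti-top≈0 (-‿cong anti₀≈0) ⟩
          0# - 0#
            ≈⟨ -‿inverseʳ 0# ⟩
          0# ∎

    Z : ℕ → K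
    Z zero    = q ^ 4
    Z (suc m) = q ^ 4 * Z m

    -- At z = q⁴ the factor z - q⁴x² already vanishes at x = 1, so the sum is its first term 1 - q;
    -- each step then contributes one factor. The parameter d is the same along the whole chain.
    quadratic-sum : ∀ m → (∀ i → i < m → Step (Z i) (suc i)) →
      sum (λ k → κ (X k) * weight (Z m) k) (suc m) ≈ (1# - q) * prod (λ i → ratio (Z i)) m
    quadratic-sum zero    _ = solve 1 (λ q → :0 :+ (:1 :- q :* :1 :^ 3) :* :1 := (:1 :- q) :* :1) ≡.refl q
    quadratic-sum (suc m) S = begin
      sum (λ k → κ (X k) * weight (Z (suc m)) k) (suc (suc m))
        ≈⟨ sum-step (S m ℕ.≤-refl) ⟩
      ratio (Z m) * sum (λ k → κ (X k) * weight (Z m) k) (suc m)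
        ≈⟨ *-congˡ (quadratic-sum m (λ i i<m → S i (ℕ.m<n⇒m<1+n i<m))) ⟩
      ratio (Z m) * ((1# - q) * prod (λ i → ratio (Z i)) m)
        ≈⟨ solve 3 (λ r c p → r :* (c :* p) := c :* (p :* r)) ≡.refl _ _ _ ⟩
      (1# - q) * (prod (λ i → ratio (Z i)) m * ratio (Z m)) ∎

  -- The case in which the parameters a^±1 of base q² terminate the sum, at b = 1; here z = q²a.
  module Terminating (F : Field) (q : FieldProperties.K F) where

    open FieldProperties F
    open Hypergeometric F
    open Nodes F q

    common₁ common₂ : K → K
    common₁ x = (1# - q * x ^ 2) ^ 2 * (1# - q ^ 2 * x ^ 2)
    common₂ x = (1# - q ^ 4 * x ^ 2) * (1# - q ^ 2 * x) ^ 2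

    -- Since z = q²a, the last two factors of the numerator are multiples of 1 - aqx and 1 - qx/a,
    -- those of the denominator of 1 - aq⁴x² and 1 - q⁴x²/a; the squares come from b = 1.
    num den : K → K → K
    num z x = q * common₁ x * ((q - z * x) * (z - q ^ 3 * x))
    den z x = common₂ x * ((1# - q ^ 2 * z * x ^ 2) * (z - q ^ 6 * x ^ 2))

    weight : K → ℕ → K
    weight z = hyper (λ j → num z (X j)) (λ j → den z (X j))

    ratioNum ratioDen ratio : K → K
    ratioNum z = (1# - q ^ 2 * z) * (q - z) ^ 2
    ratioDen z = (q ^ 2 - z) * (1# - q * z) ^ 2
    ratio z = ratioNum z ÷ ratioDen z

    -- The two `top` fields say z = q^(2n+1). The sum for z has n terms and the sum for q⁴z two
    -- more, so the weights for z must vanish both at n and at n + 1; each field accounts for one of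
    -- them.
    record Step (z : K) (n : ℕ) : Set where
      field
        q≉0    : NonZero q
        x≉0    : ∀ k → NonZero (X k)
        u≉0    : NonZero (1# - q * z)
        b≉0    : NonZero (q ^ 2 - z)
        c≉0    : NonZero (1# - q ^ 2 * z)
        den≉0  : ∀ k → NonZero (den z (X k))
        den′≉0 : ∀ k → NonZero (den (q ^ 4 * z) (X k))
        f₁≉0   : ∀ k → NonZero (q - z * X k)
        f₈≉0   : ∀ k → NonZero (z - q ^ 2 * X k ^ 2)
        f₉≉0   : ∀ k → NonZero (1# - q * z * X k)
        top    : q * z - X (suc n) ≈ 0#
        top′   : z - q * X n ≈ 0#

    module _ {z : K} {n : ℕ} (S : Step z n) where

      open Step S

      private
        z′ = q ^ 4 * z
        W = weight z
        W′ = weight z′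

        b c u v : K
        b = z - q ^ 2
        c = 1# - q ^ 2 * z
        u = 1# - q * z
        v = q - z

        A B : K → K
        A x = (q - z * x) * (1# - q * z * x) * (z - q ^ 2 * x ^ 2)
        B x = (q * z - x) * (z - q * x) * (1# - q ^ 2 * z * x ^ 2)

        A≉0 : ∀ k → NonZero (A (X k))
        A≉0 k = *-NonZero (*-NonZero (f₁≉0 k) (f₉≉0 k)) (f₈≉0 k)

      weight-ratio : ∀ k → W k * (A (X k) * c) ≈ W′ k * (B (X k) * b)
      weight-ratio k = hyper-ratio (λ k → A (X k) * c) (λ k → B (X k) * b) k
        (solve 2 (λ z q →
            (q :- z :* :1) :* (:1 :- q :* z :* :1) :* (z :- q :^ 2 :* :1 :^ 2) :* (:1 :- q :^ 2 :* z)
              := (q :* z :- :1) :* (z :- q :* :1) :* (:1 :- q :^ 2 :* z :* :1 :^ 2) :* (z :- q :^ 2))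
          ≡.refl z q)
        (λ k _ → den≉0 k) (λ k _ → den′≉0 k)
        (λ k _ → *-NonZero (A≉0 k) c≉0)
        (λ k _ → identity (X k)) k ℕ.≤-refl
        where
        identity : ∀ x →
          (num z x * (A (q ^ 2 * x) * c)) * (den z′ x * (B x * b)) ≈
          (num z′ x * (B (q ^ 2 * x) * b)) * (den z x * (A x * c))
        identity x = begin
          (q * P * (f₁ * f₂) * (A (q ^ 2 * x) * c)) * (E * e′ * (f₆ * f₁₀ * f₃ * b))
            ≈⟨ *-cong (*-congˡ (*-congʳ A⁺≈)) (*-congʳ (*-congˡ e′≈)) ⟩
          (q * P * (f₁ * f₂) * (q * (f₉ * f₅ * f₄) * c)) * (E * (q ^ 4 * (f₇ * f₈)) * (f₆ * f₁₀ * f₃ * b))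
            ≈⟨ solve 15 (λ q P c E b f₁ f₂ f₃ f₄ f₅ f₆ f₇ f₈ f₉ f₁₀ →
                 (q :* P :* (f₁ :* f₂) :* (q :* (f₉ :* f₅ :* f₄) :* c)) :* (E :* (q :^ 4 :* (f₇ :* f₈)) :* (f₆ :* f₁₀ :* f₃ :* b))
                 := (q :* P :* (q :^ 4 :* (f₅ :* f₆)) :* (q :* (f₁₀ :* f₂ :* f₇) :* b)) :* (E :* (f₃ :* f₄) :* (f₁ :* f₉ :* f₈ :* c)))
                 ≡.refl q P c E b f₁ f₂ f₃ f₄ f₅ f₆ f₇ f₈ f₉ f₁₀ ⟩
          (q * P * (q ^ 4 * (f₅ * f₆)) * (q * (f₁₀ * f₂ * f₇) * b)) * (E * (f₃ * f₄) * (f₁ * f₉ * f₈ * c))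
            ≈⟨ *-congʳ (*-cong (*-congˡ n′≈) (*-congʳ B⁺≈)) ⟨
          (q * P * n′ * (B (q ^ 2 * x) * b)) * (E * (f₃ * f₄) * (f₁ * f₉ * f₈ * c)) ∎
          where
          P = common₁ x
          E = common₂ x
          f₁ = q - z * x
          f₂ = z - q ^ 3 * x
          f₃ = 1# - q ^ 2 * z * x ^ 2
          f₄ = z - q ^ 6 * x ^ 2
          f₅ = 1# - q ^ 3 * z * x
          f₆ = q * z - x
          f₇ = 1# - q ^ 6 * z * x ^ 2
          f₈ = z - q ^ 2 * x ^ 2
          f₉ = 1# - q * z * x
          f₁₀ = z - q * x
          n′ = (q - z′ * x) * (z′ - q ^ 3 * x)
          e′ = (1# - q ^ 2 * z′ * x ^ 2) * (z′ - q ^ 6 * x ^ 2)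
          n′≈ : n′ ≈ q ^ 4 * (f₅ * f₆)
          n′≈ = solve 3 (λ q z x →
            (q :- q :^ 4 :* z :* x) :* (q :^ 4 :* z :- q :^ 3 :* x)
              := q :^ 4 :* ((:1 :- q :^ 3 :* z :* x) :* (q :* z :- x))) ≡.refl q z x
          e′≈ : e′ ≈ q ^ 4 * (f₇ * f₈)
          e′≈ = solve 3 (λ q z x →
            (:1 :- q :^ 2 :* (q :^ 4 :* z) :* x :^ 2) :* (q :^ 4 :* z :- q :^ 6 :* x :^ 2)
              := q :^ 4 :* ((:1 :- q :^ 6 :* z :* x :^ 2) :* (z :- q :^ 2 :* x :^ 2))) ≡.refl q z x
          A⁺≈ : A (q ^ 2 * x) ≈ q * (f₉ * f₅ * f₄)
          A⁺≈ = solve 3 (λ q z x →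
            (q :- z :* (q :^ 2 :* x)) :* (:1 :- q :* z :* (q :^ 2 :* x)) :* (z :- q :^ 2 :* (q :^ 2 :* x) :^ 2)
              := q :* ((:1 :- q :* z :* x) :* (:1 :- q :^ 3 :* z :* x) :* (z :- q :^ 6 :* x :^ 2))) ≡.refl q z x
          B⁺≈ : B (q ^ 2 * x) ≈ q * (f₁₀ * f₂ * f₇)
          B⁺≈ = solve 3 (λ q z x →
            (q :* z :- q :^ 2 :* x) :* (z :- q :* (q :^ 2 :* x)) :* (:1 :- q :^ 2 :* z :* (q :^ 2 :* x) :^ 2)
              := q :* ((z :- q :* x) :* (z :- q :^ 3 :* x) :* (:1 :- q :^ 6 :* z :* x :^ 2))) ≡.refl q z x

      private
        g : K → K
        g x = (1# - x ^ 2) * (1# - x) ^ 2 * (q - x)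

        anti : ℕ → K
        anti k = - ((q * (z * (1# + z)) * W′ k * ((1# - q ^ 2 * z * X k ^ 2) * g (X k)))
                     ÷ (u ^ 2 * X k * ((q - z * X k) * (1# - q * z * X k))))

      private module AntiStep (k : ℕ) where
        x = X k
        zz = z * (1# + z)
        P = common₁ x
        E = common₂ x
        f₁ = q - z * x
        f₃ = 1# - q ^ 2 * z * x ^ 2
        f₅ = 1# - q ^ 3 * z * x
        f₆ = q * z - x
        f₇ = 1# - q ^ 6 * z * x ^ 2
        f₈ = z - q ^ 2 * x ^ 2
        f₉ = 1# - q * z * x
        l = 1# - q * x

        u²≉0 : NonZero (u ^ 2)
        u²≉0 = ^-NonZero 2 u≉0

        uxA≉0 : NonZero (u ^ 2 * x * A x)
        uxA≉0 = *-NonZero (*-NonZero u²≉0 (x≉0 k)) (A≉0 k)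

        w = W′ k ÷ (u ^ 2 * x * A x)

        W′≈ : W′ k ≈ w * (u ^ 2 * x * A x)
        W′≈ = sym (÷-cancel uxA≉0)

        rW≈ : ratio z * W k ≈ - (w * (v ^ 2 * x * B x))
        rW≈ = *-cancelʳ (*-NonZero (*-NonZero b≉0 u²≉0) (A≉0 k)) (begin
          (c * v ^ 2 ÷ (b′ * u ^ 2)) * W k * (b′ * u ^ 2 * A x)
            ≈⟨ solve 5 (λ r W b u A → r :* W :* (b :* u :* A) := r :* (b :* u) :* (W :* A)) ≡.refl (c * v ^ 2 ÷ (b′ * u ^ 2)) (W k) b′ (u ^ 2) (A x) ⟩
          (c * v ^ 2 ÷ (b′ * u ^ 2)) * (b′ * u ^ 2) * (W k * A x)
            ≈⟨ *-congʳ (÷-cancel (*-NonZero b≉0 u²≉0)) ⟩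
          c * v ^ 2 * (W k * A x)
            ≈⟨ solve 4 (λ c v W A → c :* v :* (W :* A) := v :* (W :* (A :* c))) ≡.refl c (v ^ 2) (W k) (A x) ⟩
          v ^ 2 * (W k * (A x * c))
            ≈⟨ *-congˡ (weight-ratio k) ⟩
          v ^ 2 * (W′ k * (B x * b))
            ≈⟨ *-congˡ (*-cong W′≈ refl) ⟩
          v ^ 2 * (w * (u ^ 2 * x * A x) * (B x * b))
            ≈⟨ solve 8 (λ v w u x A B z q → v :* (w :* (u :* x :* A) :* (B :* (z :- q :^ 2))) := :- (w :* (v :* x :* B)) :* ((q :^ 2 :- z) :* u :* A))
                 ≡.refl (v ^ 2) w (u ^ 2) x (A x) (B x) z q ⟩
          - (w * (v ^ 2 * x * B x)) * (b′ * u ^ 2 * A x) ∎)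
          where b′ = q ^ 2 - z

        anti≈ : anti k ≈ - (w * (q * zz * (f₃ * g x * f₈)))
        anti≈ = -‿cong (sym (÷-intro (*-NonZero (*-NonZero u²≉0 (x≉0 k)) (*-NonZero (f₁≉0 k) (f₉≉0 k))) (begin
          w * (q * zz * (f₃ * g x * f₈)) * (u ^ 2 * x * (f₁ * f₉))
            ≈⟨ solve 10 (λ w q zz f₃ g f₈ u x f₁ f₉ → w :* (q :* zz :* (f₃ :* g :* f₈)) :* (u :* x :* (f₁ :* f₉))
                 := q :* zz :* (w :* (u :* x :* (f₁ :* f₉ :* f₈))) :* (f₃ :* g)) ≡.refl w q zz f₃ (g x) f₈ (u ^ 2) x f₁ f₉ ⟩
          q * zz * (w * (u ^ 2 * x * A x)) * (f₃ * g x)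
            ≈⟨ *-congʳ (*-congˡ W′≈) ⟨
          q * zz * W′ k * (f₃ * g x) ∎)))

        anti⁺≈ : anti (suc k) ≈ - (w * (zz * (f₆ * P * l * f₁)))
        anti⁺≈ = -‿cong (sym (÷-intro (*-NonZero (*-NonZero u²≉0 (x≉0 (suc k))) (*-NonZero (f₁≉0 (suc k)) (f₉≉0 (suc k))))
          (*-cancelʳ (den′≉0 k) (begin
          w * (zz * (f₆ * P * l * f₁)) * (u ^ 2 * (q ^ 2 * x) * d⁺) * (E * e′)
            ≈⟨ *-cong (*-congˡ (*-congˡ d⁺≈)) (*-congˡ e′≈) ⟩
          w * (zz * (f₆ * P * l * f₁)) * (u ^ 2 * (q ^ 2 * x) * (q * (f₉ * f₅))) * (E * (q ^ 4 * (f₇ * f₈)))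
            ≈⟨ solve 14 (λ w zz P l f₁ f₅ f₆ f₇ f₈ f₉ u q x E →
                 w :* (zz :* (f₆ :* P :* l :* f₁)) :* (u :* (q :^ 2 :* x) :* (q :* (f₉ :* f₅))) :* (E :* (q :^ 4 :* (f₇ :* f₈)))
                 := q :* zz :* (w :* (u :* x :* (f₁ :* f₉ :* f₈)) :* (q :* P :* (q :^ 4 :* (f₅ :* f₆)))) :* (f₇ :* (q :* (E :* l))))
                 ≡.refl w zz P l f₁ f₅ f₆ f₇ f₈ f₉ (u ^ 2) q x E ⟩
          q * zz * (w * (u ^ 2 * x * A x) * (q * P * (q ^ 4 * (f₅ * f₆)))) * (f₇ * (q * (E * l)))
            ≈⟨ *-cong (*-congˡ (*-cong W′≈ (*-congˡ n′≈))) h⁺≈ ⟨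
          q * zz * (W′ k * (q * P * n′)) * (f₃⁺ * g (q ^ 2 * x))
            ≈⟨ *-congʳ (*-congˡ (hyper-step _ _ k (den′≉0 k))) ⟨
          q * zz * (W′ (suc k) * (E * e′)) * (f₃⁺ * g (q ^ 2 * x))
            ≈⟨ solve 4 (λ zz W D h → zz :* (W :* D) :* h := zz :* W :* h :* D) ≡.refl (q * zz) (W′ (suc k)) (E * e′) (f₃⁺ * g (q ^ 2 * x)) ⟩
          q * zz * W′ (suc k) * (f₃⁺ * g (q ^ 2 * x)) * (E * e′) ∎))))
          where
          n′ = (q - z′ * x) * (z′ - q ^ 3 * x)
          e′ = (1# - q ^ 2 * z′ * x ^ 2) * (z′ - q ^ 6 * x ^ 2)
          d⁺ = (q - z * (q ^ 2 * x)) * (1# - q * z * (q ^ 2 * x))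
          f₃⁺ = 1# - q ^ 2 * z * (q ^ 2 * x) ^ 2
          n′≈ : n′ ≈ q ^ 4 * (f₅ * f₆)
          n′≈ = solve 3 (λ q z x →
            (q :- q :^ 4 :* z :* x) :* (q :^ 4 :* z :- q :^ 3 :* x)
              := q :^ 4 :* ((:1 :- q :^ 3 :* z :* x) :* (q :* z :- x))) ≡.refl q z x
          e′≈ : e′ ≈ q ^ 4 * (f₇ * f₈)
          e′≈ = solve 3 (λ q z x →
            (:1 :- q :^ 2 :* (q :^ 4 :* z) :* x :^ 2) :* (q :^ 4 :* z :- q :^ 6 :* x :^ 2)
              := q :^ 4 :* ((:1 :- q :^ 6 :* z :* x :^ 2) :* (z :- q :^ 2 :* x :^ 2))) ≡.refl q z x
          d⁺≈ : d⁺ ≈ q * (f₉ * f₅)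
          d⁺≈ = solve 3 (λ q z x →
            (q :- z :* (q :^ 2 :* x)) :* (:1 :- q :* z :* (q :^ 2 :* x))
              := q :* ((:1 :- q :* z :* x) :* (:1 :- q :^ 3 :* z :* x))) ≡.refl q z x
          h⁺≈ : f₃⁺ * g (q ^ 2 * x) ≈ f₇ * (q * (E * l))
          h⁺≈ = solve 3 (λ q z x →
            (:1 :- q :^ 2 :* z :* (q :^ 2 :* x) :^ 2) :* ((:1 :- (q :^ 2 :* x) :^ 2) :* (:1 :- q :^ 2 :* x) :^ 2 :* (q :- q :^ 2 :* x))
              := (:1 :- q :^ 6 :* z :* x :^ 2) :* (q :* ((:1 :- q :^ 4 :* x :^ 2) :* (:1 :- q :^ 2 :* x) :^ 2 :* (:1 :- q :* x)))) ≡.refl q z x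

        anti-step : κ x * W′ k - ratio z * (κ x * W k) ≈ anti (suc k) - anti k
        anti-step = begin
          κ x * W′ k - ratio z * (κ x * W k)
            ≈⟨ +-congˡ (-‿cong (*-swapˡ _ _ _)) ⟩
          κ x * W′ k - κ x * (ratio z * W k)
            ≈⟨ +-cong (*-congˡ W′≈) (-‿cong (*-congˡ rW≈)) ⟩
          κ x * (w * (u ^ 2 * x * A x)) - κ x * (- (w * (v ^ 2 * x * B x)))
            ≈⟨ solve 7 (λ k w x u A v B → k :* (w :* (u :* x :* A)) :- k :* (:- (w :* (v :* x :* B))) := w :* (k :* x :* (u :* A :+ v :* B)))
                 ≡.refl (κ x) w x (u ^ 2) (A x) (v ^ 2) (B x) ⟩
          w * (κ x * x * (u ^ 2 * A x + v ^ 2 * B x))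
            ≈⟨ *-congˡ (identity x z q) ⟩
          w * (- zz * (f₆ * P * l * f₁ - q * (f₃ * g x * f₈)))
            ≈⟨ solve 5 (λ w zz a b q → w :* (:- zz :* (a :- q :* b)) := :- (w :* (zz :* a)) :- :- (w :* (q :* zz :* b))) ≡.refl w zz (f₆ * P * l * f₁) (f₃ * g x * f₈) q ⟩
          - (w * (zz * (f₆ * P * l * f₁))) - - (w * (q * zz * (f₃ * g x * f₈)))
            ≈⟨ +-cong anti⁺≈ (-‿cong anti≈) ⟨
          anti (suc k) - anti k ∎
          where
          identity = solve 3 (λ x z q →
            (:1 :- q :* x :^ 3) :* x :*
              ((:1 :- q :* z) :^ 2 :* ((q :- z :* x) :* (:1 :- q :* z :* x) :* (z :- q :^ 2 :* x :^ 2))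
               :+ (q :- z) :^ 2 :* ((q :* z :- x) :* (z :- q :* x) :* (:1 :- q :^ 2 :* z :* x :^ 2)))
            := :- (z :* (:1 :+ z)) :*
              ((q :* z :- x) :* ((:1 :- q :* x :^ 2) :^ 2 :* (:1 :- q :^ 2 :* x :^ 2)) :* (:1 :- q :* x) :* (q :- z :* x)
               :- q :* ((:1 :- q :^ 2 :* z :* x :^ 2) :* ((:1 :- x :^ 2) :* (:1 :- x) :^ 2 :* (q :- x)) :* (z :- q :^ 2 :* x :^ 2))))
            ≡.refl

      private
        anti₀≈0 : anti 0 ≈ 0#
        anti₀≈0 = begin
          - ((q * (z * (1# + z)) * 1# * ((1# - q ^ 2 * z * 1# ^ 2) * g 1#)) * i)
            ≈⟨ solve 3 (λ q z i → :- ((q :* (z :* (:1 :+ z)) :* :1 :* ((:1 :- q :^ 2 :* z :* :1 :^ 2) :*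
                 ((:1 :- :1 :^ 2) :* (:1 :- :1) :^ 2 :* (q :- :1)))) :* i) := :0) ≡.refl q z i ⟩
          0# ∎
          where i = (u ^ 2 * 1# * ((q - z * 1#) * (1# - q * z * 1#))) ⁻¹

        anti-top≈0 : anti (suc (suc n)) ≈ 0#
        anti-top≈0 = begin
          anti (suc (suc n))                   ≈⟨ anti⁺≈ ⟩
          - (w * (zz * (f₆ * P * l * f₁)))     ≈⟨ -‿cong (*-congˡ (*-congˡ (*-congʳ (*-congʳ (*-congʳ top))))) ⟩
          - (w * (zz * (0# * P * l * f₁)))     ≈⟨ solve 5 (λ w z p l f → :- (w :* (z :* (:0 :* p :* l :* f))) := :0) ≡.refl w zz P l f₁ ⟩
          0# ∎
          where open AntiStep (suc n)

        weight≈0 : ∀ k → B (X k) ≈ 0# → W k ≈ 0#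
        weight≈0 k B≈0 = *-cancelʳ (*-NonZero (A≉0 k) c≉0) (begin
          W k * (A (X k) * c)    ≈⟨ weight-ratio k ⟩
          W′ k * (B (X k) * b)   ≈⟨ *-congˡ (*-congʳ B≈0) ⟩
          W′ k * (0# * b)        ≈⟨ solve 4 (λ w b a c → w :* (:0 :* b) := :0 :* (a :* c)) ≡.refl (W′ k) b (A (X k)) c ⟩
          0# * (A (X k) * c)     ∎)

        weight-n≈0 : W n ≈ 0#
        weight-n≈0 = weight≈0 n (trans (*-congʳ (*-congˡ top′)) (solve 2 (λ a b → a :* :0 :* b := :0) ≡.refl _ _))

        weight-1+n≈0 : W (suc n) ≈ 0#
        weight-1+n≈0 = weight≈0 (suc n) (trans (*-congʳ (*-congʳ top)) (solve 2 (λ a b → :0 :* a :* b := :0) ≡.refl _ _))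

      sum-step : sum (λ k → κ (X k) * W′ k) (suc (suc n)) ≈ ratio z * sum (λ k → κ (X k) * W k) n
      sum-step = begin
        sum T′ (suc (suc n))
          ≈⟨ solve 2 (λ a b → a := (a :- b) :+ b) ≡.refl _ (ratio z * sum T (suc (suc n))) ⟩
        (sum T′ (suc (suc n)) - ratio z * sum T (suc (suc n))) + ratio z * sum T (suc (suc n))
          ≈⟨ +-congʳ difference≈0 ⟩
        0# + ratio z * (sum T n + κ (X n) * W n + κ (X (suc n)) * W (suc n))
          ≈⟨ +-congˡ (*-congˡ (+-cong (+-congˡ (*-congˡ weight-n≈0)) (*-congˡ weight-1+n≈0))) ⟩
        0# + ratio z * (sum T n + κ (X n) * 0# + κ (X (suc n)) * 0#)
          ≈⟨ solve 4 (λ r t k k′ → :0 :+ r :* (t :+ k :* :0 :+ k′ :* :0) := r :* t) ≡.refl (ratio z) (sum T n) (κ (X n)) (κ (X (suc n))) ⟩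
        ratio z * sum T n ∎
        where
        T T′ : ℕ → K
        T k = κ (X k) * W k
        T′ k = κ (X k) * W′ k
        m = suc (suc n)
        difference≈0 : sum T′ m - ratio z * sum T m ≈ 0#
        difference≈0 = begin
          sum T′ m - ratio z * sum T m                  ≈⟨ +-congˡ (-‿cong (sum-*ˡ (ratio z) T m)) ⟨
          sum T′ m - sum (λ k → ratio z * T k) m        ≈⟨ +-congˡ (sum-neg _ m) ⟨
          sum T′ m + sum (λ k → - (ratio z * T k)) m    ≈⟨ sum-+ T′ _ m ⟨
          sum (λ k → T′ k - ratio z * T k) m            ≈⟨ telescope _ anti m (λ k _ → AntiStep.anti-step k) ⟩
          anti m - anti 0                               ≈⟨ +-cong anti-top≈0 (-‿cong anti₀≈0) ⟩
          0# - 0#                                       ≈⟨ -‿inverseʳ 0# ⟩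
          0# ∎

    Z : ℕ → K
    Z zero    = q ^ 3
    Z (suc m) = q ^ 4 * Z m

    double : ℕ → ℕ
    double zero    = 0
    double (suc m) = suc (suc (double m))

    -- At z = q³ the factor z - q³x removes everything after the first term, and each passage from z
    -- to q⁴z lengthens the sum by two.
    terminating-sum : ∀ m → (∀ i → i < m → Step (Z i) (suc (double i))) →
      sum (λ k → κ (X k) * weight (Z m) k) (suc (double m)) ≈ (1# - q) * prod (λ i → ratio (Z i)) m
    terminating-sum zero    _ = solve 1 (λ q → :0 :+ (:1 :- q :* :1 :^ 3) :* :1 := (:1 :- q) :* :1) ≡.refl q
    terminating-sum (suc m) S = begin
      sum (λ k → κ (X k) * weight (Z (suc m)) k) (suc (double (suc m)))
        ≈⟨ sum-step (S m ℕ.≤-refl) ⟩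
      ratio (Z m) * sum (λ k → κ (X k) * weight (Z m) k) (suc (double m))
        ≈⟨ *-congˡ (terminating-sum m (λ i i<m → S i (ℕ.m<n⇒m<1+n i<m))) ⟩
      ratio (Z m) * ((1# - q) * prod (λ i → ratio (Z i)) m)
        ≈⟨ solve 3 (λ r c p → r :* (c :* p) := c :* (p :* r)) ≡.refl _ _ _ ⟩
      (1# - q) * (prod (λ i → ratio (Z i)) m * ratio (Z m)) ∎

-- The deformed series and its closed forms

module QSeries where

  open RingSolver
  open FieldTheory
  open Summation
  open import Data.Nat as ℕ using (ℕ; zero; suc; _<_; _≤_; z≤n; s≤s)
  import Data.Nat.Properties as ℕ
  open import Data.Nat.DivMod using (_%_; [m+kn]%n≡m%n)
  open import Data.Nat.Tactic.RingSolver using (solve-∀)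
  open import Data.Product using (_×_; _,_)
  open import Relation.Binary.Definitions using (tri<; tri≈; tri>)
  open import Relation.Binary.PropositionalEquality as ≡ using (_≡_; _≢_)
  open import Relation.Nullary using (¬_; contradiction)

  -- Exponents of q are told apart in two ways: by their residues modulo 2 or 4, as here, or by
  -- size, as in `<-≢`.
  ≢-mod : ∀ c .{{_ : ℕ.NonZero c}} r r′ α β {a b} →
    a ≡ r ℕ.+ α ℕ.* c → b ≡ r′ ℕ.+ β ℕ.* c → r % c ≢ r′ % c → a ≢ b
  ≢-mod c r r′ α β ≡.refl ≡.refl r≢r′ a≡b =
    r≢r′ (≡.trans (≡.sym ([m+kn]%n≡m%n r α c)) (≡.trans (≡.cong (_% c) a≡b) ([m+kn]%n≡m%n r′ β c)))

  <-≢ : ∀ {a b} e → b ≡ suc (a ℕ.+ e) → a ≢ b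
  <-≢ {a} e b≡ = ℕ.<⇒≢ (≡.subst (a <_) (≡.sym b≡) (s≤s (ℕ.m≤m+n a e)))

  record GenericElement (F : Field) : Set where
    open FieldProperties F
    field
      q           : K
      q≉0         : NonZero q
      torsionFree : ∀ i → NonZero (1# - q ^ suc i)

  module QProperties (F : Field) (Q : GenericElement F) where

    open FieldProperties F
    open GenericElement Q
    open Nodes F q

    E : ℕ → K
    E i = 1# - q ^ i

    infix 4 _isPower_
    -- A record and not a synonym for the equation, so that the element and its exponent are
    -- recovered by unification.
    record _isPower_ (x : K) (a : ℕ) : Set where
      constructor power
      field ≈power : x ≈ q ^ a
    open _isPower_ public

    q-power : ∀ k → q ^ k isPower k
    q-power k = power refl

    q-isPower : q isPower 1
    q-isPower = power (sym (*-identityʳ q))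

    1-isPower : 1# isPower 0
    1-isPower = power refl

    *-isPower : ∀ {x y a b} → x isPower a → y isPower b → x * y isPower a ℕ.+ b
    *-isPower {a = a} {b} (power p) (power r) = power (trans (*-cong p r) (sym (^-homo-* q a b)))

    ^-isPower : ∀ {x a} k → x isPower a → x ^ k isPower a ℕ.* k
    ^-isPower {a = a} k (power p) = power (trans (^-congˡ k p) (^-assocʳ q a k))

    isPower-≡ : ∀ {x a b} → a ≡ b → x isPower a → x isPower b
    isPower-≡ ≡.refl p = p

    isPower-≈ : ∀ {x y a} → x isPower a → y isPower a → x ≈ y
    isPower-≈ (power p) (power r) = trans p (sym r)

    power≉0 : ∀ {x a} → x isPower a → NonZero x
    power≉0 {a = a} (power p) = NonZero-resp (sym p) (^-NonZero a q≉0)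

    difference : ∀ i e → q ^ i - q ^ (i ℕ.+ e) ≈ q ^ i * (1# - q ^ e)
    difference i e = trans (+-congˡ (-‿cong (^-homo-* q i e)))
      (solve 2 (λ x y → x :- x :* y := x :* (:1 :- y)) ≡.refl (q ^ i) (q ^ e))

    distinct : ∀ {i j} → i ≢ j → NonZero (q ^ i - q ^ j)
    distinct {i} {j} i≢j with ℕ.<-cmp i j
    ... | tri≈ _ i≡j _ = contradiction i≡j i≢j
    ... | tri< i<j _ _ with ℕ.m≤n⇒∃[o]m+o≡n i<j
    ...   | e , ≡.refl = NonZero-resp
      (trans (sym (difference i (suc e))) (+-congˡ (-‿cong (^-congʳ q (ℕ.+-suc i e)))))
      (*-NonZero (^-NonZero i q≉0) (torsionFree e))
    distinct {i} {j} i≢j | tri> _ _ j<i with ℕ.m≤n⇒∃[o]m+o≡n j<i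
    ...   | e , ≡.refl = NonZero-resp
      (trans (-‿cong (trans (sym (difference j (suc e))) (+-congˡ (-‿cong (^-congʳ q (ℕ.+-suc j e))))))
             (solve 2 (λ a b → :- (a :- b) := b :- a) ≡.refl (q ^ j) _))
      (neg-NonZero (*-NonZero (^-NonZero j q≉0) (torsionFree e)))

    power-difference : ∀ {x y a b} → x isPower a → y isPower b → a ≢ b → NonZero (x - y)
    power-difference (power p) (power r) a≢b = NonZero-resp (sym (+-cong p (-‿cong r))) (distinct a≢b)

    E≉0 : ∀ i → NonZero (E (suc i))
    E≉0 = torsionFree

    X-isPower : ∀ k → X k isPower (2 ℕ.* k)
    X-isPower zero    = 1-isPower
    X-isPower (suc k) = isPower-≡ (lemma k) (*-isPower (q-power 2) (X-isPower k))
      where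
      lemma : ∀ k → 2 ℕ.+ 2 ℕ.* k ≡ 2 ℕ.* suc k
      lemma = solve-∀

    X² : ∀ k → X k ^ 2 isPower (4 ℕ.* k)
    X² k = isPower-≡ (lemma k) (^-isPower 2 (X-isPower k))
      where
      lemma : ∀ k → 2 ℕ.* k ℕ.* 2 ≡ 4 ℕ.* k
      lemma = solve-∀

    -- For t = b + 1/b this is (c - ba)(c - a/b), a product of two conjugate linear factors written
    -- without b.
    quad : K → K → K → K
    quad t c a = c ^ 2 - t * c * a + a ^ 2

    quad-cong : ∀ {t t′ c c′ a a′} → t ≈ t′ → c ≈ c′ → a ≈ a′ → quad t c a ≈ quad t′ c′ a′
    quad-cong p r s = +-cong (+-cong (^-congˡ 2 r) (-‿cong (*-cong (*-cong p r) s))) (^-congˡ 2 s)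

    symm : ℕ → K
    symm β = q ^ β + (q ^ β) ⁻¹

    2# : K
    2# = 1# + 1#

    symm-0 : symm 0 ≈ 2#
    symm-0 = +-congˡ (sym (⁻¹-unique 1≉0 (*-identityˡ 1#)))

    symm-* : ∀ β → q ^ β * symm β ≈ (q ^ β) ^ 2 + 1#
    symm-* β = begin
      b * (b + b ⁻¹)      ≈⟨ distribˡ b b _ ⟩
      b * b + b * b ⁻¹    ≈⟨ +-cong (solve 1 (λ b → b :* b := b :^ 2) ≡.refl b) (⁻¹-inverse (^-NonZero β q≉0)) ⟩
      b ^ 2 + 1#          ∎
      where b = q ^ β

    quad-symm : ∀ β c a → q ^ β * quad (symm β) c a ≈ (q ^ β * c - a) * (c - q ^ β * a)
    quad-symm β c a = begin
      b * (c ^ 2 - symm β * c * a + a ^ 2)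
        ≈⟨ solve 4 (λ b t c a → b :* (c :^ 2 :- t :* c :* a :+ a :^ 2) := b :* c :^ 2 :- (b :* t) :* (c :* a) :+ b :* a :^ 2) ≡.refl b (symm β) c a ⟩
      b * c ^ 2 - (b * symm β) * (c * a) + b * a ^ 2
        ≈⟨ +-congʳ (+-congˡ (-‿cong (*-congʳ (symm-* β)))) ⟩
      b * c ^ 2 - (b ^ 2 + 1#) * (c * a) + b * a ^ 2
        ≈⟨ solve 3 (λ b c a → b :* c :^ 2 :- (b :^ 2 :+ :1) :* (c :* a) :+ b :* a :^ 2 := (b :* c :- a) :* (c :- b :* a)) ≡.refl b c a ⟩
      (b * c - a) * (c - b * a) ∎
      where b = q ^ β

    quad-symm≉0 : ∀ β {c a γ α} → c isPower γ → a isPower α → β ℕ.+ γ ≢ α → γ ≢ β ℕ.+ α →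
      NonZero (quad (symm β) c a)
    quad-symm≉0 β c a p r = λ z → *-NonZero
      (power-difference (*-isPower (q-power β) c) a p)
      (power-difference c (*-isPower (q-power β) a) r)
      (trans (sym (quad-symm β _ _)) (trans (*-congˡ z) (zeroʳ _)))

  module Series (F : Field) (Q : GenericElement F) where

    open FieldProperties F
    open GenericElement Q
    open QProperties F Q
    open Nodes F q
    open Hypergeometric F

    -- The Gasper-Rahman term ratio with quadratic parameters qbc, qc/b and q²/c², expressed in s =
    -- a + 1/a and t = b + 1/b. At c = 1 the factors 1 - qx and 1 - qc²x cancel, and s = t = 2 then
    -- gives the term ratio of the original sum apart from [6k+1].
    weightNum weightDen : K → K → K → K → K
    weightNum s t c x =
      q ^ 2 * (1# - q * x) * quad s 1# (q * x) * quad t 1# (q * c * x ^ 2) * (c ^ 2 - q ^ 2 * x ^ 2)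
    weightDen s t c x =
      (1# - q ^ 4 * x ^ 2) * quad s 1# (q ^ 4 * x ^ 2) * quad t c (q ^ 2 * x) * (1# - q * c ^ 2 * x)

    weight : K → K → K → ℕ → K
    weight s t c = hyper (λ j → weightNum s t c (X j)) (λ j → weightDen s t c (X j))

    series : K → K → K → ℕ → K
    series s t c = sum (λ k → κ (X k) * weight s t c k)

    Admissible : K → Set
    Admissible s = ∀ k → NonZero (quad s 1# (q ^ 4 * X k ^ 2))

    symm-admissible : ∀ β → (∀ k → β ≢ 4 ℕ.+ 4 ℕ.* k) → Admissible (symm β)
    symm-admissible β β≢ k = quad-symm≉0 β 1-isPower (*-isPower (q-power 4) (X² k))
      (λ e → β≢ k (≡.trans (≡.sym (ℕ.+-identityʳ β)) e))
      (λ e → ℕ.0≢1+n (≡.trans e (≡.trans (ℕ.+-suc β _) ≡.refl)))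

    module StarSteps (s : K) (adm : Admissible s) (δ : ℕ) where

      d : K
      d = q ^ δ

      open module QS = Quadratic F q s d

      Z-isPower : ∀ i → Z i isPower (4 ℕ.* i ℕ.+ 4)
      Z-isPower zero    = q-power 4
      Z-isPower (suc i) = isPower-≡ (lemma i) (*-isPower (q-power 4) (Z-isPower i))
        where
        lemma : ∀ i → 4 ℕ.+ (4 ℕ.* i ℕ.+ 4) ≡ 4 ℕ.* suc i ℕ.+ 4
        lemma = solve-∀

      -- The exponent inequalities behind `Step` for z = q^(4i+4) and d = q^δ. Only `sep₄` is
      -- restricted to small k: for b = c = qⁿ one has δ = 8m + 3, and d coincides with q³ X k at k
      -- = 4m.
      record Separated (i : ℕ) : Set where
        field
          sep₁ : ∀ k → 4 ℕ.* i ℕ.+ 5 ≢ δ ℕ.+ 2 ℕ.* k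
          sep₂ : ∀ k → 4 ℕ.* i ℕ.+ 4 ≢ δ ℕ.+ (1 ℕ.+ 2 ℕ.* k)
          sep₃ : ∀ k → 4 ℕ.* i ℕ.+ 8 ≢ δ ℕ.+ (3 ℕ.+ 2 ℕ.* k)
          sep₄ : ∀ k → k ≤ suc i → δ ≢ 3 ℕ.+ 2 ℕ.* k
          sep₅ : ∀ k → δ ≢ 4 ℕ.* i ℕ.+ 4 ℕ.+ 4 ℕ.* k

      den-nonzero : ∀ i k → δ ≢ 3 ℕ.+ 2 ℕ.* k → (4 ℕ.* i ℕ.+ 4) ≢ δ ℕ.+ (3 ℕ.+ 2 ℕ.* k) → NonZero (den (Z i) (X k))
      den-nonzero i k p r = *-NonZero
        (*-NonZero
          (*-NonZero (power-difference 1-isPower (*-isPower (q-power 4) (X² k)) (λ ()))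
                     (NonZero-resp quad≈ (adm k)))
          (power-difference (q-power δ) (*-isPower (q-power 3) (X-isPower k)) p))
        (*-NonZero
          (power-difference q-isPower (*-isPower (Z-isPower i) (X-isPower k)) (1≢ i k))
          (power-difference (Z-isPower i) (*-isPower (*-isPower (q-power 3) (q-power δ)) (X-isPower k))
            (λ e → r (≡.trans e (reorder δ k)))))
        where
        1≢ : ∀ i k → 1 ≢ 4 ℕ.* i ℕ.+ 4 ℕ.+ 2 ℕ.* k
        1≢ i k = <-≢ (4 ℕ.* i ℕ.+ 2 ℕ.+ 2 ℕ.* k) (lemma i k)
          where
          lemma : ∀ i k → 4 ℕ.* i ℕ.+ 4 ℕ.+ 2 ℕ.* k ≡ suc (1 ℕ.+ (4 ℕ.* i ℕ.+ 2 ℕ.+ 2 ℕ.* k))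
          lemma = solve-∀
        reorder : ∀ δ k → 3 ℕ.+ δ ℕ.+ 2 ℕ.* k ≡ δ ℕ.+ (3 ℕ.+ 2 ℕ.* k)
        reorder = solve-∀
        quad≈ : quad s 1# (q ^ 4 * X k ^ 2) ≈ 1# - s * q ^ 4 * X k ^ 2 + q ^ 8 * X k ^ 4
        quad≈ = solve 3 (λ s q x → :1 :^ 2 :- s :* :1 :* (q :^ 4 :* x :^ 2) :+ (q :^ 4 :* x :^ 2) :^ 2
                  := :1 :- s :* q :^ 4 :* x :^ 2 :+ q :^ 8 :* x :^ 4) ≡.refl s q (X k)

      step : ∀ i → Separated i → Step (Z i) (suc i)
      step i S = record
        { q≉0 = q≉0
        ; x≉0 = λ k → power≉0 (X-isPower k)
        ; z-1≉0 = power-difference (Z-isPower i) 1-isPower (λ e → ℕ.m+1+n≢0 (4 ℕ.* i) e)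
        ; u≉0 = NonZero-resp u≈ (adm i)
        ; g₁≉0 = power-difference qZ (q-power δ) (λ e → sep₁ 0 (≡.trans e (≡.sym (ℕ.+-identityʳ δ))))
        ; g₂≉0 = power-difference (Z-isPower i) (*-isPower q-isPower (q-power δ))
                   (λ e → sep₂ 0 (≡.trans e (ℕ.+-comm 1 δ)))
        ; q-z≉0 = power-difference q-isPower (Z-isPower i) (1≢ i)
        ; 1-qz≉0 = power-difference 1-isPower qZ (λ e → ℕ.m+1+n≢0 (4 ℕ.* i) (≡.sym e))
        ; den≉0 = λ k k<n → den-nonzero i k (sep₄ k (ℕ.<⇒≤ k<n)) (λ e → sep₂ (suc k) (≡.trans e (reorder₂ δ k)))
        ; den′≉0 = λ k k≤n → den-nonzero (suc i) k (sep₄ k k≤n) (λ e → sep₃ k (≡.trans (≡.sym (reorder₃ i)) e))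
        ; f₂≉0 = λ k _ → power-difference (q-power δ) (*-isPower (Z-isPower i) (X² k)) (sep₅ k)
        ; f₈≉0 = λ k _ → power-difference qZ (*-isPower (q-power δ) (X-isPower k)) (sep₁ k)
        ; f₉≉0 = λ k _ → power-difference (Z-isPower i) (*-isPower (*-isPower q-isPower (q-power δ)) (X-isPower k))
                   (λ e → sep₂ k (≡.trans e (reorder₁ δ k)))
        ; top = trans (+-congʳ (isPower-≈ (Z-isPower i) (isPower-≡ (reorder₄ i) (X² (suc i))))) (-‿inverseʳ _)
        }
        where
        open Separated S
        reorder₁ : ∀ δ k → 1 ℕ.+ δ ℕ.+ 2 ℕ.* k ≡ δ ℕ.+ (1 ℕ.+ 2 ℕ.* k)
        reorder₁ = solve-∀
        reorder₂ : ∀ δ k → δ ℕ.+ (3 ℕ.+ 2 ℕ.* k) ≡ δ ℕ.+ (1 ℕ.+ 2 ℕ.* suc k)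
        reorder₂ = solve-∀
        reorder₃ : ∀ i → 4 ℕ.* suc i ℕ.+ 4 ≡ 4 ℕ.* i ℕ.+ 8
        reorder₃ = solve-∀
        reorder₄ : ∀ i → 4 ℕ.* suc i ≡ 4 ℕ.* i ℕ.+ 4
        reorder₄ = solve-∀
        reorder₅ : ∀ i → 1 ℕ.+ (4 ℕ.* i ℕ.+ 4) ≡ 4 ℕ.* i ℕ.+ 5
        reorder₅ = solve-∀
        qZ : q * Z i isPower (4 ℕ.* i ℕ.+ 5)
        qZ = isPower-≡ (reorder₅ i) (*-isPower q-isPower (Z-isPower i))
        1≢ : ∀ i → 1 ≢ 4 ℕ.* i ℕ.+ 4
        1≢ i = <-≢ (4 ℕ.* i ℕ.+ 2) (lemma i)
          where
          lemma : ∀ i → 4 ℕ.* i ℕ.+ 4 ≡ suc (1 ℕ.+ (4 ℕ.* i ℕ.+ 2))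
          lemma = solve-∀
        z≈ : q ^ 4 * X i ^ 2 ≈ Z i
        z≈ = isPower-≈ (isPower-≡ (ℕ.+-comm 4 (4 ℕ.* i)) (*-isPower (q-power 4) (X² i))) (Z-isPower i)
        u≈ : quad s 1# (q ^ 4 * X i ^ 2) ≈ 1# - s * Z i + Z i ^ 2
        u≈ = trans (quad-cong refl refl z≈)
               (solve 2 (λ s z → :1 :^ 2 :- s :* :1 :* z :+ z :^ 2 := :1 :- s :* z :+ z :^ 2) ≡.refl s (Z i))

    weightDen≉0 : ∀ {s} β {c γ} k → Admissible s → c isPower γ →
      β ℕ.+ γ ≢ 2 ℕ.+ 2 ℕ.* k → γ ≢ β ℕ.+ (2 ℕ.+ 2 ℕ.* k) → NonZero (weightDen s (symm β) c (X k))
    weightDen≉0 β k adm c p r = *-NonZero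
      (*-NonZero
        (*-NonZero (power-difference 1-isPower (*-isPower (q-power 4) (X² k)) (λ ())) (adm k))
        (quad-symm≉0 β c (*-isPower (q-power 2) (X-isPower k)) p r))
      (power-difference 1-isPower (*-isPower (*-isPower q-isPower (^-isPower 2 c)) (X-isPower k)) (λ ()))

    η : K → ℕ → K
    η s i = quad s 1# (q ^ (4 ℕ.* i ℕ.+ 2)) ÷ quad s 1# (q ^ (4 ℕ.* i ℕ.+ 4))

    -- This is (1 - q) H(s) for n = 4m + 1, the factor 1 - q being the one contained in `κ`. At s =
    -- 2 it is (1 - qⁿ) times the quotient of squared q-shifted factorials in the theorem.
    closedForm : K → ℕ → K
    closedForm s m = E (4 ℕ.* m ℕ.+ 1) * prod (η s) m

    quad-power≉0 : ∀ {s} → Admissible s → ∀ i → NonZero (quad s 1# (q ^ (4 ℕ.* i ℕ.+ 4)))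
    quad-power≉0 adm i = NonZero-resp
      (quad-cong refl refl (isPower-≈ (isPower-≡ (ℕ.+-comm 4 (4 ℕ.* i)) (*-isPower (q-power 4) (X² i))) (q-power _)))
      (adm i)

    E-telescope : ∀ m (f : ℕ → K) →
      (1# - q) * prod (λ i → E (4 ℕ.* i ℕ.+ 5) ÷ E (4 ℕ.* i ℕ.+ 1) * f i) m ≈ E (4 ℕ.* m ℕ.+ 1) * prod f m
    E-telescope zero    f = *-congʳ (+-congˡ (-‿cong (sym (*-identityʳ q))))
    E-telescope (suc m) f = begin
      (1# - q) * (P * (E₅ ÷ E₁ * f m))
        ≈⟨ solve 5 (λ c P e i f → c :* (P :* (e :* i :* f)) := (c :* P) :* (e :* i :* f)) ≡.refl (1# - q) P E₅ (E₁ ⁻¹) (f m) ⟩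
      (1# - q) * P * (E₅ ÷ E₁ * f m)
        ≈⟨ *-congʳ (E-telescope m f) ⟩
      E₁ * prod f m * (E₅ ÷ E₁ * f m)
        ≈⟨ solve 5 (λ e₁ p e₅ i f → e₁ :* p :* (e₅ :* i :* f) := e₅ :* i :* e₁ :* (p :* f)) ≡.refl E₁ (prod f m) E₅ (E₁ ⁻¹) (f m) ⟩
      E₅ ÷ E₁ * E₁ * (prod f m * f m)
        ≈⟨ *-congʳ (÷-cancel (power-difference 1-isPower (q-power _) (λ e → ℕ.m+1+n≢0 (4 ℕ.* m) (≡.sym e)))) ⟩
      E₅ * (prod f m * f m)
        ≡⟨ ≡.cong (λ e → E e * (prod f m * f m)) (lemma m) ⟩
      E (4 ℕ.* suc m ℕ.+ 1) * (prod f m * f m) ∎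
      where
      P = prod (λ i → E (4 ℕ.* i ℕ.+ 5) ÷ E (4 ℕ.* i ℕ.+ 1) * f i) m
      E₅ = E (4 ℕ.* m ℕ.+ 5)
      E₁ = E (4 ℕ.* m ℕ.+ 1)
      lemma : ∀ m → 4 ℕ.* m ℕ.+ 5 ≡ 4 ℕ.* suc m ℕ.+ 1
      lemma = solve-∀

    series-cong : ∀ {s t c} N (w : ℕ → K) → (∀ k → k < N → weight s t c k ≈ w k) →
      series s t c N ≈ sum (λ k → κ (X k) * w k) N
    series-cong N w eq = sum-cong N (λ k k<N → *-congˡ (eq k k<N))

    module Match (s d z x : K) where

      numForm denForm : K → K → K → K → K → K
      numForm d z l S x = q ^ 3 * (l * S * (1# - d * x ^ 2)) * ((z - q ^ 4 * x ^ 2) * (d - z * x ^ 2))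
      denForm d z A S x = A * S * (d - q ^ 3 * x) * ((q - z * x) * (z - q ^ 3 * d * x))

      l = 1# - q * x
      A = 1# - q ^ 4 * x ^ 2
      S₁ = quad s 1# (q * x)
      S₄ = quad s 1# (q ^ 4 * x ^ 2)

      num≈ : ∀ {d′ z′} → d ≈ d′ → z ≈ z′ → Quadratic.num F q s d z x ≈ numForm d′ z′ l S₁ x
      num≈ p r = *-cong
        (*-congˡ (*-cong (*-congˡ (solve 3 (λ s q x → :1 :- s :* q :* x :+ q :^ 2 :* x :^ 2 := :1 :^ 2 :- s :* :1 :* (q :* x) :+ (q :* x) :^ 2) ≡.refl s q x))
                         (+-congˡ (-‿cong (*-congʳ p)))))
        (*-cong (+-congʳ r) (+-cong p (-‿cong (*-congʳ r))))

      den≈ : ∀ {d′ z′} → d ≈ d′ → z ≈ z′ → Quadratic.den F q s d z x ≈ denForm d′ z′ A S₄ x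
      den≈ p r = *-cong
        (*-cong (*-congˡ (solve 3 (λ s q x → :1 :- s :* q :^ 4 :* x :^ 2 :+ q :^ 8 :* x :^ 4 := :1 :^ 2 :- s :* :1 :* (q :^ 4 :* x :^ 2) :+ (q :^ 4 :* x :^ 2) :^ 2) ≡.refl s q x))
                (+-congʳ p))
        (*-cong (+-congˡ (-‿cong (*-congʳ r))) (+-cong r (-‿cong (*-congʳ (*-congˡ p)))))

      -- At c = 1 the quadratic parameters are qb, q/b and q². Here q/b takes the terminating place
      -- q⁴/z, while d = qb and z/d = q².
      match₁ : ∀ β → d ≈ q * q ^ β → z ≈ q ^ 3 * q ^ β →
        Quadratic.num F q s d z x * weightDen s (symm β) 1# x ≈ weightNum s (symm β) 1# x * Quadratic.den F q s d z x
      match₁ β d≈ z≈ = *-cancelˡ (^-NonZero β q≉0) (begin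
        y * (Quadratic.num F q s d z x * (A * S₄ * T₂ * (1# - q * 1# ^ 2 * x)))
          ≈⟨ *-congˡ (*-congʳ (num≈ d≈ z≈)) ⟩
        y * (numForm (q * y) (q ^ 3 * y) l S₁ x * (A * S₄ * T₂ * (1# - q * 1# ^ 2 * x)))
          ≈⟨ solve 6 (λ y n A S T m → y :* (n :* (A :* S :* T :* m)) := n :* (A :* S :* m) :* (y :* T)) ≡.refl y _ A S₄ T₂ _ ⟩
        numForm (q * y) (q ^ 3 * y) l S₁ x * (A * S₄ * (1# - q * 1# ^ 2 * x)) * (y * T₂)
          ≈⟨ *-congˡ (quad-symm β 1# (q ^ 2 * x)) ⟩
        numForm (q * y) (q ^ 3 * y) l S₁ x * (A * S₄ * (1# - q * 1# ^ 2 * x)) * ((y * 1# - q ^ 2 * x) * (1# - y * (q ^ 2 * x)))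
          ≈⟨ solve 7 (λ q x y l A S₁ S₄ →
               q :^ 3 :* (l :* S₁ :* (:1 :- q :* y :* x :^ 2)) :* ((q :^ 3 :* y :- q :^ 4 :* x :^ 2) :* (q :* y :- q :^ 3 :* y :* x :^ 2))
                 :* (A :* S₄ :* (:1 :- q :* :1 :^ 2 :* x)) :* ((y :* :1 :- q :^ 2 :* x) :* (:1 :- y :* (q :^ 2 :* x)))
               := q :^ 2 :* l :* S₁ :* (:1 :^ 2 :- q :^ 2 :* x :^ 2)
                 :* (A :* S₄ :* (q :* y :- q :^ 3 :* x) :* ((q :- q :^ 3 :* y :* x) :* (q :^ 3 :* y :- q :^ 3 :* (q :* y) :* x)))
                 :* ((y :* :1 :- q :* :1 :* x :^ 2) :* (:1 :- y :* (q :* :1 :* x :^ 2))))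
               ≡.refl q x y l A S₁ S₄ ⟩
        q ^ 2 * l * S₁ * (1# ^ 2 - q ^ 2 * x ^ 2) * denForm (q * y) (q ^ 3 * y) A S₄ x * ((y * 1# - q * 1# * x ^ 2) * (1# - y * (q * 1# * x ^ 2)))
          ≈⟨ *-congˡ (quad-symm β 1# (q * 1# * x ^ 2)) ⟨
        q ^ 2 * l * S₁ * (1# ^ 2 - q ^ 2 * x ^ 2) * denForm (q * y) (q ^ 3 * y) A S₄ x * (y * T₁)
          ≈⟨ solve 7 (λ y q l S m D T → q :^ 2 :* l :* S :* m :* D :* (y :* T) := y :* (q :^ 2 :* l :* S :* T :* m :* D)) ≡.refl y q l S₁ _ _ T₁ ⟩
        y * (q ^ 2 * l * S₁ * T₁ * (1# ^ 2 - q ^ 2 * x ^ 2) * denForm (q * y) (q ^ 3 * y) A S₄ x)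
          ≈⟨ *-congˡ (*-congˡ (den≈ d≈ z≈)) ⟨
        y * (q ^ 2 * l * S₁ * T₁ * (1# ^ 2 - q ^ 2 * x ^ 2) * Quadratic.den F q s d z x) ∎)
        where
        y = q ^ β
        T₁ = quad (symm β) 1# (q * 1# * x ^ 2)
        T₂ = quad (symm β) 1# (q ^ 2 * x)

      -- Now q²/c² takes the terminating place q⁴/z, and the other two parameters are d = qbc and
      -- z/d = qc/b.
      match₂ : ∀ β c → d ≈ q * q ^ β * c → z ≈ q ^ 2 * c ^ 2 →
        Quadratic.num F q s d z x * weightDen s (symm β) c x ≈ weightNum s (symm β) c x * Quadratic.den F q s d z x
      match₂ β c d≈ z≈ = *-cancelˡ (^-NonZero β q≉0) (begin
        b * (Quadratic.num F q s d z x * (A * S₄ * T₂ * (1# - q * c ^ 2 * x)))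
          ≈⟨ *-congˡ (*-congʳ (num≈ d≈ z≈)) ⟩
        b * (numForm (q * b * c) (q ^ 2 * c ^ 2) l S₁ x * (A * S₄ * T₂ * (1# - q * c ^ 2 * x)))
          ≈⟨ solve 6 (λ y n A S T m → y :* (n :* (A :* S :* T :* m)) := n :* (A :* S :* m) :* (y :* T)) ≡.refl b _ A S₄ T₂ _ ⟩
        numForm (q * b * c) (q ^ 2 * c ^ 2) l S₁ x * (A * S₄ * (1# - q * c ^ 2 * x)) * (b * T₂)
          ≈⟨ *-congˡ (quad-symm β c (q ^ 2 * x)) ⟩
        numForm (q * b * c) (q ^ 2 * c ^ 2) l S₁ x * (A * S₄ * (1# - q * c ^ 2 * x)) * ((b * c - q ^ 2 * x) * (c - b * (q ^ 2 * x)))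
          ≈⟨ solve 8 (λ q x b c l A S₁ S₄ →
               q :^ 3 :* (l :* S₁ :* (:1 :- q :* b :* c :* x :^ 2)) :* ((q :^ 2 :* c :^ 2 :- q :^ 4 :* x :^ 2) :* (q :* b :* c :- q :^ 2 :* c :^ 2 :* x :^ 2))
                 :* (A :* S₄ :* (:1 :- q :* c :^ 2 :* x)) :* ((b :* c :- q :^ 2 :* x) :* (c :- b :* (q :^ 2 :* x)))
               := q :^ 2 :* l :* S₁ :* (c :^ 2 :- q :^ 2 :* x :^ 2)
                 :* (A :* S₄ :* (q :* b :* c :- q :^ 3 :* x) :* ((q :- q :^ 2 :* c :^ 2 :* x) :* (q :^ 2 :* c :^ 2 :- q :^ 3 :* (q :* b :* c) :* x)))
                 :* ((b :* :1 :- q :* c :* x :^ 2) :* (:1 :- b :* (q :* c :* x :^ 2))))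
               ≡.refl q x b c l A S₁ S₄ ⟩
        q ^ 2 * l * S₁ * (c ^ 2 - q ^ 2 * x ^ 2) * denForm (q * b * c) (q ^ 2 * c ^ 2) A S₄ x * ((b * 1# - q * c * x ^ 2) * (1# - b * (q * c * x ^ 2)))
          ≈⟨ *-congˡ (quad-symm β 1# (q * c * x ^ 2)) ⟨
        q ^ 2 * l * S₁ * (c ^ 2 - q ^ 2 * x ^ 2) * denForm (q * b * c) (q ^ 2 * c ^ 2) A S₄ x * (b * T₁)
          ≈⟨ solve 7 (λ y q l S m D T → q :^ 2 :* l :* S :* m :* D :* (y :* T) := y :* (q :^ 2 :* l :* S :* T :* m :* D)) ≡.refl b q l S₁ _ _ T₁ ⟩
        b * (q ^ 2 * l * S₁ * T₁ * (c ^ 2 - q ^ 2 * x ^ 2) * denForm (q * b * c) (q ^ 2 * c ^ 2) A S₄ x)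
          ≈⟨ *-congˡ (*-congˡ (den≈ d≈ z≈)) ⟨
        b * (q ^ 2 * l * S₁ * T₁ * (c ^ 2 - q ^ 2 * x ^ 2) * Quadratic.den F q s d z x) ∎)
        where
        b = q ^ β
        T₁ = quad (symm β) 1# (q * c * x ^ 2)
        T₂ = quad (symm β) c (q ^ 2 * x)

    quad-0 : ∀ a → quad (symm 0) 1# a ≈ (1# - a) ^ 2
    quad-0 a = trans (quad-cong symm-0 refl refl)
      (solve 1 (λ a → :1 :^ 2 :- (:1 :+ :1) :* :1 :* a :+ a :^ 2 := (:1 :- a) :^ 2) ≡.refl a)

    module Family₁ (m : ℕ) (s : K) (adm : Admissible s) where

      open StarSteps s adm (4 ℕ.* m ℕ.+ 2)
      open QS using (Z; ratio; ratioNum; ratioDen; quadratic-sum; module Step) renaming (weight to weightᑫ)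

      separated : ∀ i → Separated i
      separated i = record
        { sep₁ = λ k → ≢-mod 2 1 0 (2 ℕ.* i ℕ.+ 2) (2 ℕ.* m ℕ.+ 1 ℕ.+ k) (e₁ i) (e₂ m k) (λ ())
        ; sep₂ = λ k → ≢-mod 2 0 1 (2 ℕ.* i ℕ.+ 2) (2 ℕ.* m ℕ.+ 1 ℕ.+ k) (e₃ i) (e₄ m k) (λ ())
        ; sep₃ = λ k → ≢-mod 2 0 1 (2 ℕ.* i ℕ.+ 4) (2 ℕ.* m ℕ.+ 2 ℕ.+ k) (e₅ i) (e₆ m k) (λ ())
        ; sep₄ = λ k _ → ≢-mod 2 0 1 (2 ℕ.* m ℕ.+ 1) (1 ℕ.+ k) (e₇ m) (e₈ k) (λ ())
        ; sep₅ = λ k → ≢-mod 4 2 0 m (i ℕ.+ 1 ℕ.+ k) (e₉ m) (e₁₀ i k) (λ ())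
        }
        where
        e₁ : ∀ i → 4 ℕ.* i ℕ.+ 5 ≡ 1 ℕ.+ (2 ℕ.* i ℕ.+ 2) ℕ.* 2
        e₁ = solve-∀
        e₂ : ∀ m k → 4 ℕ.* m ℕ.+ 2 ℕ.+ 2 ℕ.* k ≡ 0 ℕ.+ (2 ℕ.* m ℕ.+ 1 ℕ.+ k) ℕ.* 2
        e₂ = solve-∀
        e₃ : ∀ i → 4 ℕ.* i ℕ.+ 4 ≡ 0 ℕ.+ (2 ℕ.* i ℕ.+ 2) ℕ.* 2
        e₃ = solve-∀
        e₄ : ∀ m k → 4 ℕ.* m ℕ.+ 2 ℕ.+ (1 ℕ.+ 2 ℕ.* k) ≡ 1 ℕ.+ (2 ℕ.* m ℕ.+ 1 ℕ.+ k) ℕ.* 2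
        e₄ = solve-∀
        e₅ : ∀ i → 4 ℕ.* i ℕ.+ 8 ≡ 0 ℕ.+ (2 ℕ.* i ℕ.+ 4) ℕ.* 2
        e₅ = solve-∀
        e₆ : ∀ m k → 4 ℕ.* m ℕ.+ 2 ℕ.+ (3 ℕ.+ 2 ℕ.* k) ≡ 1 ℕ.+ (2 ℕ.* m ℕ.+ 2 ℕ.+ k) ℕ.* 2
        e₆ = solve-∀
        e₇ : ∀ m → 4 ℕ.* m ℕ.+ 2 ≡ 0 ℕ.+ (2 ℕ.* m ℕ.+ 1) ℕ.* 2
        e₇ = solve-∀
        e₈ : ∀ k → 3 ℕ.+ 2 ℕ.* k ≡ 1 ℕ.+ (1 ℕ.+ k) ℕ.* 2
        e₈ = solve-∀
        e₉ : ∀ m → 4 ℕ.* m ℕ.+ 2 ≡ 2 ℕ.+ m ℕ.* 4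
        e₉ = solve-∀
        e₁₀ : ∀ i k → 4 ℕ.* i ℕ.+ 4 ℕ.+ 4 ℕ.* k ≡ 0 ℕ.+ (i ℕ.+ 1 ℕ.+ k) ℕ.* 4
        e₁₀ = solve-∀

      n : ℕ
      n = 4 ℕ.* m ℕ.+ 1

      weightDen≉0′ : ∀ k → NonZero (weightDen s (symm n) 1# (X k))
      weightDen≉0′ k = weightDen≉0 n k adm 1-isPower
        (≢-mod 2 1 0 (2 ℕ.* m) (1 ℕ.+ k) (e₁ m) (e₂ k) (λ ()))
        (λ e → ℕ.0≢1+n (≡.trans e (ℕ.+-suc n _)))
        where
        e₁ : ∀ m → 4 ℕ.* m ℕ.+ 1 ℕ.+ 0 ≡ 1 ℕ.+ 2 ℕ.* m ℕ.* 2
        e₁ = solve-∀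
        e₂ : ∀ k → 2 ℕ.+ 2 ℕ.* k ≡ 0 ℕ.+ (1 ℕ.+ k) ℕ.* 2
        e₂ = solve-∀

      weight≈ : ∀ k → weight s (symm n) 1# k ≈ weightᑫ (Z m) k
      weight≈ k = prod-cong k (λ j _ → ÷-cross (weightDen≉0′ j)
          (den-nonzero m j (Separated.sep₄ (separated j) j (ℕ.n≤1+n j))
                           (λ e → Separated.sep₂ (separated m) (suc j) (≡.trans e (shift m j))))
          (sym (match₁ n d≈ z≈)))
        where
        open module M {x} = Match s (q ^ (4 ℕ.* m ℕ.+ 2)) (Z m) x
        shift : ∀ m j → 4 ℕ.* m ℕ.+ 2 ℕ.+ (3 ℕ.+ 2 ℕ.* j) ≡ 4 ℕ.* m ℕ.+ 2 ℕ.+ (1 ℕ.+ 2 ℕ.* suc j)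
        shift = solve-∀
        e₁ : ∀ m → 1 ℕ.+ (4 ℕ.* m ℕ.+ 1) ≡ 4 ℕ.* m ℕ.+ 2
        e₁ = solve-∀
        e₂ : ∀ m → 3 ℕ.+ (4 ℕ.* m ℕ.+ 1) ≡ 4 ℕ.* m ℕ.+ 4
        e₂ = solve-∀
        d≈ : q ^ (4 ℕ.* m ℕ.+ 2) ≈ q * q ^ n
        d≈ = isPower-≈ (q-power _) (isPower-≡ (e₁ m) (*-isPower q-isPower (q-power n)))
        z≈ : Z m ≈ q ^ 3 * q ^ n
        z≈ = isPower-≈ (Z-isPower m) (isPower-≡ (e₂ m) (*-isPower (q-power 3) (q-power n)))

      α β : ℕ → K
      α i = (E (4 ℕ.* i ℕ.+ 3) * E (4 ℕ.* i ℕ.+ 5)) ÷ quad s 1# (q ^ (4 ℕ.* i ℕ.+ 4))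
      β j = quad s 1# (q ^ (4 ℕ.* j ℕ.+ 2)) ÷ (E (4 ℕ.* j ℕ.+ 1) * E (4 ℕ.* j ℕ.+ 3))

      E-odd≉0 : ∀ j → NonZero (E (4 ℕ.* j ℕ.+ 1) * E (4 ℕ.* j ℕ.+ 3))
      E-odd≉0 j = *-NonZero
        (power-difference 1-isPower (q-power _) (λ e → ℕ.m+1+n≢0 (4 ℕ.* j) (≡.sym e)))
        (power-difference 1-isPower (q-power _) (λ e → ℕ.m+1+n≢0 (4 ℕ.* j) (≡.sym e)))

      -- The fixed d = q^(4m+2) makes the factor depend on i and m. As d = z q^(4j+2) for z =
      -- q^(4i+4), it separates into a function of i and a function of j; reversing the product of
      -- the `β` then matches `α i` with `β i`.
      ratio-split : ∀ i j → m ≡ suc i ℕ.+ j → ratio (Z i) ≈ α i * β j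
      ratio-split i j m≡ = begin
        ratioNum (Z i) ÷ ratioDen (Z i)
          ≈⟨ ÷-cross ratioDen≉0 (*-NonZero u≉0′ (E-odd≉0 j)) crossed ⟩
        (E (4 ℕ.* i ℕ.+ 3) * E (4 ℕ.* i ℕ.+ 5) * quad s 1# (q ^ (4 ℕ.* j ℕ.+ 2)))
          ÷ (quad s 1# (q ^ (4 ℕ.* i ℕ.+ 4)) * (E (4 ℕ.* j ℕ.+ 1) * E (4 ℕ.* j ℕ.+ 3)))
          ≈⟨ ÷-*-÷ u≉0′ (E-odd≉0 j) ⟨
        α i * β j ∎
        where
        open Step (step i (separated i)) using (g₁≉0; g₂≉0; u≉0)
        ratioDen≉0 = *-NonZero (*-NonZero g₁≉0 g₂≉0) u≉0
        u≉0′ = quad-power≉0 adm i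
        h = q ^ (4 ℕ.* i ℕ.+ 3)
        g = q ^ (4 ℕ.* j ℕ.+ 1)
        e₁ : ∀ i → 1 ℕ.+ (4 ℕ.* i ℕ.+ 3) ≡ 4 ℕ.* i ℕ.+ 4
        e₁ = solve-∀
        e₂ : ∀ i → 2 ℕ.+ (4 ℕ.* i ℕ.+ 3) ≡ 4 ℕ.* i ℕ.+ 5
        e₂ = solve-∀
        e₃ : ∀ j → 1 ℕ.+ (4 ℕ.* j ℕ.+ 1) ≡ 4 ℕ.* j ℕ.+ 2
        e₃ = solve-∀
        e₄ : ∀ j → 2 ℕ.+ (4 ℕ.* j ℕ.+ 1) ≡ 4 ℕ.* j ℕ.+ 3
        e₄ = solve-∀
        e₅ : ∀ i j → 1 ℕ.+ (4 ℕ.* i ℕ.+ 3) ℕ.+ (1 ℕ.+ (4 ℕ.* j ℕ.+ 1)) ≡ 4 ℕ.* (suc i ℕ.+ j) ℕ.+ 2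
        e₅ = solve-∀
        q-i = *-isPower q-isPower (q-power (4 ℕ.* i ℕ.+ 3))
        q-j = *-isPower q-isPower (q-power (4 ℕ.* j ℕ.+ 1))
        z≈ : Z i ≈ q * h
        z≈ = isPower-≈ (Z-isPower i) (isPower-≡ (e₁ i) q-i)
        d≈ : d ≈ q * h * (q * g)
        d≈ = isPower-≈ (q-power _) (isPower-≡ (≡.trans (e₅ i j) (≡.cong (λ m → 4 ℕ.* m ℕ.+ 2) (≡.sym m≡))) (*-isPower q-i q-j))
        E₅≈ : E (4 ℕ.* i ℕ.+ 5) ≈ 1# - q ^ 2 * h
        E₅≈ = +-congˡ (-‿cong (isPower-≈ (q-power _) (isPower-≡ (e₂ i) (*-isPower (q-power 2) (q-power _)))))
        E₃≈ : E (4 ℕ.* j ℕ.+ 3) ≈ 1# - q ^ 2 * g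
        E₃≈ = +-congˡ (-‿cong (isPower-≈ (q-power _) (isPower-≡ (e₄ j) (*-isPower (q-power 2) (q-power _)))))
        Q₂≈ : quad s 1# (q ^ (4 ℕ.* j ℕ.+ 2)) ≈ quad s 1# (q * g)
        Q₂≈ = quad-cong refl refl (isPower-≈ (q-power _) (isPower-≡ (e₃ j) q-j))
        Q₄≈ : quad s 1# (q ^ (4 ℕ.* i ℕ.+ 4)) ≈ quad s 1# (q * h)
        Q₄≈ = quad-cong refl refl (isPower-≈ (q-power _) (isPower-≡ (e₁ i) q-i))
        form₁ form₂ : K → K → K
        form₁ z d = (q - z) * (1# - q * z) * (d ^ 2 - s * z * d + z ^ 2)
        form₂ z d = (q * z - d) * (z - q * d) * (1# - s * z + z ^ 2)
        num≈ : ∀ {z z′ d d′} → z ≈ z′ → d ≈ d′ → form₁ z d ≈ form₁ z′ d′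
        num≈ p r = *-cong (*-cong (+-congˡ (-‿cong p)) (+-congˡ (-‿cong (*-congˡ p))))
          (+-cong (+-cong (^-congˡ 2 r) (-‿cong (*-cong (*-congˡ p) r))) (^-congˡ 2 p))
        den≈ : ∀ {z z′ d d′} → z ≈ z′ → d ≈ d′ → form₂ z d ≈ form₂ z′ d′
        den≈ p r = *-cong (*-cong (+-cong (*-congˡ p) (-‿cong r)) (+-cong p (-‿cong (*-congˡ r))))
          (+-cong (+-congˡ (-‿cong (*-congˡ p))) (^-congˡ 2 p))
        crossed : ratioNum (Z i) * (quad s 1# (q ^ (4 ℕ.* i ℕ.+ 4)) * (E (4 ℕ.* j ℕ.+ 1) * E (4 ℕ.* j ℕ.+ 3)))
                ≈ E (4 ℕ.* i ℕ.+ 3) * E (4 ℕ.* i ℕ.+ 5) * quad s 1# (q ^ (4 ℕ.* j ℕ.+ 2)) * ratioDen (Z i)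
        crossed = begin
          ratioNum (Z i) * (quad s 1# (q ^ (4 ℕ.* i ℕ.+ 4)) * (E (4 ℕ.* j ℕ.+ 1) * E (4 ℕ.* j ℕ.+ 3)))
            ≈⟨ *-cong (num≈ z≈ d≈) (*-cong Q₄≈ (*-congˡ E₃≈)) ⟩
          form₁ (q * h) (q * h * (q * g)) * (quad s 1# (q * h) * ((1# - g) * (1# - q ^ 2 * g)))
            ≈⟨ solve 4 (λ q g h s →
                (q :- q :* h) :* (:1 :- q :* (q :* h)) :* ((q :* h :* (q :* g)) :^ 2 :- s :* (q :* h) :* (q :* h :* (q :* g)) :+ (q :* h) :^ 2)
                  :* ((:1 :^ 2 :- s :* :1 :* (q :* h) :+ (q :* h) :^ 2) :* ((:1 :- g) :* (:1 :- q :^ 2 :* g)))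
                := (:1 :- h) :* (:1 :- q :^ 2 :* h) :* (:1 :^ 2 :- s :* :1 :* (q :* g) :+ (q :* g) :^ 2)
                  :* ((q :* (q :* h) :- q :* h :* (q :* g)) :* (q :* h :- q :* (q :* h :* (q :* g))) :* (:1 :- s :* (q :* h) :+ (q :* h) :^ 2)))
                ≡.refl q g h s ⟩
          (1# - h) * (1# - q ^ 2 * h) * quad s 1# (q * g) * form₂ (q * h) (q * h * (q * g))
            ≈⟨ *-cong (*-cong (*-congˡ E₅≈) Q₂≈) (den≈ z≈ d≈) ⟨
          E (4 ℕ.* i ℕ.+ 3) * E (4 ℕ.* i ℕ.+ 5) * quad s 1# (q ^ (4 ℕ.* j ℕ.+ 2)) * ratioDen (Z i) ∎

      αβ : ∀ i → α i * β i ≈ E (4 ℕ.* i ℕ.+ 5) ÷ E (4 ℕ.* i ℕ.+ 1) * η s i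
      αβ i = begin
        α i * β i
          ≈⟨ ÷-*-÷ u≉0′ (E-odd≉0 i) ⟩
        (E₃ * E₅ * Q₂) ÷ (Q₄ * (E₁ * E₃))
          ≈⟨ ÷-cross (*-NonZero u≉0′ (E-odd≉0 i)) (*-NonZero E₁≉0 u≉0′)
               (solve 5 (λ e₃ e₅ q₂ q₄ e₁ → e₃ :* e₅ :* q₂ :* (e₁ :* q₄) := e₅ :* q₂ :* (q₄ :* (e₁ :* e₃))) ≡.refl E₃ E₅ Q₂ Q₄ E₁) ⟩
        (E₅ * Q₂) ÷ (E₁ * Q₄)
          ≈⟨ ÷-*-÷ E₁≉0 u≉0′ ⟨
        E₅ ÷ E₁ * η s i ∎
        where
        u≉0′ = quad-power≉0 adm i
        E₁ = E (4 ℕ.* i ℕ.+ 1)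
        E₃ = E (4 ℕ.* i ℕ.+ 3)
        E₅ = E (4 ℕ.* i ℕ.+ 5)
        Q₂ = quad s 1# (q ^ (4 ℕ.* i ℕ.+ 2))
        Q₄ = quad s 1# (q ^ (4 ℕ.* i ℕ.+ 4))
        E₁≉0 : NonZero E₁
        E₁≉0 = power-difference 1-isPower (q-power _) (λ e → ℕ.m+1+n≢0 (4 ℕ.* i) (≡.sym e))

      family₁ : series s (symm n) 1# (suc m) ≈ closedForm s m
      family₁ = begin
        series s (symm n) 1# (suc m)
          ≈⟨ series-cong (suc m) (weightᑫ (Z m)) (λ k _ → weight≈ k) ⟩
        sum (λ k → κ (X k) * weightᑫ (Z m) k) (suc m)
          ≈⟨ quadratic-sum m (λ i _ → step i (separated i)) ⟩
        (1# - q) * prod (λ i → ratio (Z i)) m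
          ≈⟨ *-congˡ (prod-cong m split) ⟩
        (1# - q) * prod (λ i → α i * β (m ℕ.∸ suc i)) m
          ≈⟨ *-congˡ (prod-* α (λ i → β (m ℕ.∸ suc i)) m) ⟩
        (1# - q) * (prod α m * prod (λ i → β (m ℕ.∸ suc i)) m)
          ≈⟨ *-congˡ (*-congˡ (prod-reverse β m)) ⟨
        (1# - q) * (prod α m * prod β m)
          ≈⟨ *-congˡ (prod-* α β m) ⟨
        (1# - q) * prod (λ i → α i * β i) m
          ≈⟨ *-congˡ (prod-cong m (λ i _ → αβ i)) ⟩
        (1# - q) * prod (λ i → E (4 ℕ.* i ℕ.+ 5) ÷ E (4 ℕ.* i ℕ.+ 1) * η s i) m
          ≈⟨ E-telescope m (η s) ⟩
        closedForm s m ∎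
        where
        split : ∀ i → i < m → ratio (Z i) ≈ α i * β (m ℕ.∸ suc i)
        split i i<m = ratio-split i (m ℕ.∸ suc i) (≡.sym (ℕ.m+[n∸m]≡n i<m))

    module Family₂ where

      open module T = Terminating F q using (Z; double; ratio; terminating-sum; num; den; Step; module Step) renaming (weight to weightᵗ)

      Z-isPower : ∀ i → Z i isPower (4 ℕ.* i ℕ.+ 3)
      Z-isPower zero    = q-power 3
      Z-isPower (suc i) = isPower-≡ (lemma i) (*-isPower (q-power 4) (Z-isPower i))
        where
        lemma : ∀ i → 4 ℕ.+ (4 ℕ.* i ℕ.+ 3) ≡ 4 ℕ.* suc i ℕ.+ 3
        lemma = solve-∀

      double≡ : ∀ m → double m ≡ 2 ℕ.* m
      double≡ zero    = ≡.refl
      double≡ (suc m) = ≡.trans (≡.cong (λ k → suc (suc k)) (double≡ m)) (lemma m)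
        where
        lemma : ∀ m → suc (suc (2 ℕ.* m)) ≡ 2 ℕ.* suc m
        lemma = solve-∀

      odd≢even : ∀ i k c → 4 ℕ.* i ℕ.+ 3 ≢ 2 ℕ.* c ℕ.+ 4 ℕ.* k
      odd≢even i k c = ≢-mod 2 1 0 (2 ℕ.* i ℕ.+ 1) (c ℕ.+ 2 ℕ.* k) (e₁ i) (e₂ c k) (λ ())
        where
        e₁ : ∀ i → 4 ℕ.* i ℕ.+ 3 ≡ 1 ℕ.+ (2 ℕ.* i ℕ.+ 1) ℕ.* 2
        e₁ = solve-∀
        e₂ : ∀ c k → 2 ℕ.* c ℕ.+ 4 ℕ.* k ≡ 0 ℕ.+ (c ℕ.+ 2 ℕ.* k) ℕ.* 2
        e₂ = solve-∀

      den≉0 : ∀ i k → NonZero (den (Z i) (X k))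
      den≉0 i k = *-NonZero
        (*-NonZero (power-difference 1-isPower (*-isPower (q-power 4) (X² k)) (λ ()))
                   (^-NonZero 2 (power-difference 1-isPower (*-isPower (q-power 2) (X-isPower k)) (λ ()))))
        (*-NonZero (power-difference 1-isPower (*-isPower (*-isPower (q-power 2) (Z-isPower i)) (X² k)) (λ ()))
                   (power-difference (Z-isPower i) (*-isPower (q-power 6) (X² k)) (odd≢even i k 3)))

      step : ∀ i → Step (Z i) (suc (double i))
      step i = record
        { q≉0 = q≉0
        ; x≉0 = λ k → power≉0 (X-isPower k)
        ; u≉0 = power-difference 1-isPower (*-isPower q-isPower (Z-isPower i)) (λ ())
        ; b≉0 = power-difference (q-power 2) (Z-isPower i) (λ e → odd≢even i 0 1 (≡.sym e))
        ; c≉0 = power-difference 1-isPower (*-isPower (q-power 2) (Z-isPower i)) (λ ())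
        ; den≉0 = den≉0 i
        ; den′≉0 = den≉0 (suc i)
        ; f₁≉0 = λ k → power-difference q-isPower (*-isPower (Z-isPower i) (X-isPower k)) (<-≢ (4 ℕ.* i ℕ.+ 1 ℕ.+ 2 ℕ.* k) (e₁ i k))
        ; f₈≉0 = λ k → power-difference (Z-isPower i) (*-isPower (q-power 2) (X² k)) (odd≢even i k 1)
        ; f₉≉0 = λ k → power-difference 1-isPower (*-isPower (*-isPower q-isPower (Z-isPower i)) (X-isPower k)) (λ ())
        ; top = trans (+-congʳ (isPower-≈ (*-isPower q-isPower (Z-isPower i)) (isPower-≡ (e₂ i) (X-isPower (suc (suc (double i))))))) (-‿inverseʳ _)
        ; top′ = trans (+-congʳ (isPower-≈ (Z-isPower i) (isPower-≡ (e₃ i) (*-isPower q-isPower (X-isPower (suc (double i))))))) (-‿inverseʳ _)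
        }
        where
        e₁ : ∀ i k → 4 ℕ.* i ℕ.+ 3 ℕ.+ 2 ℕ.* k ≡ suc (1 ℕ.+ (4 ℕ.* i ℕ.+ 1 ℕ.+ 2 ℕ.* k))
        e₁ = solve-∀
        e₂ : ∀ i → 2 ℕ.* suc (suc (double i)) ≡ 1 ℕ.+ (4 ℕ.* i ℕ.+ 3)
        e₂ i rewrite double≡ i = lemma i
          where
          lemma : ∀ i → 2 ℕ.* suc (suc (2 ℕ.* i)) ≡ 1 ℕ.+ (4 ℕ.* i ℕ.+ 3)
          lemma = solve-∀
        e₃ : ∀ i → 1 ℕ.+ 2 ℕ.* suc (double i) ≡ 4 ℕ.* i ℕ.+ 3
        e₃ i rewrite double≡ i = lemma i
          where
          lemma : ∀ i → 1 ℕ.+ 2 ℕ.* suc (2 ℕ.* i) ≡ 4 ℕ.* i ℕ.+ 3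
          lemma = solve-∀

      match : ∀ n z x → z ≈ q ^ 2 * q ^ n →
        num z x * weightDen (symm n) (symm 0) 1# x ≈ weightNum (symm n) (symm 0) 1# x * den z x
      match n z x z≈ = *-cancelˡ (^-NonZero n q≉0) (begin
        y * (num z x * (A * S₄ * T₂ * m₁))
          ≈⟨ *-congˡ (*-cong num≈ (*-congʳ (*-congˡ (quad-0 (q ^ 2 * x))))) ⟩
        y * (N * (A * S₄ * (1# - q ^ 2 * x) ^ 2 * m₁))
          ≈⟨ solve 6 (λ y N A S t m → y :* (N :* (A :* S :* t :* m)) := N :* (A :* t :* m) :* (y :* S)) ≡.refl y N A S₄ _ m₁ ⟩
        N * (A * (1# - q ^ 2 * x) ^ 2 * m₁) * (y * S₄)
          ≈⟨ *-congˡ (quad-symm n 1# (q ^ 4 * x ^ 2)) ⟩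
        N * (A * (1# - q ^ 2 * x) ^ 2 * m₁) * ((y * 1# - q ^ 4 * x ^ 2) * (1# - y * (q ^ 4 * x ^ 2)))
          ≈⟨ solve 3 (λ q x y →
               q :* ((:1 :- q :* x :^ 2) :^ 2 :* (:1 :- q :^ 2 :* x :^ 2)) :* ((q :- q :^ 2 :* y :* x) :* (q :^ 2 :* y :- q :^ 3 :* x))
                 :* ((:1 :- q :^ 4 :* x :^ 2) :* (:1 :- q :^ 2 :* x) :^ 2 :* (:1 :- q :* :1 :^ 2 :* x))
                 :* ((y :* :1 :- q :^ 4 :* x :^ 2) :* (:1 :- y :* (q :^ 4 :* x :^ 2)))
               := q :^ 2 :* (:1 :- q :* x) :* (:1 :- q :* :1 :* x :^ 2) :^ 2 :* (:1 :^ 2 :- q :^ 2 :* x :^ 2)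
                 :* ((:1 :- q :^ 4 :* x :^ 2) :* (:1 :- q :^ 2 :* x) :^ 2 :* ((:1 :- q :^ 2 :* (q :^ 2 :* y) :* x :^ 2) :* (q :^ 2 :* y :- q :^ 6 :* x :^ 2)))
                 :* ((y :* :1 :- q :* x) :* (:1 :- y :* (q :* x))))
               ≡.refl q x y ⟩
        q ^ 2 * l * (1# - q * 1# * x ^ 2) ^ 2 * m₂ * D * ((y * 1# - q * x) * (1# - y * (q * x)))
          ≈⟨ *-congˡ (quad-symm n 1# (q * x)) ⟨
        q ^ 2 * l * (1# - q * 1# * x ^ 2) ^ 2 * m₂ * D * (y * S₁)
          ≈⟨ solve 7 (λ q l t m D y S → q :^ 2 :* l :* t :* m :* D :* (y :* S) := y :* (q :^ 2 :* l :* S :* t :* m :* D)) ≡.refl q l _ m₂ D y S₁ ⟩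
        y * (q ^ 2 * l * S₁ * (1# - q * 1# * x ^ 2) ^ 2 * m₂ * D)
          ≈⟨ *-congˡ (*-cong (*-congʳ (*-congˡ (quad-0 (q * 1# * x ^ 2)))) den≈) ⟨
        y * (q ^ 2 * l * S₁ * T₁ * m₂ * den z x) ∎)
        where
        y = q ^ n
        l = 1# - q * x
        A = 1# - q ^ 4 * x ^ 2
        m₁ = 1# - q * 1# ^ 2 * x
        m₂ = 1# ^ 2 - q ^ 2 * x ^ 2
        S₁ = quad (symm n) 1# (q * x)
        S₄ = quad (symm n) 1# (q ^ 4 * x ^ 2)
        T₁ = quad (symm 0) 1# (q * 1# * x ^ 2)
        T₂ = quad (symm 0) 1# (q ^ 2 * x)
        N = q * T.common₁ x * ((q - q ^ 2 * y * x) * (q ^ 2 * y - q ^ 3 * x))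
        D = T.common₂ x * ((1# - q ^ 2 * (q ^ 2 * y) * x ^ 2) * (q ^ 2 * y - q ^ 6 * x ^ 2))
        num≈ : num z x ≈ N
        num≈ = *-congˡ (*-cong (+-congˡ (-‿cong (*-congʳ z≈))) (+-congʳ z≈))
        den≈ : den z x ≈ D
        den≈ = *-congˡ (*-cong (+-congˡ (-‿cong (*-congʳ (*-congˡ z≈)))) (+-congʳ z≈))

      -- This is the factor to which `αβ` leads at s = 2, which is why the sum terminated by a has
      -- the same value as the one terminated by b.
      ratio≈ : ∀ i → ratio (Z i) ≈ E (4 ℕ.* i ℕ.+ 5) ÷ E (4 ℕ.* i ℕ.+ 1) * η (symm 0) i
      ratio≈ i = begin
        T.ratioNum (Z i) ÷ T.ratioDen (Z i)
          ≈⟨ ÷-cross (*-NonZero b≉0 (^-NonZero 2 u≉0)) (*-NonZero E₁≉0 (^-NonZero 2 E₄≉0)) crossed ⟩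
        (E (4 ℕ.* i ℕ.+ 5) * E (4 ℕ.* i ℕ.+ 2) ^ 2) ÷ (E (4 ℕ.* i ℕ.+ 1) * E (4 ℕ.* i ℕ.+ 4) ^ 2)
          ≈⟨ ÷-*-÷ E₁≉0 (^-NonZero 2 E₄≉0) ⟨
        E (4 ℕ.* i ℕ.+ 5) ÷ E (4 ℕ.* i ℕ.+ 1) * (E (4 ℕ.* i ℕ.+ 2) ^ 2 ÷ E (4 ℕ.* i ℕ.+ 4) ^ 2)
          ≈⟨ *-congˡ (÷-cong (quad-0 _) (quad-0 _)) ⟨
        E (4 ℕ.* i ℕ.+ 5) ÷ E (4 ℕ.* i ℕ.+ 1) * η (symm 0) i ∎
        where
        open Step (step i) using (b≉0; u≉0)
        E₁≉0 : NonZero (E (4 ℕ.* i ℕ.+ 1))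
        E₁≉0 = power-difference 1-isPower (q-power _) (λ e → ℕ.m+1+n≢0 (4 ℕ.* i) (≡.sym e))
        E₄≉0 : NonZero (E (4 ℕ.* i ℕ.+ 4))
        E₄≉0 = power-difference 1-isPower (q-power _) (λ e → ℕ.m+1+n≢0 (4 ℕ.* i) (≡.sym e))
        g = q ^ (4 ℕ.* i ℕ.+ 1)
        e : ∀ k i → k ℕ.+ (4 ℕ.* i ℕ.+ 1) ≡ 4 ℕ.* i ℕ.+ suc k
        e = solve-∀
        shifted : ∀ k → q ^ (4 ℕ.* i ℕ.+ suc k) ≈ q ^ k * g
        shifted k = isPower-≈ (q-power _) (isPower-≡ (e k i) (*-isPower (q-power k) (q-power _)))
        E≈ : ∀ k → E (4 ℕ.* i ℕ.+ suc k) ≈ 1# - q ^ k * g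
        E≈ k = +-congˡ (-‿cong (shifted k))
        z≈ : Z i ≈ q ^ 2 * g
        z≈ = isPower-≈ (Z-isPower i) (isPower-≡ (e 2 i) (*-isPower (q-power 2) (q-power _)))
        crossed : T.ratioNum (Z i) * (E (4 ℕ.* i ℕ.+ 1) * E (4 ℕ.* i ℕ.+ 4) ^ 2)
                ≈ E (4 ℕ.* i ℕ.+ 5) * E (4 ℕ.* i ℕ.+ 2) ^ 2 * T.ratioDen (Z i)
        crossed = begin
          T.ratioNum (Z i) * (E (4 ℕ.* i ℕ.+ 1) * E (4 ℕ.* i ℕ.+ 4) ^ 2)
            ≈⟨ *-cong (*-cong (+-congˡ (-‿cong (*-congˡ z≈))) (^-congˡ 2 (+-congˡ (-‿cong z≈)))) (*-congˡ (^-congˡ 2 (E≈ 3))) ⟩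
          (1# - q ^ 2 * (q ^ 2 * g)) * (q - q ^ 2 * g) ^ 2 * ((1# - g) * (1# - q ^ 3 * g) ^ 2)
            ≈⟨ solve 2 (λ q g → (:1 :- q :^ 2 :* (q :^ 2 :* g)) :* (q :- q :^ 2 :* g) :^ 2 :* ((:1 :- g) :* (:1 :- q :^ 3 :* g) :^ 2)
                 := (:1 :- q :^ 4 :* g) :* (:1 :- q :^ 1 :* g) :^ 2 :* ((q :^ 2 :- q :^ 2 :* g) :* (:1 :- q :* (q :^ 2 :* g)) :^ 2)) ≡.refl q g ⟩
          (1# - q ^ 4 * g) * (1# - q ^ 1 * g) ^ 2 * ((q ^ 2 - q ^ 2 * g) * (1# - q * (q ^ 2 * g)) ^ 2)
            ≈⟨ *-cong (*-cong (E≈ 4) (^-congˡ 2 (E≈ 1))) (*-cong (+-congˡ (-‿cong z≈)) (^-congˡ 2 (+-congˡ (-‿cong (*-congˡ z≈))))) ⟨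
          E (4 ℕ.* i ℕ.+ 5) * E (4 ℕ.* i ℕ.+ 2) ^ 2 * T.ratioDen (Z i) ∎

      family₂ : ∀ m → Admissible (symm (4 ℕ.* m ℕ.+ 1)) →
        series (symm (4 ℕ.* m ℕ.+ 1)) (symm 0) 1# (suc (2 ℕ.* m)) ≈ closedForm (symm 0) m
      family₂ m adm = begin
        series (symm n) (symm 0) 1# (suc (2 ℕ.* m))
          ≡⟨ ≡.cong (λ k → series (symm n) (symm 0) 1# (suc k)) (double≡ m) ⟨
        series (symm n) (symm 0) 1# (suc (double m))
          ≈⟨ series-cong (suc (double m)) (weightᵗ (Z m)) (λ k _ → weight≈ k) ⟩
        sum (λ k → κ (X k) * weightᵗ (Z m) k) (suc (double m))
          ≈⟨ terminating-sum m (λ i _ → step i) ⟩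
        (1# - q) * prod (λ i → ratio (Z i)) m
          ≈⟨ *-congˡ (prod-cong m (λ i _ → ratio≈ i)) ⟩
        (1# - q) * prod (λ i → E (4 ℕ.* i ℕ.+ 5) ÷ E (4 ℕ.* i ℕ.+ 1) * η (symm 0) i) m
          ≈⟨ E-telescope m (η (symm 0)) ⟩
        closedForm (symm 0) m ∎
        where
        n = 4 ℕ.* m ℕ.+ 1
        e : ∀ m → 2 ℕ.+ (4 ℕ.* m ℕ.+ 1) ≡ 4 ℕ.* m ℕ.+ 3
        e = solve-∀
        weight≈ : ∀ k → weight (symm n) (symm 0) 1# k ≈ weightᵗ (Z m) k
        weight≈ k = prod-cong k (λ j _ → ÷-cross
          (weightDen≉0 0 j adm 1-isPower (λ ()) (λ ()))
          (den≉0 m j)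
          (sym (match n (Z m) (X j) (isPower-≈ (Z-isPower m) (isPower-≡ (e m) (*-isPower (q-power 2) (q-power n)))))))

    pairDen : K → K → K → K → K
    pairDen e z w t = q * e * t - q ^ 2 * z - w

    pairNum : K → K → K → K → K → K
    pairNum e z w s t = e ^ 2 * (t ^ 2 + s ^ 2 - 2#) + z ^ 2 + w ^ 2 - s * t * e * (z + w)

    -- With d = eb and zw = e², the factor w - qeb is a multiple of qz - e/b. Inverting b thus
    -- interchanges the paired factors, and their product, freed of a power of be, depends on t = b
    -- + 1/b alone.
    module Pairing (β : ℕ) (e z w : K) (zw≈e² : z * w ≈ e ^ 2) where

      b = q ^ β
      t = symm β

      pairDen-factor : b * e * pairDen e z w t ≈ (q * z - e * b) * (w - q * (e * b))
      pairDen-factor = begin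
        b * e * (q * e * t - q ^ 2 * z - w)
          ≈⟨ solve 6 (λ b e q t z w → b :* e :* (q :* e :* t :- q :^ 2 :* z :- w)
               := q :* e :^ 2 :* (b :* t) :- (q :^ 2 :* z :* (e :* b) :+ e :* b :* w)) ≡.refl b e q t z w ⟩
        q * e ^ 2 * (b * t) - (q ^ 2 * z * (e * b) + e * b * w)
          ≈⟨ +-congʳ (*-congˡ (symm-* β)) ⟩
        q * e ^ 2 * (b ^ 2 + 1#) - (q ^ 2 * z * (e * b) + e * b * w)
          ≈⟨ solve 5 (λ b e q z w → q :* e :^ 2 :* (b :^ 2 :+ :1) :- (q :^ 2 :* z :* (e :* b) :+ e :* b :* w)
               := q :* e :^ 2 :+ (q :* (e :* b) :^ 2 :- (q :^ 2 :* z :* (e :* b) :+ e :* b :* w))) ≡.refl b e q z w ⟩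
        q * e ^ 2 + (q * (e * b) ^ 2 - (q ^ 2 * z * (e * b) + e * b * w))
          ≈⟨ +-congʳ (*-congˡ zw≈e²) ⟨
        q * (z * w) + (q * (e * b) ^ 2 - (q ^ 2 * z * (e * b) + e * b * w))
          ≈⟨ solve 5 (λ b e q z w → q :* (z :* w) :+ (q :* (e :* b) :^ 2 :- (q :^ 2 :* z :* (e :* b) :+ e :* b :* w))
               := (q :* z :- e :* b) :* (w :- q :* (e :* b))) ≡.refl b e q z w ⟩
        (q * z - e * b) * (w - q * (e * b)) ∎

      pairNum-factor : ∀ s → let d = e * b in
        (d ^ 2 - s * z * d + z ^ 2) * (d ^ 2 - s * w * d + w ^ 2) ≈ (b * e) ^ 2 * pairNum e z w s t
      pairNum-factor s = begin
        ((e * b) ^ 2 - s * z * (e * b) + z ^ 2) * ((e * b) ^ 2 - s * w * (e * b) + w ^ 2)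
          ≈⟨ solve 5 (λ e b s z w →
               ((e :* b) :^ 2 :- s :* z :* (e :* b) :+ z :^ 2) :* ((e :* b) :^ 2 :- s :* w :* (e :* b) :+ w :^ 2)
               := (e :* b) :^ 2 :* ((e :* b) :^ 2 :- s :* (e :* b) :* (z :+ w) :+ z :^ 2 :+ w :^ 2)
                  :+ (s :^ 2 :* (e :* b) :^ 2 :- s :* (e :* b) :* (z :+ w) :+ z :* w) :* (z :* w)) ≡.refl e b s z w ⟩
        (e * b) ^ 2 * ((e * b) ^ 2 - s * (e * b) * (z + w) + z ^ 2 + w ^ 2)
          + (s ^ 2 * (e * b) ^ 2 - s * (e * b) * (z + w) + z * w) * (z * w)
          ≈⟨ +-congˡ (*-cong (+-congˡ zw≈e²) zw≈e²) ⟩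
        (e * b) ^ 2 * ((e * b) ^ 2 - s * (e * b) * (z + w) + z ^ 2 + w ^ 2)
          + (s ^ 2 * (e * b) ^ 2 - s * (e * b) * (z + w) + e ^ 2) * e ^ 2
          ≈⟨ solve 5 (λ e b s z w →
               (e :* b) :^ 2 :* ((e :* b) :^ 2 :- s :* (e :* b) :* (z :+ w) :+ z :^ 2 :+ w :^ 2)
                 :+ (s :^ 2 :* (e :* b) :^ 2 :- s :* (e :* b) :* (z :+ w) :+ e :^ 2) :* e :^ 2
               := e :^ 2 :* (e :^ 2 :* ((b :^ 2 :+ :1) :^ 2 :+ b :^ 2 :* s :^ 2 :- (:1 :+ :1) :* b :^ 2) :+ b :^ 2 :* (z :^ 2 :+ w :^ 2)
                  :- s :* b :* (b :^ 2 :+ :1) :* e :* (z :+ w))) ≡.refl e b s z w ⟩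
        e ^ 2 * (e ^ 2 * ((b ^ 2 + 1#) ^ 2 + b ^ 2 * s ^ 2 - 2# * b ^ 2) + b ^ 2 * (z ^ 2 + w ^ 2)
          - s * b * (b ^ 2 + 1#) * e * (z + w))
          ≈⟨ *-congˡ (+-cong (+-congʳ (*-congˡ (+-congʳ (+-congʳ (^-congˡ 2 (symm-* β))))))
                             (-‿cong (*-congʳ (*-congʳ (*-congˡ (symm-* β)))))) ⟨
        e ^ 2 * (e ^ 2 * ((b * t) ^ 2 + b ^ 2 * s ^ 2 - 2# * b ^ 2) + b ^ 2 * (z ^ 2 + w ^ 2)
          - s * b * (b * t) * e * (z + w))
          ≈⟨ solve 6 (λ e b s z w t →
               e :^ 2 :* (e :^ 2 :* ((b :* t) :^ 2 :+ b :^ 2 :* s :^ 2 :- (:1 :+ :1) :* b :^ 2) :+ b :^ 2 :* (z :^ 2 :+ w :^ 2)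
                 :- s :* b :* (b :* t) :* e :* (z :+ w))
               := (b :* e) :^ 2 :* (e :^ 2 :* (t :^ 2 :+ s :^ 2 :- (:1 :+ :1)) :+ z :^ 2 :+ w :^ 2 :- s :* t :* e :* (z :+ w)))
               ≡.refl e b s z w t ⟩
        (b * e) ^ 2 * pairNum e z w s t ∎

    module _ (m : ℕ) where

      private n = 4 ℕ.* m ℕ.+ 1

      -- The index 2m - 1 - i: the exponents 4i + 4 of z and 4 (2m - 1 - i) + 4 of w then add up to
      -- 8m + 4, twice the exponent of e.
      mirror : ℕ → ℕ
      mirror i = m ℕ.+ (m ℕ.∸ suc i)

      pair : K → K → ℕ → K
      pair s t i = (q ^ 2 * pairNum e z w s t)
                 ÷ ((pairDen e z w t * pairDen e w z t) * (quad s 1# z * quad s 1# w))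
        where
        e = q ^ (4 ℕ.* m ℕ.+ 2)
        z = q ^ (4 ℕ.* i ℕ.+ 4)
        w = q ^ (4 ℕ.* mirror i ℕ.+ 4)

      zw≈e² : ∀ i → i < m → q ^ (4 ℕ.* i ℕ.+ 4) * q ^ (4 ℕ.* mirror i ℕ.+ 4) ≈ (q ^ (4 ℕ.* m ℕ.+ 2)) ^ 2
      zw≈e² i i<m with ℕ.m≤n⇒∃[o]m+o≡n i<m
      ... | j , ≡.refl = isPower-≈ (isPower-≡ (eq i j)
        (*-isPower (q-power (4 ℕ.* i ℕ.+ 4)) (q-power (4 ℕ.* (suc i ℕ.+ j ℕ.+ (suc i ℕ.+ j ℕ.∸ suc i)) ℕ.+ 4))))
        (^-isPower 2 (q-power (4 ℕ.* (suc i ℕ.+ j) ℕ.+ 2)))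
        where
        lemma : ∀ i j → 4 ℕ.* i ℕ.+ 4 ℕ.+ (4 ℕ.* (suc i ℕ.+ j ℕ.+ j) ℕ.+ 4) ≡ (4 ℕ.* (suc i ℕ.+ j) ℕ.+ 2) ℕ.* 2
        lemma = solve-∀
        eq : ∀ i j → 4 ℕ.* i ℕ.+ 4 ℕ.+ (4 ℕ.* (suc i ℕ.+ j ℕ.+ (suc i ℕ.+ j ℕ.∸ suc i)) ℕ.+ 4) ≡ (4 ℕ.* (suc i ℕ.+ j) ℕ.+ 2) ℕ.* 2
        eq i j = ≡.trans (≡.cong (λ l → 4 ℕ.* i ℕ.+ 4 ℕ.+ (4 ℕ.* (suc i ℕ.+ j ℕ.+ l) ℕ.+ 4)) (ℕ.m+n∸m≡n i j)) (lemma i j)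

      -- The two values b = 1 and b = qⁿ are the corners of the cube on the face c = qⁿ.
      data Shift : ℕ → Set where
        none : Shift 0
        full : Shift n

      module Family₃ {β : ℕ} (shift : Shift β) (s : K) (adm : Admissible s) where

        open StarSteps s adm (4 ℕ.* m ℕ.+ 2 ℕ.+ β)
        open QS using (Z; ratio; ratioNum; ratioDen; quadratic-sum; module Step) renaming (weight to weightᑫ)

        separated : ∀ i → i < m ℕ.+ m → Separated i
        separated i i<2m = go shift
          where
          go : Shift β → StarSteps.Separated s adm (4 ℕ.* m ℕ.+ 2 ℕ.+ β) i
          go none = record
            { sep₁ = λ k e → Separated₀.sep₁ k (≡.trans e (≡.cong (ℕ._+ 2 ℕ.* k) (ℕ.+-identityʳ δ₀)))
            ; sep₂ = λ k e → Separated₀.sep₂ k (≡.trans e (≡.cong (ℕ._+ (1 ℕ.+ 2 ℕ.* k)) (ℕ.+-identityʳ δ₀)))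
            ; sep₃ = λ k e → Separated₀.sep₃ k (≡.trans e (≡.cong (ℕ._+ (3 ℕ.+ 2 ℕ.* k)) (ℕ.+-identityʳ δ₀)))
            ; sep₄ = λ k k≤ e → Separated₀.sep₄ k k≤ (≡.trans (≡.sym (ℕ.+-identityʳ δ₀)) e)
            ; sep₅ = λ k e → Separated₀.sep₅ k (≡.trans (≡.sym (ℕ.+-identityʳ δ₀)) e)
            }
            where
            δ₀ = 4 ℕ.* m ℕ.+ 2
            module Separated₀ = StarSteps.Separated (Family₁.separated m s adm i)
          go full with ℕ.m≤n⇒∃[o]m+o≡n i<2m
          ... | l , eq = record
            { sep₁ = λ k → <-≢ (1 ℕ.+ 4 ℕ.* l ℕ.+ 2 ℕ.* k) (≡.trans (e₁ m k) (≡.trans (≡.cong (λ x → 4 ℕ.* x ℕ.+ (3 ℕ.+ 2 ℕ.* k)) (≡.sym eq)) (e₁′ i l k)))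
            ; sep₂ = λ k → <-≢ (3 ℕ.+ 4 ℕ.* l ℕ.+ 2 ℕ.* k) (≡.trans (e₂ m k) (≡.trans (≡.cong (λ x → 4 ℕ.* x ℕ.+ (4 ℕ.+ 2 ℕ.* k)) (≡.sym eq)) (e₂′ i l k)))
            ; sep₃ = λ k → <-≢ (1 ℕ.+ 4 ℕ.* l ℕ.+ 2 ℕ.* k) (≡.trans (e₃ m k) (≡.trans (≡.cong (λ x → 4 ℕ.* x ℕ.+ (6 ℕ.+ 2 ℕ.* k)) (≡.sym eq)) (e₃′ i l k)))
            ; sep₄ = λ k k≤ e → bound k k≤ (ℕ.*-cancelˡ-≡ _ _ 2 (ℕ.+-cancelˡ-≡ 3 _ _ (≡.trans (≡.sym (e₄ m)) e)))
            ; sep₅ = λ k → ≢-mod 2 1 0 (4 ℕ.* m ℕ.+ 1) (2 ℕ.* i ℕ.+ 2 ℕ.+ 2 ℕ.* k) (e₅ m) (e₆ i k) (λ ())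
            }
            where
            e₁ : ∀ m k → 4 ℕ.* m ℕ.+ 2 ℕ.+ (4 ℕ.* m ℕ.+ 1) ℕ.+ 2 ℕ.* k ≡ 4 ℕ.* (m ℕ.+ m) ℕ.+ (3 ℕ.+ 2 ℕ.* k)
            e₁ = solve-∀
            e₁′ : ∀ i l k → 4 ℕ.* (suc i ℕ.+ l) ℕ.+ (3 ℕ.+ 2 ℕ.* k) ≡ suc (4 ℕ.* i ℕ.+ 5 ℕ.+ (1 ℕ.+ 4 ℕ.* l ℕ.+ 2 ℕ.* k))
            e₁′ = solve-∀
            e₂ : ∀ m k → 4 ℕ.* m ℕ.+ 2 ℕ.+ (4 ℕ.* m ℕ.+ 1) ℕ.+ (1 ℕ.+ 2 ℕ.* k) ≡ 4 ℕ.* (m ℕ.+ m) ℕ.+ (4 ℕ.+ 2 ℕ.* k)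
            e₂ = solve-∀
            e₂′ : ∀ i l k → 4 ℕ.* (suc i ℕ.+ l) ℕ.+ (4 ℕ.+ 2 ℕ.* k) ≡ suc (4 ℕ.* i ℕ.+ 4 ℕ.+ (3 ℕ.+ 4 ℕ.* l ℕ.+ 2 ℕ.* k))
            e₂′ = solve-∀
            e₃ : ∀ m k → 4 ℕ.* m ℕ.+ 2 ℕ.+ (4 ℕ.* m ℕ.+ 1) ℕ.+ (3 ℕ.+ 2 ℕ.* k) ≡ 4 ℕ.* (m ℕ.+ m) ℕ.+ (6 ℕ.+ 2 ℕ.* k)
            e₃ = solve-∀
            e₃′ : ∀ i l k → 4 ℕ.* (suc i ℕ.+ l) ℕ.+ (6 ℕ.+ 2 ℕ.* k) ≡ suc (4 ℕ.* i ℕ.+ 8 ℕ.+ (1 ℕ.+ 4 ℕ.* l ℕ.+ 2 ℕ.* k))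
            e₃′ = solve-∀
            e₄ : ∀ m → 4 ℕ.* m ℕ.+ 2 ℕ.+ (4 ℕ.* m ℕ.+ 1) ≡ 3 ℕ.+ 2 ℕ.* (m ℕ.+ m ℕ.+ (m ℕ.+ m))
            e₄ = solve-∀
            e₅ : ∀ m → 4 ℕ.* m ℕ.+ 2 ℕ.+ (4 ℕ.* m ℕ.+ 1) ≡ 1 ℕ.+ (4 ℕ.* m ℕ.+ 1) ℕ.* 2
            e₅ = solve-∀
            e₆ : ∀ i k → 4 ℕ.* i ℕ.+ 4 ℕ.+ 4 ℕ.* k ≡ 0 ℕ.+ (2 ℕ.* i ℕ.+ 2 ℕ.+ 2 ℕ.* k) ℕ.* 2
            e₆ = solve-∀
            bound : ∀ k → k ≤ suc i → ¬ m ℕ.+ m ℕ.+ (m ℕ.+ m) ≡ k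
            bound k k≤ ≡.refl = ℕ.<-irrefl ≡.refl (ℕ.≤-<-trans (ℕ.≤-trans k≤ i<2m) (ℕ.m<m+n (m ℕ.+ m) (ℕ.≤-<-trans z≤n i<2m)))

        private
          N = m ℕ.+ m
          e = q ^ (4 ℕ.* m ℕ.+ 2)

        top-bounds : ∀ j → j < N →
          (4 ℕ.* m ℕ.+ 2 ℕ.+ β ≢ 3 ℕ.+ 2 ℕ.* j) × (4 ℕ.* N ℕ.+ 4 ≢ 4 ℕ.* m ℕ.+ 2 ℕ.+ β ℕ.+ (3 ℕ.+ 2 ℕ.* j)) ×
          (β ℕ.+ n ≢ 2 ℕ.+ 2 ℕ.* j) × (n ≢ β ℕ.+ (2 ℕ.+ 2 ℕ.* j))
        top-bounds j j<N = Separated.sep₄ (separated j j<N) j (ℕ.n≤1+n j) , go shift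
          where
          go : ∀ {β} → Shift β → (4 ℕ.* N ℕ.+ 4 ≢ 4 ℕ.* m ℕ.+ 2 ℕ.+ β ℕ.+ (3 ℕ.+ 2 ℕ.* j)) ×
            (β ℕ.+ n ≢ 2 ℕ.+ 2 ℕ.* j) × (n ≢ β ℕ.+ (2 ℕ.+ 2 ℕ.* j))
          go none =
              ≢-mod 2 0 1 (4 ℕ.* m ℕ.+ 2) (2 ℕ.* m ℕ.+ 2 ℕ.+ j) (e₁ m) (e₂ m j) (λ ())
            , ≢-mod 2 1 0 (2 ℕ.* m) (1 ℕ.+ j) (e₃ m) (e₄ j) (λ ())
            , ≢-mod 2 1 0 (2 ℕ.* m) (1 ℕ.+ j) (e₃ m) (e₄ j) (λ ())
            where
            e₁ : ∀ m → 4 ℕ.* (m ℕ.+ m) ℕ.+ 4 ≡ 0 ℕ.+ (4 ℕ.* m ℕ.+ 2) ℕ.* 2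
            e₁ = solve-∀
            e₂ : ∀ m j → 4 ℕ.* m ℕ.+ 2 ℕ.+ 0 ℕ.+ (3 ℕ.+ 2 ℕ.* j) ≡ 1 ℕ.+ (2 ℕ.* m ℕ.+ 2 ℕ.+ j) ℕ.* 2
            e₂ = solve-∀
            e₃ : ∀ m → 4 ℕ.* m ℕ.+ 1 ≡ 1 ℕ.+ 2 ℕ.* m ℕ.* 2
            e₃ = solve-∀
            e₄ : ∀ j → 2 ℕ.+ 2 ℕ.* j ≡ 0 ℕ.+ (1 ℕ.+ j) ℕ.* 2
            e₄ = solve-∀
          go full with ℕ.m≤n⇒∃[o]m+o≡n j<N
          ... | l , eq =
              <-≢ (1 ℕ.+ 2 ℕ.* j) (e₁ m j)
            , (λ e → <-≢ (2 ℕ.* j ℕ.+ 3 ℕ.+ 4 ℕ.* l)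
                  (≡.trans (e₂ m) (≡.trans (≡.cong (λ x → 4 ℕ.* x ℕ.+ 2) (≡.sym eq)) (e₃ j l))) (≡.sym e))
            , <-≢ (1 ℕ.+ 2 ℕ.* j) (ℕ.+-suc n _)
            where
            e₁ : ∀ m j → 4 ℕ.* m ℕ.+ 2 ℕ.+ (4 ℕ.* m ℕ.+ 1) ℕ.+ (3 ℕ.+ 2 ℕ.* j) ≡ suc (4 ℕ.* (m ℕ.+ m) ℕ.+ 4 ℕ.+ (1 ℕ.+ 2 ℕ.* j))
            e₁ = solve-∀
            e₂ : ∀ m → 4 ℕ.* m ℕ.+ 1 ℕ.+ (4 ℕ.* m ℕ.+ 1) ≡ 4 ℕ.* (m ℕ.+ m) ℕ.+ 2
            e₂ = solve-∀
            e₃ : ∀ j l → 4 ℕ.* (suc j ℕ.+ l) ℕ.+ 2 ≡ suc (2 ℕ.+ 2 ℕ.* j ℕ.+ (2 ℕ.* j ℕ.+ 3 ℕ.+ 4 ℕ.* l))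
            e₃ = solve-∀

        weight≈ : ∀ k → k ≤ N → weight s (symm β) (q ^ n) k ≈ weightᑫ (Z N) k
        weight≈ k k≤N = prod-cong k (λ j j<k → let b₁ , b₂ , b₃ , b₄ = top-bounds j (ℕ.<-≤-trans j<k k≤N) in
          ÷-cross (weightDen≉0 β j adm (q-power n) b₃ b₄) (den-nonzero N j b₁ b₂)
            (sym (Match.match₂ s d (Z N) (X j) β (q ^ n) d≈ z≈)))
          where
          e₁ : ∀ m β → 1 ℕ.+ β ℕ.+ (4 ℕ.* m ℕ.+ 1) ≡ 4 ℕ.* m ℕ.+ 2 ℕ.+ β
          e₁ = solve-∀
          e₂ : ∀ m → 2 ℕ.+ (4 ℕ.* m ℕ.+ 1) ℕ.* 2 ≡ 4 ℕ.* (m ℕ.+ m) ℕ.+ 4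
          e₂ = solve-∀
          d≈ : d ≈ q * q ^ β * q ^ n
          d≈ = isPower-≈ (q-power (4 ℕ.* m ℕ.+ 2 ℕ.+ β))
            (isPower-≡ (e₁ m β) (*-isPower (*-isPower q-isPower (q-power β)) (q-power n)))
          z≈ : Z N ≈ q ^ 2 * (q ^ n) ^ 2
          z≈ = isPower-≈ (Z-isPower N) (isPower-≡ (e₂ m) (*-isPower (q-power 2) (^-isPower 2 (q-power n))))

        -- What remains of a factor of the product once the part `EE`, free of all parameters, is
        -- split off. `EE` contains E n at i = m - 1, which is the source of the extra [n].
        ϱ : K → K
        ϱ z = (q * (d ^ 2 - s * z * d + z ^ 2)) ÷ ratioDen z

        EE : ℕ → K
        EE i = E (4 ℕ.* i ℕ.+ 3) * E (4 ℕ.* i ℕ.+ 5)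

        ratio≈ : ∀ i → ratio (Z i) ≈ EE i * ϱ (Z i)
        ratio≈ i = begin
          ((q - z) * (1# - q * z) * Qᵈ) * I
            ≈⟨ *-congʳ (*-congʳ (*-cong (+-congˡ (-‿cong z≈)) (+-congˡ (-‿cong (*-congˡ z≈))))) ⟩
          ((q - q * h) * (1# - q * (q * h)) * Qᵈ) * I
            ≈⟨ solve 4 (λ q h Qᵈ I → ((q :- q :* h) :* (:1 :- q :* (q :* h)) :* Qᵈ) :* I
                 := (:1 :- h) :* (:1 :- q :^ 2 :* h) :* ((q :* Qᵈ) :* I)) ≡.refl q h Qᵈ I ⟩
          (1# - h) * (1# - q ^ 2 * h) * ((q * Qᵈ) * I)
            ≈⟨ *-congʳ (*-congˡ (+-congˡ (-‿cong (isPower-≈ (q-power (4 ℕ.* i ℕ.+ 5)) (isPower-≡ (e₂ i) (*-isPower (q-power 2) (q-power (4 ℕ.* i ℕ.+ 3)))))))) ⟨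
          EE i * ϱ z ∎
          where
          z = Z i
          h = q ^ (4 ℕ.* i ℕ.+ 3)
          Qᵈ = d ^ 2 - s * z * d + z ^ 2
          I = ratioDen z ⁻¹
          e₁ : ∀ i → 1 ℕ.+ (4 ℕ.* i ℕ.+ 3) ≡ 4 ℕ.* i ℕ.+ 4
          e₁ = solve-∀
          e₂ : ∀ i → 2 ℕ.+ (4 ℕ.* i ℕ.+ 3) ≡ 4 ℕ.* i ℕ.+ 5
          e₂ = solve-∀
          z≈ : z ≈ q * h
          z≈ = isPower-≈ (Z-isPower i) (isPower-≡ (e₁ i) (*-isPower q-isPower (q-power (4 ℕ.* i ℕ.+ 3))))

        mirror<N : ∀ i → i < m → mirror i < N
        mirror<N i i<m = ℕ.+-monoʳ-< m (ℕ.∸-monoʳ-< (s≤s z≤n) i<m)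

        ϱ-pair : ∀ i → i < m → ϱ (Z i) * ϱ (Z (mirror i)) ≈ pair s (symm β) i
        ϱ-pair i i<m = begin
          ϱ (Z i) * ϱ (Z (mirror i))
            ≈⟨ *-cong (ϱ-cong z≈) (ϱ-cong w≈) ⟩
          ϱ z * ϱ w
            ≈⟨ ÷-*-÷ Dz≉0 Dw≉0 ⟩
          (q * Qᵈ z * (q * Qᵈ w)) ÷ (ratioDen z * ratioDen w)
            ≈⟨ ÷-cross (*-NonZero Dz≉0 Dw≉0) pairDen≉0 (begin
                 q * Qᵈ z * (q * Qᵈ w) * ((D₁ * D₂) * (quad s 1# z * quad s 1# w))
                   ≈⟨ solve 6 (λ q Qz Qw D₁ D₂ U → q :* Qz :* (q :* Qw) :* ((D₁ :* D₂) :* U) := q :^ 2 :* (Qz :* Qw) :* ((D₁ :* D₂) :* U))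
                        ≡.refl q (Qᵈ z) (Qᵈ w) D₁ D₂ (quad s 1# z * quad s 1# w) ⟩
                 q ^ 2 * (Qᵈ z * Qᵈ w) * ((D₁ * D₂) * (quad s 1# z * quad s 1# w))
                   ≈⟨ *-congʳ (*-congˡ QQ) ⟩
                 q ^ 2 * ((b * e) ^ 2 * P) * ((D₁ * D₂) * (quad s 1# z * quad s 1# w))
                   ≈⟨ solve 7 (λ q c P D₁ D₂ u v → q :^ 2 :* (c :^ 2 :* P) :* ((D₁ :* D₂) :* (u :* v))
                        := q :^ 2 :* P :* ((c :* D₁) :* (c :* D₂) :* (u :* v))) ≡.refl q (b * e) P D₁ D₂ (quad s 1# z) (quad s 1# w) ⟩
                 q ^ 2 * P * ((b * e * D₁) * (b * e * D₂) * (quad s 1# z * quad s 1# w))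
                   ≈⟨ *-congˡ DD ⟩
                 q ^ 2 * P * (ratioDen z * ratioDen w) ∎) ⟩
          pair s (symm β) i ∎
          where
          b = q ^ β
          z = q ^ (4 ℕ.* i ℕ.+ 4)
          w = q ^ (4 ℕ.* mirror i ℕ.+ 4)
          D₁ = pairDen e z w (symm β)
          D₂ = pairDen e w z (symm β)
          P = pairNum e z w s (symm β)
          Qᵈ : K → K
          Qᵈ z = d ^ 2 - s * z * d + z ^ 2
          z≈ : Z i ≈ z
          z≈ = ≈power (Z-isPower i)
          w≈ : Z (mirror i) ≈ w
          w≈ = ≈power (Z-isPower (mirror i))
          Qᵈ-cong : ∀ {z z′} → z ≈ z′ → Qᵈ z ≈ Qᵈ z′
          Qᵈ-cong p = +-cong (+-congˡ (-‿cong (*-congʳ (*-congˡ p)))) (^-congˡ 2 p)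
          ratioDen-cong : ∀ {z z′} → z ≈ z′ → ratioDen z ≈ ratioDen z′
          ratioDen-cong p = *-cong (*-cong (+-congʳ (*-congˡ p)) (+-congʳ p)) (+-cong (+-congˡ (-‿cong (*-congˡ p))) (^-congˡ 2 p))
          ϱ-cong : ∀ {z z′} → z ≈ z′ → ϱ z ≈ ϱ z′
          ϱ-cong p = ÷-cong (*-congˡ (Qᵈ-cong p)) (ratioDen-cong p)
          ratioDen≉0 : ∀ i → i < N → NonZero (ratioDen (Z i))
          ratioDen≉0 i i<N = *-NonZero (*-NonZero g₁≉0 g₂≉0) u≉0
            where open Step (step i (separated i i<N)) using (g₁≉0; g₂≉0; u≉0)
          Dz≉0 = NonZero-resp (ratioDen-cong z≈) (ratioDen≉0 i (ℕ.<-≤-trans i<m (ℕ.m≤m+n m m)))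
          Dw≉0 = NonZero-resp (ratioDen-cong w≈) (ratioDen≉0 (mirror i) (mirror<N i i<m))
          d≈ : d ≈ e * b
          d≈ = ^-homo-* q (4 ℕ.* m ℕ.+ 2) β
          zw≈ = zw≈e² i i<m
          module Pᶻʷ = Pairing β e z w zw≈
          module Pʷᶻ = Pairing β e w z (trans (*-comm w z) zw≈)
          QQ : Qᵈ z * Qᵈ w ≈ (b * e) ^ 2 * P
          QQ = trans (*-cong (+-congʳ (+-cong (^-congˡ 2 d≈) (-‿cong (*-congˡ d≈)))) (+-congʳ (+-cong (^-congˡ 2 d≈) (-‿cong (*-congˡ d≈)))))
                     (Pᶻʷ.pairNum-factor s)
          DD : (b * e * D₁) * (b * e * D₂) * (quad s 1# z * quad s 1# w) ≈ ratioDen z * ratioDen w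
          DD = begin
            (b * e * D₁) * (b * e * D₂) * (quad s 1# z * quad s 1# w)
              ≈⟨ *-congʳ (*-cong Pᶻʷ.pairDen-factor Pʷᶻ.pairDen-factor) ⟩
            ((q * z - e * b) * (w - q * (e * b))) * ((q * w - e * b) * (z - q * (e * b))) * (quad s 1# z * quad s 1# w)
              ≈⟨ *-congʳ (*-cong (*-cong (+-congˡ (-‿cong d≈)) (+-congˡ (-‿cong (*-congˡ d≈))))
                                 (*-cong (+-congˡ (-‿cong d≈)) (+-congˡ (-‿cong (*-congˡ d≈))))) ⟨
            ((q * z - d) * (w - q * d)) * ((q * w - d) * (z - q * d)) * (quad s 1# z * quad s 1# w)
              ≈⟨ solve 7 (λ a b c f s z w →
                   (a :* b) :* (c :* f) :* ((:1 :^ 2 :- s :* :1 :* z :+ z :^ 2) :* (:1 :^ 2 :- s :* :1 :* w :+ w :^ 2))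
                   := (a :* f :* (:1 :- s :* z :+ z :^ 2)) :* (c :* b :* (:1 :- s :* w :+ w :^ 2)))
                   ≡.refl (q * z - d) (w - q * d) (q * w - d) (z - q * d) s z w ⟩
            ratioDen z * ratioDen w ∎
          pairDen≉0 : NonZero ((D₁ * D₂) * (quad s 1# z * quad s 1# w))
          pairDen≉0 p = *-NonZero Dz≉0 Dw≉0 (trans (sym DD) (trans
            (solve 4 (λ c D₁ D₂ U → (c :* D₁) :* (c :* D₂) :* U := c :^ 2 :* ((D₁ :* D₂) :* U)) ≡.refl (b * e) D₁ D₂ (quad s 1# z * quad s 1# w))
            (trans (*-congˡ p) (zeroʳ _))))

        family₃ : series s (symm β) (q ^ n) (suc N) ≈ (1# - q) * (prod EE N * prod (pair s (symm β)) m)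
        family₃ = begin
          series s (symm β) (q ^ n) (suc N)
            ≈⟨ series-cong (suc N) (weightᑫ (Z N)) (λ k k<1+N → weight≈ k (ℕ.≤-pred k<1+N)) ⟩
          sum (λ k → κ (X k) * weightᑫ (Z N) k) (suc N)
            ≈⟨ quadratic-sum N (λ i i<N → step i (separated i i<N)) ⟩
          (1# - q) * prod (λ i → ratio (Z i)) N
            ≈⟨ *-congˡ (prod-cong N (λ i _ → ratio≈ i)) ⟩
          (1# - q) * prod (λ i → EE i * ϱ (Z i)) N
            ≈⟨ *-congˡ (prod-* EE (λ i → ϱ (Z i)) N) ⟩
          (1# - q) * (prod EE N * prod (λ i → ϱ (Z i)) N)
            ≈⟨ *-congˡ (*-congˡ (prod-split (λ i → ϱ (Z i)) m m)) ⟩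
          (1# - q) * (prod EE N * (prod (λ i → ϱ (Z i)) m * prod (λ i → ϱ (Z (m ℕ.+ i))) m))
            ≈⟨ *-congˡ (*-congˡ (*-congˡ (prod-reverse (λ i → ϱ (Z (m ℕ.+ i))) m))) ⟩
          (1# - q) * (prod EE N * (prod (λ i → ϱ (Z i)) m * prod (λ i → ϱ (Z (mirror i))) m))
            ≈⟨ *-congˡ (*-congˡ (prod-* (λ i → ϱ (Z i)) (λ i → ϱ (Z (mirror i))) m)) ⟨
          (1# - q) * (prod EE N * prod (λ i → ϱ (Z i) * ϱ (Z (mirror i))) m)
            ≈⟨ *-congˡ (*-congˡ (prod-cong m ϱ-pair)) ⟩
          (1# - q) * (prod EE N * prod (pair s (symm β)) m) ∎

-- The undeformed series and the target value

module Plain where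

  open RingSolver
  open FieldTheory
  open Summation
  open QSeries
  open import Data.Nat as ℕ using (ℕ; suc; _<_)
  import Data.Nat.Properties as ℕ
  open import Data.Nat.Tactic.RingSolver using (solve-∀)
  open import Relation.Binary.PropositionalEquality as ≡ using (_≡_)
  open import Data.Sum using (inj₁; inj₂)

  -- The series at c = 1, where the factor 1 - q x cancels.
  module PlainSeries (F : Field) (Q : GenericElement F) where

    open FieldProperties F
    open GenericElement Q
    open QProperties F Q
    open Series F Q
    open Nodes F q
    open Hypergeometric F

    num₁ den₁ : K → K → K → K
    num₁ s t x = q ^ 2 * quad s 1# (q * x) * quad t 1# (q * x ^ 2) * (1# - q ^ 2 * x ^ 2)
    den₁ s t x = (1# - q ^ 4 * x ^ 2) * quad s 1# (q ^ 4 * x ^ 2) * quad t 1# (q ^ 2 * x)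

    weight₁ : K → K → ℕ → K
    weight₁ s t = hyper (λ j → num₁ s t (X j)) (λ j → den₁ s t (X j))

    -- The cancelled factor is 1 - q^(2j+1), which is no unit modulo Φ_d at j = (d - 1)/2. Only the
    -- reduced weight can be handled modulo Φ_d when the first block runs past that index.
    weight₁≈ : ∀ s t k → (∀ j → j < k → NonZero (weightDen s t 1# (X j))) → weight s t 1# k ≈ weight₁ s t k
    weight₁≈ s t k den≉0 = prod-cong k λ j j<k → ÷-cross (den≉0 j j<k) (*-NonZero⁻ˡ (den≉0 j j<k))
      (solve 7 (λ q x t l S₁ S₄ T₂ →
          q :^ 2 :* (:1 :- q :* x) :* S₁ :* (:1 :^ 2 :- t :* :1 :* (q :* :1 :* x :^ 2) :+ (q :* :1 :* x :^ 2) :^ 2) :* (:1 :^ 2 :- q :^ 2 :* x :^ 2)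
            :* (l :* S₄ :* T₂)
          := q :^ 2 :* S₁ :* (:1 :^ 2 :- t :* :1 :* (q :* x :^ 2) :+ (q :* x :^ 2) :^ 2) :* (:1 :- q :^ 2 :* x :^ 2)
            :* (l :* S₄ :* T₂ :* (:1 :- q :* :1 :^ 2 :* x)))
        ≡.refl q (X j) t (1# - q ^ 4 * X j ^ 2) (quad s 1# (q * X j)) (quad s 1# (q ^ 4 * X j ^ 2)) (quad t 1# (q ^ 2 * X j)))

    baseNum baseDen base : ℕ → K
    baseNum j = q ^ 2 * ((E (2 ℕ.* j ℕ.+ 1) * E (2 ℕ.* j ℕ.+ 1)) * ((E (4 ℕ.* j ℕ.+ 1) * E (4 ℕ.* j ℕ.+ 1)) * E (4 ℕ.* j ℕ.+ 2)))
    baseDen j = E (4 ℕ.* j ℕ.+ 4) ^ 3 * E (2 ℕ.* j ℕ.+ 2) ^ 2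
    base j = baseNum j ÷ baseDen j

    E-suc≉0 : ∀ i k → NonZero (E (i ℕ.+ suc k))
    E-suc≉0 i k = NonZero-resp (reflexive (≡.cong E (≡.sym (ℕ.+-suc i k)))) (E≉0 (i ℕ.+ k))

    baseDen≉0 : ∀ j → NonZero (baseDen j)
    baseDen≉0 j = *-NonZero (^-NonZero 3 (E-suc≉0 (4 ℕ.* j) 3)) (^-NonZero 2 (E-suc≉0 (2 ℕ.* j) 1))

    E-power : ∀ {x} a → x isPower a → 1# - x ≈ E a
    E-power a p = +-congˡ (-‿cong (≈power p))

    num₁≈ : ∀ j → num₁ (symm 0) (symm 0) (X j) ≈ baseNum j
    num₁≈ j = begin
      q ^ 2 * quad (symm 0) 1# (q * X j) * quad (symm 0) 1# (q * X j ^ 2) * (1# - q ^ 2 * X j ^ 2)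
        ≈⟨ *-cong (*-cong (*-congˡ (trans (quad-0 _) (^-congˡ 2 e₁))) (trans (quad-0 _) (^-congˡ 2 e₂))) e₃ ⟩
      q ^ 2 * E (2 ℕ.* j ℕ.+ 1) ^ 2 * E (4 ℕ.* j ℕ.+ 1) ^ 2 * E (4 ℕ.* j ℕ.+ 2)
        ≈⟨ solve 4 (λ q a b c → q :^ 2 :* a :^ 2 :* b :^ 2 :* c := q :^ 2 :* ((a :* a) :* ((b :* b) :* c))) ≡.refl q _ _ _ ⟩
      baseNum j ∎
      where
      e₁ = E-power _ (isPower-≡ (ℕ.+-comm 1 (2 ℕ.* j)) (*-isPower q-isPower (X-isPower j)))
      e₂ = E-power _ (isPower-≡ (ℕ.+-comm 1 (4 ℕ.* j)) (*-isPower q-isPower (X² j)))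
      e₃ = E-power _ (isPower-≡ (ℕ.+-comm 2 (4 ℕ.* j)) (*-isPower (q-power 2) (X² j)))

    den₁≈ : ∀ j → den₁ (symm 0) (symm 0) (X j) ≈ baseDen j
    den₁≈ j = begin
      (1# - q ^ 4 * X j ^ 2) * quad (symm 0) 1# (q ^ 4 * X j ^ 2) * quad (symm 0) 1# (q ^ 2 * X j)
        ≈⟨ *-cong (*-cong e₁ (trans (quad-0 _) (^-congˡ 2 e₁))) (trans (quad-0 _) (^-congˡ 2 e₂)) ⟩
      E (4 ℕ.* j ℕ.+ 4) * E (4 ℕ.* j ℕ.+ 4) ^ 2 * E (2 ℕ.* j ℕ.+ 2) ^ 2
        ≈⟨ solve 2 (λ a b → a :* a :^ 2 :* b :^ 2 := a :^ 3 :* b :^ 2) ≡.refl _ _ ⟩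
      baseDen j ∎
      where
      e₁ = E-power _ (isPower-≡ (ℕ.+-comm 4 (4 ℕ.* j)) (*-isPower (q-power 4) (X² j)))
      e₂ = E-power _ (isPower-≡ (ℕ.+-comm 2 (2 ℕ.* j)) (*-isPower (q-power 2) (X-isPower j)))

    weight₁≈base : ∀ k → weight₁ (symm 0) (symm 0) k ≈ prod base k
    weight₁≈base k = prod-cong k λ j _ → ÷-cong (num₁≈ j) (den₁≈ j)

    admissible-0 : Admissible (symm 0)
    admissible-0 = symm-admissible 0 (λ k ())

    weight≈base : ∀ k → weight (symm 0) (symm 0) 1# k ≈ prod base k
    weight≈base k = trans (weight₁≈ (symm 0) (symm 0) k (λ j _ → weightDen≉0 0 j admissible-0 1-isPower (λ ()) (λ ()))) (weight₁≈base k)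

    term : ℕ → K
    term k = κ (X k) * prod base k

    series≈ : ∀ N → series (symm 0) (symm 0) 1# N ≈ sum term N
    series≈ N = series-cong N (prod base) (λ k _ → weight≈base k)

    κ≈ : ∀ k → κ (X k) ≈ E (6 ℕ.* k ℕ.+ 1)
    κ≈ k = E-power (6 ℕ.* k ℕ.+ 1) (isPower-≡ (lemma k) (*-isPower q-isPower (^-isPower 3 (X-isPower k))))
      where
      lemma : ∀ k → 1 ℕ.+ 2 ℕ.* k ℕ.* 3 ≡ 6 ℕ.* k ℕ.+ 1
      lemma = solve-∀

    -- At s = 2 the logarithmic derivative in s of 1 - s q^a + q^(2a) is -`ε a`. For a = 2j this is
    -- also q^(2j)/[2j]² divided by (1 - q)².
    ε : ℕ → K
    ε a = q ^ a ÷ E a ^ 2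

    harmonic : ℕ → K
    harmonic = sum (λ i → ε (4 ℕ.* i ℕ.+ 2) - ε (4 ℕ.* i ℕ.+ 4))

    -- The right-hand side times 1 - q. The factors (1 - q)² of [n]² and of the squares [2j]²
    -- cancel.
    centralValue : ℕ → K
    centralValue m = closedForm (symm 0) m * (1# + E n ^ 2 * (2# - q ^ n) * harmonic m)
      where n = 4 ℕ.* m ℕ.+ 1

    η-0 : ∀ i → η (symm 0) i ≈ E (4 ℕ.* i ℕ.+ 2) ^ 2 ÷ E (4 ℕ.* i ℕ.+ 4) ^ 2
    η-0 i = ÷-cong (quad-0 _) (quad-0 _)

    -- At t = qⁿ + q⁻ⁿ with n = 4m + 1 the numerator of the factor of index m vanishes.
    weight-vanishes : ∀ m s → Admissible s → ∀ k → m < k → weight s (symm (4 ℕ.* m ℕ.+ 1)) 1# k ≈ 0#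
    weight-vanishes m s adm (suc k) m<1+k with ℕ.m≤n⇒m<n∨m≡n (ℕ.≤-pred m<1+k)
    ... | inj₁ m<k = trans (*-congʳ (weight-vanishes m s adm k m<k)) (zeroˡ _)
    ... | inj₂ ≡.refl = begin
      W * ((a * quad (symm n) 1# (q * 1# * X m ^ 2) * b) * c)
        ≈⟨ *-congˡ (*-congʳ (*-congʳ (*-congˡ quad≈0))) ⟩
      W * ((a * 0# * b) * c)
        ≈⟨ solve 4 (λ W a b c → W :* ((a :* :0 :* b) :* c) := :0) ≡.refl W a b c ⟩
      0# ∎
      where
      n = 4 ℕ.* m ℕ.+ 1
      W = weight s (symm n) 1# m
      a = q ^ 2 * (1# - q * X m) * quad s 1# (q * X m)
      b = 1# ^ 2 - q ^ 2 * X m ^ 2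
      c = weightDen s (symm n) 1# (X m) ⁻¹
      x≈ : q * 1# * X m ^ 2 ≈ q ^ n * 1#
      x≈ = isPower-≈ (isPower-≡ (lemma m) (*-isPower (*-isPower q-isPower 1-isPower) (X² m))) (isPower-≡ (ℕ.+-identityʳ n) (*-isPower (q-power n) 1-isPower))
        where
        lemma : ∀ m → 1 ℕ.+ 0 ℕ.+ 4 ℕ.* m ≡ 4 ℕ.* m ℕ.+ 1
        lemma = solve-∀
      quad≈0 : quad (symm n) 1# (q * 1# * X m ^ 2) ≈ 0#
      quad≈0 = *-cancelˡ (^-NonZero n q≉0) (begin
        q ^ n * quad (symm n) 1# (q * 1# * X m ^ 2)
          ≈⟨ quad-symm n 1# _ ⟩
        (q ^ n * 1# - q * 1# * X m ^ 2) * d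
          ≈⟨ *-congʳ (trans (+-congˡ (-‿cong x≈)) (-‿inverseʳ _)) ⟩
        0# * d
          ≈⟨ solve 2 (λ d y → :0 :* d := y :* :0) ≡.refl d (q ^ n) ⟩
        q ^ n * 0# ∎)
        where d = 1# - q ^ n * (q * 1# * X m ^ 2)

-- Divisibility in the localisation at a cyclotomic polynomial

module Local where

  open RingSolver
  open FieldTheory
  open Summation
  open QSeries
  open import Data.Bool using (Bool; true; false)
  open import Data.Nat as ℕ using (ℕ; zero; suc; _<_)
  import Data.Nat.Properties as ℕ
  open import Data.Nat.Divisibility using (_∣_; ∣m+n∣m⇒∣n; _∣0; ∣m∣n⇒∣m+n)
  open import Data.Product using (Σ; _×_; _,_; proj₁; proj₂)
  open import Data.Sum using (inj₁; inj₂)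
  open import Data.Unit using (⊤; tt)
  open import Relation.Binary.PropositionalEquality as ≡ using (_≡_)
  open import Relation.Nullary using (¬_; contradiction)

  -- The axioms satisfied by the rational functions whose denominator is coprime to Φ_n,
  -- with φ = Φ_n.
  record LocalRing (F : Field) (Q : GenericElement F) (n : ℕ) : Set₁ where
    open FieldProperties F
    open GenericElement Q
    open QProperties F Q
    field
      Int        : K → Set
      Int-resp   : ∀ {x y} → x ≈ y → Int x → Int y
      Int-0      : Int 0#
      Int-1      : Int 1#
      Int-+      : ∀ {x y} → Int x → Int y → Int (x + y)
      Int-*      : ∀ {x y} → Int x → Int y → Int (x * y)
      Int-neg    : ∀ {x} → Int x → Int (- x)
      Int-q      : Int q
      Int-q⁻¹    : Int (q ⁻¹)
      φ          : K
      Int-φ      : Int φ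
      E-period   : Σ K λ ψ → Int ψ × E n ≈ φ * ψ
      Int-E⁻¹    : ∀ i → ¬ n ∣ i → Int (E i ⁻¹)
      -- The inverse of 1 + qⁿ + ... + q^(ln), which is congruent to the nonzero constant l + 1. It
      -- allows 1 - q^(n(l+1)) in a denominator to be cancelled against E n.
      Int-ratio  : ∀ l → Int (E n ÷ E (n ℕ.* suc l))

  module LocalProperties {F : Field} {Q : GenericElement F} {n : ℕ} (L : LocalRing F Q n) where

    open FieldProperties F
    open GenericElement Q
    open QProperties F Q
    open LocalRing L

    Int-- : ∀ {x y} → Int x → Int y → Int (x - y)
    Int-- p r = Int-+ p (Int-neg r)

    Int-^ : ∀ {x} k → Int x → Int (x ^ k)
    Int-^ zero    p = Int-1
    Int-^ (suc k) p = Int-* p (Int-^ k p)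

    Int-power : ∀ i → Int (q ^ i)
    Int-power i = Int-^ i Int-q

    Int-E : ∀ i → Int (E i)
    Int-E i = Int-- Int-1 (Int-power i)

    Int-sum : ∀ {f} k → (∀ i → i < k → Int (f i)) → Int (sum f k)
    Int-sum zero    _ = Int-0
    Int-sum (suc k) p = Int-+ (Int-sum k (λ i i<k → p i (ℕ.m<n⇒m<1+n i<k))) (p k ℕ.≤-refl)

    Int-prod : ∀ {f} k → (∀ i → i < k → Int (f i)) → Int (prod f k)
    Int-prod zero    _ = Int-1
    Int-prod (suc k) p = Int-* (Int-prod k (λ i i<k → p i (ℕ.m<n⇒m<1+n i<k))) (p k ℕ.≤-refl)

    record Unit (x : K) : Set where
      field
        nonZero : NonZero x
        int     : Int x
        int⁻¹   : Int (x ⁻¹)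
    open Unit public

    Unit-resp : ∀ {x y} → x ≈ y → Unit x → Unit y
    Unit-resp x≈y u = record
      { nonZero = NonZero-resp x≈y (nonZero u) ; int = Int-resp x≈y (int u) ; int⁻¹ = Int-resp (⁻¹-cong x≈y) (int⁻¹ u) }

    Unit-* : ∀ {x y} → Unit x → Unit y → Unit (x * y)
    Unit-* u v = record
      { nonZero = *-NonZero (nonZero u) (nonZero v) ; int = Int-* (int u) (int v)
      ; int⁻¹ = Int-resp (⁻¹-distrib-* (nonZero u) (nonZero v)) (Int-* (int⁻¹ u) (int⁻¹ v)) }

    Unit-1 : Unit 1#
    Unit-1 = record { nonZero = 1≉0 ; int = Int-1 ; int⁻¹ = Int-resp (⁻¹-unique 1≉0 (*-identityˡ 1#)) Int-1 }

    Unit-q : Unit q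
    Unit-q = record { nonZero = q≉0 ; int = Int-q ; int⁻¹ = Int-q⁻¹ }

    Unit-neg : ∀ {x} → Unit x → Unit (- x)
    Unit-neg {x} u = record
      { nonZero = neg-NonZero (nonZero u) ; int = Int-neg (int u)
      ; int⁻¹ = Int-resp (⁻¹-unique (neg-NonZero (nonZero u))
          (trans (solve 2 (λ x i → :- x :* :- i := x :* i) ≡.refl x (x ⁻¹)) (⁻¹-inverse (nonZero u))))
          (Int-neg (int⁻¹ u)) }

    Unit-^ : ∀ {x} k → Unit x → Unit (x ^ k)
    Unit-^ zero    u = Unit-1
    Unit-^ (suc k) u = Unit-* u (Unit-^ k u)

    Unit-power : ∀ {x i} → x isPower i → Unit x
    Unit-power {i = i} p = Unit-resp (sym (≈power p)) (Unit-^ i Unit-q)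

    Int-÷ : ∀ {x y} → Int x → Unit y → Int (x ÷ y)
    Int-÷ p u = Int-* p (int⁻¹ u)

    Unit-cancel : ∀ {x y} → Unit x → Unit (x * y) → Unit y
    Unit-cancel {x} {y} u v = record
      { nonZero = λ y≈0 → nonZero v (trans (*-congˡ y≈0) (zeroʳ x))
      ; int = Int-resp y≈ (Int-÷ (int v) u)
      ; int⁻¹ = Int-resp y⁻¹≈ (Int-* (int u) (int⁻¹ v)) }
      where
      y≈ : x * y ÷ x ≈ y
      y≈ = *-cancelʳ (nonZero u) (trans (÷-cancel (nonZero u)) (*-comm x y))
      y≉0 : NonZero y
      y≉0 y≈0 = nonZero v (trans (*-congˡ y≈0) (zeroʳ x))
      y⁻¹≈ : x * (x * y) ⁻¹ ≈ y ⁻¹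
      y⁻¹≈ = ⁻¹-unique y≉0 (trans (solve 3 (λ x y i → y :* (x :* i) := x :* y :* i) ≡.refl x y _) (⁻¹-inverse (nonZero v)))

    Unit-E : ∀ i → ¬ n ∣ i → Unit (E i)
    Unit-E zero    n∤i = contradiction (n ∣0) n∤i
    Unit-E (suc i) n∤i = record { nonZero = E≉0 i ; int = Int-E (suc i) ; int⁻¹ = Int-E⁻¹ (suc i) n∤i }

    Unit-difference : ∀ {x y i j} → x isPower i → y isPower j →
      (∀ e → i ℕ.+ e ≡ j → ¬ n ∣ e) → (∀ e → j ℕ.+ e ≡ i → ¬ n ∣ e) → Unit (x - y)
    Unit-difference {x} {y} {i} {j} p r c c′ with ℕ.≤-total i j
    ... | inj₁ i≤j = Unit-resp
          (trans (sym (difference i (j ℕ.∸ i))) (sym (+-cong (≈power p) (-‿cong (trans (≈power r) (^-congʳ q (≡.sym (ℕ.m+[n∸m]≡n i≤j))))))))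
          (Unit-* (Unit-power (q-power i)) (Unit-E (j ℕ.∸ i) (c _ (ℕ.m+[n∸m]≡n i≤j))))
    ... | inj₂ j≤i = Unit-resp
          (trans (-‿cong (trans (sym (difference j (i ℕ.∸ j))) (sym (+-cong (≈power r) (-‿cong (trans (≈power p) (^-congʳ q (≡.sym (ℕ.m+[n∸m]≡n j≤i)))))))))
                 (solve 2 (λ a b → :- (a :- b) := b :- a) ≡.refl y x))
          (Unit-neg (Unit-* (Unit-power (q-power j)) (Unit-E (i ℕ.∸ j) (c′ _ (ℕ.m+[n∸m]≡n j≤i)))))

    -- Multiples of n in an exponent are invisible modulo φ, so the difference behaves like 1 - q^j.
    Unit-shifted : ∀ {x y i β} j → x isPower i → y isPower (β ℕ.+ j) → n ∣ i → n ∣ β → ¬ n ∣ j → Unit (x - y)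
    Unit-shifted {i = i} {β} j p r n∣i n∣β n∤j = Unit-difference p r
      (λ e eq n∣e → n∤j (∣m+n∣m⇒∣n (≡.subst (n ∣_) eq (∣m∣n⇒∣m+n n∣i n∣e)) n∣β))
      (λ e eq n∣e → n∤j (∣m+n∣m⇒∣n (∣m+n∣m⇒∣n (≡.subst (n ∣_) (≡.trans (≡.sym eq) (ℕ.+-comm _ e)) n∣i) n∣e) n∣β))

    Unit-quad : ∀ β {c a γ} α → c isPower γ → a isPower α → n ∣ β → n ∣ γ → ¬ n ∣ α → Unit (quad (symm β) c a)
    Unit-quad β {γ = γ} α p r n∣β n∣γ n∤α = Unit-cancel (Unit-power (q-power β)) (Unit-resp (sym (quad-symm β _ _))
      (Unit-* (Unit-shifted {β = 0} α (*-isPower (q-power β) p) r (∣m∣n⇒∣m+n n∣β n∣γ) (n ∣0) n∤α)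
              (Unit-shifted α p (*-isPower (q-power β) r) n∣γ n∣β n∤α)))

    Int-symm : ∀ β → Int (symm β)
    Int-symm β = Int-+ (Int-power β) (int⁻¹ (Unit-power (q-power β)))

    Int-quad : ∀ {t c a} → Int t → Int c → Int a → Int (quad t c a)
    Int-quad p r s = Int-+ (Int-- (Int-^ 2 r) (Int-* (Int-* p r) s)) (Int-^ 2 s)

    record Div (k : ℕ) (x : K) : Set where
      constructor divides
      field
        {quotient} : K
        int-quotient : Int quotient
        equality : x ≈ φ ^ k * quotient
    open Div public

    Div-resp : ∀ {k x y} → x ≈ y → Div k x → Div k y
    Div-resp x≈y (divides w e) = divides w (trans (sym x≈y) e)

    Div-0 : ∀ k → Div k 0#
    Div-0 k = divides Int-0 (sym (zeroʳ _))

    Div-+ : ∀ {k x y} → Div k x → Div k y → Div k (x + y)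
    Div-+ (divides p e) (divides r e′) = divides (Int-+ p r) (trans (+-cong e e′) (sym (distribˡ _ _ _)))

    Div-neg : ∀ {k x} → Div k x → Div k (- x)
    Div-neg {k} (divides {w} p e) = divides (Int-neg p) (trans (-‿cong e) (solve 2 (λ a b → :- (a :* b) := a :* :- b) ≡.refl (φ ^ k) w))

    Div-- : ∀ {k x y} → Div k x → Div k y → Div k (x - y)
    Div-- p r = Div-+ p (Div-neg r)

    Div-* : ∀ {j k x y} → Div j x → Div k y → Div (j ℕ.+ k) (x * y)
    Div-* {j} {k} (divides {v} p e) (divides {w} r e′) = divides (Int-* p r) (begin
      _ * _                      ≈⟨ *-cong e e′ ⟩
      φ ^ j * v * (φ ^ k * w)    ≈⟨ solve 4 (λ a b v w → a :* v :* (b :* w) := a :* b :* (v :* w)) ≡.refl (φ ^ j) (φ ^ k) v w ⟩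
      φ ^ j * φ ^ k * (v * w)    ≈⟨ *-congʳ (^-homo-* φ j k) ⟨
      φ ^ (j ℕ.+ k) * (v * w)    ∎)

    Int⇒Div : ∀ {x} → Int x → Div 0 x
    Int⇒Div p = divides p (sym (*-identityˡ _))

    Div⇒Int : ∀ {k x} → Div k x → Int x
    Div⇒Int {k} (divides p e) = Int-resp (sym e) (Int-* (Int-^ k Int-φ) p)

    Div-*ʳ : ∀ {k x y} → Div k x → Int y → Div k (x * y)
    Div-*ʳ {k} p r = ≡.subst (λ k → Div k _) (ℕ.+-identityʳ k) (Div-* p (Int⇒Div r))

    Div-*ˡ : ∀ {k x y} → Int x → Div k y → Div k (x * y)
    Div-*ˡ p r = Div-* (Int⇒Div p) r

    Div-^ : ∀ {x} k → Div 1 x → Div k (x ^ k)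
    Div-^ zero    p = Int⇒Div Int-1
    Div-^ (suc k) p = Div-* p (Div-^ k p)

    Div-sum : ∀ {k f} N → (∀ i → i < N → Div k (f i)) → Div k (sum f N)
    Div-sum {k} zero _ = Div-0 k
    Div-sum (suc N) p = Div-+ (Div-sum N (λ i i<N → p i (ℕ.m<n⇒m<1+n i<N))) (p N ℕ.≤-refl)

    Div-E-period : Div 1 (E n)
    Div-E-period = divides (proj₁ (proj₂ E-period)) (trans (proj₂ (proj₂ E-period)) (*-congʳ (sym (*-identityʳ φ))))

    Int-prod-factor : ∀ {f} N i {c} → (∀ j → j < N → Int (f j)) → i < N → Σ K (λ w → Int w × f i ≈ c * w) →
      Σ K λ w → Int w × prod f N ≈ c * w
    Int-prod-factor {f} (suc N) i {c} p i<1+N (w , Int-w , e) with ℕ.m≤n⇒m<n∨m≡n (ℕ.≤-pred i<1+N)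
    ... | inj₂ ≡.refl = prod f N * w , Int-* (Int-prod N (λ j j<N → p j (ℕ.m<n⇒m<1+n j<N))) Int-w ,
          trans (*-congˡ e) (*-swapˡ _ _ _)
    ... | inj₁ i<N with Int-prod-factor N i (λ j j<N → p j (ℕ.m<n⇒m<1+n j<N)) i<N (w , Int-w , e)
    ...   | w′ , Int-w′ , e′ = w′ * f N , Int-* Int-w′ (p N ℕ.≤-refl) , trans (*-congʳ e′) (*-assoc _ _ _)

    E-multiple : ∀ l → Σ K λ w → Int w × E (n ℕ.* l) ≈ E n * w
    E-multiple zero    = 0# , Int-0 , trans (+-congˡ (-‿cong (^-congʳ q (ℕ.*-zeroʳ n)))) (trans (-‿inverseʳ 1#) (sym (zeroʳ _)))
    E-multiple (suc l) with E-multiple l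
    ... | w , Int-w , e = 1# + q ^ n * w , Int-+ Int-1 (Int-* (Int-power n) Int-w) , (begin
      1# - q ^ (n ℕ.* suc l)                  ≈⟨ +-congˡ (-‿cong (trans (^-congʳ q (ℕ.*-suc n l)) (^-homo-* q n (n ℕ.* l)))) ⟩
      1# - q ^ n * q ^ (n ℕ.* l)              ≈⟨ solve 2 (λ a b → :1 :- a :* b := (:1 :- a) :+ a :* (:1 :- b)) ≡.refl (q ^ n) _ ⟩
      (1# - q ^ n) + q ^ n * (1# - q ^ (n ℕ.* l)) ≈⟨ +-congˡ (*-congˡ e) ⟩
      (1# - q ^ n) + q ^ n * ((1# - q ^ n) * w)   ≈⟨ solve 2 (λ a w → (:1 :- a) :+ a :* ((:1 :- a) :* w) := (:1 :- a) :* (:1 :+ a :* w)) ≡.refl (q ^ n) w ⟩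
      (1# - q ^ n) * (1# + q ^ n * w)         ∎)

    -- Mem f is to be read: f is integral, and its differences in each direction of the cube X
    -- (mixed ones included) are divisible by the steps of those directions.
    record Family (X : Set) : Set₁ where
      field
        Mem       : (X → K) → Set
        Mem-resp  : ∀ {f g} → (∀ x → f x ≈ g x) → Mem f → Mem g
        Mem-const : ∀ {a} → Int a → Mem (λ _ → a)
        Mem-+     : ∀ {f g} → Mem f → Mem g → Mem (λ x → f x + g x)
        Mem-*     : ∀ {f g} → Mem f → Mem g → Mem (λ x → f x * g x)
        Mem-⁻¹    : ∀ {f} → (∀ x → Unit (f x)) → Mem f → Mem (λ x → f x ⁻¹)

      Mem-neg : ∀ {f} → Mem f → Mem (λ x → - f x)
      Mem-neg {f} p = Mem-resp (λ x → solve 1 (λ a → :- :1 :* a := :- a) ≡.refl (f x)) (Mem-* (Mem-const (Int-neg Int-1)) p)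

      Mem-- : ∀ {f g} → Mem f → Mem g → Mem (λ x → f x - g x)
      Mem-- p r = Mem-+ p (Mem-neg r)

      Mem-^ : ∀ {f} k → Mem f → Mem (λ x → f x ^ k)
      Mem-^ zero    p = Mem-const Int-1
      Mem-^ (suc k) p = Mem-* p (Mem-^ k p)

      Mem-÷ : ∀ {f g} → Mem f → Mem g → (∀ x → Unit (g x)) → Mem (λ x → f x ÷ g x)
      Mem-÷ p r u = Mem-* p (Mem-⁻¹ u r)

      Mem-prod : ∀ {f : X → ℕ → K} k → (∀ i → i < k → Mem (λ x → f x i)) → Mem (λ x → prod (f x) k)
      Mem-prod zero    _ = Mem-const Int-1
      Mem-prod (suc k) p = Mem-* (Mem-prod k (λ i i<k → p i (ℕ.m<n⇒m<1+n i<k))) (p k ℕ.≤-refl)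

      Mem-sum : ∀ {f : X → ℕ → K} k → (∀ i → i < k → Mem (λ x → f x i)) → Mem (λ x → sum (f x) k)
      Mem-sum zero    _ = Mem-const Int-0
      Mem-sum (suc k) p = Mem-+ (Mem-sum k (λ i i<k → p i (ℕ.m<n⇒m<1+n i<k))) (p k ℕ.≤-refl)

      Mem-quad : ∀ {t c a} → Mem t → Mem c → Mem a → Mem (λ x → quad (t x) (c x) (a x))
      Mem-quad p r s = Mem-+ (Mem-- (Mem-^ 2 r) (Mem-* (Mem-* p r) s)) (Mem-^ 2 s)

    point : Family ⊤
    point = record
      { Mem = λ f → Int (f tt) ; Mem-resp = λ e → Int-resp (e tt) ; Mem-const = λ p → p
      ; Mem-+ = Int-+ ; Mem-* = Int-* ; Mem-⁻¹ = λ u _ → int⁻¹ (u tt) }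

    -- Adds one direction with step π. As the slope must itself be a member on the old cube,
    -- iteration makes each mixed difference divisible by the product of the steps involved.
    module Extend {X : Set} (𝓕 : Family X) (π : K) (Int-π : Int π) where

      open Family 𝓕

      record Mem′ (f : Bool × X → K) : Set where
        constructor member
        field
          {slope}   : X → K
          origin    : Mem (λ x → f (false , x))
          slope-Mem : Mem slope
          increment : ∀ x → f (true , x) ≈ f (false , x) + π * slope x

      extend : Family (Bool × X)
      extend = record
        { Mem = Mem′
        ; Mem-resp = λ { e (member p r i) → member (Mem-resp (λ x → e (false , x)) p) r
            (λ x → trans (sym (e (true , x))) (trans (i x) (+-congʳ (e (false , x))))) }
        ; Mem-const = λ p → member (Mem-const p) (Mem-const Int-0)
            (λ x → solve 2 (λ a π → a := a :+ π :* :0) ≡.refl _ π)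
        ; Mem-+ = λ { (member p r i) (member p′ r′ i′) → member (Mem-+ p p′) (Mem-+ r r′)
            (λ x → trans (+-cong (i x) (i′ x))
              (solve 5 (λ a b c d π → (a :+ π :* b) :+ (c :+ π :* d) := (a :+ c) :+ π :* (b :+ d)) ≡.refl _ _ _ _ π)) }
        ; Mem-* = λ { {f} {g} (member {s} p r i) (member {s′} p′ r′ i′) → member (Mem-* p p′)
            (Mem-+ (Mem-+ (Mem-* p r′) (Mem-* r p′)) (Mem-* (Mem-const Int-π) (Mem-* r r′)))
            (λ x → trans (*-cong (i x) (i′ x))
              (solve 5 (λ a b c d π → (a :+ π :* b) :* (c :+ π :* d) := a :* c :+ π :* (a :* d :+ b :* c :+ π :* (b :* d)))
                ≡.refl (f (false , x)) (s x) (g (false , x)) (s′ x) π)) }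
        -- The slope is -s/(b (b + πs)), from 1/(b + πs) - 1/b; the inverse of b + πs is a member on
        -- the old cube because b + πs is one there.
        ; Mem-⁻¹ = λ { {f} u (member {s} p r i) → member (Mem-⁻¹ (λ x → u (false , x)) p)
            (Mem-* (Mem-neg r) (Mem-* (Mem-⁻¹ (λ x → u (false , x)) p) (Mem-true⁻¹ u p r i)))
            (λ x → *-cancelʳ (*-NonZero (nonZero (u (true , x))) (nonZero (u (false , x))))
              (inverse-increment (f (true , x)) (f (false , x)) (s x) (nonZero (u (true , x))) (nonZero (u (false , x))) (i x))) }
        }
        where
        inverse-increment : ∀ a b s → NonZero a → NonZero b → a ≈ b + π * s →
          a ⁻¹ * (a * b) ≈ (b ⁻¹ + π * (- s * (b ⁻¹ * a ⁻¹))) * (a * b)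
        inverse-increment a b s a≉0 b≉0 e = begin
          a ⁻¹ * (a * b)                        ≈⟨ solve 3 (λ i a b → i :* (a :* b) := a :* i :* b) ≡.refl (a ⁻¹) a b ⟩
          a * a ⁻¹ * b                          ≈⟨ *-congʳ (⁻¹-inverse a≉0) ⟩
          1# * b                                ≈⟨ solve 3 (λ b s π → :1 :* b := (b :+ π :* s) :* :1 :- π :* s :* (:1 :* :1)) ≡.refl b s π ⟩
          (b + π * s) * 1# - π * s * (1# * 1#)  ≈⟨ +-cong (*-cong e (⁻¹-inverse b≉0)) (-‿cong (*-congˡ (*-cong (⁻¹-inverse b≉0) (⁻¹-inverse a≉0)))) ⟨
          a * (b * b ⁻¹) - π * s * ((b * b ⁻¹) * (a * a ⁻¹))
            ≈⟨ solve 6 (λ a b i j s π → a :* (b :* j) :- π :* s :* ((b :* j) :* (a :* i)) := (j :+ π :* (:- s :* (j :* i))) :* (a :* b))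
                 ≡.refl a b (a ⁻¹) (b ⁻¹) s π ⟩
          (b ⁻¹ + π * (- s * (b ⁻¹ * a ⁻¹))) * (a * b) ∎
        Mem-true⁻¹ : ∀ {f : Bool × X → K} {s} → (∀ x → Unit (f x)) → Mem (λ x → f (false , x)) → Mem s →
          (∀ x → f (true , x) ≈ f (false , x) + π * s x) → Mem (λ x → f (true , x) ⁻¹)
        Mem-true⁻¹ u p r i = Mem-⁻¹ (λ x → u (true , x)) (Mem-resp (λ x → sym (i x)) (Mem-+ p (Mem-* (Mem-const Int-π) r)))

-- Block structure of the sum modulo a cyclotomic polynomial

module Periodic where

  open RingSolver
  open FieldTheory
  open Summation
  open QSeries
  open Plain
  open Local
  open import Data.Bool using (Bool; true; false; if_then_else_)
  open import Data.Nat as ℕ using (ℕ; zero; suc; _<_; _≤_; z≤n; s≤s)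
  import Data.Nat.Properties as ℕ
  open import Data.Nat.Divisibility using (_∣_; _∣?_; divides; >⇒∤; ∣m+n∣m⇒∣n; m∣m*n; _∣0; ∣n⇒∣m*n)
  open import Data.Nat.Tactic.RingSolver using (solve-∀)
  open import Data.Product using (Σ; _×_; _,_; proj₁; proj₂)
  open import Data.Sum using (_⊎_; inj₁; inj₂)
  open import Data.Unit using (⊤; tt)
  open import Relation.Binary.PropositionalEquality as ≡ using (_≡_)
  open import Relation.Nullary using (¬_; yes; no)

  ∤-small : ∀ {n r} → 0 < r → r < n → ¬ n ∣ r
  ∤-small {r = suc _} _ r<n = >⇒∤ r<n

  ∤-double : ∀ {n} δ i → n ≡ suc (2 ℕ.* δ) → ¬ n ∣ i → ¬ n ∣ 2 ℕ.* i
  ∤-double {n} δ i ≡.refl n∤i n∣2i = n∤i (∣m+n∣m⇒∣n (≡.subst (n ∣_) (lemma δ i) (m∣m*n i)) (∣n⇒∣m*n δ n∣2i))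
    where
    lemma : ∀ δ i → suc (2 ℕ.* δ) ℕ.* i ≡ δ ℕ.* (2 ℕ.* i) ℕ.+ i
    lemma = solve-∀

  ∤-quadruple : ∀ {n} δ i → n ≡ suc (2 ℕ.* δ) → ¬ n ∣ i → ¬ n ∣ 4 ℕ.* i
  ∤-quadruple {n} δ i n≡ n∤i n∣4i = ∤-double δ (2 ℕ.* i) n≡ (∤-double δ i n≡ n∤i) (≡.subst (n ∣_) (lemma i) n∣4i)
    where
    lemma : ∀ i → 4 ℕ.* i ≡ 2 ℕ.* (2 ℕ.* i)
    lemma = solve-∀

  -- n = 2δ + 1 is odd and 4μ + 1 is the least multiple of n congruent to 1 modulo 4.
  module PeriodicSums {F : Field} {Q : GenericElement F} {n : ℕ} (L : LocalRing F Q n)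
    (δ μ g : ℕ) (n≡ : n ≡ suc (2 ℕ.* δ)) (4μ+1≡ : 4 ℕ.* μ ℕ.+ 1 ≡ n ℕ.* g) (μ<n : μ < n) where

    open FieldProperties F
    open GenericElement Q
    open QProperties F Q
    open Series F Q
    open PlainSeries F Q
    open Nodes F q
    open LocalRing L
    open LocalProperties L hiding (divides)
    open LocalProperties L using () renaming (divides to divided)

    ∤-2+2j : ∀ j → ¬ n ∣ suc j → ¬ n ∣ 2 ℕ.+ 2 ℕ.* j
    ∤-2+2j j n∤ = ≡.subst (λ i → ¬ n ∣ i) (ℕ.*-suc 2 j) (∤-double δ (suc j) n≡ n∤)

    ∤-4+4j : ∀ j → ¬ n ∣ suc j → ¬ n ∣ 4 ℕ.+ 4 ℕ.* j
    ∤-4+4j j n∤ = ≡.subst (λ i → ¬ n ∣ i) (ℕ.*-suc 4 j) (∤-quadruple δ (suc j) n≡ n∤)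

    Unit-baseDen : ∀ j → ¬ n ∣ suc j → Unit (baseDen j)
    Unit-baseDen j n∤ = Unit-*
      (Unit-^ 3 (Unit-E (4 ℕ.* j ℕ.+ 4) (≡.subst (λ i → ¬ n ∣ i) (ℕ.+-comm 4 (4 ℕ.* j)) (∤-4+4j j n∤))))
      (Unit-^ 2 (Unit-E (2 ℕ.* j ℕ.+ 2) (≡.subst (λ i → ¬ n ∣ i) (ℕ.+-comm 2 (2 ℕ.* j)) (∤-2+2j j n∤))))

    Int-baseNum : ∀ j → Int (baseNum j)
    Int-baseNum j = Int-* (Int-power 2) (Int-* (Int-* a a) (Int-* (Int-* b b) (Int-E (4 ℕ.* j ℕ.+ 2))))
      where
      a = Int-E (2 ℕ.* j ℕ.+ 1)
      b = Int-E (4 ℕ.* j ℕ.+ 1)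

    Int-base : ∀ j → ¬ n ∣ suc j → Int (base j)
    Int-base j n∤ = Int-÷ (Int-baseNum j) (Unit-baseDen j n∤)

    small : ∀ {j r} → j < r → r < n → ¬ n ∣ suc j
    small j<r r<n = ∤-small (s≤s z≤n) (ℕ.≤-<-trans j<r r<n)

    Multiple : K → Set
    Multiple x = Σ K λ w → Int w × x ≈ E n * w

    E-Multiple : ∀ {i} l → i ≡ n ℕ.* l → Multiple (E i)
    E-Multiple l ≡.refl = E-multiple l

    Multiple⇒Div : ∀ {x} → Multiple x → Div 1 x
    Multiple⇒Div (w , Int-w , e) = Div-resp (sym e) (Div-*ʳ Div-E-period Int-w)

    -- Offset δ supplies three multiples of E n, from the squared factor with exponent 2j + 1 and
    -- the factor with exponent 4j + 2; offset μ supplies two, from the squared factor with exponent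
    -- 4j + 1. Powers of E n and not of φ are recorded because they are to be cancelled through
    -- `Int-ratio`.
    window : ∀ l k → δ < k → μ < k → Σ K λ w → Int w × prod (λ j → baseNum (n ℕ.* l ℕ.+ j)) k ≈ E n ^ 5 * w
    window l k δ<k μ<k with
        Int-prod-factor {λ j → E (2 ℕ.* (n ℕ.* l ℕ.+ j) ℕ.+ 1)} k δ (λ j _ → Int-E (2 ℕ.* (n ℕ.* l ℕ.+ j) ℕ.+ 1)) δ<k (E-Multiple (2 ℕ.* l ℕ.+ 1) (≡.trans (e₁ (n ℕ.* l) δ) (≡.trans (≡.cong (2 ℕ.* (n ℕ.* l) ℕ.+_) (≡.sym n≡)) (e₁′ n l))))
      | Int-prod-factor {λ j → E (4 ℕ.* (n ℕ.* l ℕ.+ j) ℕ.+ 1)} k μ (λ j _ → Int-E (4 ℕ.* (n ℕ.* l ℕ.+ j) ℕ.+ 1)) μ<k (E-Multiple (4 ℕ.* l ℕ.+ g) (≡.trans (e₂ (n ℕ.* l) μ) (≡.trans (≡.cong (4 ℕ.* (n ℕ.* l) ℕ.+_) 4μ+1≡) (e₂′ n l g))))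
      | Int-prod-factor {λ j → E (4 ℕ.* (n ℕ.* l ℕ.+ j) ℕ.+ 2)} k δ (λ j _ → Int-E (4 ℕ.* (n ℕ.* l ℕ.+ j) ℕ.+ 2)) δ<k (E-Multiple (4 ℕ.* l ℕ.+ 2) (≡.trans (e₃ (n ℕ.* l) δ) (≡.trans (≡.cong (λ x → 4 ℕ.* (n ℕ.* l) ℕ.+ 2 ℕ.* x) (≡.sym n≡)) (e₃′ n l))))
      where
      e₁ : ∀ a δ → 2 ℕ.* (a ℕ.+ δ) ℕ.+ 1 ≡ 2 ℕ.* a ℕ.+ suc (2 ℕ.* δ)
      e₁ = solve-∀
      e₁′ : ∀ n l → 2 ℕ.* (n ℕ.* l) ℕ.+ n ≡ n ℕ.* (2 ℕ.* l ℕ.+ 1)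
      e₁′ = solve-∀
      e₂ : ∀ a μ → 4 ℕ.* (a ℕ.+ μ) ℕ.+ 1 ≡ 4 ℕ.* a ℕ.+ (4 ℕ.* μ ℕ.+ 1)
      e₂ = solve-∀
      e₂′ : ∀ n l g → 4 ℕ.* (n ℕ.* l) ℕ.+ n ℕ.* g ≡ n ℕ.* (4 ℕ.* l ℕ.+ g)
      e₂′ = solve-∀
      e₃ : ∀ a δ → 4 ℕ.* (a ℕ.+ δ) ℕ.+ 2 ≡ 4 ℕ.* a ℕ.+ 2 ℕ.* suc (2 ℕ.* δ)
      e₃ = solve-∀
      e₃′ : ∀ n l → 4 ℕ.* (n ℕ.* l) ℕ.+ 2 ℕ.* n ≡ n ℕ.* (4 ℕ.* l ℕ.+ 2)
      e₃′ = solve-∀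
    ... | wa , Int-wa , ea | wb , Int-wb , eb | wc , Int-wc , ec =
      P * ((wa * wa) * ((wb * wb) * wc)) ,
      Int-* (Int-prod k (λ _ _ → Int-power 2)) (Int-* (Int-* Int-wa Int-wa) (Int-* (Int-* Int-wb Int-wb) Int-wc)) ,
      (begin
        prod (λ j → baseNum (n ℕ.* l ℕ.+ j)) k
          ≈⟨ trans (prod-* (λ _ → q ^ 2) _ k) (*-congˡ (trans (prod-* (λ j → a j * a j) _ k) (*-cong (prod-* a a k) (trans (prod-* (λ j → b j * b j) c k) (*-congʳ (prod-* b b k)))))) ⟩
        P * ((prod a k * prod a k) * ((prod b k * prod b k) * prod c k))
          ≈⟨ *-congˡ (*-cong (*-cong ea ea) (*-cong (*-cong eb eb) ec)) ⟩
        P * ((E n * wa * (E n * wa)) * ((E n * wb * (E n * wb)) * (E n * wc)))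
          ≈⟨ solve 5 (λ P e a b c → P :* ((e :* a :* (e :* a)) :* ((e :* b :* (e :* b)) :* (e :* c))) := e :^ 5 :* (P :* ((a :* a) :* ((b :* b) :* c)))) ≡.refl P (E n) wa wb wc ⟩
        E n ^ 5 * (P * ((wa * wa) * ((wb * wb) * wc))) ∎)
      where
      P = prod (λ _ → q ^ 2) k
      a b c : ℕ → K
      a j = E (2 ℕ.* (n ℕ.* l ℕ.+ j) ℕ.+ 1)
      b j = E (4 ℕ.* (n ℕ.* l ℕ.+ j) ℕ.+ 1)
      c j = E (4 ℕ.* (n ℕ.* l ℕ.+ j) ℕ.+ 2)

    prod-base : ∀ l k → prod (λ j → base (n ℕ.* l ℕ.+ j)) k ≈
      prod (λ j → baseNum (n ℕ.* l ℕ.+ j)) k * prod (λ j → baseDen (n ℕ.* l ℕ.+ j) ⁻¹) k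
    prod-base l k = prod-* (λ j → baseNum (n ℕ.* l ℕ.+ j)) (λ j → baseDen (n ℕ.* l ℕ.+ j) ⁻¹) k

    ∤-block : ∀ l {j k} → j < k → k < n → ¬ n ∣ suc (n ℕ.* l ℕ.+ j)
    ∤-block l {j} j<k k<n n∣ = small j<k k<n (∣m+n∣m⇒∣n (≡.subst (n ∣_) (≡.sym (ℕ.+-suc (n ℕ.* l) j)) n∣) (m∣m*n l))

    -- Inside the first block the denominators are units, so all five numerator factors from
    -- `window` survive. This is what makes the two upper limits of the theorem interchangeable
    -- modulo Φₙ⁵.
    Div-base⁵ : ∀ k → δ < k → μ < k → k < n → Div 5 (prod base k)
    Div-base⁵ k δ<k μ<k k<n = Div-resp prod≈
      (Div-*ʳ (Div-*ʳ (Div-^ 5 Div-E-period) (proj₁ (proj₂ W)))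
              (Int-prod k (λ j j<k → int⁻¹ (Unit-baseDen (n ℕ.* 0 ℕ.+ j) (∤-block 0 j<k k<n)))))
      where
      W = window 0 k δ<k μ<k
      D = prod (λ j → baseDen (n ℕ.* 0 ℕ.+ j) ⁻¹) k
      prod≈ : E n ^ 5 * proj₁ W * D ≈ prod base k
      prod≈ = begin
        E n ^ 5 * proj₁ W * D                      ≈⟨ *-congʳ (proj₂ (proj₂ W)) ⟨
        prod (λ j → baseNum (n ℕ.* 0 ℕ.+ j)) k * D ≈⟨ prod-base 0 k ⟨
        prod (λ j → base (n ℕ.* 0 ℕ.+ j)) k        ≈⟨ prod-cong k (λ j _ → reflexive (≡.cong (λ z → base (z ℕ.+ j)) (ℕ.*-zeroʳ n))) ⟩
        prod base k                                ∎

    -- In a full block only the last index has a denominator that is no unit, with three factors of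
    -- exponent n(4l + 4) and two of exponent n(2l + 2). The five numerator factors from `window`
    -- compensate them.
    Int-block : ∀ l → Int (prod (λ j → base (n ℕ.* l ℕ.+ j)) n)
    Int-block l = Int-resp (sym block≈)
      (Int-* (Int-* (Int-^ 3 (Int-ratio (3 ℕ.+ 4 ℕ.* l))) (Int-^ 2 (Int-ratio (1 ℕ.+ 2 ℕ.* l))))
             (Int-* (proj₁ (proj₂ W)) (Int-prod (2 ℕ.* δ) (λ j j<k → int⁻¹ (Unit-baseDen (n ℕ.* l ℕ.+ j) (∤-block l j<k 2δ<n))))))
      where
      W = window l n (≡.subst (δ <_) (≡.sym n≡) (s≤s (ℕ.m≤m+n δ _))) μ<n
      w = proj₁ W
      D : ℕ → K
      D j = baseDen (n ℕ.* l ℕ.+ j) ⁻¹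
      2δ<n : 2 ℕ.* δ < n
      2δ<n = ≡.subst (2 ℕ.* δ <_) (≡.sym n≡) ℕ.≤-refl
      E₄ = E (n ℕ.* suc (3 ℕ.+ 4 ℕ.* l))
      E₂ = E (n ℕ.* suc (1 ℕ.+ 2 ℕ.* l))
      e₄ : 4 ℕ.* (n ℕ.* l ℕ.+ 2 ℕ.* δ) ℕ.+ 4 ≡ n ℕ.* suc (3 ℕ.+ 4 ℕ.* l)
      e₄ = ≡.trans (lemma (n ℕ.* l) δ) (≡.trans (≡.cong (λ x → 4 ℕ.* (n ℕ.* l) ℕ.+ 4 ℕ.* x) (≡.sym n≡)) (lemma′ n l))
        where
        lemma : ∀ a δ → 4 ℕ.* (a ℕ.+ 2 ℕ.* δ) ℕ.+ 4 ≡ 4 ℕ.* a ℕ.+ 4 ℕ.* suc (2 ℕ.* δ)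
        lemma = solve-∀
        lemma′ : ∀ n l → 4 ℕ.* (n ℕ.* l) ℕ.+ 4 ℕ.* n ≡ n ℕ.* suc (3 ℕ.+ 4 ℕ.* l)
        lemma′ = solve-∀
      e₂ : 2 ℕ.* (n ℕ.* l ℕ.+ 2 ℕ.* δ) ℕ.+ 2 ≡ n ℕ.* suc (1 ℕ.+ 2 ℕ.* l)
      e₂ = ≡.trans (lemma (n ℕ.* l) δ) (≡.trans (≡.cong (λ x → 2 ℕ.* (n ℕ.* l) ℕ.+ 2 ℕ.* x) (≡.sym n≡)) (lemma′ n l))
        where
        lemma : ∀ a δ → 2 ℕ.* (a ℕ.+ 2 ℕ.* δ) ℕ.+ 2 ≡ 2 ℕ.* a ℕ.+ 2 ℕ.* suc (2 ℕ.* δ)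
        lemma = solve-∀
        lemma′ : ∀ n l → 2 ℕ.* (n ℕ.* l) ℕ.+ 2 ℕ.* n ≡ n ℕ.* suc (1 ℕ.+ 2 ℕ.* l)
        lemma′ = solve-∀
      E₄≉0 : NonZero E₄
      E₄≉0 = NonZero-resp (reflexive (≡.cong E e₄)) (E-suc≉0 (4 ℕ.* (n ℕ.* l ℕ.+ 2 ℕ.* δ)) 3)
      E₂≉0 : NonZero E₂
      E₂≉0 = NonZero-resp (reflexive (≡.cong E e₂)) (E-suc≉0 (2 ℕ.* (n ℕ.* l ℕ.+ 2 ℕ.* δ)) 1)
      last : D (2 ℕ.* δ) ≈ (E₄ ⁻¹) ^ 3 * (E₂ ⁻¹) ^ 2
      last = trans (⁻¹-cong (*-cong (^-congˡ 3 (reflexive (≡.cong E e₄))) (^-congˡ 2 (reflexive (≡.cong E e₂)))))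
        (sym (⁻¹-unique (*-NonZero (^-NonZero 3 E₄≉0) (^-NonZero 2 E₂≉0)) (begin
          E₄ ^ 3 * E₂ ^ 2 * ((E₄ ⁻¹) ^ 3 * (E₂ ⁻¹) ^ 2)
            ≈⟨ solve 4 (λ a b i j → a :^ 3 :* b :^ 2 :* (i :^ 3 :* j :^ 2) := (a :* i) :^ 3 :* (b :* j) :^ 2) ≡.refl E₄ E₂ _ _ ⟩
          (E₄ * E₄ ⁻¹) ^ 3 * (E₂ * E₂ ⁻¹) ^ 2
            ≈⟨ *-cong (^-congˡ 3 (⁻¹-inverse E₄≉0)) (^-congˡ 2 (⁻¹-inverse E₂≉0)) ⟩
          1# ^ 3 * 1# ^ 2
            ≈⟨ solve 0 (:1 :^ 3 :* :1 :^ 2 := :1) ≡.refl ⟩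
          1# ∎)))
      block≈ : prod (λ j → base (n ℕ.* l ℕ.+ j)) n ≈ (E n ÷ E₄) ^ 3 * (E n ÷ E₂) ^ 2 * (w * prod D (2 ℕ.* δ))
      block≈ = begin
        prod (λ j → base (n ℕ.* l ℕ.+ j)) n
          ≈⟨ prod-base l n ⟩
        prod (λ j → baseNum (n ℕ.* l ℕ.+ j)) n * prod D n
          ≈⟨ *-cong (proj₂ (proj₂ W)) (reflexive (≡.cong (prod D) n≡)) ⟩
        E n ^ 5 * w * (prod D (2 ℕ.* δ) * D (2 ℕ.* δ))
          ≈⟨ *-congˡ (*-congˡ last) ⟩
        E n ^ 5 * w * (prod D (2 ℕ.* δ) * ((E₄ ⁻¹) ^ 3 * (E₂ ⁻¹) ^ 2))
          ≈⟨ solve 5 (λ e w p i j → e :^ 5 :* w :* (p :* (i :^ 3 :* j :^ 2)) := (e :* i) :^ 3 :* (e :* j) :^ 2 :* (w :* p)) ≡.refl (E n) w _ (E₄ ⁻¹) (E₂ ⁻¹) ⟩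
        (E n ÷ E₄) ^ 3 * (E n ÷ E₂) ^ 2 * (w * prod D (2 ℕ.* δ)) ∎

    Int-prod-base : ∀ l → Int (prod base (n ℕ.* l))
    Int-prod-base zero    = Int-resp (reflexive (≡.cong (prod base) (≡.sym (ℕ.*-zeroʳ n)))) Int-1
    Int-prod-base (suc l) = Int-resp
      (sym (trans (reflexive (≡.cong (prod base) (≡.trans (ℕ.*-suc n l) (ℕ.+-comm n _)))) (prod-split base (n ℕ.* l) n)))
      (Int-* (Int-prod-base l) (Int-block l))

    open Extend point φ Int-φ
    open Mem′
    open Family extend

    -- A cube with one direction of step φ: its end `false` is the first block, its end `true` the
    -- block that starts at nl. Each 1 - q^(cj+e) changes between them by a multiple of φ, hence so
    -- does everything built from these.
    module Block (l : ℕ) where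

      at : Bool × ⊤ → ℕ → ℕ
      at (b , _) j = if b then n ℕ.* l ℕ.+ j else j

      E-Mem : ∀ c e j → Mem (λ p → E (c ℕ.* at p j ℕ.+ e))
      E-Mem c e j = member {slope = λ _ → a * (ψ * w)} (Int-E (c ℕ.* j ℕ.+ e))
        (Int-* (Int-power (c ℕ.* j ℕ.+ e)) (Int-* (proj₁ (proj₂ E-period)) (proj₁ (proj₂ W)))) (λ _ → begin
        1# - q ^ (c ℕ.* (n ℕ.* l ℕ.+ j) ℕ.+ e)
          ≈⟨ +-congˡ (-‿cong (trans (^-congʳ q (lemma c n l j e)) (^-homo-* q (c ℕ.* j ℕ.+ e) (n ℕ.* (c ℕ.* l))))) ⟩
        1# - a * q ^ (n ℕ.* (c ℕ.* l))
          ≈⟨ solve 2 (λ a x → :1 :- a :* x := (:1 :- a) :+ a :* (:1 :- x)) ≡.refl a _ ⟩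
        (1# - a) + a * E (n ℕ.* (c ℕ.* l))
          ≈⟨ +-congˡ (*-congˡ (trans (proj₂ (proj₂ W)) (*-congʳ (proj₂ (proj₂ E-period))))) ⟩
        (1# - a) + a * (φ * ψ * w)
          ≈⟨ +-congˡ (solve 4 (λ a f s w → a :* (f :* s :* w) := f :* (a :* (s :* w))) ≡.refl a φ ψ w) ⟩
        (1# - a) + φ * (a * (ψ * w)) ∎)
        where
        ψ = proj₁ E-period
        W = E-multiple (c ℕ.* l)
        w = proj₁ W
        a = q ^ (c ℕ.* j ℕ.+ e)
        lemma : ∀ c n l j e → c ℕ.* (n ℕ.* l ℕ.+ j) ℕ.+ e ≡ (c ℕ.* j ℕ.+ e) ℕ.+ n ℕ.* (c ℕ.* l)
        lemma = solve-∀

      Unit-at : ∀ {j k} → j < k → k < n → ∀ p → Unit (baseDen (at p j))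
      Unit-at j<k k<n (false , _) = Unit-baseDen _ (small j<k k<n)
      Unit-at j<k k<n (true , _)  = Unit-baseDen _ (∤-block l j<k k<n)

      localTerm : Bool × ⊤ → ℕ → K
      localTerm p r = E (6 ℕ.* at p r ℕ.+ 1) * prod (λ j → base (at p j)) r

      localTerm-Mem : ∀ r → r < n → Mem (λ p → localTerm p r)
      localTerm-Mem r r<n = Mem-* (E-Mem 6 1 r) (Mem-prod r (λ j j<r → Mem-÷
        (Mem-* (Mem-const (Int-power 2)) (Mem-* (Mem-* (E-Mem 2 1 j) (E-Mem 2 1 j)) (Mem-* (Mem-* (E-Mem 4 1 j) (E-Mem 4 1 j)) (E-Mem 4 2 j))))
        (Mem-* (Mem-^ 3 (E-Mem 4 4 j)) (Mem-^ 2 (E-Mem 2 2 j)))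
        (Unit-at j<r r<n)))

      -- The block is the integral prefactor `prod base (n l)` times a sum congruent modulo φ to the
      -- first R terms of the series.
      Div-block : ∀ R → R ≤ n → Div 1 (sum term R) → Div 1 (sum (λ r → term (n ℕ.* l ℕ.+ r)) R)
      Div-block R R≤n div = Div-resp (sym block≈)
        (Div-*ˡ (Int-prod-base l) (Div-+ div (divided (slope-Mem M) (*-congʳ (sym (*-identityʳ φ))))))
        where
        M : Mem′ (λ p → sum (localTerm p) R)
        M = Mem-sum R (λ r r<R → localTerm-Mem r (ℕ.<-≤-trans r<R R≤n))
        block≈ : sum (λ r → term (n ℕ.* l ℕ.+ r)) R ≈ prod base (n ℕ.* l) * (sum term R + φ * slope M tt)
        block≈ = begin
          sum (λ r → term (n ℕ.* l ℕ.+ r)) R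
            ≈⟨ sum-cong R (λ r _ → trans (*-cong (κ≈ (n ℕ.* l ℕ.+ r)) (prod-split base (n ℕ.* l) r)) (*-swapˡ _ _ _)) ⟩
          sum (λ r → prod base (n ℕ.* l) * localTerm (true , tt) r) R
            ≈⟨ sum-*ˡ _ _ R ⟩
          prod base (n ℕ.* l) * sum (localTerm (true , tt)) R
            ≈⟨ *-congˡ (increment M tt) ⟩
          prod base (n ℕ.* l) * (sum (localTerm (false , tt)) R + φ * slope M tt)
            ≈⟨ *-congˡ (+-congʳ (sum-cong R (λ r _ → *-congʳ (κ≈ r)))) ⟨
          prod base (n ℕ.* l) * (sum term R + φ * slope M tt) ∎

    sum-extend : ∀ {f} a b → a ≤ b → (∀ r → a ≤ r → r < b → Div 1 (f r)) → Div 1 (sum f b - sum f a)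
    sum-extend {f} a b a≤b p = Div-resp (begin
      sum (λ i → f (a ℕ.+ i)) (b ℕ.∸ a)
        ≈⟨ solve 2 (λ x y → y := x :+ y :- x) ≡.refl (sum f a) _ ⟩
      sum f a + sum (λ i → f (a ℕ.+ i)) (b ℕ.∸ a) - sum f a
        ≈⟨ +-congʳ (sum-split f a (b ℕ.∸ a)) ⟨
      sum f (a ℕ.+ (b ℕ.∸ a)) - sum f a
        ≡⟨ ≡.cong (λ k → sum f k - sum f a) (ℕ.m+[n∸m]≡n a≤b) ⟩
      sum f b - sum f a ∎)
      (Div-sum (b ℕ.∸ a) (λ i i< → p (a ℕ.+ i) (ℕ.m≤m+n a i)
        (≡.subst (a ℕ.+ i <_) (ℕ.m+[n∸m]≡n a≤b) (ℕ.+-monoʳ-< a i<))))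

    -- The numerator factor at index δ contains E n and the one at index μ contains E (4μ + 1), a
    -- multiple of E n; either suffices, the denominators being units for r < n.
    Div-term : ∀ r → δ < r ⊎ μ < r → r < n → Div 1 (term r)
    Div-term r late r<n = Div-*ˡ (Int-resp (sym (κ≈ r)) (Int-E (6 ℕ.* r ℕ.+ 1))) (Multiple⇒Div (go late))
      where
      factor : ∀ j → ¬ n ∣ suc j → Multiple (baseNum j) → Multiple (base j)
      factor j n∤ (w , Int-w , e) = w ÷ baseDen j , Int-÷ Int-w (Unit-baseDen j n∤) , trans (*-congʳ e) (*-assoc _ _ _)
      go : δ < r ⊎ μ < r → Multiple (prod base r)
      go (inj₁ δ<r) = Int-prod-factor r δ (λ j j<r → Int-base j (small j<r r<n)) δ<r (factor δ (small δ<r r<n)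
        (let w , Int-w , e = E-Multiple 1 (≡.trans (lemma δ) (≡.trans (≡.sym n≡) (≡.sym (ℕ.*-identityʳ n)))) in
         _ , Int-* (Int-* Int-w (Int-* (Int-E (2 ℕ.* δ ℕ.+ 1)) (Int-* (Int-* (Int-E (4 ℕ.* δ ℕ.+ 1)) (Int-E (4 ℕ.* δ ℕ.+ 1))) (Int-E (4 ℕ.* δ ℕ.+ 2))))) (Int-power 2) ,
         trans (*-congˡ (*-congʳ (*-congʳ e)))
           (solve 5 (λ q n w a b → q :* ((n :* w :* a) :* b) := n :* (w :* (a :* b) :* q)) ≡.refl (q ^ 2) (E n) w (E (2 ℕ.* δ ℕ.+ 1)) _)))
        where
        lemma : ∀ δ → 2 ℕ.* δ ℕ.+ 1 ≡ suc (2 ℕ.* δ)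
        lemma = solve-∀
      go (inj₂ μ<r) = Int-prod-factor r μ (λ j j<r → Int-base j (small j<r r<n)) μ<r (factor μ (small μ<r r<n)
        (let w , Int-w , e = E-Multiple g 4μ+1≡ in
         _ , Int-* (Int-* Int-w (Int-* (Int-* (Int-E (4 ℕ.* μ ℕ.+ 1)) (Int-E (4 ℕ.* μ ℕ.+ 2))) (Int-* (Int-E (2 ℕ.* μ ℕ.+ 1)) (Int-E (2 ℕ.* μ ℕ.+ 1))))) (Int-power 2) ,
         trans (*-congˡ (*-congˡ (*-congʳ (*-congʳ e))))
           (solve 6 (λ q n w a b c → q :* (c :* ((n :* w :* a) :* b)) := n :* (w :* ((a :* b) :* c) :* q)) ≡.refl (q ^ 2) (E n) w (E (4 ℕ.* μ ℕ.+ 1)) (E (4 ℕ.* μ ℕ.+ 2)) _)))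

    -- On the first block the series is congruent to the one with b = q^(4μ+1), which has a closed form.
    Div-sum-μ : Div 1 (sum term (suc μ))
    Div-sum-μ = Div-resp sum≈
      (Div-- (Div-*ʳ (Multiple⇒Div (E-Multiple g 4μ+1≡)) (Int-prod μ Int-η))
             (divided (slope-Mem M) (*-congʳ (sym (*-identityʳ φ)))))
      where
      n′ = 4 ℕ.* μ ℕ.+ 1
      n∣n′ : n ∣ n′
      n∣n′ = ≡.subst (n ∣_) (≡.sym 4μ+1≡) (m∣m*n g)
      step : Div 1 (symm n′ - symm 0)
      step = Div-resp (sym (*-cancelˡ (^-NonZero n′ q≉0) (begin
        y * (symm n′ - symm 0)                 ≈⟨ distribˡ y _ _ ⟩
        y * symm n′ + y * - symm 0             ≈⟨ +-cong (symm-* n′) (*-congˡ (-‿cong symm-0)) ⟩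
        y ^ 2 + 1# + y * - 2#                  ≈⟨ solve 1 (λ y → y :^ 2 :+ :1 :+ y :* :- (:1 :+ :1) := :1 :* ((:1 :- y) :* (:1 :- y))) ≡.refl y ⟩
        1# * (E n′ * E n′)                     ≈⟨ *-congʳ (⁻¹-inverse (^-NonZero n′ q≉0)) ⟨
        y * y ⁻¹ * (E n′ * E n′)               ≈⟨ solve 3 (λ y i e → y :* i :* (e :* e) := y :* (e :* (e :* i))) ≡.refl y (y ⁻¹) (E n′) ⟩
        y * (E n′ * (E n′ * y ⁻¹))             ∎)))
        (Div-*ʳ (Multiple⇒Div (E-Multiple g 4μ+1≡)) (Int-* (Int-E n′) (int⁻¹ (Unit-power (q-power n′)))))
        where y = q ^ n′
      t : Bool × ⊤ → K
      t (b , _) = if b then symm n′ else symm 0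
      t-Mem : Mem t
      t-Mem = member {slope = λ _ → quotient step} (Int-symm 0) (int-quotient step) (λ _ → begin
        symm n′                             ≈⟨ solve 2 (λ a b → a := b :+ (a :- b)) ≡.refl (symm n′) (symm 0) ⟩
        symm 0 + (symm n′ - symm 0)         ≈⟨ +-congˡ (trans (equality step) (*-congʳ (*-identityʳ φ))) ⟩
        symm 0 + φ * quotient step          ∎)
      Int-X : ∀ j → Int (X j)
      Int-X j = Int-resp (sym (≈power (X-isPower j))) (Int-power (2 ℕ.* j))
      Unit-den : ∀ j → suc j < n → ∀ p → Unit (den₁ (symm 0) (t p) (X j))
      Unit-den j j+1<n p = Unit-*
        (Unit-* (Unit-resp (sym (E-power (4 ℕ.+ 4 ℕ.* j) 4+4j)) (Unit-E (4 ℕ.+ 4 ℕ.* j) n∤4))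
                (Unit-quad 0 _ 1-isPower 4+4j (n ∣0) (n ∣0) n∤4))
        (last p)
        where
        n∤ = ∤-small (s≤s z≤n) j+1<n
        n∤4 = ∤-4+4j j n∤
        4+4j = *-isPower (q-power 4) (X² j)
        last : ∀ p → Unit (quad (t p) 1# (q ^ 2 * X j))
        last (false , _) = Unit-quad 0 _ 1-isPower (*-isPower (q-power 2) (X-isPower j)) (n ∣0) (n ∣0) (∤-2+2j j n∤)
        last (true , _)  = Unit-quad n′ _ 1-isPower (*-isPower (q-power 2) (X-isPower j)) n∣n′ (n ∣0) (∤-2+2j j n∤)
      weight₁-Mem : ∀ k → k < suc μ → Mem (λ p → weight₁ (symm 0) (t p) k)
      weight₁-Mem k k<1+μ = Mem-prod k (λ j j<k → Mem-÷
        (Mem-* (Mem-* (Mem-const (Int-* (Int-power 2) (Int-quad (Int-symm 0) Int-1 (Int-* Int-q (Int-X j)))))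
                      (Mem-quad t-Mem (Mem-const Int-1) (Mem-const (Int-* Int-q (Int-^ 2 (Int-X j))))))
               (Mem-const (Int-- Int-1 (Int-* (Int-power 2) (Int-^ 2 (Int-X j))))))
        (Mem-* (Mem-const (Int-* (Int-- Int-1 (Int-* (Int-power 4) (Int-^ 2 (Int-X j)))) (Int-quad (Int-symm 0) Int-1 (Int-* (Int-power 4) (Int-^ 2 (Int-X j))))))
               (Mem-quad t-Mem (Mem-const Int-1) (Mem-const (Int-* (Int-power 2) (Int-X j)))))
        (Unit-den j (ℕ.≤-<-trans (ℕ.≤-trans j<k (ℕ.≤-pred k<1+μ)) μ<n)))
      series-Mem : ∀ k → k < suc μ → Mem (λ p → κ (X k) * weight₁ (symm 0) (t p) k)
      series-Mem k k<1+μ = Mem-* (Mem-const (Int-resp (sym (κ≈ k)) (Int-E (6 ℕ.* k ℕ.+ 1)))) (weight₁-Mem k k<1+μ)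
      M : Mem′ (λ p → sum (λ k → κ (X k) * weight₁ (symm 0) (t p) k) (suc μ))
      M = Mem-sum (suc μ) series-Mem
      Int-η : ∀ i → i < μ → Int (η (symm 0) i)
      Int-η i i<μ = Int-÷ (Int-quad (Int-symm 0) Int-1 (Int-power (4 ℕ.* i ℕ.+ 2)))
        (Unit-quad 0 _ 1-isPower (q-power (4 ℕ.* i ℕ.+ 4)) (n ∣0) (n ∣0)
          (≡.subst (λ e → ¬ n ∣ e) (ℕ.+-comm 4 (4 ℕ.* i)) (∤-4+4j i (small i<μ μ<n))))
      sum≈ : closedForm (symm 0) μ - φ * slope M tt ≈ sum term (suc μ)
      sum≈ = begin
        closedForm (symm 0) μ - φ * slope M tt
          ≈⟨ +-congʳ (Family₁.family₁ μ (symm 0) admissible-0) ⟨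
        series (symm 0) (symm n′) 1# (suc μ) - φ * slope M tt
          ≈⟨ +-congʳ (series-cong (suc μ) _ (λ k _ → weight₁≈ (symm 0) (symm n′) k (λ j _ → Family₁.weightDen≉0′ μ (symm 0) admissible-0 j))) ⟩
        sum (λ k → κ (X k) * weight₁ (symm 0) (symm n′) k) (suc μ) - φ * slope M tt
          ≈⟨ +-congʳ (increment M tt) ⟩
        sum (λ k → κ (X k) * weight₁ (symm 0) (symm 0) k) (suc μ) + φ * slope M tt - φ * slope M tt
          ≈⟨ solve 2 (λ a b → a :+ b :- b := a) ≡.refl _ (φ * slope M tt) ⟩
        sum (λ k → κ (X k) * weight₁ (symm 0) (symm 0) k) (suc μ)
          ≈⟨ sum-cong (suc μ) (λ k _ → *-congˡ (weight₁≈base k)) ⟩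
        sum term (suc μ) ∎

    -- The closed form controls the first μ + 1 terms. Between μ + 1 and R, in whichever order they
    -- come, all terms are divisible by φ: they lie beyond μ in one case and beyond δ in the other.
    Div-sum-first : ∀ R → R ≤ n → δ < R → Div 1 (sum term R)
    Div-sum-first R R≤n δ<R with ℕ.≤-total (suc μ) R
    ... | inj₁ μ<R = Div-resp (solve 2 (λ a b → a :- b :+ b := a) ≡.refl _ _)
      (Div-+ (sum-extend (suc μ) R μ<R (λ r μ<r r<R → Div-term r (inj₂ μ<r) (ℕ.<-≤-trans r<R R≤n))) Div-sum-μ)
    ... | inj₂ R≤1+μ = Div-resp (solve 2 (λ a b → b :- (b :- a) := a) ≡.refl _ _)
      (Div-- Div-sum-μ (sum-extend R (suc μ) R≤1+μ (λ r R≤r r<1+μ → Div-term r (inj₁ (ℕ.<-≤-trans δ<R R≤r)) (ℕ.≤-<-trans (ℕ.≤-pred r<1+μ) μ<n))))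

    Div-sum-blocks : ∀ l → Div 1 (sum term (n ℕ.* l))
    Div-sum-blocks zero    = Div-resp (reflexive (≡.cong (sum term) (≡.sym (ℕ.*-zeroʳ n)))) (Div-0 1)
    Div-sum-blocks (suc l) = Div-resp
      (sym (trans (reflexive (≡.cong (sum term) (≡.trans (ℕ.*-suc n l) (ℕ.+-comm n _)))) (sum-split term (n ℕ.* l) n)))
      (Div-+ (Div-sum-blocks l) (Block.Div-block l n ℕ.≤-refl
        (Div-sum-first n ℕ.≤-refl (≡.subst (δ <_) (≡.sym n≡) (s≤s (ℕ.m≤m+n δ _))))))

    Div-sum-half : ∀ l → Div 1 (sum term (n ℕ.* l ℕ.+ suc δ))
    Div-sum-half l = Div-resp (sym (sum-split term (n ℕ.* l) (suc δ)))
      (Div-+ (Div-sum-blocks l) (Block.Div-block l (suc δ) δ<n (Div-sum-first (suc δ) δ<n ℕ.≤-refl)))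
      where
      δ<n : suc δ ≤ n
      δ<n = ≡.subst (δ <_) (≡.sym n≡) (s≤s (ℕ.m≤m+n δ _))

    -- The square root of `η (symm 0)`. Its products are integral for the same reason as those of
    -- `base`: one zero of the numerator, at offset δ, against one zero of the denominator, at the
    -- end of the block.
    ratio₂ : ℕ → K
    ratio₂ j = E (4 ℕ.* j ℕ.+ 2) ÷ E (4 ℕ.* j ℕ.+ 4)

    Int-ratio₂ : ∀ j → ¬ n ∣ suc j → Int (ratio₂ j)
    Int-ratio₂ j n∤ = Int-÷ (Int-E (4 ℕ.* j ℕ.+ 2))
      (Unit-E (4 ℕ.* j ℕ.+ 4) (≡.subst (λ i → ¬ n ∣ i) (ℕ.+-comm 4 (4 ℕ.* j)) (∤-4+4j j n∤)))

    Int-ratio₂-block : ∀ l → Int (prod (λ j → ratio₂ (n ℕ.* l ℕ.+ j)) n)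
    Int-ratio₂-block l = Int-resp (sym block≈)
      (Int-* (Int-ratio (3 ℕ.+ 4 ℕ.* l)) (Int-* (proj₁ (proj₂ W)) (Int-prod (2 ℕ.* δ) (λ j j<k → Int-÷ Int-1 (unit j j<k)))))
      where
      2δ<n : 2 ℕ.* δ < n
      2δ<n = ≡.subst (2 ℕ.* δ <_) (≡.sym n≡) ℕ.≤-refl
      unit : ∀ j → j < 2 ℕ.* δ → Unit (E (4 ℕ.* (n ℕ.* l ℕ.+ j) ℕ.+ 4))
      unit j j<k = Unit-E (4 ℕ.* (n ℕ.* l ℕ.+ j) ℕ.+ 4)
        (≡.subst (λ i → ¬ n ∣ i) (ℕ.+-comm 4 (4 ℕ.* (n ℕ.* l ℕ.+ j))) (∤-4+4j (n ℕ.* l ℕ.+ j) (∤-block l j<k 2δ<n)))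
      a D : ℕ → K
      a j = E (4 ℕ.* (n ℕ.* l ℕ.+ j) ℕ.+ 2)
      D j = E (4 ℕ.* (n ℕ.* l ℕ.+ j) ℕ.+ 4) ⁻¹
      W : Multiple (prod a n)
      W = Int-prod-factor {a} n δ (λ j _ → Int-E (4 ℕ.* (n ℕ.* l ℕ.+ j) ℕ.+ 2)) (≡.subst (δ <_) (≡.sym n≡) (s≤s (ℕ.m≤m+n δ _)))
        (E-Multiple (4 ℕ.* l ℕ.+ 2) (≡.trans (e₁ (n ℕ.* l) δ) (≡.trans (≡.cong (λ x → 4 ℕ.* (n ℕ.* l) ℕ.+ 2 ℕ.* x) (≡.sym n≡)) (e₂ n l))))
        where
        e₁ : ∀ a δ → 4 ℕ.* (a ℕ.+ δ) ℕ.+ 2 ≡ 4 ℕ.* a ℕ.+ 2 ℕ.* suc (2 ℕ.* δ)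
        e₁ = solve-∀
        e₂ : ∀ n l → 4 ℕ.* (n ℕ.* l) ℕ.+ 2 ℕ.* n ≡ n ℕ.* (4 ℕ.* l ℕ.+ 2)
        e₂ = solve-∀
      e₃ : 4 ℕ.* (n ℕ.* l ℕ.+ 2 ℕ.* δ) ℕ.+ 4 ≡ n ℕ.* suc (3 ℕ.+ 4 ℕ.* l)
      e₃ = ≡.trans (lemma (n ℕ.* l) δ) (≡.trans (≡.cong (λ x → 4 ℕ.* (n ℕ.* l) ℕ.+ 4 ℕ.* x) (≡.sym n≡)) (lemma′ n l))
        where
        lemma : ∀ a δ → 4 ℕ.* (a ℕ.+ 2 ℕ.* δ) ℕ.+ 4 ≡ 4 ℕ.* a ℕ.+ 4 ℕ.* suc (2 ℕ.* δ)
        lemma = solve-∀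
        lemma′ : ∀ n l → 4 ℕ.* (n ℕ.* l) ℕ.+ 4 ℕ.* n ≡ n ℕ.* suc (3 ℕ.+ 4 ℕ.* l)
        lemma′ = solve-∀
      block≈ : prod (λ j → ratio₂ (n ℕ.* l ℕ.+ j)) n ≈
        (E n ÷ E (n ℕ.* suc (3 ℕ.+ 4 ℕ.* l))) * (proj₁ W * prod (λ j → 1# ÷ E (4 ℕ.* (n ℕ.* l ℕ.+ j) ℕ.+ 4)) (2 ℕ.* δ))
      block≈ = begin
        prod (λ j → a j * D j) n
          ≈⟨ prod-* a D n ⟩
        prod a n * prod D n
          ≈⟨ *-cong (proj₂ (proj₂ W)) (reflexive (≡.cong (prod D) n≡)) ⟩
        E n * proj₁ W * (prod D (2 ℕ.* δ) * D (2 ℕ.* δ))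
          ≈⟨ *-congˡ (*-cong (prod-cong (2 ℕ.* δ) (λ j _ → sym (*-identityˡ (D j)))) (⁻¹-cong (reflexive (≡.cong E e₃)))) ⟩
        E n * proj₁ W * (prod (λ j → 1# ÷ E (4 ℕ.* (n ℕ.* l ℕ.+ j) ℕ.+ 4)) (2 ℕ.* δ) * E (n ℕ.* suc (3 ℕ.+ 4 ℕ.* l)) ⁻¹)
          ≈⟨ solve 4 (λ e w p i → e :* w :* (p :* i) := e :* i :* (w :* p)) ≡.refl (E n) (proj₁ W) _ (E (n ℕ.* suc (3 ℕ.+ 4 ℕ.* l)) ⁻¹) ⟩
        (E n ÷ E (n ℕ.* suc (3 ℕ.+ 4 ℕ.* l))) * (proj₁ W * prod (λ j → 1# ÷ E (4 ℕ.* (n ℕ.* l ℕ.+ j) ℕ.+ 4)) (2 ℕ.* δ)) ∎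

    Int-prod-ratio₂ : ∀ l r → r < n → Int (prod ratio₂ (n ℕ.* l ℕ.+ r))
    Int-prod-ratio₂ l r r<n = Int-resp (sym (prod-split ratio₂ (n ℕ.* l) r))
      (Int-* (blocks l) (Int-prod r (λ j j<r → Int-ratio₂ (n ℕ.* l ℕ.+ j) (∤-block l j<r r<n))))
      where
      blocks : ∀ l → Int (prod ratio₂ (n ℕ.* l))
      blocks zero    = Int-resp (reflexive (≡.cong (prod ratio₂) (≡.sym (ℕ.*-zeroʳ n)))) Int-1
      blocks (suc l) = Int-resp
        (sym (trans (reflexive (≡.cong (prod ratio₂) (≡.trans (ℕ.*-suc n l) (ℕ.+-comm n _)))) (prod-split ratio₂ (n ℕ.* l) n)))
        (Int-* (blocks l) (Int-ratio₂-block l))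

    -- For n ∤ a + 1 the denominator is a unit; otherwise it is some E (n (k + 1)), and `Int-ratio`
    -- applies. This lets the factor [n]² absorb the poles of the harmonic sum.
    Int-period-ratio : ∀ l a → Int (E (n ℕ.* l) ÷ E (suc a))
    Int-period-ratio l a with n ∣? suc a
    ... | no n∤a = Int-÷ (Int-E (n ℕ.* l)) (Unit-E (suc a) n∤a)
    ... | yes (divides (suc k) a≡) = Int-resp
      (begin
        (E n ÷ E (n ℕ.* suc k)) * proj₁ (E-multiple l)
          ≈⟨ solve 3 (λ e i w → e :* i :* w := e :* w :* i) ≡.refl (E n) (E (n ℕ.* suc k) ⁻¹) _ ⟩
        E n * proj₁ (E-multiple l) * E (n ℕ.* suc k) ⁻¹
          ≈⟨ *-cong (proj₂ (proj₂ (E-multiple l))) (⁻¹-cong (reflexive (≡.cong E (≡.trans a≡ (ℕ.*-comm (suc k) n))))) ⟨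
        E (n ℕ.* l) ÷ E (suc a) ∎)
      (Int-* (Int-ratio k) (proj₁ (proj₂ (E-multiple l))))

-- The congruence modulo the fifth power of Φₙ

module Central where

  open RingSolver
  open FieldTheory
  open Summation
  open QSeries
  open Plain
  open Local
  open Periodic
  open import Data.Bool using (Bool; true; false)
  open import Data.Nat as ℕ using (ℕ; zero; suc; _<_; _≤_; z≤n; s≤s)
  import Data.Nat.Properties as ℕ
  open import Data.Nat.Divisibility using (_∣_; _∣0; ∣n⇒∣m*n; ∣-refl)
  open import Data.Nat.Tactic.RingSolver using (solve-∀)
  open import Data.Product using (Σ; _×_; _,_; proj₁; proj₂)
  open import Data.Unit using (⊤; tt)
  open import Relation.Binary.PropositionalEquality as ≡ using (_≡_)
  open import Relation.Nullary using (¬_)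

  module CentralCongruence {F : Field} {Q : GenericElement F} (m′ : ℕ) (L : LocalRing F Q (4 ℕ.* suc m′ ℕ.+ 1)) where

    m n N : ℕ
    m = suc m′
    n = 4 ℕ.* m ℕ.+ 1
    N = m ℕ.+ m

    open FieldProperties F
    open GenericElement Q
    open QProperties F Q
    open Series F Q
    open PlainSeries F Q
    open Nodes F q
    open LocalRing L
    open LocalProperties L

    n≡ : n ≡ suc (2 ℕ.* (2 ℕ.* m))
    n≡ = lemma m
      where
      lemma : ∀ m → 4 ℕ.* m ℕ.+ 1 ≡ suc (2 ℕ.* (2 ℕ.* m))
      lemma = solve-∀

    m<n : m < n
    m<n = ≡.subst (m <_) (lemma m) (s≤s (ℕ.m≤m+n m (3 ℕ.* m)))
      where
      lemma : ∀ m → suc (m ℕ.+ 3 ℕ.* m) ≡ 4 ℕ.* m ℕ.+ 1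
      lemma = solve-∀

    open PeriodicSums L (2 ℕ.* m) m 1 n≡ (≡.sym (ℕ.*-identityʳ n)) m<n
      using (∤-2+2j; ∤-4+4j; Div-base⁵; Multiple⇒Div)

    y h u₀ : K
    y = q ^ n
    h = E n
    u₀ = symm n - symm 0

    y-unit : Unit y
    y-unit = Unit-power (q-power n)

    u₀≈ : u₀ ≈ h ^ 2 * y ⁻¹
    u₀≈ = *-cancelˡ (^-NonZero n q≉0) (begin
      y * (symm n - symm 0)              ≈⟨ distribˡ y _ _ ⟩
      y * symm n + y * - symm 0          ≈⟨ +-cong (symm-* n) (*-congˡ (-‿cong symm-0)) ⟩
      y ^ 2 + 1# + y * - 2#              ≈⟨ solve 1 (λ y → y :^ 2 :+ :1 :+ y :* :- (:1 :+ :1) := (:1 :- y) :^ 2 :* :1) ≡.refl y ⟩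
      h ^ 2 * 1#                         ≈⟨ *-congˡ (⁻¹-inverse (nonZero y-unit)) ⟨
      h ^ 2 * (y * y ⁻¹)                 ≈⟨ *-swapˡ _ _ _ ⟩
      y * (h ^ 2 * y ⁻¹)                 ∎)

    Div-h : Div 1 h
    Div-h = Div-E-period

    Div-u₀ : Div 2 u₀
    Div-u₀ = Div-resp (sym u₀≈) (Div-*ʳ (Div-^ 2 Div-h) (int⁻¹ y-unit))

    Int-u₀ : Int u₀
    Int-u₀ = Div⇒Int Div-u₀

    shiftOf : Bool → ℕ
    shiftOf false = 0
    shiftOf true  = n

    n∣shiftOf : ∀ b → n ∣ shiftOf b
    n∣shiftOf false = n ∣0
    n∣shiftOf true  = ∣-refl

    σ : Bool → K
    σ b = symm (shiftOf b)

    γ : Bool → K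
    γ false = 1#
    γ true  = y

    γ-isPower : ∀ b → γ b isPower shiftOf b
    γ-isPower false = 1-isPower
    γ-isPower true  = q-power n

    -- The three directions of deformation: b, a and c.
    module E₁ = Extend point u₀ Int-u₀
    𝓕₁ = E₁.extend
    module E₂ = Extend 𝓕₁ u₀ Int-u₀
    𝓕₂ = E₂.extend
    -- The parameter c itself moves from 1 to qⁿ, by -(1 - qⁿ); this direction contributes a single
    -- power of φ.
    module E₃ = Extend 𝓕₂ (- h) (Int-neg (Int-E n))
    𝓕₃ = E₃.extend

    Point₂ Point₃ : Set
    Point₂ = Bool × (Bool × ⊤)
    Point₃ = Bool × Point₂

    σ-Mem₁ : Family.Mem 𝓕₁ (λ p → σ (proj₁ p))
    σ-Mem₁ = E₁.member {slope = λ _ → 1#} (Int-symm 0) Int-1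
      (λ _ → solve 2 (λ a b → a := b :+ (a :- b) :* :1) ≡.refl (symm n) (symm 0))

    lift₁ : ∀ {f} → Family.Mem 𝓕₁ f → Family.Mem 𝓕₂ (λ p → f (proj₂ p))
    lift₁ p = E₂.member p (Family.Mem-const 𝓕₁ Int-0) (λ _ → solve 2 (λ a u → a := a :+ u :* :0) ≡.refl _ u₀)

    lift₂ : ∀ {f} → Family.Mem 𝓕₂ f → Family.Mem 𝓕₃ (λ p → f (proj₂ p))
    lift₂ p = E₃.member p (Family.Mem-const 𝓕₂ Int-0) (λ _ → solve 2 (λ a u → a := a :+ u :* :0) ≡.refl _ (- h))

    s₂ t₂ : Point₂ → K
    s₂ (a , _) = σ a
    t₂ (_ , b , _) = σ b

    s₂-Mem : Family.Mem 𝓕₂ s₂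
    s₂-Mem = E₂.member {slope = λ _ → 1#} (Family.Mem-const 𝓕₁ (Int-symm 0)) (Family.Mem-const 𝓕₁ Int-1)
      (λ _ → solve 2 (λ a b → a := b :+ (a :- b) :* :1) ≡.refl (symm n) (symm 0))

    t₂-Mem : Family.Mem 𝓕₂ t₂
    t₂-Mem = lift₁ σ-Mem₁

    c₃ : Point₃ → K
    c₃ (c , _) = γ c

    c₃-Mem : Family.Mem 𝓕₃ c₃
    c₃-Mem = E₃.member {slope = λ _ → 1#} (Family.Mem-const 𝓕₂ Int-1) (Family.Mem-const 𝓕₂ Int-1)
      (λ _ → solve 1 (λ y → y := :1 :+ :- (:1 :- y) :* :1) ≡.refl y)

    mixed : (Point₂ → K) → K
    mixed f = f (true , true , tt) - f (true , false , tt) - f (false , true , tt) + f (false , false , tt)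

    mixed-cong : ∀ {f g} → (∀ p → f p ≈ g p) → mixed f ≈ mixed g
    mixed-cong e = +-cong (+-cong (+-cong (e _) (-‿cong (e _))) (-‿cong (e _))) (e _)

    -- The witness is the slope in the b-direction of the slope in the a-direction; all lower terms
    -- cancel in the alternating sum.
    mixed-Mem : ∀ {f} → Family.Mem 𝓕₂ f → Σ K λ w → Int w × mixed f ≈ u₀ ^ 2 * w
    mixed-Mem {f} (E₂.member (E₁.member {s} _ Int-s i₀) (E₁.member {s′} _ Int-s′ i₁) i₂) = s′ tt , Int-s′ , (begin
      mixed f
        ≈⟨ +-congʳ (+-cong (+-cong (trans (i₂ _) (+-cong (i₀ tt) (*-congˡ (i₁ tt)))) (-‿cong (i₂ _))) (-‿cong (i₀ tt))) ⟩
      ((f₀₀ + u₀ * s tt) + u₀ * (g + u₀ * s′ tt)) - (f₀₀ + u₀ * g) - (f₀₀ + u₀ * s tt) + f₀₀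
        ≈⟨ solve 5 (λ f u s g s′ → ((f :+ u :* s) :+ u :* (g :+ u :* s′)) :- (f :+ u :* g) :- (f :+ u :* s) :+ f := u :^ 2 :* s′)
             ≡.refl f₀₀ u₀ (s tt) g (s′ tt) ⟩
      u₀ ^ 2 * s′ tt ∎)
      where
      f₀₀ = f (false , false , tt)
      g = _

    Div-mixed : ∀ {f} → Family.Mem 𝓕₂ f → Div 4 (mixed f)
    Div-mixed mem = Div-resp (sym (proj₂ (proj₂ M))) (Div-*ʳ (Div-* Div-u₀ (Div-* Div-u₀ (Int⇒Div Int-1))) (proj₁ (proj₂ M)))
      where M = mixed-Mem mem

    Div-mixed₃ : ∀ {f} → Family.Mem 𝓕₃ f → Div 5 (mixed (λ p → f (true , p))) → Div 5 (mixed (λ p → f (false , p)))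
    Div-mixed₃ {f} (E₃.member {g} _ Mem-g i) div = Div-resp (begin
      mixed (λ p → f (true , p)) + h * mixed g
        ≈⟨ +-congʳ (mixed-cong i) ⟩
      mixed (λ p → f (false , p) + - h * g p) + h * mixed g
        ≈⟨ solve 9 (λ h a b c d a′ b′ c′ d′ →
             (a :+ :- h :* a′) :- (b :+ :- h :* b′) :- (c :+ :- h :* c′) :+ (d :+ :- h :* d′) :+ h :* (a′ :- b′ :- c′ :+ d′)
               := a :- b :- c :+ d) ≡.refl h _ _ _ _ (g _) (g _) (g _) (g _) ⟩
      mixed (λ p → f (false , p)) ∎)
      (Div-+ div (Div-* Div-h (Div-mixed Mem-g)))

    Int-X : ∀ j → Int (X j)
    Int-X j = Int-resp (sym (≈power (X-isPower j))) (Int-power (2 ℕ.* j))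

    ∤-suc : ∀ {j} → j < N → ¬ n ∣ suc j
    ∤-suc {j} j<N = ∤-small (s≤s z≤n) (ℕ.≤-<-trans j<N N<n)
      where
      N<n : N < n
      N<n = ≡.subst (N <_) (lemma m) (s≤s (ℕ.m≤m+n N N))
        where
        lemma : ∀ m → suc ((m ℕ.+ m) ℕ.+ (m ℕ.+ m)) ≡ 4 ℕ.* m ℕ.+ 1
        lemma = solve-∀

    ∤-1+2j : ∀ {j} → j < N → ¬ n ∣ 1 ℕ.+ 2 ℕ.* j
    ∤-1+2j {j} j<N = ∤-small (s≤s z≤n) (≡.subst (1 ℕ.+ 2 ℕ.* j <_) (lemma m) (ℕ.+-monoʳ-< 1 (ℕ.*-monoʳ-< 2 j<N)))
      where
      lemma : ∀ m → 1 ℕ.+ 2 ℕ.* (m ℕ.+ m) ≡ 4 ℕ.* m ℕ.+ 1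
      lemma = solve-∀

    -- At j = N the last factor 1 - q c² X j has an exponent divisible by n. The deformed series
    -- must therefore stop at k = N, and the longer sum is reached only after the deformation is
    -- removed.
    Unit-weightDen : ∀ a b c {j} → j < N → Unit (weightDen (σ a) (σ b) (γ c) (X j))
    Unit-weightDen a b c {j} j<N = Unit-*
      (Unit-* (Unit-* (Unit-resp (sym (E-power (4 ℕ.+ 4 ℕ.* j) 4+4j)) (Unit-E (4 ℕ.+ 4 ℕ.* j) n∤4))
                      (Unit-quad (shiftOf a) _ 1-isPower 4+4j (n∣shiftOf a) (n ∣0) n∤4))
              (Unit-quad (shiftOf b) _ (γ-isPower c) (*-isPower (q-power 2) (X-isPower j)) (n∣shiftOf b) (n∣shiftOf c) (∤-2+2j j n∤)))
      (Unit-shifted {β = 2 ℕ.* shiftOf c} (1 ℕ.+ 2 ℕ.* j) 1-isPower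
        (isPower-≡ (lemma (shiftOf c) j) (*-isPower (*-isPower q-isPower (^-isPower 2 (γ-isPower c))) (X-isPower j)))
        (n ∣0) (∣n⇒∣m*n 2 (n∣shiftOf c)) (∤-1+2j j<N))
      where
      n∤ = ∤-suc j<N
      n∤4 = ∤-4+4j j n∤
      4+4j = *-isPower (q-power 4) (X² j)
      lemma : ∀ s j → 1 ℕ.+ s ℕ.* 2 ℕ.+ 2 ℕ.* j ≡ 2 ℕ.* s ℕ.+ (1 ℕ.+ 2 ℕ.* j)
      lemma = solve-∀

    series₃ : Point₃ → K
    series₃ (c , a , b , _) = series (σ a) (σ b) (γ c) (suc N)

    module _ where

      open Family 𝓕₃

      weight-Mem : ∀ k → k ≤ N → Mem (λ { (c , a , b , _) → weight (σ a) (σ b) (γ c) k })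
      weight-Mem k k≤N = Mem-prod k (λ j j<k → Mem-÷
        (Mem-* (Mem-* (Mem-* (Mem-const (Int-* (Int-power 2) (Int-- Int-1 (Int-* Int-q (Int-X j)))))
                             (Mem-quad (lift₂ s₂-Mem) (Mem-const Int-1) (Mem-const (Int-* Int-q (Int-X j)))))
                      (Mem-quad (lift₂ t₂-Mem) (Mem-const Int-1) (Mem-* (Mem-* (Mem-const Int-q) c₃-Mem) (Mem-const (Int-^ 2 (Int-X j))))))
               (Mem-- (Mem-^ 2 c₃-Mem) (Mem-const (Int-* (Int-power 2) (Int-^ 2 (Int-X j))))))
        (Mem-* (Mem-* (Mem-* (Mem-const (Int-- Int-1 (Int-* (Int-power 4) (Int-^ 2 (Int-X j)))))
                             (Mem-quad (lift₂ s₂-Mem) (Mem-const Int-1) (Mem-const (Int-* (Int-power 4) (Int-^ 2 (Int-X j))))))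
                      (Mem-quad (lift₂ t₂-Mem) c₃-Mem (Mem-const (Int-* (Int-power 2) (Int-X j)))))
               (Mem-- (Mem-const Int-1) (Mem-* (Mem-* (Mem-const Int-q) (Mem-^ 2 c₃-Mem)) (Mem-const (Int-X j)))))
        (λ { (c , a , b , _) → Unit-weightDen a b c (ℕ.<-≤-trans j<k k≤N) }))

      series-Mem : Mem series₃
      series-Mem = Mem-sum (suc N) (λ k k<1+N → Mem-* (Mem-const (Int-resp (sym (κ≈ k)) (Int-E (6 ℕ.* k ℕ.+ 1)))) (weight-Mem k (ℕ.≤-pred k<1+N)))

    Unit-swap : ∀ {x y} → Unit (x - y) → Unit (y - x)
    Unit-swap {x} {y} u = Unit-resp (solve 2 (λ x y → :- (x :- y) := y :- x) ≡.refl x y) (Unit-neg u)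

    Unit-relative : ∀ {x y i β} a j → x isPower (a ℕ.+ i) → y isPower (a ℕ.+ (β ℕ.+ j)) → n ∣ i → n ∣ β → ¬ n ∣ j → Unit (x - y)
    Unit-relative {x} {y} {i} {β} a j p r n∣i n∣β n∤j = Unit-resp (begin
      q ^ a * (q ^ i - q ^ (β ℕ.+ j))             ≈⟨ solve 3 (λ a x y → a :* (x :- y) := a :* x :- a :* y) ≡.refl (q ^ a) _ _ ⟩
      q ^ a * q ^ i - q ^ a * q ^ (β ℕ.+ j)       ≈⟨ +-cong (^-homo-* q a i) (-‿cong (^-homo-* q a (β ℕ.+ j))) ⟨
      q ^ (a ℕ.+ i) - q ^ (a ℕ.+ (β ℕ.+ j))       ≈⟨ +-cong (≈power p) (-‿cong (≈power r)) ⟨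
      x - y                                       ∎)
      (Unit-* (Unit-power (q-power a)) (Unit-shifted j (q-power i) (q-power (β ℕ.+ j)) n∣i n∣β n∤j))

    module Pair (i j : ℕ) (m≡ : m ≡ suc i ℕ.+ j) where

      e z w : K
      e = q ^ (4 ℕ.* m ℕ.+ 2)
      z = q ^ (4 ℕ.* i ℕ.+ 4)
      w = q ^ (4 ℕ.* mirror m i ℕ.+ 4)

      i<m : i < m
      i<m = ≡.subst (i <_) (≡.sym m≡) (s≤s (ℕ.m≤m+n i j))

      mirror≡ : mirror m i ≡ m ℕ.+ j
      mirror≡ = ≡.cong (m ℕ.+_) (≡.trans (≡.cong (ℕ._∸ suc i) m≡) (ℕ.m+n∸m≡n (suc i) j))

      zw≈ : z * w ≈ e ^ 2
      zw≈ = zw≈e² m i i<m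

      j<m : j < m
      j<m = ≡.subst (j <_) (≡.sym m≡) (s≤s (ℕ.m≤n+m j i))

      -- After a power of q and multiples of n are removed, the linear factors of `pairDen` have
      -- exponent 4j + 1 or 4j + 3. As j < m, both are below n.
      n∤4j+ : ∀ {r} → 0 < r → r < 4 → ¬ n ∣ 4 ℕ.* j ℕ.+ r
      n∤4j+ {r} 0<r r<4 = ∤-small (ℕ.<-≤-trans 0<r (ℕ.m≤n+m r (4 ℕ.* j)))
        (ℕ.<-≤-trans (ℕ.+-monoʳ-< (4 ℕ.* j) r<4) (ℕ.≤-trans (ℕ.≤-reflexive (≡.trans (ℕ.+-comm (4 ℕ.* j) 4) (≡.sym (ℕ.*-suc 4 j))))
          (ℕ.≤-trans (ℕ.*-monoʳ-≤ 4 j<m) (ℕ.m≤m+n (4 ℕ.* m) 1))))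

      w-isPower : w isPower 4 ℕ.* (m ℕ.+ j) ℕ.+ 4
      w-isPower = isPower-≡ (≡.cong (λ k → 4 ℕ.* k ℕ.+ 4) mirror≡) (q-power _)

      module _ (β : ℕ) (n∣β : n ∣ β) where

        b = q ^ β

        eb : e * b isPower 4 ℕ.* m ℕ.+ 2 ℕ.+ β
        eb = *-isPower (q-power (4 ℕ.* m ℕ.+ 2)) (q-power β)

        Unit-qz-eb : Unit (q * z - e * b)
        Unit-qz-eb = Unit-relative {i = 0} {β} (4 ℕ.* i ℕ.+ 5) (4 ℕ.* j ℕ.+ 1) (isPower-≡ (e₁ i) (*-isPower q-isPower (q-power (4 ℕ.* i ℕ.+ 4))))
          (isPower-≡ (≡.trans (≡.cong (λ m → 4 ℕ.* m ℕ.+ 2 ℕ.+ β) m≡) (e₂ i j β)) eb) (n ∣0) n∣β (n∤4j+ (s≤s z≤n) (s≤s (s≤s z≤n)))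
          where
          e₁ : ∀ i → 1 ℕ.+ (4 ℕ.* i ℕ.+ 4) ≡ 4 ℕ.* i ℕ.+ 5 ℕ.+ 0
          e₁ = solve-∀
          e₂ : ∀ i j β → 4 ℕ.* (suc i ℕ.+ j) ℕ.+ 2 ℕ.+ β ≡ 4 ℕ.* i ℕ.+ 5 ℕ.+ (β ℕ.+ (4 ℕ.* j ℕ.+ 1))
          e₂ = solve-∀

        Unit-z-qeb : Unit (z - q * (e * b))
        Unit-z-qeb = Unit-relative {i = 0} {β} (4 ℕ.* i ℕ.+ 4) (4 ℕ.* j ℕ.+ 3) (isPower-≡ (≡.sym (ℕ.+-identityʳ _)) (q-power (4 ℕ.* i ℕ.+ 4)))
          (isPower-≡ (≡.trans (≡.cong (λ m → 1 ℕ.+ (4 ℕ.* m ℕ.+ 2 ℕ.+ β)) m≡) (e₂ i j β)) (*-isPower q-isPower eb)) (n ∣0) n∣β (n∤4j+ (s≤s z≤n) (s≤s (s≤s (s≤s (s≤s z≤n)))))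
          where
          e₂ : ∀ i j β → 1 ℕ.+ (4 ℕ.* (suc i ℕ.+ j) ℕ.+ 2 ℕ.+ β) ≡ 4 ℕ.* i ℕ.+ 4 ℕ.+ (β ℕ.+ (4 ℕ.* j ℕ.+ 3))
          e₂ = solve-∀

        Unit-w-qeb : Unit (w - q * (e * b))
        Unit-w-qeb = Unit-swap (Unit-relative {i = β} {0} (4 ℕ.* m ℕ.+ 3) (4 ℕ.* j ℕ.+ 1) (isPower-≡ (e₁ m β) (*-isPower q-isPower eb))
          (isPower-≡ (e₂ m j) w-isPower) n∣β (n ∣0) (n∤4j+ (s≤s z≤n) (s≤s (s≤s z≤n))))
          where
          e₁ : ∀ m β → 1 ℕ.+ (4 ℕ.* m ℕ.+ 2 ℕ.+ β) ≡ 4 ℕ.* m ℕ.+ 3 ℕ.+ β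
          e₁ = solve-∀
          e₂ : ∀ m j → 4 ℕ.* (m ℕ.+ j) ℕ.+ 4 ≡ 4 ℕ.* m ℕ.+ 3 ℕ.+ (0 ℕ.+ (4 ℕ.* j ℕ.+ 1))
          e₂ = solve-∀

        Unit-qw-eb : Unit (q * w - e * b)
        Unit-qw-eb = Unit-swap (Unit-relative {i = β} {0} (4 ℕ.* m ℕ.+ 2) (4 ℕ.* j ℕ.+ 3) eb
          (isPower-≡ (e₂ m j) (*-isPower q-isPower w-isPower)) n∣β (n ∣0) (n∤4j+ (s≤s z≤n) (s≤s (s≤s (s≤s (s≤s z≤n))))))
          where
          e₂ : ∀ m j → 1 ℕ.+ (4 ℕ.* (m ℕ.+ j) ℕ.+ 4) ≡ 4 ℕ.* m ℕ.+ 2 ℕ.+ (0 ℕ.+ (4 ℕ.* j ℕ.+ 3))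
          e₂ = solve-∀

        Unit-be : Unit (b * e)
        Unit-be = Unit-* (Unit-power (q-power β)) (Unit-power (q-power (4 ℕ.* m ℕ.+ 2)))

        Unit-pairDen₁ : Unit (pairDen e z w (symm β))
        Unit-pairDen₁ = Unit-cancel Unit-be (Unit-resp (sym (Pairing.pairDen-factor β e z w zw≈)) (Unit-* Unit-qz-eb Unit-w-qeb))

        Unit-pairDen₂ : Unit (pairDen e w z (symm β))
        Unit-pairDen₂ = Unit-cancel Unit-be (Unit-resp (sym (Pairing.pairDen-factor β e w z (trans (*-comm w z) zw≈))) (Unit-* Unit-qw-eb Unit-z-qeb))

      Unit-quads : ∀ β → n ∣ β → Unit (quad (symm β) 1# z * quad (symm β) 1# w)
      Unit-quads β n∣β = Unit-*
        (Unit-quad β _ 1-isPower (q-power (4 ℕ.* i ℕ.+ 4)) n∣β (n ∣0) (n∤ i (ℕ.<-≤-trans i<m (ℕ.m≤m+n m m))))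
        (Unit-quad β _ 1-isPower w-isPower n∣β (n ∣0) (n∤ (m ℕ.+ j) (ℕ.+-monoʳ-< m j<m)))
        where
        n∤ : ∀ k → k < N → ¬ n ∣ 4 ℕ.* k ℕ.+ 4
        n∤ k k<N = ≡.subst (λ e → ¬ n ∣ e) (ℕ.+-comm 4 (4 ℕ.* k)) (∤-4+4j k (∤-suc k<N))

      open Family 𝓕₂

      -- Membership with step u₀ holds because the paired factor is a rational function of s and t
      -- with unit denominators. A single `ϱ` contains b, which moves only by a multiple of φ and
      -- not of φ².
      pair-Mem : Mem (λ p → pair m (s₂ p) (t₂ p) i)
      pair-Mem = Mem-÷
        (Mem-* (Mem-const (Int-power 2))
          (Mem-- (Mem-+ (Mem-+ (Mem-* (Mem-const (Int-^ 2 Int-e)) (Mem-- (Mem-+ (Mem-^ 2 t₂-Mem) (Mem-^ 2 s₂-Mem)) (Mem-const (Int-+ Int-1 Int-1))))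
                               (Mem-const (Int-^ 2 Int-z))) (Mem-const (Int-^ 2 Int-w)))
                 (Mem-* (Mem-* (Mem-* s₂-Mem t₂-Mem) (Mem-const Int-e)) (Mem-const (Int-+ Int-z Int-w)))))
        (Mem-* (Mem-* (Mem-- (Mem-- (Mem-* (Mem-const (Int-* Int-q Int-e)) t₂-Mem) (Mem-const (Int-* (Int-power 2) Int-z))) (Mem-const Int-w))
                      (Mem-- (Mem-- (Mem-* (Mem-const (Int-* Int-q Int-e)) t₂-Mem) (Mem-const (Int-* (Int-power 2) Int-w))) (Mem-const Int-z)))
               (Mem-* (Mem-quad s₂-Mem (Mem-const Int-1) (Mem-const Int-z)) (Mem-quad s₂-Mem (Mem-const Int-1) (Mem-const Int-w))))
        (λ { (a , b , _) → Unit-* (Unit-* (Unit-pairDen₁ (shiftOf b) (n∣shiftOf b)) (Unit-pairDen₂ (shiftOf b) (n∣shiftOf b)))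
                                  (Unit-quads (shiftOf a) (n∣shiftOf a)) })
        where
        Int-e = Int-power (4 ℕ.* m ℕ.+ 2)
        Int-z = Int-power (4 ℕ.* i ℕ.+ 4)
        Int-w = Int-power (4 ℕ.* mirror m i ℕ.+ 4)

    σ-admissible : ∀ a → Admissible (σ a)
    σ-admissible false = admissible-0
    σ-admissible true  = symm-admissible n (λ k → ≢-mod 2 1 0 (2 ℕ.* m) (2 ℕ.+ 2 ℕ.* k) (e₁ m) (e₂ k) (λ ()))
      where
      e₁ : ∀ m → 4 ℕ.* m ℕ.+ 1 ≡ 1 ℕ.+ 2 ℕ.* m ℕ.* 2
      e₁ = solve-∀
      e₂ : ∀ k → 4 ℕ.+ 4 ℕ.* k ≡ 0 ℕ.+ (2 ℕ.+ 2 ℕ.* k) ℕ.* 2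
      e₂ = solve-∀

    EE : ℕ → K
    EE i = E (4 ℕ.* i ℕ.+ 3) * E (4 ℕ.* i ℕ.+ 5)

    -- Index m - 1, which is m′, contributes E (4m′ + 5) = E n.
    Div-EE : Div 1 (prod EE N)
    Div-EE = Multiple⇒Div (Int-prod-factor N m′ (λ j _ → Int-* (Int-E (4 ℕ.* j ℕ.+ 3)) (Int-E (4 ℕ.* j ℕ.+ 5))) (s≤s (ℕ.m≤m+n m′ m))
      (E (4 ℕ.* m′ ℕ.+ 3) , Int-E (4 ℕ.* m′ ℕ.+ 3) , trans (*-comm _ _) (*-congʳ (reflexive (≡.cong E (lemma m′))))))
      where
      lemma : ∀ m′ → 4 ℕ.* m′ ℕ.+ 5 ≡ 4 ℕ.* suc m′ ℕ.+ 1
      lemma = solve-∀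

    -- `EE` does not vary over the face, so it comes out of the mixed difference with one power of
    -- φ; the product of pairs is a member of the square and supplies the other four.
    Div-face : Div 5 (mixed (λ p → series₃ (true , p)))
    Div-face = Div-resp (begin
      (1# - q) * prod EE N * mixed P
        ≈⟨ solve 6 (λ c e a b f g → c :* e :* (a :- b :- f :+ g)
             := c :* (e :* a) :- c :* (e :* b) :- c :* (e :* f) :+ c :* (e :* g)) ≡.refl (1# - q) (prod EE N)
               (P (true , true , tt)) (P (true , false , tt)) (P (false , true , tt)) (P (false , false , tt)) ⟩
      mixed (λ p → (1# - q) * (prod EE N * P p))
        ≈⟨ mixed-cong {λ p → (1# - q) * (prod EE N * P p)} {λ p → series₃ (true , p)} (λ { (a , b , _) → sym (Family₃.family₃ m (toShift b) (σ a) (σ-admissible a)) }) ⟩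
      mixed (λ p → series₃ (true , p)) ∎)
      (Div-* (Div-*ˡ (Int-- Int-1 Int-q) Div-EE)
             (Div-mixed (Family.Mem-prod 𝓕₂ m (λ i i<m → Pair.pair-Mem i (m ℕ.∸ suc i) (≡.sym (ℕ.m+[n∸m]≡n i<m))))))
      where
      P : Point₂ → K
      P p = prod (pair m (s₂ p) (t₂ p)) m
      toShift : ∀ b → Shift m (shiftOf b)
      toShift false = none
      toShift true  = full

    -- All corners of the cube must be sums of the same length N + 1; for b = qⁿ the terms beyond
    -- index m are zero.
    family₁-extended : ∀ s → Admissible s → series s (symm n) 1# (suc N) ≈ closedForm s m
    family₁-extended s adm = begin
      series s (symm n) 1# (suc N)
        ≈⟨ sum-split _ (suc m) m ⟩
      series s (symm n) 1# (suc m) + sum (λ i → κ (X (suc m ℕ.+ i)) * weight s (symm n) 1# (suc m ℕ.+ i)) m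
        ≈⟨ +-cong (Family₁.family₁ m s adm) (sum-cong m (λ i _ → trans (*-congˡ (weight-vanishes m s adm (suc m ℕ.+ i) (s≤s (ℕ.m≤m+n m i)))) (zeroʳ _))) ⟩
      closedForm s m + sum (λ _ → 0#) m
        ≈⟨ +-congˡ (sum-0 m) ⟩
      closedForm s m + 0#
        ≈⟨ +-identityʳ _ ⟩
      closedForm s m ∎
      where
      sum-0 : ∀ k → sum (λ _ → 0#) k ≈ 0#
      sum-0 zero    = refl
      sum-0 (suc k) = trans (+-identityʳ _) (sum-0 k)

    family₂-extended : series (symm n) (symm 0) 1# (suc N) ≈ closedForm (symm 0) m
    family₂-extended = trans (reflexive (≡.cong (λ k → series (symm n) (symm 0) 1# (suc (m ℕ.+ k))) (≡.sym (ℕ.+-identityʳ m))))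
      (Family₂.family₂ m (σ-admissible true))

    H₀ H₁ : K
    H₀ = closedForm (symm 0) m
    H₁ = closedForm (symm n) m

    -- series₃ at the origin is an alternating sum of its values at the other corners
    -- of the cube, up to the mixed third difference.
    Div-origin : Div 5 (sum term (suc N) - (H₀ + H₀ - H₁))
    Div-origin = Div-resp (begin
      mixed (λ p → series₃ (false , p))
        ≈⟨ +-cong (+-cong (+-cong (family₁-extended (symm n) (σ-admissible true)) (-‿cong family₂-extended))
                          (-‿cong (family₁-extended (symm 0) admissible-0))) (series≈ (suc N)) ⟩
      H₁ - H₀ - H₀ + sum term (suc N)
        ≈⟨ solve 3 (λ a b s → a :- b :- b :+ s := s :- (b :+ b :- a)) ≡.refl H₁ H₀ (sum term (suc N)) ⟩
      sum term (suc N) - (H₀ + H₀ - H₁) ∎)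
      (Div-mixed₃ series-Mem Div-face)

    n∤4i+2 : ∀ i → i < m → ¬ n ∣ 4 ℕ.* i ℕ.+ 2
    n∤4i+2 i i<m = ∤-small (ℕ.<-≤-trans (s≤s z≤n) (ℕ.m≤n+m 2 (4 ℕ.* i))) (ℕ.≤-<-trans
      (ℕ.≤-trans (ℕ.+-monoʳ-≤ (4 ℕ.* i) (s≤s (s≤s z≤n))) (ℕ.≤-trans (ℕ.≤-reflexive (≡.trans (ℕ.+-comm (4 ℕ.* i) 4) (≡.sym (ℕ.*-suc 4 i)))) (ℕ.*-monoʳ-≤ 4 i<m)))
      (≡.subst (4 ℕ.* m <_) (ℕ.+-comm 1 (4 ℕ.* m)) ℕ.≤-refl))

    n∤4i+4 : ∀ i → i < m → ¬ n ∣ 4 ℕ.* i ℕ.+ 4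
    n∤4i+4 i i<m = ≡.subst (λ e → ¬ n ∣ e) (ℕ.+-comm 4 (4 ℕ.* i)) (∤-4+4j i (∤-suc (ℕ.<-≤-trans i<m (ℕ.m≤m+n m m))))

    Int-ε : ∀ a → ¬ n ∣ a → Int (ε a)
    Int-ε a n∤a = Int-÷ (Int-power a) (Unit-^ 2 (Unit-E a n∤a))

    Int-harmonic : ∀ k → k ≤ m → Int (harmonic k)
    Int-harmonic k k≤m = Int-sum k (λ i i<k → Int-- (Int-ε (4 ℕ.* i ℕ.+ 2) (n∤4i+2 i (ℕ.<-≤-trans i<k k≤m))) (Int-ε (4 ℕ.* i ℕ.+ 4) (n∤4i+4 i (ℕ.<-≤-trans i<k k≤m))))

    Unit-quad-E : ∀ b a → ¬ n ∣ a → Unit (quad (σ b) 1# (q ^ a))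
    Unit-quad-E b a n∤a = Unit-quad (shiftOf b) a 1-isPower (q-power a) (n∣shiftOf b) (n ∣0) n∤a

    quad-perturbed : ∀ a → ¬ n ∣ a → quad (symm n) 1# (q ^ a) ≈ quad (symm 0) 1# (q ^ a) * (1# - u₀ * ε a)
    quad-perturbed a n∤a = begin
      quad (symm n) 1# x
        ≈⟨ solve 3 (λ s s₀ x → :1 :^ 2 :- s :* :1 :* x :+ x :^ 2 := (:1 :^ 2 :- s₀ :* :1 :* x :+ x :^ 2) :- (s :- s₀) :* x) ≡.refl (symm n) (symm 0) x ⟩
      quad (symm 0) 1# x - u₀ * x
        ≈⟨ +-cong (quad-0 x) (-‿cong (*-congˡ (sym (÷-cancel (nonZero (Unit-^ 2 (Unit-E a n∤a))))))) ⟩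
      E a ^ 2 - u₀ * (ε a * E a ^ 2)
        ≈⟨ solve 3 (λ e u ε → e :- u :* (ε :* e) := e :* (:1 :- u :* ε)) ≡.refl (E a ^ 2) u₀ (ε a) ⟩
      E a ^ 2 * (1# - u₀ * ε a)
        ≈⟨ *-congʳ (quad-0 x) ⟨
      quad (symm 0) 1# x * (1# - u₀ * ε a) ∎
      where x = q ^ a

    -- The factor is multiplied by (1 - u₀e)/(1 - u₀e′), and 1 - u₀e = (1 - u₀(e - e′))(1 - u₀e′) +
    -- u₀² e′(e′ - e). The witness is the last term after division by the perturbed denominator.
    η-perturbed : ∀ i → i < m → Σ K λ w → Int w ×
      η (symm n) i ≈ η (symm 0) i * (1# - u₀ * (ε (4 ℕ.* i ℕ.+ 2) - ε (4 ℕ.* i ℕ.+ 4))) + u₀ ^ 2 * w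
    η-perturbed i i<m = A * (e′ * (e′ - e)) ÷ B′ ,
      Int-÷ (Int-* (int A-unit) (Int-* Int-e′ (Int-- Int-e′ (Int-ε (4 ℕ.* i ℕ.+ 2) n∤₂)))) B′-unit ,
      *-cancelʳ (nonZero B′-unit) (begin
        A′ ÷ B′ * B′
          ≈⟨ ÷-cancel (nonZero B′-unit) ⟩
        A′
          ≈⟨ quad-perturbed (4 ℕ.* i ℕ.+ 2) n∤₂ ⟩
        A * (1# - u₀ * e)
          ≈⟨ solve 4 (λ A u e e′ → A :* (:1 :- u :* e) := A :* ((:1 :- u :* (e :- e′)) :* (:1 :- u :* e′)) :+ u :^ 2 :* (A :* (e′ :* (e′ :- e)))) ≡.refl A u₀ e e′ ⟩
        A * ((1# - u₀ * (e - e′)) * (1# - u₀ * e′)) + u₀ ^ 2 * (A * (e′ * (e′ - e)))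
          ≈⟨ +-cong (*-congʳ (÷-cancel (nonZero B-unit))) (*-congˡ (÷-cancel (nonZero B′-unit))) ⟨
        (A ÷ B * B) * ((1# - u₀ * (e - e′)) * (1# - u₀ * e′)) + u₀ ^ 2 * (A * (e′ * (e′ - e)) ÷ B′ * B′)
          ≈⟨ +-congʳ (solve 4 (λ r b x y → (r :* b) :* (x :* y) := r :* x :* (b :* y)) ≡.refl (A ÷ B) B (1# - u₀ * (e - e′)) (1# - u₀ * e′)) ⟩
        A ÷ B * (1# - u₀ * (e - e′)) * (B * (1# - u₀ * e′)) + u₀ ^ 2 * (A * (e′ * (e′ - e)) ÷ B′ * B′)
          ≈⟨ +-congʳ (*-congˡ (quad-perturbed (4 ℕ.* i ℕ.+ 4) n∤₄)) ⟨
        A ÷ B * (1# - u₀ * (e - e′)) * B′ + u₀ ^ 2 * (A * (e′ * (e′ - e)) ÷ B′ * B′)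
          ≈⟨ solve 4 (λ r b u w → r :* b :+ u :* (w :* b) := (r :+ u :* w) :* b) ≡.refl (A ÷ B * (1# - u₀ * (e - e′))) B′ (u₀ ^ 2) (A * (e′ * (e′ - e)) ÷ B′) ⟩
        (A ÷ B * (1# - u₀ * (e - e′)) + u₀ ^ 2 * (A * (e′ * (e′ - e)) ÷ B′)) * B′ ∎)
      where
      n∤₂ = n∤4i+2 i i<m
      n∤₄ = n∤4i+4 i i<m
      e = ε (4 ℕ.* i ℕ.+ 2)
      e′ = ε (4 ℕ.* i ℕ.+ 4)
      A = quad (symm 0) 1# (q ^ (4 ℕ.* i ℕ.+ 2))
      B = quad (symm 0) 1# (q ^ (4 ℕ.* i ℕ.+ 4))
      A′ = quad (symm n) 1# (q ^ (4 ℕ.* i ℕ.+ 2))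
      B′ = quad (symm n) 1# (q ^ (4 ℕ.* i ℕ.+ 4))
      Int-e′ = Int-ε (4 ℕ.* i ℕ.+ 4) n∤₄
      A-unit = Unit-quad-E false (4 ℕ.* i ℕ.+ 2) n∤₂
      B-unit = Unit-quad-E false (4 ℕ.* i ℕ.+ 4) n∤₄
      B′-unit = Unit-quad-E true (4 ℕ.* i ℕ.+ 4) n∤₄

    Int-η : ∀ i → i < m → Int (η (symm 0) i)
    Int-η i i<m = Int-÷ (int (Unit-quad-E false (4 ℕ.* i ℕ.+ 2) (n∤4i+2 i i<m))) (Unit-quad-E false (4 ℕ.* i ℕ.+ 4) (n∤4i+4 i i<m))

    -- First-order expansion of a product: the linear coefficients add up to the harmonic sum, and
    -- everything of second order in u₀ is collected in w.
    prod-perturbed : ∀ k → k ≤ m → Σ K λ w → Int w ×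
      prod (η (symm n)) k ≈ prod (η (symm 0)) k * (1# - u₀ * harmonic k) + u₀ ^ 2 * w
    prod-perturbed zero    _   = 0# , Int-0 , solve 1 (λ u → :1 := :1 :* (:1 :- u :* :0) :+ u :^ 2 :* :0) ≡.refl u₀
    prod-perturbed (suc k) k<m =
      P * ηₖ * (S * d) + (P * (1# - u₀ * S) * v + w * (ηₖ * (1# - u₀ * d)) + u₀ ^ 2 * (w * v)) ,
      Int-+ (Int-* (Int-* Int-P Int-ηₖ) (Int-* Int-S Int-d))
            (Int-+ (Int-+ (Int-* (Int-* Int-P (Int-- Int-1 (Int-* Int-u₀ Int-S))) Int-v)
                          (Int-* Int-w (Int-* Int-ηₖ (Int-- Int-1 (Int-* Int-u₀ Int-d)))))
                   (Int-* (Int-^ 2 Int-u₀) (Int-* Int-w Int-v))) ,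
      trans (*-cong e e′)
        (solve 7 (λ P η S d u w v →
           (P :* (:1 :- u :* S) :+ u :^ 2 :* w) :* (η :* (:1 :- u :* d) :+ u :^ 2 :* v)
           := P :* η :* (:1 :- u :* (S :+ d))
              :+ u :^ 2 :* (P :* η :* (S :* d) :+ (P :* (:1 :- u :* S) :* v :+ w :* (η :* (:1 :- u :* d)) :+ u :^ 2 :* (w :* v))))
           ≡.refl P ηₖ S d u₀ w v)
      where
      IH = prod-perturbed k (ℕ.<⇒≤ k<m)
      w = proj₁ IH
      Int-w = proj₁ (proj₂ IH)
      e = proj₂ (proj₂ IH)
      step = η-perturbed k k<m
      v = proj₁ step
      Int-v = proj₁ (proj₂ step)
      e′ = proj₂ (proj₂ step)
      P = prod (η (symm 0)) k
      ηₖ = η (symm 0) k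
      S = harmonic k
      d = ε (4 ℕ.* k ℕ.+ 2) - ε (4 ℕ.* k ℕ.+ 4)
      Int-P = Int-prod k (λ i i<k → Int-η i (ℕ.<-trans i<k k<m))
      Int-ηₖ = Int-η k k<m
      Int-S = Int-harmonic k (ℕ.<⇒≤ k<m)
      Int-d = Int-- (Int-ε (4 ℕ.* k ℕ.+ 2) (n∤4i+2 k k<m)) (Int-ε (4 ℕ.* k ℕ.+ 4) (n∤4i+4 k k<m))

    -- 1/y = 2 - y + (1 - y)²/y, so that u₀ = h²/y is h² (2 - y) up to h⁴.
    u₀-expansion : u₀ ≈ h ^ 2 * (2# - y) + h ^ 4 * y ⁻¹
    u₀-expansion = *-cancelˡ (^-NonZero n q≉0) (begin
      y * u₀                                              ≈⟨ *-congˡ u₀≈ ⟩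
      y * (h ^ 2 * y ⁻¹)                                  ≈⟨ *-swapˡ _ _ _ ⟩
      h ^ 2 * (y * y ⁻¹)                                  ≈⟨ *-congˡ yy⁻¹ ⟩
      h ^ 2 * 1#                                          ≈⟨ solve 1 (λ y → (:1 :- y) :^ 2 :* :1 := y :* ((:1 :- y) :^ 2 :* (:1 :+ :1 :- y)) :+ (:1 :- y) :^ 4 :* :1) ≡.refl y ⟩
      y * (h ^ 2 * (2# - y)) + h ^ 4 * 1#                 ≈⟨ +-congˡ (*-congˡ yy⁻¹) ⟨
      y * (h ^ 2 * (2# - y)) + h ^ 4 * (y * y ⁻¹)         ≈⟨ solve 4 (λ y a h i → y :* a :+ h :* (y :* i) := y :* (a :+ h :* i)) ≡.refl y (h ^ 2 * (2# - y)) (h ^ 4) (y ⁻¹) ⟩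
      y * (h ^ 2 * (2# - y) + h ^ 4 * y ⁻¹)               ∎)
      where
      yy⁻¹ = ⁻¹-inverse (nonZero y-unit)

    -- Both closed forms carry the factor h = E n. Errors of order u₀², hence φ⁴, and the error h⁴/y
    -- of replacing u₀ by h²(2 - y) thus become divisible by φ⁵. This replacement is the origin of
    -- the factor 2 - qⁿ.
    central : Div 5 (sum term (suc N) - centralValue m)
    central = Div-resp (begin
      (S - (H₀ + H₀ - H₁)) + (h ^ 5 * (P * (harmonic m * y ⁻¹)) - h * (u₀ ^ 2 * w))
        ≈⟨ +-congʳ (+-congˡ (-‿cong (+-congˡ (-‿cong (*-congˡ e))))) ⟩
      (S - (h * P + h * P - h * (P * (1# - u₀ * harmonic m) + u₀ ^ 2 * w))) + (h ^ 5 * (P * (harmonic m * y ⁻¹)) - h * (u₀ ^ 2 * w))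
        ≈⟨ solve 7 (λ S h P u σ w i →
             (S :- (h :* P :+ h :* P :- h :* (P :* (:1 :- u :* σ) :+ u :^ 2 :* w))) :+ (h :^ 5 :* (P :* (σ :* i)) :- h :* (u :^ 2 :* w))
               := S :- h :* P :* (:1 :+ (u :- h :^ 4 :* i) :* σ)) ≡.refl S h P u₀ (harmonic m) w (y ⁻¹) ⟩
      S - h * P * (1# + (u₀ - h ^ 4 * y ⁻¹) * harmonic m)
        ≈⟨ +-congˡ (-‿cong (*-congˡ (+-congˡ (*-congʳ (trans (+-congʳ u₀-expansion) (solve 2 (λ a b → a :+ b :- b := a) ≡.refl _ _)))))) ⟩
      S - centralValue m ∎)
      (Div-+ Div-origin (Div-- (Div-*ʳ (Div-^ 5 Div-h) (Int-* Int-P (Int-* (Int-harmonic m ℕ.≤-refl) (int⁻¹ y-unit))))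
                               (Div-* Div-h (Div-*ʳ (Div-* Div-u₀ (Div-*ʳ Div-u₀ Int-1)) Int-w))))
      where
      perturbed = prod-perturbed m ℕ.≤-refl
      w = proj₁ perturbed
      Int-w = proj₁ (proj₂ perturbed)
      e = proj₂ (proj₂ perturbed)
      S = sum term (suc N)
      P = prod (η (symm 0)) m
      Int-P = Int-prod m Int-η

    -- Every term with N < k < n lies beyond both critical indices 2m and m, so `Div-base⁵` applies
    -- to it.
    central-full : Div 5 (sum term n - centralValue m)
    central-full = Div-resp (begin
      (tail + (sum term (suc N) - centralValue m))
        ≈⟨ solve 3 (λ a b c → a :+ (b :- c) := b :+ a :- c) ≡.refl tail (sum term (suc N)) (centralValue m) ⟩
      sum term (suc N) + tail - centralValue m
        ≈⟨ +-congʳ (sum-split term (suc N) N) ⟨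
      sum term (suc N ℕ.+ N) - centralValue m
        ≡⟨ ≡.cong (λ k → sum term k - centralValue m) (lemma m) ⟩
      sum term n - centralValue m ∎)
      (Div-+ (Div-sum N (λ i i<N → Div-*ˡ (Int-resp (sym (κ≈ (suc N ℕ.+ i))) (Int-E (6 ℕ.* (suc N ℕ.+ i) ℕ.+ 1))) (Div-base⁵ (suc N ℕ.+ i)
          (≡.subst (λ k → k < suc N ℕ.+ i) (≡.cong (m ℕ.+_) (≡.sym (ℕ.+-identityʳ m))) (s≤s (ℕ.m≤m+n N i)))
          (s≤s (ℕ.≤-trans (ℕ.m≤m+n m m) (ℕ.m≤m+n N i)))
          (≡.subst (suc N ℕ.+ i <_) (lemma m) (ℕ.+-monoʳ-< (suc N) i<N))))) central)
      where
      tail = sum (λ i → term (suc N ℕ.+ i)) N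
      lemma : ∀ m → suc (m ℕ.+ m) ℕ.+ (m ℕ.+ m) ≡ 4 ℕ.* m ℕ.+ 1
      lemma = solve-∀

-- Coefficient lists as an integral domain

module Polynomials where

  open import Defs
  open RingSolver
  open import Algebra.Bundles using (CommutativeRing)
  import Algebra.Properties.Semiring.Exp as Exp
  open import Data.Integer as ℤ using (ℤ; +_)
  import Data.Integer.Properties as ℤ
  open import Data.List using ([]; _∷_; map)
  open import Data.List.Relation.Unary.All using ([]; _∷_; all?)
  open import Data.Nat as ℕ using (ℕ; zero; suc)
  import Data.Nat.Properties as ℕ
  open import Data.Product using (_,_)
  open import Data.Sum as Sum using (_⊎_; inj₁; inj₂)
  open import Level using (0ℓ)
  open import Relation.Binary.PropositionalEquality as ≡ using (_≡_; refl; sym; trans; cong; cong₂; module ≡-Reasoning)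
  open import Relation.Nullary using (¬_; Dec; yes; no)

  open Solver ℤ.+-*-commutativeRing using (solve)

  coeff : Poly → ℕ → ℤ
  coeff []      i       = + 0
  coeff (a ∷ f) zero    = a
  coeff (a ∷ f) (suc i) = coeff f i

  infix 4 _≐_
  -- Coefficientwise equality ignores trailing zeros, as `_≃_` does, but does not pass through a
  -- subtraction; the ring laws are proved for it and carried over to `_≃_`.
  record _≐_ (f g : Poly) : Set where
    constructor pointwise
    field at : ∀ i → coeff f i ≡ coeff g i
  open _≐_

  shift : Poly → Poly
  shift f = + 0 ∷ f

  scale : ℤ → Poly → Poly
  scale a = map (a ℤ.*_)

  coeff-⊕ : ∀ f g i → coeff (f ⊕ g) i ≡ coeff f i ℤ.+ coeff g i
  coeff-⊕ []      g       i       = sym (ℤ.+-identityˡ _)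
  coeff-⊕ (a ∷ f) []      i       = sym (ℤ.+-identityʳ _)
  coeff-⊕ (a ∷ f) (b ∷ g) zero    = refl
  coeff-⊕ (a ∷ f) (b ∷ g) (suc i) = coeff-⊕ f g i

  coeff-pneg : ∀ f i → coeff (pneg f) i ≡ ℤ.- coeff f i
  coeff-pneg []      i       = refl
  coeff-pneg (a ∷ f) zero    = refl
  coeff-pneg (a ∷ f) (suc i) = coeff-pneg f i

  coeff-scale : ∀ a f i → coeff (scale a f) i ≡ a ℤ.* coeff f i
  coeff-scale a []      i       = sym (ℤ.*-zeroʳ a)
  coeff-scale a (b ∷ f) zero    = refl
  coeff-scale a (b ∷ f) (suc i) = coeff-scale a f i

  coeff-IsZero : ∀ {f} → IsZero f → ∀ i → coeff f i ≡ + 0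
  coeff-IsZero []      i       = refl
  coeff-IsZero (p ∷ z) zero    = p
  coeff-IsZero (p ∷ z) (suc i) = coeff-IsZero z i

  IsZero-coeff : ∀ f → (∀ i → coeff f i ≡ + 0) → IsZero f
  IsZero-coeff []      z = []
  IsZero-coeff (a ∷ f) z = z 0 ∷ IsZero-coeff f (λ i → z (suc i))

  coeff-⊖ : ∀ f g i → coeff (f ⊖ g) i ≡ coeff f i ℤ.- coeff g i
  coeff-⊖ f g i = trans (coeff-⊕ f (pneg g) i) (cong (ℤ._+_ (coeff f i)) (coeff-pneg g i))

  ≃⇒≐ : ∀ {f g} → f ≃ g → f ≐ g
  ≃⇒≐ {f} {g} z = pointwise λ i → ℤ.i-j≡0⇒i≡j _ _ (trans (sym (coeff-⊖ f g i)) (coeff-IsZero z i))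

  ≐⇒≃ : ∀ {f g} → f ≐ g → f ≃ g
  ≐⇒≃ {f} {g} e = IsZero-coeff (f ⊖ g) λ i → trans (coeff-⊖ f g i) (ℤ.i≡j⇒i-j≡0 (at e i))

  ≐-refl : ∀ {f} → f ≐ f
  ≐-refl = pointwise λ _ → refl

  ≐-sym : ∀ {f g} → f ≐ g → g ≐ f
  ≐-sym e = pointwise λ i → sym (at e i)

  ≐-trans : ∀ {f g h} → f ≐ g → g ≐ h → f ≐ h
  ≐-trans e e′ = pointwise λ i → trans (at e i) (at e′ i)

  ⊕-cong≐ : ∀ {f f′ g g′} → f ≐ f′ → g ≐ g′ → f ⊕ g ≐ f′ ⊕ g′
  ⊕-cong≐ {f} {f′} {g} {g′} e e′ = pointwise λ i →
    trans (coeff-⊕ f g i) (trans (cong₂ ℤ._+_ (at e i) (at e′ i)) (sym (coeff-⊕ f′ g′ i)))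

  shift-cong : ∀ {f g} → f ≐ g → shift f ≐ shift g
  shift-cong e = pointwise λ { zero → refl ; (suc i) → at e i }

  coeff-∷⊗ : ∀ a f g i → coeff ((a ∷ f) ⊗ g) i ≡ a ℤ.* coeff g i ℤ.+ coeff (shift (f ⊗ g)) i
  coeff-∷⊗ a f g i = trans (coeff-⊕ (scale a g) (shift (f ⊗ g)) i) (cong (ℤ._+ coeff (shift (f ⊗ g)) i) (coeff-scale a g i))

  ⊗-zeroˡ≐ : ∀ f g → f ≐ [] → f ⊗ g ≐ []
  ⊗-zeroˡ≐ []      g e = ≐-refl
  ⊗-zeroˡ≐ (a ∷ f) g e = pointwise λ i → trans (coeff-∷⊗ a f g i)
    (cong₂ ℤ._+_ (trans (cong (ℤ._* coeff g i) (at e 0)) (ℤ.*-zeroˡ (coeff g i))) (tail i))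
    where
    tail : ∀ i → coeff (shift (f ⊗ g)) i ≡ + 0
    tail zero    = refl
    tail (suc i) = at (⊗-zeroˡ≐ f g (pointwise λ i → at e (suc i))) i

  ⊗-congʳ≐ : ∀ f f′ g → f ≐ f′ → f ⊗ g ≐ f′ ⊗ g
  ⊗-congʳ≐ []      f′       g e = ≐-sym (⊗-zeroˡ≐ f′ g (≐-sym e))
  ⊗-congʳ≐ (a ∷ f) []       g e = ⊗-zeroˡ≐ (a ∷ f) g e
  ⊗-congʳ≐ (a ∷ f) (a′ ∷ f′) g e = pointwise λ i → begin
    coeff ((a ∷ f) ⊗ g) i                          ≡⟨ coeff-∷⊗ a f g i ⟩
    a ℤ.* coeff g i ℤ.+ coeff (shift (f ⊗ g)) i    ≡⟨ cong₂ ℤ._+_ (cong (ℤ._* coeff g i) (at e 0))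
                                                         (at (shift-cong (⊗-congʳ≐ f f′ g (pointwise λ i → at e (suc i)))) i) ⟩
    a′ ℤ.* coeff g i ℤ.+ coeff (shift (f′ ⊗ g)) i  ≡⟨ coeff-∷⊗ a′ f′ g i ⟨
    coeff ((a′ ∷ f′) ⊗ g) i                        ∎
    where open ≡-Reasoning

  ⊗-zeroʳ≐ : ∀ f → f ⊗ [] ≐ []
  ⊗-zeroʳ≐ []      = ≐-refl
  ⊗-zeroʳ≐ (a ∷ f) = pointwise λ { zero → refl ; (suc i) → at (⊗-zeroʳ≐ f) i }

  -- The product is defined by recursion on its left factor. This mirror recursion on the right
  -- factor is what yields commutativity.
  coeff-⊗∷ : ∀ f b g i → coeff (f ⊗ (b ∷ g)) i ≡ b ℤ.* coeff f i ℤ.+ coeff (shift (f ⊗ g)) i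
  coeff-⊗∷ []      b g zero    = sym (trans (ℤ.+-identityʳ _) (ℤ.*-zeroʳ b))
  coeff-⊗∷ []      b g (suc i) = sym (trans (ℤ.+-identityʳ _) (ℤ.*-zeroʳ b))
  coeff-⊗∷ (a ∷ f) b g zero    = trans (coeff-∷⊗ a f (b ∷ g) 0) (cong (ℤ._+ + 0) (ℤ.*-comm a b))
  coeff-⊗∷ (a ∷ f) b g (suc i) = begin
    coeff ((a ∷ f) ⊗ (b ∷ g)) (suc i)                                     ≡⟨ coeff-∷⊗ a f (b ∷ g) (suc i) ⟩
    a ℤ.* coeff g i ℤ.+ coeff (f ⊗ (b ∷ g)) i                             ≡⟨ cong (ℤ._+_ (a ℤ.* coeff g i)) (coeff-⊗∷ f b g i) ⟩
    a ℤ.* coeff g i ℤ.+ (b ℤ.* coeff f i ℤ.+ coeff (shift (f ⊗ g)) i)     ≡⟨ solve 3 (λ x y z → x :+ (y :+ z) := y :+ (x :+ z)) refl (a ℤ.* coeff g i) (b ℤ.* coeff f i) _ ⟩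
    b ℤ.* coeff f i ℤ.+ (a ℤ.* coeff g i ℤ.+ coeff (shift (f ⊗ g)) i)     ≡⟨ cong (ℤ._+_ (b ℤ.* coeff f i)) (coeff-∷⊗ a f g i) ⟨
    b ℤ.* coeff f i ℤ.+ coeff ((a ∷ f) ⊗ g) i                             ∎
    where open ≡-Reasoning

  ⊗-comm≐ : ∀ f g → f ⊗ g ≐ g ⊗ f
  ⊗-comm≐ []      g = ≐-sym (⊗-zeroʳ≐ g)
  ⊗-comm≐ (a ∷ f) g = pointwise λ i →
    trans (coeff-∷⊗ a f g i)
      (trans (cong (ℤ._+_ (a ℤ.* coeff g i)) (at (shift-cong (⊗-comm≐ f g)) i)) (sym (coeff-⊗∷ g a f i)))

  ⊗-distribʳ≐ : ∀ h f g → (f ⊕ g) ⊗ h ≐ f ⊗ h ⊕ g ⊗ h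
  ⊗-distribʳ≐ h []      g       = ≐-refl
  ⊗-distribʳ≐ h (a ∷ f) []      = pointwise λ i → sym (trans (coeff-⊕ ((a ∷ f) ⊗ h) [] i) (ℤ.+-identityʳ _))
  ⊗-distribʳ≐ h (a ∷ f) (b ∷ g) = pointwise λ i → begin
    coeff ((a ℤ.+ b ∷ f ⊕ g) ⊗ h) i
      ≡⟨ coeff-∷⊗ (a ℤ.+ b) (f ⊕ g) h i ⟩
    (a ℤ.+ b) ℤ.* coeff h i ℤ.+ coeff (shift ((f ⊕ g) ⊗ h)) i
      ≡⟨ cong (ℤ._+_ ((a ℤ.+ b) ℤ.* coeff h i)) (tail i) ⟩
    (a ℤ.+ b) ℤ.* coeff h i ℤ.+ (coeff (shift (f ⊗ h)) i ℤ.+ coeff (shift (g ⊗ h)) i)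
      ≡⟨ solve 5 (λ a b h x y → (a :+ b) :* h :+ (x :+ y) := (a :* h :+ x) :+ (b :* h :+ y)) refl a b (coeff h i) _ _ ⟩
    (a ℤ.* coeff h i ℤ.+ coeff (shift (f ⊗ h)) i) ℤ.+ (b ℤ.* coeff h i ℤ.+ coeff (shift (g ⊗ h)) i)
      ≡⟨ cong₂ ℤ._+_ (coeff-∷⊗ a f h i) (coeff-∷⊗ b g h i) ⟨
    coeff ((a ∷ f) ⊗ h) i ℤ.+ coeff ((b ∷ g) ⊗ h) i
      ≡⟨ coeff-⊕ ((a ∷ f) ⊗ h) ((b ∷ g) ⊗ h) i ⟨
    coeff ((a ∷ f) ⊗ h ⊕ (b ∷ g) ⊗ h) i ∎
    where
    open ≡-Reasoning
    tail : ∀ i → coeff (shift ((f ⊕ g) ⊗ h)) i ≡ coeff (shift (f ⊗ h)) i ℤ.+ coeff (shift (g ⊗ h)) i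
    tail zero    = refl
    tail (suc i) = trans (at (⊗-distribʳ≐ h f g) i) (coeff-⊕ (f ⊗ h) (g ⊗ h) i)

  scale-⊗≐ : ∀ a g h → scale a g ⊗ h ≐ scale a (g ⊗ h)
  scale-⊗≐ a []      h = ≐-refl
  scale-⊗≐ a (b ∷ g) h = pointwise λ i → begin
    coeff ((a ℤ.* b ∷ scale a g) ⊗ h) i
      ≡⟨ coeff-∷⊗ (a ℤ.* b) (scale a g) h i ⟩
    a ℤ.* b ℤ.* coeff h i ℤ.+ coeff (shift (scale a g ⊗ h)) i
      ≡⟨ cong (ℤ._+_ (a ℤ.* b ℤ.* coeff h i)) (tail i) ⟩
    a ℤ.* b ℤ.* coeff h i ℤ.+ a ℤ.* coeff (shift (g ⊗ h)) i
      ≡⟨ solve 4 (λ a b h x → a :* b :* h :+ a :* x := a :* (b :* h :+ x)) refl a b (coeff h i) _ ⟩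
    a ℤ.* (b ℤ.* coeff h i ℤ.+ coeff (shift (g ⊗ h)) i)
      ≡⟨ cong (a ℤ.*_) (coeff-∷⊗ b g h i) ⟨
    a ℤ.* coeff ((b ∷ g) ⊗ h) i
      ≡⟨ coeff-scale a ((b ∷ g) ⊗ h) i ⟨
    coeff (scale a ((b ∷ g) ⊗ h)) i ∎
    where
    open ≡-Reasoning
    tail : ∀ i → coeff (shift (scale a g ⊗ h)) i ≡ a ℤ.* coeff (shift (g ⊗ h)) i
    tail zero    = sym (ℤ.*-zeroʳ a)
    tail (suc i) = trans (at (scale-⊗≐ a g h) i) (coeff-scale a (g ⊗ h) i)

  shift-⊗≐ : ∀ f h → shift f ⊗ h ≐ shift (f ⊗ h)
  shift-⊗≐ f h = pointwise λ i → trans (coeff-∷⊗ (+ 0) f h i) (trans (cong (ℤ._+ coeff (shift (f ⊗ h)) i) (ℤ.*-zeroˡ (coeff h i))) (ℤ.+-identityˡ _))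

  ⊗-assoc≐ : ∀ f g h → (f ⊗ g) ⊗ h ≐ f ⊗ (g ⊗ h)
  ⊗-assoc≐ []      g h = ≐-refl
  ⊗-assoc≐ (a ∷ f) g h = ≐-trans (⊗-distribʳ≐ h (scale a g) (shift (f ⊗ g)))
    (⊕-cong≐ (scale-⊗≐ a g h) (≐-trans (shift-⊗≐ (f ⊗ g) h) (shift-cong (⊗-assoc≐ f g h))))

  ⊗-identityˡ≐ : ∀ f → one ⊗ f ≐ f
  ⊗-identityˡ≐ f = pointwise λ i → trans (coeff-∷⊗ (+ 1) [] f i) (trans (cong₂ ℤ._+_ (ℤ.*-identityˡ (coeff f i)) (shift[] i)) (ℤ.+-identityʳ _))
    where
    shift[] : ∀ i → coeff (shift []) i ≡ + 0
    shift[] zero    = refl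
    shift[] (suc i) = refl

  ⊕-assoc≐ : ∀ f g h → (f ⊕ g) ⊕ h ≐ f ⊕ (g ⊕ h)
  ⊕-assoc≐ f g h = pointwise λ i → begin
    coeff ((f ⊕ g) ⊕ h) i                       ≡⟨ coeff-⊕ (f ⊕ g) h i ⟩
    coeff (f ⊕ g) i ℤ.+ coeff h i               ≡⟨ cong (ℤ._+ coeff h i) (coeff-⊕ f g i) ⟩
    coeff f i ℤ.+ coeff g i ℤ.+ coeff h i       ≡⟨ ℤ.+-assoc (coeff f i) _ _ ⟩
    coeff f i ℤ.+ (coeff g i ℤ.+ coeff h i)     ≡⟨ cong (ℤ._+_ (coeff f i)) (coeff-⊕ g h i) ⟨
    coeff f i ℤ.+ coeff (g ⊕ h) i               ≡⟨ coeff-⊕ f (g ⊕ h) i ⟨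
    coeff (f ⊕ (g ⊕ h)) i                       ∎
    where open ≡-Reasoning

  ⊕-comm≐ : ∀ f g → f ⊕ g ≐ g ⊕ f
  ⊕-comm≐ f g = pointwise λ i → trans (coeff-⊕ f g i) (trans (ℤ.+-comm (coeff f i) _) (sym (coeff-⊕ g f i)))

  ⊕-identityʳ≐ : ∀ f → f ⊕ [] ≐ f
  ⊕-identityʳ≐ f = pointwise λ i → trans (coeff-⊕ f [] i) (ℤ.+-identityʳ _)

  ⊖-inverseʳ≐ : ∀ f → f ⊖ f ≐ []
  ⊖-inverseʳ≐ f = pointwise λ i → trans (coeff-⊖ f f i) (ℤ.+-inverseʳ (coeff f i))

  pneg-cong≐ : ∀ {f g} → f ≐ g → pneg f ≐ pneg g
  pneg-cong≐ {f} {g} e = pointwise λ i → trans (coeff-pneg f i) (trans (cong ℤ.-_ (at e i)) (sym (coeff-pneg g i)))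

  ⊗-cong≐ : ∀ {f f′ g g′} → f ≐ f′ → g ≐ g′ → f ⊗ g ≐ f′ ⊗ g′
  ⊗-cong≐ {f} {f′} {g} {g′} e e′ = ≐-trans (⊗-congʳ≐ f f′ g e)
    (≐-trans (⊗-comm≐ f′ g) (≐-trans (⊗-congʳ≐ g g′ f′ e′) (⊗-comm≐ g′ f′)))

  polyRing : CommutativeRing 0ℓ 0ℓ
  polyRing = record
    { Carrier = Poly ; _≈_ = _≐_ ; _+_ = _⊕_ ; _*_ = _⊗_ ; -_ = pneg ; 0# = [] ; 1# = one
    ; isCommutativeRing = record
      { isRing = record
        { +-isAbelianGroup = record
          { isGroup = record
            { isMonoid = record
              { isSemigroup = record
                { isMagma = record
                  { isEquivalence = record { refl = ≐-refl ; sym = ≐-sym ; trans = ≐-trans }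
                  ; ∙-cong = ⊕-cong≐ }
                ; assoc = ⊕-assoc≐ }
              ; identity = (λ f → ≐-refl) , ⊕-identityʳ≐ }
            ; inverse = (λ f → ≐-trans (⊕-comm≐ (pneg f) f) (⊖-inverseʳ≐ f)) , ⊖-inverseʳ≐
            ; ⁻¹-cong = pneg-cong≐ }
          ; comm = ⊕-comm≐ }
        ; *-cong = ⊗-cong≐
        ; *-assoc = ⊗-assoc≐
        ; *-identity = ⊗-identityˡ≐ , (λ f → ≐-trans (⊗-comm≐ f one) (⊗-identityˡ≐ f))
        ; distrib = (λ f g h → ≐-trans (⊗-comm≐ f (g ⊕ h)) (≐-trans (⊗-distribʳ≐ f g h)
                       (⊕-cong≐ (⊗-comm≐ g f) (⊗-comm≐ h f))))
                  , ⊗-distribʳ≐ }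
      ; *-comm = ⊗-comm≐ } }

  module P = CommutativeRing polyRing
  open Exp P.semiring using () renaming (_^_ to _^ʳ_)

  -- The lowest coefficient of the product is that of f times that of g, so one of them is zero;
  -- that one is stripped and the induction continues on the shorter list.
  ⊗-noZeroDivisors : ∀ f g → f ⊗ g ≐ [] → f ≐ [] ⊎ g ≐ []
  ⊗-noZeroDivisors []      g       e = inj₁ ≐-refl
  ⊗-noZeroDivisors (a ∷ f) []      e = inj₂ ≐-refl
  ⊗-noZeroDivisors (a ∷ f) (b ∷ g) e = Sum.[
      (λ a≡0 → Sum.map₁ (cons a≡0) (⊗-noZeroDivisors f (b ∷ g) (pointwise λ i →
        trans (sym (trans (coeff-∷⊗ a f (b ∷ g) (suc i)) (drop a≡0 _ _))) (at e (suc i))))) ,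
      (λ b≡0 → Sum.map₂ (cons b≡0) (⊗-noZeroDivisors (a ∷ f) g (pointwise λ i →
        trans (sym (trans (coeff-⊗∷ (a ∷ f) b g (suc i)) (drop b≡0 _ _))) (at e (suc i))))) ]
    (ℤ.i*j≡0⇒i≡0∨j≡0 a (trans (sym (trans (coeff-∷⊗ a f (b ∷ g) 0) (ℤ.+-identityʳ _))) (at e 0)))
    where
    drop : ∀ {a} → a ≡ + 0 → ∀ x y → a ℤ.* x ℤ.+ y ≡ y
    drop refl x y = ℤ.+-identityˡ y
    cons : ∀ {a f} → a ≡ + 0 → f ≐ [] → a ∷ f ≐ []
    cons a≡0 f≐[] = pointwise λ { zero → a≡0 ; (suc i) → at f≐[] i }

  ≐[]⇒IsZero : ∀ {f} → f ≐ [] → IsZero f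
  ≐[]⇒IsZero {f} e = IsZero-coeff f (at e)

  IsZero⇒≐[] : ∀ {f} → IsZero f → f ≐ []
  IsZero⇒≐[] z = pointwise (coeff-IsZero z)

  ≐[]? : ∀ f → Dec (f ≐ [])
  ≐[]? f with all? (ℤ._≟ + 0) f
  ... | yes z = yes (IsZero⇒≐[] z)
  ... | no ¬z = no λ e → ¬z (≐[]⇒IsZero e)

  one≢[] : ¬ one ≐ []
  one≢[] e with at e 0
  ... | ()

  indeterminate : Poly
  indeterminate = X^ 1

  X^≐ : ∀ k → X^ k ≐ indeterminate ^ʳ k
  X^≐ zero    = ≐-refl
  X^≐ (suc k) = ≐-trans (shift-cong (≐-trans (X^≐ k) (≐-sym (⊗-identityˡ≐ (indeterminate ^ʳ k)))))
    (≐-sym (shift-⊗≐ one (indeterminate ^ʳ k)))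

  ^ᵖ≡^ : ∀ f k → f ^ᵖ k ≡ f ^ʳ k
  ^ᵖ≡^ f zero    = refl
  ^ᵖ≡^ f (suc k) = cong (f ⊗_) (^ᵖ≡^ f k)

-- The field of fractions of a decidable domain

module Fractions where

  open RingSolver
  open FieldTheory using (Field)
  open import Algebra.Bundles using (CommutativeRing)
  import Algebra.Properties.Ring as RingProperties
  open import Data.Empty using (⊥-elim)
  open import Data.Product using (_,_)
  open import Data.Sum using (_⊎_; inj₁; inj₂)
  open import Level using (0ℓ)
  open import Relation.Binary.PropositionalEquality as ≡ using ()
  import Relation.Binary.Reasoning.Setoid as SetoidReasoning
  open import Relation.Nullary using (¬_; Dec; yes; no)

  record DecidableDomain : Set₁ where
    field
      commutativeRing : CommutativeRing 0ℓ 0ℓ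
    open CommutativeRing commutativeRing
    field
      noZeroDivisors : ∀ x y → x * y ≈ 0# → x ≈ 0# ⊎ y ≈ 0#
      ≈0?            : ∀ x → Dec (x ≈ 0#)
      1≉0            : ¬ 1# ≈ 0#

  module FractionField (D : DecidableDomain) where

    open DecidableDomain D hiding (commutativeRing)
    open CommutativeRing (DecidableDomain.commutativeRing D)
    open RingProperties ring using (x∙y⁻¹≈ε⇒x≈y; x≈y⇒x∙y⁻¹≈ε)
    open Solver (DecidableDomain.commutativeRing D) using (solve)
    open SetoidReasoning setoid

    NonZero : Carrier → Set
    NonZero x = ¬ x ≈ 0#

    *-NonZero : ∀ {x y} → NonZero x → NonZero y → NonZero (x * y)
    *-NonZero {x} {y} x≉0 y≉0 xy≈0 with noZeroDivisors x y xy≈0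
    ... | inj₁ x≈0 = x≉0 x≈0
    ... | inj₂ y≈0 = y≉0 y≈0

    *-cancelʳ : ∀ {d x y} → NonZero d → x * d ≈ y * d → x ≈ y
    *-cancelʳ {d} {x} {y} d≉0 eq with noZeroDivisors (x - y) d
      (trans (solve 3 (λ x y d → (x :- y) :* d := x :* d :- y :* d) ≡.refl x y d) (x≈y⇒x∙y⁻¹≈ε eq))
    ... | inj₁ x-y≈0 = x∙y⁻¹≈ε⇒x≈y x y x-y≈0
    ... | inj₂ d≈0   = ⊥-elim (d≉0 d≈0)

    record Fraction : Set where
      constructor _/_[_]
      field
        top bot : Carrier
        bot≉0   : NonZero bot
    open Fraction

    infix 4 _∼_
    record _∼_ (x y : Fraction) : Set where
      constructor cross
      field eq : top x * bot y ≈ top y * bot x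
    open _∼_

    ∼-trans : ∀ {x y z} → x ∼ y → y ∼ z → x ∼ z
    ∼-trans {a / b [ _ ]} {c / d [ d≉0 ]} {e / f [ _ ]} (cross p) (cross r) = cross (*-cancelʳ d≉0 (begin
      a * f * d     ≈⟨ solve 3 (λ a f d → a :* f :* d := a :* d :* f) ≡.refl a f d ⟩
      a * d * f     ≈⟨ *-congʳ p ⟩
      c * b * f     ≈⟨ solve 3 (λ c b f → c :* b :* f := c :* f :* b) ≡.refl c b f ⟩
      c * f * b     ≈⟨ *-congʳ r ⟩
      e * d * b     ≈⟨ solve 3 (λ e d b → e :* d :* b := e :* b :* d) ≡.refl e d b ⟩
      e * b * d     ∎))

    _+ꟳ_ _*ꟳ_ : Fraction → Fraction → Fraction
    (a / b [ p ]) +ꟳ (c / d [ r ]) = (a * d + c * b) / (b * d) [ *-NonZero p r ]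
    (a / b [ p ]) *ꟳ (c / d [ r ]) = (a * c) / (b * d) [ *-NonZero p r ]

    -ꟳ_ : Fraction → Fraction
    -ꟳ (a / b [ p ]) = (- a) / b [ p ]

    embed : Carrier → Fraction
    embed a = a / 1# [ 1≉0 ]

    -- Totality forces a case distinction on the numerator, for which zero must be decidable; zero
    -- is sent to zero.
    inverse : Fraction → Fraction
    inverse (a / b [ p ]) with ≈0? a
    ... | yes _  = embed 0#
    ... | no a≉0 = b / a [ a≉0 ]

    inverse-cong : ∀ {x y} → x ∼ y → inverse x ∼ inverse y
    inverse-cong {a / b [ p ]} {c / d [ r ]} (cross e) with ≈0? a | ≈0? c
    ... | yes _   | yes _   = cross refl
    ... | yes a≈0 | no c≉0  = ⊥-elim (*-NonZero c≉0 p (trans (sym e) (trans (*-congʳ a≈0) (zeroˡ d))))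
    ... | no a≉0  | yes c≈0 = ⊥-elim (*-NonZero a≉0 r (trans e (trans (*-congʳ c≈0) (zeroˡ b))))
    ... | no _    | no _    = cross (trans (*-comm b c) (trans (sym e) (*-comm a d)))

    fractionRing : CommutativeRing 0ℓ 0ℓ
    fractionRing = record
      { Carrier = Fraction ; _≈_ = _∼_ ; _+_ = _+ꟳ_ ; _*_ = _*ꟳ_ ; -_ = -ꟳ_ ; 0# = embed 0# ; 1# = embed 1#
      ; isCommutativeRing = record
        { isRing = record
          { +-isAbelianGroup = record
            { isGroup = record
              { isMonoid = record
                { isSemigroup = record
                  { isMagma = record
                    { isEquivalence = record
                      { refl = cross refl ; sym = λ { (cross e) → cross (sym e) } ; trans = ∼-trans }
                    ; ∙-cong = +-cong′ }
                  ; assoc = λ { (a / b [ _ ]) (c / d [ _ ]) (e / f [ _ ]) → cross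
                      (solve 6 (λ a b c d e f → ((a :* d :+ c :* b) :* f :+ e :* (b :* d)) :* (b :* (d :* f))
                                  := (a :* (d :* f) :+ (c :* f :+ e :* d) :* b) :* (b :* d :* f)) ≡.refl a b c d e f) } }
                ; identity = (λ { (a / b [ _ ]) → cross
                                (solve 2 (λ a b → (:0 :* b :+ a :* :1) :* b := a :* (:1 :* b)) ≡.refl a b) })
                           , (λ { (a / b [ _ ]) → cross
                                (solve 2 (λ a b → (a :* :1 :+ :0 :* b) :* b := a :* (b :* :1)) ≡.refl a b) }) }
              ; inverse = (λ { (a / b [ _ ]) → cross
                              (solve 2 (λ a b → (:- a :* b :+ a :* b) :* :1 := :0 :* (b :* b)) ≡.refl a b) })
                        , (λ { (a / b [ _ ]) → cross
                              (solve 2 (λ a b → (a :* b :+ :- a :* b) :* :1 := :0 :* (b :* b)) ≡.refl a b) })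
              ; ⁻¹-cong = λ { {a / b [ _ ]} {c / d [ _ ]} (cross e) → cross (begin
                  - a * d     ≈⟨ solve 2 (λ a d → :- a :* d := :- (a :* d)) ≡.refl a d ⟩
                  - (a * d)   ≈⟨ -‿cong e ⟩
                  - (c * b)   ≈⟨ solve 2 (λ c b → :- (c :* b) := :- c :* b) ≡.refl c b ⟩
                  - c * b     ∎) } }
            ; comm = λ { (a / b [ _ ]) (c / d [ _ ]) → cross
                (solve 4 (λ a b c d → (a :* d :+ c :* b) :* (d :* b) := (c :* b :+ a :* d) :* (b :* d)) ≡.refl a b c d) } }
          ; *-cong = *-cong′
          ; *-assoc = λ { (a / b [ _ ]) (c / d [ _ ]) (e / f [ _ ]) → cross
              (solve 6 (λ a b c d e f → a :* c :* e :* (b :* (d :* f)) := a :* (c :* e) :* (b :* d :* f)) ≡.refl a b c d e f) }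
          ; *-identity = (λ { (a / b [ _ ]) → cross (solve 2 (λ a b → :1 :* a :* b := a :* (:1 :* b)) ≡.refl a b) })
                       , (λ { (a / b [ _ ]) → cross (solve 2 (λ a b → a :* :1 :* b := a :* (b :* :1)) ≡.refl a b) })
          ; distrib = (λ { (a / b [ _ ]) (c / d [ _ ]) (e / f [ _ ]) → cross
                          (solve 6 (λ a b c d e f → a :* (c :* f :+ e :* d) :* (b :* d :* (b :* f))
                            := (a :* c :* (b :* f) :+ a :* e :* (b :* d)) :* (b :* (d :* f))) ≡.refl a b c d e f) })
                    , (λ { (a / b [ _ ]) (c / d [ _ ]) (e / f [ _ ]) → cross
                          (solve 6 (λ a b c d e f → (c :* f :+ e :* d) :* a :* (d :* b :* (f :* b))
                            := (c :* a :* (f :* b) :+ e :* a :* (d :* b)) :* (d :* f :* b)) ≡.refl a b c d e f) }) }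
        ; *-comm = λ { (a / b [ _ ]) (c / d [ _ ]) → cross
            (solve 4 (λ a b c d → a :* c :* (d :* b) := c :* a :* (b :* d)) ≡.refl a b c d) } } }
      where
      +-cong′ : ∀ {x y u v} → x ∼ y → u ∼ v → x +ꟳ u ∼ y +ꟳ v
      +-cong′ {a / b [ _ ]} {a′ / b′ [ _ ]} {c / d [ _ ]} {c′ / d′ [ _ ]} (cross p) (cross r) = cross (begin
        (a * d + c * b) * (b′ * d′)
          ≈⟨ solve 6 (λ a b c d b′ d′ → (a :* d :+ c :* b) :* (b′ :* d′) := a :* b′ :* (d :* d′) :+ c :* d′ :* (b :* b′)) ≡.refl a b c d b′ d′ ⟩
        a * b′ * (d * d′) + c * d′ * (b * b′)
          ≈⟨ +-cong (*-congʳ p) (*-congʳ r) ⟩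
        a′ * b * (d * d′) + c′ * d * (b * b′)
          ≈⟨ solve 6 (λ a b c d b′ d′ → a :* b :* (d :* d′) :+ c :* d :* (b :* b′) := (a :* d′ :+ c :* b′) :* (b :* d)) ≡.refl a′ b c′ d b′ d′ ⟩
        (a′ * d′ + c′ * b′) * (b * d) ∎)
      *-cong′ : ∀ {x y u v} → x ∼ y → u ∼ v → x *ꟳ u ∼ y *ꟳ v
      *-cong′ {a / b [ _ ]} {a′ / b′ [ _ ]} {c / d [ _ ]} {c′ / d′ [ _ ]} (cross p) (cross r) = cross (begin
        a * c * (b′ * d′)      ≈⟨ solve 4 (λ a c b d → a :* c :* (b :* d) := a :* b :* (c :* d)) ≡.refl a c b′ d′ ⟩
        a * b′ * (c * d′)      ≈⟨ *-cong p r ⟩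
        a′ * b * (c′ * d)      ≈⟨ solve 4 (λ a c b d → a :* b :* (c :* d) := a :* c :* (b :* d)) ≡.refl a′ c′ b d ⟩
        a′ * c′ * (b * d)      ∎)

    top≉0 : ∀ {x} → ¬ x ∼ embed 0# → NonZero (top x)
    top≉0 x≁0 a≈0 = x≁0 (cross (trans (*-identityʳ _) (trans a≈0 (sym (zeroˡ _)))))

    inverse-inverse : ∀ {x} → ¬ x ∼ embed 0# → x *ꟳ inverse x ∼ embed 1#
    inverse-inverse {a / b [ p ]} x≁0 with ≈0? a
    ... | yes a≈0 = ⊥-elim (top≉0 x≁0 a≈0)
    ... | no _    = cross (solve 2 (λ a b → a :* b :* :1 := :1 :* (b :* a)) ≡.refl a b)

    embed-injective : ∀ {a b} → embed a ∼ embed b → a ≈ b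
    embed-injective (cross e) = trans (sym (*-identityʳ _)) (trans e (*-identityʳ _))

    fractionField : Field
    fractionField = record
      { commutativeRing = fractionRing ; _⁻¹ = inverse ; ⁻¹-cong = inverse-cong ; ⁻¹-inverse = inverse-inverse
      ; 1≉0 = λ e → 1≉0 (embed-injective e) }

    embed-cong : ∀ {a b} → a ≈ b → embed a ∼ embed b
    embed-cong e = cross (*-congʳ e)

    embed-+ : ∀ a b → embed (a + b) ∼ embed a +ꟳ embed b
    embed-+ a b = cross (solve 2 (λ a b → (a :+ b) :* (:1 :* :1) := (a :* :1 :+ b :* :1) :* :1) ≡.refl a b)

    embed-* : ∀ a b → embed (a * b) ∼ embed a *ꟳ embed b
    embed-* a b = cross (solve 2 (λ a b → a :* b :* (:1 :* :1) := a :* b :* :1) ≡.refl a b)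

    embed-neg : ∀ a → embed (- a) ∼ -ꟳ embed a
    embed-neg a = cross refl

    denominator : Fraction → Carrier
    denominator = bot

    numerator : Fraction → Carrier
    numerator = top

    denominator≉0 : ∀ x → NonZero (denominator x)
    denominator≉0 = bot≉0

    clear : ∀ x → x *ꟳ embed (denominator x) ∼ embed (numerator x)
    clear (a / b [ _ ]) = cross (solve 2 (λ a b → a :* b :* :1 := a :* (b :* :1)) ≡.refl a b)

-- Coprimality of cyclotomic polynomials

module Cyclotomic where

  open import Defs using (divisors)
  open RingSolver
  open FieldTheory using (Field)
  open Fractions
  open import Algebra.Bundles using (CommutativeRing)
  import Algebra.Properties.Semiring.Exp as Exp
  open import Data.Bool using (if_then_else_)
  open import Data.Integer as ℤ using (ℤ; +_)
  import Data.Integer.Properties as ℤ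
  open import Data.List using (List; []; _∷_; map; filter; foldr; upTo; applyUpTo)
  open import Data.List.Properties using (map-upTo; map-∘)
  open import Data.Nat as ℕ using (ℕ; zero; suc; _<_; _≤_; z≤n; s≤s)
  import Data.Nat.Properties as ℕ
  open import Data.Nat.Divisibility using (_∣_; _∣?_; divides; ∣-trans; ∣⇒≤; >⇒∤; ∣-refl; ∣-antisym)
  import Data.Nat.GCD as GCD
  open import Data.Product using (Σ; _,_)
  open import Data.Sum using (inj₁; inj₂; [_,_])
  open import Relation.Binary.PropositionalEquality as ≡ using (_≡_; _≢_)
  import Relation.Binary.Reasoning.Setoid as SetoidReasoning
  open import Relation.Nullary using (¬_; yes; no; does; contradiction)

  module DomainProperties (D : DecidableDomain) where

    open DecidableDomain D using (≈0?; 1≉0) public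
    open CommutativeRing (DecidableDomain.commutativeRing D) public renaming (Carrier to R₀)
    open Exp semiring using (_^_; ^-homo-*; ^-congˡ; ^-congʳ) public
    open Solver (DecidableDomain.commutativeRing D) public using (solve; fromℤ; fromℤ-+; fromℤ-*)
    open FractionField D public using (NonZero; *-NonZero; *-cancelʳ)
    open SetoidReasoning setoid public

    -- A Bézout identity over ℚ with cleared denominators: over ℤ the combination reaches a nonzero
    -- integer and in general not 1. It is the form of coprimality used in `CongMod`.
    record Coprime (f g : R₀) : Set where
      constructor bezout
      field
        u v      : R₀
        c        : ℤ
        identity : u * f + v * g ≈ fromℤ c
        c≢0      : c ≢ + 0

    Coprime-sym : ∀ {f g} → Coprime f g → Coprime g f
    Coprime-sym (bezout u v c e c≢0) = bezout v u c (trans (+-comm _ _) e) c≢0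

    Coprime-* : ∀ {f f′ g} → Coprime f g → Coprime f′ g → Coprime (f * f′) g
    Coprime-* {f} {f′} {g} (bezout u v c e c≢0) (bezout u′ v′ c′ e′ c′≢0) =
      bezout (u * u′) (u * f * v′ + v * fromℤ c′) (c ℤ.* c′) (begin
        u * u′ * (f * f′) + (u * f * v′ + v * fromℤ c′) * g
          ≈⟨ solve 8 (λ u u′ v v′ f f′ g c′ → u :* u′ :* (f :* f′) :+ (u :* f :* v′ :+ v :* c′) :* g
               := u :* f :* (u′ :* f′ :+ v′ :* g) :+ v :* g :* c′) ≡.refl u u′ v v′ f f′ g (fromℤ c′) ⟩
        u * f * (u′ * f′ + v′ * g) + v * g * fromℤ c′
          ≈⟨ +-congʳ (*-congˡ e′) ⟩
        u * f * fromℤ c′ + v * g * fromℤ c′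
          ≈⟨ distribʳ (fromℤ c′) _ _ ⟨
        (u * f + v * g) * fromℤ c′
          ≈⟨ *-congʳ e ⟩
        fromℤ c * fromℤ c′
          ≈⟨ fromℤ-* c c′ ⟨
        fromℤ (c ℤ.* c′) ∎)
      (λ cc′≡0 → [ c≢0 , c′≢0 ] (ℤ.i*j≡0⇒i≡0∨j≡0 c cc′≡0))

    Coprime-*ʳ : ∀ {f g g′} → Coprime f g → Coprime f g′ → Coprime f (g * g′)
    Coprime-*ʳ p r = Coprime-sym (Coprime-* (Coprime-sym p) (Coprime-sym r))

    Coprime-one : ∀ {g} → Coprime 1# g
    Coprime-one {g} = bezout 1# 0# (+ 1) (solve 1 (λ g → :1 :* :1 :+ :0 :* g := :1) ≡.refl g) (λ ())

    Coprime-^ : ∀ {f g} k → Coprime f g → Coprime f (g ^ k)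
    Coprime-^ zero    p = Coprime-sym Coprime-one
    Coprime-^ (suc k) p = Coprime-*ʳ p (Coprime-^ k p)

    Coprime-resp : ∀ {f f′ g g′} → f ≈ f′ → g ≈ g′ → Coprime f g → Coprime f′ g′
    Coprime-resp p r (bezout u v c e c≢0) = bezout u v c (trans (sym (+-cong (*-congˡ p) (*-congˡ r))) e) c≢0

    Coprime-factor : ∀ {f g h k} → g ≈ h * k → Coprime f g → Coprime f k
    Coprime-factor {f} {g} {h} {k} g≈hk (bezout u v c e c≢0) = bezout u (v * h) c
      (trans (+-congˡ (trans (*-assoc v h k) (*-congˡ (sym g≈hk)))) e) c≢0

    prodTo : ℕ → (ℕ → R₀) → R₀
    prodTo zero    f = 1#
    prodTo (suc k) f = prodTo k f * f k

    product : List R₀ → R₀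
    product = foldr _*_ 1#

    prodTo-cong : ∀ {f g : ℕ → R₀} k → (∀ i → i < k → f i ≈ g i) → prodTo k f ≈ prodTo k g
    prodTo-cong zero    _ = refl
    prodTo-cong (suc k) e = *-cong (prodTo-cong k (λ i i<k → e i (ℕ.m<n⇒m<1+n i<k))) (e k ℕ.≤-refl)

    prodTo-* : ∀ (f g : ℕ → R₀) k → prodTo k (λ i → f i * g i) ≈ prodTo k f * prodTo k g
    prodTo-* f g zero    = sym (*-identityˡ 1#)
    prodTo-* f g (suc k) = trans (*-congʳ (prodTo-* f g k))
      (solve 4 (λ a b c d → a :* b :* (c :* d) := a :* c :* (b :* d)) ≡.refl _ _ _ _)

    prodTo-head : ∀ (f : ℕ → R₀) k → prodTo (suc k) f ≈ f 0 * prodTo k (λ i → f (suc i))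
    prodTo-head f zero    = *-comm 1# (f 0)
    prodTo-head f (suc k) = trans (*-congʳ (prodTo-head f k)) (*-assoc _ _ _)

    prodTo-ones : ∀ (f : ℕ → R₀) j k → j ≤ k → (∀ i → j ≤ i → f i ≈ 1#) → prodTo k f ≈ prodTo j f
    prodTo-ones f j zero    z≤n _ = refl
    prodTo-ones f j (suc k) j≤1+k e with ℕ.m≤n⇒m<n∨m≡n j≤1+k
    ... | inj₂ ≡.refl = refl
    ... | inj₁ j<1+k  = trans (*-cong (prodTo-ones f j k (ℕ.≤-pred j<1+k) e) (e k (ℕ.≤-pred j<1+k))) (*-identityʳ _)

    product-applyUpTo : ∀ (f : ℕ → R₀) k → product (applyUpTo f k) ≈ prodTo k f
    product-applyUpTo f zero    = refl
    product-applyUpTo f (suc k) = trans (*-congˡ (product-applyUpTo (λ i → f (suc i)) k)) (sym (prodTo-head f k))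

  record CyclotomicData (D : DecidableDomain) : Set where
    open DomainProperties D
    field
      t             : R₀
      t≉0           : NonZero t
      ξ≉0           : ∀ d → NonZero (t ^ suc d - 1#)
      Φ             : ℕ → R₀
      factorization : ∀ d → product (map Φ (divisors (suc d))) ≈ t ^ suc d - 1#

  module CyclotomicTheory (D : DecidableDomain) (𝒞 : CyclotomicData D) where

    open DomainProperties D
    open CyclotomicData 𝒞

    ξ : ℕ → R₀
    ξ d = t ^ d - 1#

    geometric : ℕ → ℕ → R₀
    geometric g zero    = 0#
    geometric g (suc k) = geometric g k + t ^ (g ℕ.* k)

    ξ-geometric : ∀ g k → ξ (g ℕ.* k) ≈ ξ g * geometric g k
    ξ-geometric g zero    = trans (reflexive (≡.cong ξ (ℕ.*-zeroʳ g))) (trans (-‿inverseʳ 1#) (sym (zeroʳ _)))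
    ξ-geometric g (suc k) = begin
      t ^ (g ℕ.* suc k) - 1#
        ≈⟨ +-congʳ (trans (reflexive (≡.cong (t ^_) (ℕ.*-suc g k))) (^-homo-* t g (g ℕ.* k))) ⟩
      t ^ g * t ^ (g ℕ.* k) - 1#
        ≈⟨ solve 2 (λ a b → a :* b :- :1 := (b :- :1) :+ (a :- :1) :* b) ≡.refl (t ^ g) (t ^ (g ℕ.* k)) ⟩
      ξ (g ℕ.* k) + ξ g * t ^ (g ℕ.* k)
        ≈⟨ +-congʳ (ξ-geometric g k) ⟩
      ξ g * geometric g k + ξ g * t ^ (g ℕ.* k)
        ≈⟨ distribˡ _ _ _ ⟨
      ξ g * geometric g (suc k) ∎

    -- Each of the k summands is congruent to 1 modulo t^g - 1. The nonzero integers of the Bézout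
    -- identities below come from here.
    geometric-mod : ∀ g k → Σ R₀ λ w → geometric g k ≈ fromℤ (+ k) + ξ g * w
    geometric-mod g zero    = 0# , solve 1 (λ x → :0 := :0 :+ x :* :0) ≡.refl (ξ g)
    geometric-mod g (suc k) with geometric-mod g k
    ... | w , e = w + geometric g k , (begin
      geometric g k + t ^ (g ℕ.* k)
        ≈⟨ solve 2 (λ a b → a :+ b := a :+ (:1 :+ (b :- :1))) ≡.refl (geometric g k) (t ^ (g ℕ.* k)) ⟩
      geometric g k + (1# + ξ (g ℕ.* k))
        ≈⟨ +-cong e (+-congˡ (ξ-geometric g k)) ⟩
      fromℤ (+ k) + ξ g * w + (1# + ξ g * geometric g k)
        ≈⟨ solve 4 (λ c x w y → c :+ x :* w :+ (:1 :+ x :* y) := (:1 :+ c) :+ x :* (w :+ y)) ≡.refl (fromℤ (+ k)) (ξ g) w (geometric g k) ⟩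
      (1# + fromℤ (+ k)) + ξ g * (w + geometric g k)
        ≈⟨ +-congʳ (fromℤ-+ (+ 1) (+ k)) ⟨
      fromℤ (+ suc k) + ξ g * (w + geometric g k) ∎)

    -- Replacing the factors of non-divisors by 1 turns products over divisors into products over an
    -- initial segment, which can be compared index by index.
    factor : ℕ → ℕ → R₀
    factor d x = if does (x ∣? d) then Φ x else 1#

    factor-∣ : ∀ {d x} → x ∣ d → factor d x ≡ Φ x
    factor-∣ {d} {x} x∣d with x ∣? d
    ... | yes _  = ≡.refl
    ... | no x∤d = contradiction x∣d x∤d

    factor-∤ : ∀ {d x} → ¬ x ∣ d → factor d x ≡ 1#
    factor-∤ {d} {x} x∤d with x ∣? d
    ... | yes x∣d = contradiction x∣d x∤d
    ... | no _    = ≡.refl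

    prod-filter : ∀ d xs → product (map Φ (filter (_∣? d) xs)) ≈ product (map (factor d) xs)
    prod-filter d []       = refl
    prod-filter d (x ∷ xs) with x ∣? d
    ... | yes _ = *-congˡ (prod-filter d xs)
    ... | no _  = trans (prod-filter d xs) (sym (*-identityˡ _))

    ξ-factors : ∀ d → ξ (suc d) ≈ prodTo (suc d) (λ i → factor (suc d) (suc i))
    ξ-factors d = sym (begin
      prodTo (suc d) (λ i → factor (suc d) (suc i))
        ≈⟨ product-applyUpTo _ (suc d) ⟨
      product (applyUpTo (λ i → factor (suc d) (suc i)) (suc d))
        ≡⟨ ≡.cong product (≡.sym (≡.trans (≡.sym (map-∘ (upTo (suc d)))) (map-upTo _ (suc d)))) ⟩
      product (map (factor (suc d)) (map suc (upTo (suc d))))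
        ≈⟨ prod-filter (suc d) (map suc (upTo (suc d))) ⟨
      product (map Φ (divisors (suc d)))
        ≈⟨ factorization d ⟩
      ξ (suc d) ∎)

    cofactor : ℕ → R₀
    cofactor zero    = 1#
    cofactor (suc d) = prodTo d (λ i → factor (suc d) (suc i))

    ξ-cofactor : ∀ d → ξ (suc d) ≈ cofactor (suc d) * Φ (suc d)
    ξ-cofactor d = trans (ξ-factors d) (*-congˡ (reflexive (factor-∣ ∣-refl)))

    Φ≉0 : ∀ d → ¬ Φ (suc d) ≈ 0#
    Φ≉0 d e = ξ≉0 d (trans (ξ-cofactor d) (trans (*-congˡ e) (zeroʳ _)))

    -- The divisors of d + 1 split into those of g + 1, d + 1 itself, and the others, whose factors
    -- make up R.
    Φ-proper : ∀ d g → suc g ∣ suc d → suc g < suc d → Σ R₀ λ R → ξ (suc d) ≈ ξ (suc g) * (R * Φ (suc d))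
    Φ-proper d g g∣d g<d = prodTo d rest , (begin
      ξ (suc d)
        ≈⟨ ξ-factors d ⟩
      prodTo (suc d) (λ i → factor (suc d) (suc i))
        ≈⟨ prodTo-cong (suc d) (λ i _ → split (suc i)) ⟩
      prodTo (suc d) (λ i → factor (suc g) (suc i) * rest i)
        ≈⟨ prodTo-* _ rest (suc d) ⟩
      prodTo (suc d) (λ i → factor (suc g) (suc i)) * (prodTo d rest * rest d)
        ≈⟨ *-cong (prodTo-ones _ (suc g) (suc d) (ℕ.<⇒≤ g<d) (λ i g<i → reflexive (factor-∤ (>⇒∤ (s≤s g<i)))))
                    (*-congˡ (reflexive (≡.trans (rest-∤ (>⇒∤ g<d)) (factor-∣ ∣-refl)))) ⟩
      prodTo (suc g) (λ i → factor (suc g) (suc i)) * (prodTo d rest * Φ (suc d))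
        ≈⟨ *-congʳ (ξ-factors g) ⟨
      ξ (suc g) * (prodTo d rest * Φ (suc d)) ∎)
      where
      rest′ : ℕ → R₀
      rest′ x = if does (x ∣? suc g) then 1# else factor (suc d) x
      rest : ℕ → R₀
      rest i = rest′ (suc i)
      rest-∤ : ∀ {x} → ¬ x ∣ suc g → rest′ x ≡ factor (suc d) x
      rest-∤ {x} x∤g with x ∣? suc g
      ... | yes x∣g = contradiction x∣g x∤g
      ... | no _    = ≡.refl
      split : ∀ x → factor (suc d) x ≈ factor (suc g) x * rest′ x
      split x with x ∣? suc g
      ... | yes x∣g = trans (reflexive (factor-∣ (∣-trans x∣g g∣d))) (sym (*-identityʳ _))
      ... | no _    = sym (*-identityˡ _)

    -- Cancelling ξ (g + 1) identifies R Φ with the geometric sum, which is congruent modulo ξ (g +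
    -- 1) to the nonzero integer (d + 1)/(g + 1).
    Φ-coprime-proper : ∀ d g → suc g ∣ suc d → suc g < suc d → Coprime (Φ (suc d)) (ξ (suc g))
    Φ-coprime-proper d g (divides (suc k) d≡kg) g<d with Φ-proper d g (divides (suc k) d≡kg) g<d | geometric-mod (suc g) (suc k)
    ... | R , e | w , e′ = bezout R (- w) (+ suc k) (begin
        R * Φ (suc d) + - w * ξ (suc g)
          ≈⟨ +-congʳ (*-cancelʳ (ξ≉0 g) (begin
               R * Φ (suc d) * ξ (suc g)             ≈⟨ *-comm _ _ ⟩
               ξ (suc g) * (R * Φ (suc d))           ≈⟨ e ⟨
               ξ (suc d)                             ≡⟨ ≡.cong ξ (≡.trans d≡kg (ℕ.*-comm (suc k) (suc g))) ⟩
               ξ (suc g ℕ.* suc k)                   ≈⟨ ξ-geometric (suc g) (suc k) ⟩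
               ξ (suc g) * geometric (suc g) (suc k) ≈⟨ *-comm _ _ ⟩
               geometric (suc g) (suc k) * ξ (suc g) ∎)) ⟩
        geometric (suc g) (suc k) + - w * ξ (suc g)
          ≈⟨ +-congʳ e′ ⟩
        fromℤ (+ suc k) + ξ (suc g) * w + - w * ξ (suc g)
          ≈⟨ solve 3 (λ c x w → c :+ x :* w :+ :- w :* x := c) ≡.refl (fromℤ (+ suc k)) (ξ (suc g)) w ⟩
        fromℤ (+ suc k) ∎)
      (λ ())

    -- A Bézout identity g + yd = xi between exponents transfers through t^g - 1 = (t^(g + yd) - 1)
    -- - t^g (t^(yd) - 1); the other sign is symmetric.
    ξ-gcd : ∀ i d → Σ R₀ λ A → Σ R₀ λ B → ξ (GCD.gcd i d) ≈ A * ξ i + B * ξ d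
    ξ-gcd i d with GCD.Bézout.identity (GCD.gcd-GCD i d)
    ... | GCD.Bézout.+- x y eq = geometric i x , - (t ^ g * geometric d y) ,
          combine i d x y (≡.trans eq (ℕ.*-comm x i))
      where
      g = GCD.gcd i d
      combine : ∀ i d x y → g ℕ.+ y ℕ.* d ≡ i ℕ.* x → ξ g ≈ geometric i x * ξ i + - (t ^ g * geometric d y) * ξ d
      combine i d x y eq = begin
        t ^ g - 1#
          ≈⟨ solve 2 (λ a b → a :- :1 := (a :* b :- :1) :- a :* (b :- :1)) ≡.refl (t ^ g) (t ^ (y ℕ.* d)) ⟩
        (t ^ g * t ^ (y ℕ.* d) - 1#) - t ^ g * ξ (y ℕ.* d)
          ≈⟨ +-cong (+-congʳ (trans (sym (^-homo-* t g (y ℕ.* d))) (reflexive (≡.cong (t ^_) eq))))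
                      (-‿cong (*-congˡ (trans (reflexive (≡.cong ξ (ℕ.*-comm y d))) (ξ-geometric d y)))) ⟩
        ξ (i ℕ.* x) - t ^ g * (ξ d * geometric d y)
          ≈⟨ +-congʳ (ξ-geometric i x) ⟩
        ξ i * geometric i x - t ^ g * (ξ d * geometric d y)
          ≈⟨ solve 5 (λ a b x d y → a :* b :- x :* (d :* y) := b :* a :+ :- (x :* y) :* d) ≡.refl (ξ i) (geometric i x) (t ^ g) (ξ d) (geometric d y) ⟩
        geometric i x * ξ i + - (t ^ g * geometric d y) * ξ d ∎
    ... | GCD.Bézout.-+ x y eq = - (t ^ g * geometric i x) , geometric d y , (begin
        t ^ g - 1#
          ≈⟨ solve 2 (λ a b → a :- :1 := (a :* b :- :1) :- a :* (b :- :1)) ≡.refl (t ^ g) (t ^ (x ℕ.* i)) ⟩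
        (t ^ g * t ^ (x ℕ.* i) - 1#) - t ^ g * ξ (x ℕ.* i)
          ≈⟨ +-cong (+-congʳ (trans (sym (^-homo-* t g (x ℕ.* i))) (reflexive (≡.cong (t ^_) (≡.trans eq (ℕ.*-comm y d))))))
                      (-‿cong (*-congˡ (trans (reflexive (≡.cong ξ (ℕ.*-comm x i))) (ξ-geometric i x)))) ⟩
        ξ (d ℕ.* y) - t ^ g * (ξ i * geometric i x)
          ≈⟨ +-congʳ (ξ-geometric d y) ⟩
        ξ d * geometric d y - t ^ g * (ξ i * geometric i x)
          ≈⟨ solve 5 (λ a b x d y → a :* b :- x :* (d :* y) := :- (x :* y) :* d :+ b :* a) ≡.refl (ξ d) (geometric d y) (t ^ g) (ξ i) (geometric i x) ⟩
        - (t ^ g * geometric i x) * ξ i + geometric d y * ξ d ∎)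
      where g = GCD.gcd i d

    -- Let g be the gcd of i and d + 1, a proper divisor of d + 1. Then ξ g is a combination of ξ i
    -- and ξ (d + 1), the latter is a multiple of Φ, and Φ is already coprime to ξ g.
    Φ-coprime-ξ : ∀ d i → ¬ suc d ∣ i → Coprime (Φ (suc d)) (ξ i)
    Φ-coprime-ξ d i d∤i with GCD.gcd i (suc d) in eq | ξ-gcd i (suc d) | GCD.gcd[m,n]∣n i (suc d) | GCD.gcd[m,n]∣m i (suc d)
    ... | zero  | _         | g∣d | _ = contradiction g∣d (λ { (divides k d≡) → ℕ.1+n≢0 (≡.trans d≡ (ℕ.*-zeroʳ k)) })
    ... | suc g | A , B , e | g∣d | g∣i with ℕ.m≤n⇒m<n∨m≡n (∣⇒≤ g∣d)
    ...   | inj₂ ≡.refl = contradiction g∣i d∤i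
    ...   | inj₁ g<d with Φ-coprime-proper d g g∣d g<d
    ...     | bezout u v c e′ c≢0 = bezout (u + v * B * cofactor (suc d)) (v * A) c (begin
        (u + v * B * cofactor (suc d)) * Φ (suc d) + v * A * ξ i
          ≈⟨ solve 7 (λ u v A B f φ x → (u :+ v :* B :* f) :* φ :+ v :* A :* x := u :* φ :+ v :* (A :* x :+ B :* (f :* φ))) ≡.refl u v A B (cofactor (suc d)) (Φ (suc d)) (ξ i) ⟩
        u * Φ (suc d) + v * (A * ξ i + B * (cofactor (suc d) * Φ (suc d)))
          ≈⟨ +-congˡ (*-congˡ (+-congˡ (*-congˡ (ξ-cofactor d)))) ⟨
        u * Φ (suc d) + v * (A * ξ i + B * ξ (suc d))
          ≈⟨ +-congˡ (*-congˡ e) ⟨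
        u * Φ (suc d) + v * ξ (suc g)
          ≈⟨ e′ ⟩
        fromℤ c ∎) c≢0

    -- Of two distinct indices one does not divide the other, and Φ of the other index divides the
    -- corresponding ξ.
    Φ-coprime : ∀ d d′ → d ≢ d′ → Coprime (Φ (suc d)) (Φ (suc d′))
    Φ-coprime d d′ d≢d′ with suc d ∣? suc d′ | suc d′ ∣? suc d
    ... | no d∤d′  | _        = Coprime-factor (ξ-cofactor d′) (Φ-coprime-ξ d (suc d′) d∤d′)
    ... | yes _    | no d′∤d  = Coprime-sym (Coprime-factor (ξ-cofactor d) (Φ-coprime-ξ d′ (suc d) d′∤d))
    ... | yes d∣d′ | yes d′∣d = contradiction (ℕ.suc-injective (∣-antisym d∣d′ d′∣d)) d≢d′

-- Cyclotomic localisations and the Chinese remainder theorem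

module Localization where

  open RingSolver
  open FieldTheory
  open Fractions
  open Cyclotomic
  open QSeries using (GenericElement; module QProperties)
  open Local using (LocalRing; module LocalProperties)
  open import Data.Integer using (+_)
  open import Data.Nat as ℕ using (ℕ; zero; suc; _<_; _≤_)
  import Data.Nat.Properties as ℕ
  open import Data.Nat.Divisibility using (_∣_; _∣?_; _∣0; 1∣_; ∣-refl)
  open import Data.Product using (Σ; _×_; _,_; proj₁; proj₂)
  open import Data.Sum using (_⊎_; inj₁; inj₂)
  open import Relation.Binary.PropositionalEquality as ≡ using (_≡_; _≢_)
  open import Relation.Nullary using (¬_; yes; no; contradiction)

  -- An interface to the fraction field, so that later arguments use embedding and clearing of
  -- denominators and never the representation of fractions.
  record QuotientField (D : DecidableDomain) : Set₁ where
    open DomainProperties D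
    field
      field′ : Field
    open FieldProperties field′ using () renaming (K to Fraction; _≈_ to _≈′_; _+_ to _+′_; _*_ to _*′_; -_ to -′_)
    field
      embed           : R₀ → Fraction
      embed-cong      : ∀ {a b} → a ≈ b → embed a ≈′ embed b
      embed-injective : ∀ {a b} → embed a ≈′ embed b → a ≈ b
      embed-+         : ∀ a b → embed (a + b) ≈′ embed a +′ embed b
      embed-*         : ∀ a b → embed (a * b) ≈′ embed a *′ embed b
      embed-neg       : ∀ a → embed (- a) ≈′ -′ embed a
      embed-0         : embed 0# ≈′ FieldProperties.0# field′
      embed-1         : embed 1# ≈′ FieldProperties.1# field′
      clear           : ∀ x → Σ R₀ λ d → Σ R₀ λ a → NonZero d × x *′ embed d ≈′ embed a

  module FractionsOf (D : DecidableDomain) (𝔔 : QuotientField D) where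

    open DomainProperties D
    open QuotientField 𝔔 public
    module 𝕂 = FieldProperties field′
    open 𝕂 using () renaming (K to Fraction) public

    embed-NonZero : ∀ {a} → NonZero a → 𝕂.NonZero (embed a)
    embed-NonZero a≉0 e = a≉0 (embed-injective (𝕂.trans e (𝕂.sym embed-0)))

    embed-^ : ∀ a k → embed (a ^ k) 𝕂.≈ embed a 𝕂.^ k
    embed-^ a zero    = embed-1
    embed-^ a (suc k) = 𝕂.trans (embed-* a (a ^ k)) (𝕂.*-congˡ (embed-^ a k))

    embed-- : ∀ a b → embed (a - b) 𝕂.≈ embed a 𝕂.- embed b
    embed-- a b = 𝕂.trans (embed-+ a (- b)) (𝕂.+-congˡ (embed-neg b))

    -- x is a fraction whose numerator is divisible by h and whose denominator is coprime to f.
    record Denominator (f h : R₀) (x : Fraction) : Set where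
      constructor over
      field
        den      : R₀
        quotient : R₀
        den≉0    : NonZero den
        coprime  : Coprime den f
        cleared  : x 𝕂.* embed den 𝕂.≈ embed (h * quotient)

    module _ {f : R₀} where

      Integral : Fraction → Set
      Integral = Denominator f 1#

      integral : ∀ {x} den a → NonZero den → Coprime den f → x 𝕂.* embed den 𝕂.≈ embed a → Integral x
      integral den a den≉0 cop e = over den a den≉0 cop (𝕂.trans e (embed-cong (sym (*-identityˡ a))))

      cleared₁ : ∀ {x} (p : Integral x) → x 𝕂.* embed (Denominator.den p) 𝕂.≈ embed (Denominator.quotient p)
      cleared₁ p = 𝕂.trans (Denominator.cleared p) (embed-cong (*-identityˡ _))

      Integral-embed : ∀ a → Integral (embed a)
      Integral-embed a = integral 1# a 1≉0 Coprime-one (𝕂.trans (𝕂.*-congˡ embed-1) (𝕂.*-identityʳ _))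

      Integral-resp : ∀ {x y} → x 𝕂.≈ y → Integral x → Integral y
      Integral-resp x≈y (over d a d≉0 cop e) = over d a d≉0 cop (𝕂.trans (𝕂.*-congʳ (𝕂.sym x≈y)) e)

      Integral-+ : ∀ {x y} → Integral x → Integral y → Integral (x 𝕂.+ y)
      Integral-+ {x} {y} p@(over d a d≉0 cop _) r@(over d′ a′ d′≉0 cop′ _) =
        integral (d * d′) (a * d′ + a′ * d) (*-NonZero d≉0 d′≉0) (Coprime-* cop cop′) (𝕂.begin
          (x 𝕂.+ y) 𝕂.* embed (d * d′)
            𝕂.≈⟨ 𝕂.*-congˡ (embed-* d d′) ⟩
          (x 𝕂.+ y) 𝕂.* (embed d 𝕂.* embed d′)
            𝕂.≈⟨ 𝕂.solve 4 (λ x y d e → (x :+ y) :* (d :* e) := x :* d :* e :+ y :* e :* d) ≡.refl x y (embed d) (embed d′) ⟩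
          x 𝕂.* embed d 𝕂.* embed d′ 𝕂.+ y 𝕂.* embed d′ 𝕂.* embed d
            𝕂.≈⟨ 𝕂.+-cong (𝕂.*-congʳ (cleared₁ p)) (𝕂.*-congʳ (cleared₁ r)) ⟩
          embed a 𝕂.* embed d′ 𝕂.+ embed a′ 𝕂.* embed d
            𝕂.≈⟨ 𝕂.sym (𝕂.trans (embed-+ (a * d′) (a′ * d)) (𝕂.+-cong (embed-* a d′) (embed-* a′ d))) ⟩
          embed (a * d′ + a′ * d) 𝕂.∎)

      Integral-* : ∀ {x y} → Integral x → Integral y → Integral (x 𝕂.* y)
      Integral-* {x} {y} p@(over d a d≉0 cop _) r@(over d′ a′ d′≉0 cop′ _) =
        integral (d * d′) (a * a′) (*-NonZero d≉0 d′≉0) (Coprime-* cop cop′) (𝕂.begin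
          x 𝕂.* y 𝕂.* embed (d * d′)
            𝕂.≈⟨ 𝕂.*-congˡ (embed-* d d′) ⟩
          x 𝕂.* y 𝕂.* (embed d 𝕂.* embed d′)
            𝕂.≈⟨ 𝕂.solve 4 (λ x y d e → x :* y :* (d :* e) := x :* d :* (y :* e)) ≡.refl x y (embed d) (embed d′) ⟩
          x 𝕂.* embed d 𝕂.* (y 𝕂.* embed d′)
            𝕂.≈⟨ 𝕂.*-cong (cleared₁ p) (cleared₁ r) ⟩
          embed a 𝕂.* embed a′
            𝕂.≈⟨ 𝕂.sym (embed-* a a′) ⟩
          embed (a * a′) 𝕂.∎)

      Integral-neg : ∀ {x} → Integral x → Integral (𝕂.- x)
      Integral-neg {x} p@(over d a d≉0 cop _) = integral d (- a) d≉0 cop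
        (𝕂.trans (𝕂.solve 2 (λ x d → :- x :* d := :- (x :* d)) ≡.refl x (embed d))
          (𝕂.trans (𝕂.-‿cong (cleared₁ p)) (𝕂.sym (embed-neg a))))

      Integral-⁻¹ : ∀ {x} d a → NonZero d → Coprime d f → x 𝕂.≈ embed d → Integral (embed a 𝕂.* x 𝕂.⁻¹)
      Integral-⁻¹ {x} d a d≉0 cop x≈d = integral d a d≉0 cop (𝕂.begin
        embed a 𝕂.* x 𝕂.⁻¹ 𝕂.* embed d     𝕂.≈⟨ 𝕂.*-congˡ (𝕂.sym x≈d) ⟩
        embed a 𝕂.÷ x 𝕂.* x                𝕂.≈⟨ 𝕂.÷-cancel (𝕂.NonZero-resp (𝕂.sym x≈d) (embed-NonZero d≉0)) ⟩
        embed a                            𝕂.∎)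

    -- Everything is coprime to 1 and a multiple of it. This covers the indices that do not divide
    -- n, whose factor is 1.
    Denominator-trivial : ∀ x → Denominator 1# 1# x
    Denominator-trivial x with clear x
    ... | d , a , d≉0 , e = integral d a d≉0 (Coprime-sym Coprime-one) e

    Denominator-resp : ∀ {f f′ h h′ x} → f ≈ f′ → h ≈ h′ → Denominator f h x → Denominator f′ h′ x
    Denominator-resp f≈ h≈ (over d a d≉0 cop e) =
      over d a d≉0 (Coprime-resp refl f≈ cop) (𝕂.trans e (embed-cong (*-congʳ h≈)))

    Coprime-shift : ∀ {f g} h → Coprime f g → Coprime (f + g * h) g
    Coprime-shift {f} {g} h (bezout u v c e c≢0) = bezout u (v - u * h) c
      (trans (solve 5 (λ u v f g h → u :* (f :+ g :* h) :+ (v :- u :* h) :* g := u :* f :+ v :* g) ≡.refl u v f g h) e) c≢0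

    -- The scalar s ∈ {1, 2} only serves to keep the new denominator nonzero.
    module _ {f g : R₀} (f≉0 : NonZero f) (f⊥g : Coprime f g) {x : Fraction} (p : Denominator f f x) (r : Denominator g g x) where

      private
        open module p = Denominator p renaming (den to d; quotient to a)
        open module r = Denominator r renaming (den to d′; quotient to a′)

      -- From x d = f a and x d′ = g a′ follows x (d g + s f d′) = f g (a + s a′). The new
      -- denominator is congruent to d g modulo f and to s f d′ modulo g, hence coprime to both.
      combine : ∀ s → Coprime s g → NonZero (d * g + f * (s * d′)) → Denominator (f * g) (f * g) x
      combine s s⊥g nz = over (d * g + f * (s * d′)) (a + s * a′) nz
        (Coprime-*ʳ (Coprime-shift (s * d′) (Coprime-* p.coprime (Coprime-sym f⊥g)))
                    (Coprime-resp (trans (+-congˡ (*-comm g d)) (+-comm _ _)) refl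
                      (Coprime-shift d (Coprime-* f⊥g (Coprime-* s⊥g r.coprime)))))
        (𝕂.begin
          x 𝕂.* embed (d * g + f * (s * d′))
            𝕂.≈⟨ 𝕂.*-congˡ (𝕂.trans (embed-+ _ _) (𝕂.+-cong (embed-* d g) (𝕂.trans (embed-* f _) (𝕂.*-congˡ (embed-* s d′))))) ⟩
          x 𝕂.* (embed d 𝕂.* embed g 𝕂.+ embed f 𝕂.* (embed s 𝕂.* embed d′))
            𝕂.≈⟨ 𝕂.solve 6 (λ x d g f s d′ → x :* (d :* g :+ f :* (s :* d′)) := x :* d :* g :+ f :* s :* (x :* d′)) ≡.refl x (embed d) (embed g) (embed f) (embed s) (embed d′) ⟩
          x 𝕂.* embed d 𝕂.* embed g 𝕂.+ embed f 𝕂.* embed s 𝕂.* (x 𝕂.* embed d′)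
            𝕂.≈⟨ 𝕂.+-cong (𝕂.*-congʳ p.cleared) (𝕂.*-congˡ r.cleared) ⟩
          embed (f * a) 𝕂.* embed g 𝕂.+ embed f 𝕂.* embed s 𝕂.* embed (g * a′)
            𝕂.≈⟨ 𝕂.+-cong (𝕂.sym (embed-* (f * a) g)) (𝕂.trans (𝕂.*-congʳ (𝕂.sym (embed-* f s))) (𝕂.sym (embed-* (f * s) (g * a′)))) ⟩
          embed (f * a * g) 𝕂.+ embed (f * s * (g * a′))
            𝕂.≈⟨ 𝕂.sym (embed-+ _ _) ⟩
          embed (f * a * g + f * s * (g * a′))
            𝕂.≈⟨ embed-cong (solve 5 (λ f a g s a′ → f :* a :* g :+ f :* s :* (g :* a′) := f :* g :* (a :+ s :* a′)) ≡.refl f a g s a′) ⟩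
          embed (f * g * (a + s * a′)) 𝕂.∎)

      chineseRemainder : Denominator (f * g) (f * g) x
      chineseRemainder with ≈0? (d * g + f * (1# * d′))
      ... | no nz  = combine 1# Coprime-one nz
      ... | yes z  = combine (1# + 1#) 2⊥g (λ e → *-NonZero f≉0 r.den≉0 (begin
          f * d′
            ≈⟨ solve 4 (λ d g f d′ → f :* d′ := d :* g :+ f :* ((:1 :+ :1) :* d′) :- (d :* g :+ f :* (:1 :* d′))) ≡.refl d g f d′ ⟩
          (d * g + f * ((1# + 1#) * d′)) - (d * g + f * (1# * d′))
            ≈⟨ +-cong e (-‿cong z) ⟩
          0# - 0#
            ≈⟨ -‿inverseʳ 0# ⟩
          0# ∎))
        where
        2⊥g : Coprime (1# + 1#) g
        2⊥g = bezout 1# 0# (+ 2) (trans (solve 1 (λ g → :1 :* (:1 :+ :1) :+ :0 :* g := :1 :+ :1) ≡.refl g) (sym (fromℤ-+ (+ 1) (+ 1)))) (λ ())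

  module CyclotomicLocalRing (D : DecidableDomain) (𝔔 : QuotientField D) (𝒞 : CyclotomicData D) where

    open DomainProperties D
    open CyclotomicData 𝒞
    open CyclotomicTheory D 𝒞
    open FractionsOf D 𝔔

    generic : GenericElement field′
    generic = record
      { q = embed t
      ; q≉0 = embed-NonZero t≉0
      ; torsionFree = λ i → 𝕂.NonZero-resp (embed-1-t^ (suc i)) (embed-NonZero (1-t^≉0 i)) }
      where
      1-t^≉0 : ∀ i → NonZero (1# - t ^ suc i)
      1-t^≉0 i e = ξ≉0 i (trans (solve 1 (λ x → x :- :1 := :- (:1 :- x)) ≡.refl (t ^ suc i)) (trans (-‿cong e) (solve 0 (:- :0 := :0) ≡.refl)))
      embed-1-t^ : ∀ i → embed (1# - t ^ i) 𝕂.≈ 𝕂.1# 𝕂.- embed t 𝕂.^ i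
      embed-1-t^ i = 𝕂.trans (embed-- 1# (t ^ i)) (𝕂.+-cong embed-1 (𝕂.-‿cong (embed-^ t i)))

    open QProperties field′ generic using (E)

    E≈ : ∀ i → E i 𝕂.≈ embed (- ξ i)
    E≈ i = 𝕂.trans (𝕂.trans (𝕂.+-cong (𝕂.sym embed-1) (𝕂.-‿cong (𝕂.sym (embed-^ t i)))) (𝕂.sym (embed-- 1# (t ^ i))))
      (embed-cong (solve 1 (λ x → :1 :- x := :- (x :- :1)) ≡.refl (t ^ i)))

    Coprime-neg : ∀ {f g} → Coprime f g → Coprime (- f) g
    Coprime-neg {f} {g} (bezout u v c e c≢0) = bezout (- u) v c
      (trans (solve 4 (λ u v f g → :- u :* :- f :+ v :* g := u :* f :+ v :* g) ≡.refl u v f g) e) c≢0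

    neg-NonZero : ∀ {a} → NonZero a → NonZero (- a)
    neg-NonZero {a} a≉0 e = a≉0 (trans (solve 1 (λ a → a := :- (:- a)) ≡.refl a) (trans (-‿cong e) (solve 0 (:- :0 := :0) ≡.refl)))

    geometric≉0 : ∀ g k → NonZero (geometric (suc g) (suc k))
    geometric≉0 g k e = ξ≉0 (k ℕ.+ g ℕ.* suc k) (trans (ξ-geometric (suc g) (suc k)) (trans (*-congˡ e) (zeroʳ _)))

    -- The geometric sum is congruent to k + 1 modulo ξ (d + 1), a multiple of Φ. This is what
    -- `Int-ratio` rests on.
    geometric-coprime : ∀ d k → Coprime (geometric (suc d) (suc k)) (Φ (suc d))
    geometric-coprime d k = bezout 1# (- (w * cofactor (suc d))) (+ suc k) (begin
      1# * G + - (w * cofactor (suc d)) * Φ (suc d)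
        ≈⟨ solve 4 (λ G w c φ → :1 :* G :+ :- (w :* c) :* φ := G :- (c :* φ) :* w) ≡.refl G w (cofactor (suc d)) (Φ (suc d)) ⟩
      G - cofactor (suc d) * Φ (suc d) * w
        ≈⟨ +-cong (proj₂ (geometric-mod (suc d) (suc k))) (-‿cong (*-congʳ (sym (ξ-cofactor d)))) ⟩
      fromℤ (+ suc k) + ξ (suc d) * w - ξ (suc d) * w
        ≈⟨ solve 2 (λ c x → c :+ x :- x := c) ≡.refl (fromℤ (+ suc k)) (ξ (suc d) * w) ⟩
      fromℤ (+ suc k) ∎) (λ ())
      where
      G = geometric (suc d) (suc k)
      w = proj₁ (geometric-mod (suc d) (suc k))

    t-coprime : ∀ d → Coprime t (Φ (suc d))
    t-coprime d = bezout (t ^ d) (- cofactor (suc d)) (+ 1) (begin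
      t ^ d * t + - cofactor (suc d) * Φ (suc d)
        ≈⟨ solve 4 (λ p t c φ → p :* t :+ :- c :* φ := t :* p :- c :* φ) ≡.refl (t ^ d) t (cofactor (suc d)) (Φ (suc d)) ⟩
      t ^ suc d - cofactor (suc d) * Φ (suc d)
        ≈⟨ +-congˡ (-‿cong (ξ-cofactor d)) ⟨
      t ^ suc d - ξ (suc d)
        ≈⟨ solve 1 (λ x → x :- (x :- :1) := :1) ≡.refl (t ^ suc d) ⟩
      1# ∎) (λ ())

    localRing : ∀ d → LocalRing field′ generic (suc d)
    localRing d = record
      { Int = Integral {Φ (suc d)}
      ; Int-resp = Integral-resp
      ; Int-0 = Integral-resp embed-0 (Integral-embed 0#)
      ; Int-1 = Integral-resp embed-1 (Integral-embed 1#)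
      ; Int-+ = Integral-+
      ; Int-* = Integral-*
      ; Int-neg = Integral-neg
      ; Int-q = Integral-embed t
      ; Int-q⁻¹ = Integral-resp (𝕂.trans (𝕂.*-congʳ embed-1) (𝕂.*-identityˡ _)) (Integral-⁻¹ t 1# t≉0 (t-coprime d) 𝕂.refl)
      ; φ = embed (Φ (suc d))
      ; Int-φ = Integral-embed (Φ (suc d))
      ; E-period = embed (- cofactor (suc d)) , Integral-embed (- cofactor (suc d)) ,
          𝕂.trans (E≈ (suc d)) (𝕂.trans (embed-cong (trans (-‿cong (ξ-cofactor d))
            (solve 2 (λ c φ → :- (c :* φ) := φ :* :- c) ≡.refl (cofactor (suc d)) (Φ (suc d))))) (embed-* _ _))
      ; Int-E⁻¹ = Int-E⁻¹
      ; Int-ratio = Int-ratio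
      }
      where
      Int-E⁻¹ : ∀ i → ¬ suc d ∣ i → Integral {Φ (suc d)} (E i 𝕂.⁻¹)
      Int-E⁻¹ zero    d∤i = contradiction (suc d ∣0) d∤i
      Int-E⁻¹ (suc i) d∤i = Integral-resp (𝕂.trans (𝕂.*-congʳ embed-1) (𝕂.*-identityˡ _))
        (Integral-⁻¹ (- ξ (suc i)) 1# (neg-NonZero (ξ≉0 i)) (Coprime-neg (Coprime-sym (Φ-coprime-ξ d (suc i) d∤i))) (E≈ (suc i)))
      Int-ratio : ∀ l → Integral {Φ (suc d)} (E (suc d) 𝕂.÷ E (suc d ℕ.* suc l))
      Int-ratio l = integral G 1# (geometric≉0 d l) (geometric-coprime d l) (𝕂.*-cancelʳ E′≉0 (𝕂.begin
        (E (suc d) 𝕂.÷ E′) 𝕂.* embed G 𝕂.* E′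
          𝕂.≈⟨ 𝕂.solve 3 (λ r g e → r :* g :* e := r :* e :* g) ≡.refl (E (suc d) 𝕂.÷ E′) (embed G) E′ ⟩
        (E (suc d) 𝕂.÷ E′) 𝕂.* E′ 𝕂.* embed G
          𝕂.≈⟨ 𝕂.*-congʳ (𝕂.÷-cancel E′≉0) ⟩
        E (suc d) 𝕂.* embed G
          𝕂.≈⟨ 𝕂.*-congʳ (E≈ (suc d)) ⟩
        embed (- ξ (suc d)) 𝕂.* embed G
          𝕂.≈⟨ 𝕂.sym (embed-* _ _) ⟩
        embed (- ξ (suc d) * G)
          𝕂.≈⟨ embed-cong (trans (solve 2 (λ x g → :- x :* g := :- (x :* g)) ≡.refl (ξ (suc d)) G) (-‿cong (sym (ξ-geometric (suc d) (suc l))))) ⟩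
        embed (- ξ (suc d ℕ.* suc l))
          𝕂.≈⟨ 𝕂.sym (E≈ (suc d ℕ.* suc l)) ⟩
        E′
          𝕂.≈⟨ 𝕂.sym (𝕂.trans (𝕂.*-congʳ embed-1) (𝕂.*-identityˡ E′)) ⟩
        embed 1# 𝕂.* E′ 𝕂.∎))
        where
        G = geometric (suc d) (suc l)
        E′ = E (suc d ℕ.* suc l)
        E′≉0 : 𝕂.NonZero E′
        E′≉0 = 𝕂.NonZero-resp (𝕂.sym (E≈ (suc d ℕ.* suc l))) (embed-NonZero (neg-NonZero (ξ≉0 (l ℕ.+ d ℕ.* suc l))))

    Div⇒Denominator : ∀ d k {x} → LocalProperties.Div (localRing d) k x → Denominator (Φ (suc d) ^ k) (Φ (suc d) ^ k) x
    Div⇒Denominator d k {x} (LocalProperties.divides {w} Int-w e) = over den quotient den≉0 (Coprime-^ k coprime) (𝕂.begin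
      x 𝕂.* embed den
        𝕂.≈⟨ 𝕂.*-congʳ e ⟩
      embed (Φ (suc d)) 𝕂.^ k 𝕂.* w 𝕂.* embed den
        𝕂.≈⟨ 𝕂.*-assoc _ _ _ ⟩
      embed (Φ (suc d)) 𝕂.^ k 𝕂.* (w 𝕂.* embed den)
        𝕂.≈⟨ 𝕂.*-cong (𝕂.sym (embed-^ (Φ (suc d)) k)) (cleared₁ Int-w) ⟩
      embed (Φ (suc d) ^ k) 𝕂.* embed quotient
        𝕂.≈⟨ 𝕂.sym (embed-* _ _) ⟩
      embed (Φ (suc d) ^ k * quotient) 𝕂.∎)
      where open Denominator Int-w

    -- Qₙ stands for [n], whose factors are the Φ_d with 1 < d ∣ n; those with d < n are f 0, …, f (n₂ - 1).
    module Moduli (n₂ : ℕ) (Qₙ : R₀) (Qₙ≈ : Qₙ * ξ 1 ≈ ξ (suc (suc n₂))) {x : Fraction}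
      (proper : ∀ d → suc (suc d) ∣ suc (suc n₂) → d < n₂ → Denominator (Φ (suc (suc d))) (Φ (suc (suc d))) x)
      (central : Denominator (Φ (suc (suc n₂)) ^ 5) (Φ (suc (suc n₂)) ^ 5) x) where

      n = suc (suc n₂)

      f : ℕ → R₀
      f i = factor n (suc (suc i))

      f-cases : ∀ i → (f i ≡ Φ (suc (suc i)) × suc (suc i) ∣ n) ⊎ f i ≡ 1#
      f-cases i with suc (suc i) ∣? n
      ... | yes i∣n = inj₁ (factor-∣ i∣n , i∣n)
      ... | no i∤n  = inj₂ (factor-∤ i∤n)

      f-Denominator : ∀ i → i < n₂ → Denominator (f i) (f i) x
      f-Denominator i i<n₂ with f i | f-cases i
      ... | _ | inj₁ (≡.refl , i∣n) = proper i i∣n i<n₂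
      ... | _ | inj₂ ≡.refl         = Denominator-trivial x

      f≉0 : ∀ i → NonZero (f i)
      f≉0 i with f i | f-cases i
      ... | _ | inj₁ (≡.refl , _) = Φ≉0 (suc i)
      ... | _ | inj₂ ≡.refl       = 1≉0

      prodTo≉0 : ∀ k → NonZero (prodTo k f)
      prodTo≉0 zero    = 1≉0
      prodTo≉0 (suc k) = *-NonZero (prodTo≉0 k) (f≉0 k)

      f-coprime-Φ : ∀ i j → i ≢ j → Coprime (f i) (Φ (suc (suc j)))
      f-coprime-Φ i j i≢j with f i | f-cases i
      ... | _ | inj₁ (≡.refl , _) = Φ-coprime (suc i) (suc j) (λ e → i≢j (ℕ.suc-injective e))
      ... | _ | inj₂ ≡.refl       = Coprime-one

      f-coprime : ∀ i j → i ≢ j → Coprime (f i) (f j)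
      f-coprime i j i≢j with f j | f-cases j
      ... | _ | inj₁ (≡.refl , _) = f-coprime-Φ i j i≢j
      ... | _ | inj₂ ≡.refl       = Coprime-sym Coprime-one

      prodTo-coprime : ∀ {g} k → (∀ i → i < k → Coprime (f i) g) → Coprime (prodTo k f) g
      prodTo-coprime zero    _ = Coprime-one
      prodTo-coprime (suc k) c = Coprime-* (prodTo-coprime k (λ i i<k → c i (ℕ.m<n⇒m<1+n i<k))) (c k ℕ.≤-refl)

      prodTo-Denominator : ∀ k → k ≤ n₂ → Denominator (prodTo k f) (prodTo k f) x
      prodTo-Denominator zero    _    = Denominator-trivial x
      prodTo-Denominator (suc k) k<n₂ = chineseRemainder (prodTo≉0 k) (prodTo-coprime k (λ i i<k → f-coprime i k (ℕ.<⇒≢ i<k)))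
        (prodTo-Denominator k (ℕ.<⇒≤ k<n₂)) (f-Denominator k k<n₂)

      -- The index 1 contributes Φ 1 = ξ 1, which is exactly the factor by which ξ n exceeds [n].
      Qₙ-factors : Qₙ ≈ prodTo n₂ f * Φ n
      Qₙ-factors = *-cancelʳ (ξ≉0 0) (begin
        Qₙ * ξ 1                                     ≈⟨ Qₙ≈ ⟩
        ξ n                                          ≈⟨ ξ-factors (suc n₂) ⟩
        prodTo n (λ i → factor n (suc i))            ≈⟨ prodTo-head _ (suc n₂) ⟩
        factor n 1 * (prodTo n₂ f * f n₂)            ≈⟨ *-cong (reflexive (factor-∣ (1∣ n))) (*-congˡ (reflexive (factor-∣ ∣-refl))) ⟩
        Φ 1 * (prodTo n₂ f * Φ n)                    ≈⟨ *-congʳ (sym (trans (ξ-cofactor 0) (*-identityˡ _))) ⟩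
        ξ 1 * (prodTo n₂ f * Φ n)                    ≈⟨ *-comm _ _ ⟩
        prodTo n₂ f * Φ n * ξ 1                      ∎)

      -- In [n] Φₙ⁴ the factor [n] contributes one more Φₙ, so the modulus is the product of the Φ_d
      -- with 1 < d < n, d ∣ n, times Φₙ⁵.
      total : Denominator (Qₙ * Φ n ^ 4) (Qₙ * Φ n ^ 4) x
      total = Denominator-resp eq eq (chineseRemainder (prodTo≉0 n₂)
        (Coprime-^ 5 (prodTo-coprime n₂ (λ i i<n₂ → f-coprime-Φ i n₂ (ℕ.<⇒≢ i<n₂)))) (prodTo-Denominator n₂ ℕ.≤-refl) central)
        where
        eq : prodTo n₂ f * Φ n ^ 5 ≈ Qₙ * Φ n ^ 4
        eq = trans (solve 2 (λ p φ → p :* φ :^ 5 := p :* φ :* φ :^ 4) ≡.refl (prodTo n₂ f) (Φ n)) (*-congʳ (sym Qₙ-factors))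

-- Translation between the concrete fractions and the fraction field

module Assembly where

  open import Defs
  open RingSolver
  open FieldTheory
  open Polynomials
  open Fractions
  open Summation
  open QSeries
  open Plain
  open Local
  open Periodic
  open Central
  open Cyclotomic
  open Localization
  open import Data.Integer as ℤ using (ℤ; +_; -[1+_])
  import Data.Integer.Properties as ℤ
  open import Data.List using ([]; _∷_)
  open import Data.List.Relation.Unary.All using ([]; _∷_; all?)
  open import Data.Nat as ℕ using (ℕ; zero; suc; _<_; _≤_; z≤n; s≤s)
  import Data.Nat.Properties as ℕ
  open import Data.Nat.DivMod using (_%_; _/_; m≡m%n+[m/n]*n; m%n<n)
  open import Data.Nat.Divisibility using (_∣_; divides; >⇒∤)
  open import Data.Nat.Tactic.RingSolver using (solve-∀)
  open import Data.Product using (Σ; _×_; _,_; proj₁; proj₂)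
  open import Data.Sum using (_⊎_; inj₁; inj₂)
  open import Relation.Binary.PropositionalEquality as ≡ using (_≡_)
  open import Relation.Nullary using (¬_; contradiction)
  open import Relation.Nullary.Decidable using (from-yes)

  -- The partial sums computed by the local function of sumᶠ; the hole is filled by unification in sumᶠ≡.
  mutual
    partialSum : ℕ → ℕ → (ℕ → Frac) → ℕ → Frac
    partialSum a b f = _

    sumᶠ≡ : ∀ a b f → sumᶠ a b f ≡ partialSum a b f (suc b ℕ.∸ a)
    sumᶠ≡ a b f with suc b ℕ.∸ a
    ... | k = ≡.refl {x = partialSum a b f k}

  polyDomain : DecidableDomain
  polyDomain = record
    { commutativeRing = polyRing ; noZeroDivisors = ⊗-noZeroDivisors ; ≈0? = ≐[]? ; 1≉0 = one≢[] }

  abstract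
    -- Kept abstract so that equations between fractions are checked symbolically and are not
    -- unfolded into operations on coefficient lists.
    quotientField : QuotientField polyDomain
    quotientField = record
      { field′ = fractionField ; embed = embed ; embed-cong = embed-cong ; embed-injective = embed-injective
      ; embed-+ = embed-+ ; embed-* = embed-* ; embed-neg = embed-neg ; embed-0 = cross ≐-refl ; embed-1 = cross ≐-refl
      ; clear = λ x → denominator x , numerator x , denominator≉0 x , clear x }
      where open FractionField polyDomain

  module DP = DomainProperties polyDomain
  module FO = FractionsOf polyDomain quotientField
  open FO using (module 𝕂; embed; embed-cong; embed-injective; embed-+; embed-*; embed-neg; embed-0; embed-1; embed-^; embed--)
  open 𝕂

  -- A `Frac` carries no proof about its denominator and is not reduced. This relation ties it to an
  -- element of the field and is preserved by the operations on fractions.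
  record Represents (A : Frac) (x : K) : Set where
    constructor represents
    field
      den≢[] : ¬ den A ≐ []
      cleared : x * embed (den A) ≈ embed (num A)

  ⊗≢[] : ∀ {f g} → ¬ f ≐ [] → ¬ g ≐ [] → ¬ f ⊗ g ≐ []
  ⊗≢[] = DP.*-NonZero

  Represents-≈ : ∀ {A x y} → x ≈ y → Represents A x → Represents A y
  Represents-≈ x≈y (represents d e) = represents d (trans (*-congʳ (sym x≈y)) e)

  Represents-+ : ∀ {A B x y} → Represents A x → Represents B y → Represents (A +ᶠ B) (x + y)
  Represents-+ {a , b} {c , d} {x} {y} (represents p e) (represents r e′) = represents (⊗≢[] p r) (begin
    (x + y) * embed (b ⊗ d)
      ≈⟨ *-congˡ (embed-* b d) ⟩
    (x + y) * (embed b * embed d)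
      ≈⟨ solve 4 (λ x y b d → (x :+ y) :* (b :* d) := x :* b :* d :+ y :* d :* b) ≡.refl x y (embed b) (embed d) ⟩
    x * embed b * embed d + y * embed d * embed b
      ≈⟨ +-cong (*-congʳ e) (*-congʳ e′) ⟩
    embed a * embed d + embed c * embed b
      ≈⟨ +-cong (embed-* a d) (embed-* c b) ⟨
    embed (a ⊗ d) + embed (c ⊗ b)
      ≈⟨ embed-+ (a ⊗ d) (c ⊗ b) ⟨
    embed (a ⊗ d ⊕ c ⊗ b) ∎)

  Represents-* : ∀ {A B x y} → Represents A x → Represents B y → Represents (A *ᶠ B) (x * y)
  Represents-* {a , b} {c , d} {x} {y} (represents p e) (represents r e′) = represents (⊗≢[] p r) (begin
    x * y * embed (b ⊗ d)                ≈⟨ *-congˡ (embed-* b d) ⟩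
    x * y * (embed b * embed d)          ≈⟨ solve 4 (λ x y b d → x :* y :* (b :* d) := x :* b :* (y :* d)) ≡.refl x y (embed b) (embed d) ⟩
    x * embed b * (y * embed d)          ≈⟨ *-cong e e′ ⟩
    embed a * embed c                    ≈⟨ embed-* a c ⟨
    embed (a ⊗ c)                        ∎)

  Represents-poly : ∀ f → Represents (fromPoly f) (embed f)
  Represents-poly f = represents one≢[] (trans (*-congˡ embed-1) (*-identityʳ _))

  Represents-÷ : ∀ {f g x y} → embed f ≈ x → embed g ≈ y → NonZero y → Represents (f , g) (x ÷ y)
  Represents-÷ f≈ g≈ y≉0 = represents (λ g≐[] → y≉0 (trans (sym g≈) (trans (embed-cong g≐[]) embed-0)))
    (trans (*-congˡ g≈) (trans (÷-cancel y≉0) (sym f≈)))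

  Represents-partialSum : ∀ {a b f v} k → (∀ i → i < k → Represents (f (a ℕ.+ i)) (v i)) → Represents (partialSum a b f k) (sum v k)
  Represents-partialSum zero    _ = Represents-≈ embed-0 (Represents-poly [])
  Represents-partialSum {a} {b} {f} (suc k) r =
    Represents-+ (Represents-partialSum {a} {b} {f} k (λ i i<k → r i (ℕ.m<n⇒m<1+n i<k))) (r k ℕ.≤-refl)

  fromℤ≐C : ∀ c → DP.fromℤ c ≐ C c
  fromℤ≐C (+ n)    = ≐-trans (fromℤ-+ve′ n) (×≐C n)
    where
    open Solver polyRing renaming (fromℤ-+ve to fromℤ-+ve′)
    open import Algebra.Properties.Semiring.Mult P.semiring using () renaming (_×_ to _·_)
    ×≐C : ∀ n → n · one ≐ C (+ n)
    ×≐C zero    = pointwise λ { zero → ≡.refl ; (suc i) → ≡.refl }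
    ×≐C (suc n) = ⊕-cong≐ (≐-refl {one}) (×≐C n)
  fromℤ≐C -[1+ n ] = ≐-trans (fromℤ-neg′ (+ suc n)) (pneg-cong≐ (fromℤ≐C (+ suc n)))
    where open Solver polyRing renaming (fromℤ-neg to fromℤ-neg′)

  congruence : ∀ {A B x y M} → Represents A x → Represents B y → FO.Denominator M M (x - y) → CongMod A B M
  congruence {a , b} {c , d} {x} {y} {M} (represents _ e) (represents _ e′) (FO.over D k D≉0 (DP.bezout u v i id i≢0) cl) =
    M ⊗ k , D , k , u , v , i , (λ z → D≉0 (IsZero⇒≐[] z)) ,
    ≐⇒≃ (embed-injective (begin
      embed (M ⊗ k ⊗ (b ⊗ d))
        ≈⟨ trans (embed-* (M ⊗ k) (b ⊗ d)) (*-cong (sym cl) (embed-* b d)) ⟩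
      (x - y) * embed D * (embed b * embed d)
        ≈⟨ solve 5 (λ x y D b d → (x :- y) :* D :* (b :* d) := (x :* b :* d :- y :* d :* b) :* D) ≡.refl x y (embed D) (embed b) (embed d) ⟩
      (x * embed b * embed d - y * embed d * embed b) * embed D
        ≈⟨ *-congʳ (+-cong (*-congʳ e) (-‿cong (*-congʳ e′))) ⟩
      (embed a * embed d - embed c * embed b) * embed D
        ≈⟨ *-congʳ (+-cong (embed-* a d) (-‿cong (embed-* c b))) ⟨
      (embed (a ⊗ d) - embed (c ⊗ b)) * embed D
        ≈⟨ trans (embed-* (a ⊗ d ⊖ c ⊗ b) D) (*-congʳ (embed-- (a ⊗ d) (c ⊗ b))) ⟨
      embed ((a ⊗ d ⊖ c ⊗ b) ⊗ D) ∎)) ,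
    ≐⇒≃ (≐-refl {M ⊗ k}) ,
    ≐⇒≃ (≐-trans id (fromℤ≐C i)) , i≢0

  module Translation (Φ : ℕ → Poly) (cyclotomic : IsCyclotomicFamily Φ) where

    ξ≐ : ∀ d → X^ (suc d) ⊖ one ≐ indeterminate DP.^ suc d DP.- one
    ξ≐ d = ⊕-cong≐ (X^≐ (suc d)) ≐-refl

    coeff-X^ : ∀ k → coeff (X^ k) k ≡ + 1
    coeff-X^ zero    = ≡.refl
    coeff-X^ (suc k) = coeff-X^ k

    ξ≢[] : ∀ d → ¬ X^ (suc d) ⊖ one ≐ []
    ξ≢[] d e with ≡.trans (≡.sym (≡.trans (coeff-⊖ (X^ (suc d)) one (suc d)) (≡.cong (ℤ._- + 0) (coeff-X^ d)))) (_≐_.at e (suc d))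
    ... | ()

    cyclotomicData : CyclotomicData polyDomain
    cyclotomicData = record
      { t = indeterminate
      ; t≉0 = λ e → contradiction (_≐_.at e 1) λ ()
      ; ξ≉0 = λ d e → ξ≢[] d (≐-trans (ξ≐ d) e)
      ; Φ = Φ
      ; factorization = λ d → ≐-trans (≃⇒≐ (cyclotomic d)) (ξ≐ d) }

    open CyclotomicLocalRing polyDomain quotientField cyclotomicData public
    open GenericElement generic public
    open QProperties FO.field′ generic public
    open Series FO.field′ generic public
    open PlainSeries FO.field′ generic public
    open Nodes FO.field′ q public

    embed-X^ : ∀ k → embed (X^ k) ≈ q ^ k
    embed-X^ k = trans (embed-cong (X^≐ k)) (embed-^ indeterminate k)

    embed-⊗ : ∀ f g {x y} → embed f ≈ x → embed g ≈ y → embed (f ⊗ g) ≈ x * y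
    embed-⊗ f g p r = trans (embed-* f g) (*-cong p r)

    embed-^² : ∀ f {x} → embed f ≈ x → embed (f ^ᵖ 2) ≈ x ^ 2
    embed-^² f p = embed-⊗ f (f ⊗ one) p (embed-⊗ f one p embed-1)

    embed-^³ : ∀ f {x} → embed f ≈ x → embed (f ^ᵖ 3) ≈ x ^ 3
    embed-^³ f p = embed-⊗ f (f ^ᵖ 2) p (embed-^² f p)

    embed-1-X^ : ∀ k → embed (one ⊖ X^ k) ≈ E k
    embed-1-X^ k = trans (embed-- one (X^ k)) (+-cong embed-1 (-‿cong (embed-X^ k)))

    poch : ℕ → ℕ → ℕ → K
    poch s t = prod (λ j → E (s ℕ.+ t ℕ.* j))

    embed-qpoch : ∀ s t k → embed (qpoch s t k) ≈ poch s t k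
    embed-qpoch s t zero    = embed-1
    embed-qpoch s t (suc k) = embed-⊗ (qpoch s t k) (one ⊖ X^ (s ℕ.+ t ℕ.* k)) (embed-qpoch s t k) (embed-1-X^ (s ℕ.+ t ℕ.* k))

    E₁≉0 : NonZero (E 1)
    E₁≉0 = E≉0 0

    embed-qint-* : ∀ r → embed (qint r) * E 1 ≈ E r
    embed-qint-* zero    = trans (*-congʳ embed-0) (trans (zeroˡ _) (sym (-‿inverseʳ 1#)))
    embed-qint-* (suc r) = begin
      embed (qint r ⊕ X^ r) * E 1
        ≈⟨ *-congʳ (trans (embed-+ (qint r) (X^ r)) (+-congˡ (embed-X^ r))) ⟩
      (embed (qint r) + q ^ r) * E 1
        ≈⟨ distribʳ (E 1) _ _ ⟩
      embed (qint r) * E 1 + q ^ r * E 1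
        ≈⟨ +-congʳ (embed-qint-* r) ⟩
      (1# - q ^ r) + q ^ r * (1# - q ^ 1)
        ≈⟨ solve 2 (λ x y → (:1 :- x) :+ x :* (:1 :- y :^ 1) := :1 :- y :* x) ≡.refl (q ^ r) q ⟩
      E (suc r) ∎

    embed-qint : ∀ r → embed (qint r) ≈ E r ÷ E 1
    embed-qint r = ÷-intro E₁≉0 (embed-qint-* r)

    poch≉0 : ∀ s t k → NonZero (poch (suc s) t k)
    poch≉0 s t k = prod-NonZero k (λ j _ → E≉0 (s ℕ.+ t ℕ.* j))

    base-product : ∀ k → prod base k * (poch 2 2 k ^ 2 * poch 4 4 k ^ 3) ≈
      poch 1 2 k ^ 2 * poch 2 4 k * poch 1 4 k ^ 2 * q ^ (2 ℕ.* k)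
    base-product zero = solve 0 (:1 :* (:1 :^ 2 :* :1 :^ 3) := :1 :^ 2 :* :1 :* :1 :^ 2 :* :1) ≡.refl
    base-product (suc k) = begin
      prod base k * base k * ((A * e₂) ^ 2 * (B * e₄) ^ 3)
        ≈⟨ solve 6 (λ p b A e B f → p :* b :* ((A :* e) :^ 2 :* (B :* f) :^ 3) := p :* (A :^ 2 :* B :^ 3) :* (b :* (f :^ 3 :* e :^ 2))) ≡.refl
             (prod base k) (base k) A e₂ B e₄ ⟩
      prod base k * (A ^ 2 * B ^ 3) * (base k * (e₄ ^ 3 * e₂ ^ 2))
        ≈⟨ *-cong (base-product k) base-cancel ⟩
      U ^ 2 * V * Z ^ 2 * q ^ (2 ℕ.* k) * (q ^ 2 * ((o₂ * o₂) * ((o₄ * o₄) * t₄)))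
        ≈⟨ solve 8 (λ U V Z x q a b c → U :^ 2 :* V :* Z :^ 2 :* x :* (q :^ 2 :* ((a :* a) :* ((b :* b) :* c)))
             := (U :* a) :^ 2 :* (V :* c) :* (Z :* b) :^ 2 :* (q :^ 2 :* x)) ≡.refl U V Z (q ^ (2 ℕ.* k)) q o₂ o₄ t₄ ⟩
      (U * o₂) ^ 2 * (V * t₄) * (Z * o₄) ^ 2 * (q ^ 2 * q ^ (2 ℕ.* k))
        ≈⟨ *-congˡ (trans (sym (^-homo-* q 2 (2 ℕ.* k))) (^-congʳ q (≡.sym (ℕ.*-suc 2 k)))) ⟩
      (U * o₂) ^ 2 * (V * t₄) * (Z * o₄) ^ 2 * q ^ (2 ℕ.* suc k) ∎
      where
      A = poch 2 2 k
      B = poch 4 4 k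
      U = poch 1 2 k
      V = poch 2 4 k
      Z = poch 1 4 k
      e₂ = E (2 ℕ.+ 2 ℕ.* k)
      e₄ = E (4 ℕ.+ 4 ℕ.* k)
      o₂ = E (1 ℕ.+ 2 ℕ.* k)
      o₄ = E (1 ℕ.+ 4 ℕ.* k)
      t₄ = E (2 ℕ.+ 4 ℕ.* k)
      E-comm : ∀ s a → E (s ℕ.+ a) ≈ E (a ℕ.+ s)
      E-comm s a = reflexive (≡.cong E (ℕ.+-comm s a))
      base-cancel : base k * (e₄ ^ 3 * e₂ ^ 2) ≈ q ^ 2 * ((o₂ * o₂) * ((o₄ * o₄) * t₄))
      base-cancel = begin
        base k * (e₄ ^ 3 * e₂ ^ 2)
          ≈⟨ *-congˡ (*-cong (^-congˡ 3 (E-comm 4 (4 ℕ.* k))) (^-congˡ 2 (E-comm 2 (2 ℕ.* k)))) ⟩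
        base k * baseDen k
          ≈⟨ ÷-cancel (baseDen≉0 k) ⟩
        baseNum k
          ≈⟨ *-congˡ (*-cong (*-cong (E-comm 1 (2 ℕ.* k)) (E-comm 1 (2 ℕ.* k)))
               (*-cong (*-cong (E-comm 1 (4 ℕ.* k)) (E-comm 1 (4 ℕ.* k))) (E-comm 2 (4 ℕ.* k)))) ⟨
        q ^ 2 * ((o₂ * o₂) * ((o₄ * o₄) * t₄)) ∎

    -- The division by 1 - q turns 1 - q^(6k+1) into [6k+1].
    Represents-lhsTerm : ∀ k → Represents (lhsTerm k) (term k ÷ E 1)
    Represents-lhsTerm k = represents
      (λ e → NonZero-resp (sym den≈) (*-NonZero (^-NonZero 2 (poch≉0 1 2 k)) (^-NonZero 3 (poch≉0 3 4 k))) (trans (embed-cong e) embed-0))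
      (begin
        term k ÷ E 1 * embed (den (lhsTerm k))
          ≈⟨ *-cong (*-congʳ (*-congʳ (κ≈ k))) den≈ ⟩
        E (6 ℕ.* k ℕ.+ 1) * prod base k * E 1 ⁻¹ * (poch 2 2 k ^ 2 * poch 4 4 k ^ 3)
          ≈⟨ solve 4 (λ e b i d → e :* b :* i :* d := e :* i :* (b :* d)) ≡.refl (E (6 ℕ.* k ℕ.+ 1)) (prod base k) (E 1 ⁻¹) _ ⟩
        E (6 ℕ.* k ℕ.+ 1) ÷ E 1 * (prod base k * (poch 2 2 k ^ 2 * poch 4 4 k ^ 3))
          ≈⟨ *-congˡ (base-product k) ⟩
        E (6 ℕ.* k ℕ.+ 1) ÷ E 1 * (U * poch 2 4 k * V * q ^ (2 ℕ.* k))
          ≈⟨ solve 5 (λ a b c d e → a :* (b :* c :* d :* e) := a :* b :* c :* d :* e) ≡.refl _ U (poch 2 4 k) V (q ^ (2 ℕ.* k)) ⟩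
        E (6 ℕ.* k ℕ.+ 1) ÷ E 1 * U * poch 2 4 k * V * q ^ (2 ℕ.* k)
          ≈⟨ num≈ ⟨
        embed (num (lhsTerm k)) ∎)
      where
      U = poch 1 2 k ^ 2
      V = poch 1 4 k ^ 2
      Q = qint (6 ℕ.* k ℕ.+ 1)
      den≈ : embed (den (lhsTerm k)) ≈ poch 2 2 k ^ 2 * poch 4 4 k ^ 3
      den≈ = embed-⊗ (qpoch 2 2 k ^ᵖ 2) (qpoch 4 4 k ^ᵖ 3) (embed-^² (qpoch 2 2 k) (embed-qpoch 2 2 k)) (embed-^³ (qpoch 4 4 k) (embed-qpoch 4 4 k))
      num≈ : embed (num (lhsTerm k)) ≈ E (6 ℕ.* k ℕ.+ 1) ÷ E 1 * U * poch 2 4 k * V * q ^ (2 ℕ.* k)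
      num≈ = embed-⊗ (Q ⊗ (qpoch 1 2 k ^ᵖ 2) ⊗ qpoch 2 4 k ⊗ (qpoch 1 4 k ^ᵖ 2)) (X^ (2 ℕ.* k))
        (embed-⊗ (Q ⊗ (qpoch 1 2 k ^ᵖ 2) ⊗ qpoch 2 4 k) (qpoch 1 4 k ^ᵖ 2)
          (embed-⊗ (Q ⊗ (qpoch 1 2 k ^ᵖ 2)) (qpoch 2 4 k)
            (embed-⊗ Q (qpoch 1 2 k ^ᵖ 2) (embed-qint (6 ℕ.* k ℕ.+ 1)) (embed-^² (qpoch 1 2 k) (embed-qpoch 1 2 k)))
            (embed-qpoch 2 4 k))
          (embed-^² (qpoch 1 4 k) (embed-qpoch 1 4 k)))
        (embed-X^ (2 ℕ.* k))

    Represents-LHS : ∀ M → Represents (LHS M) (sum term (suc M) ÷ E 1)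
    Represents-LHS M = ≡.subst (λ A → Represents A (sum term (suc M) ÷ E 1)) (≡.sym (sumᶠ≡ 0 M lhsTerm))
      (Represents-≈ (trans (sum-cong (suc M) (λ k _ → *-comm (term k) (E 1 ⁻¹))) (trans (sum-*ˡ (E 1 ⁻¹) term (suc M)) (*-comm (E 1 ⁻¹) _)))
        (Represents-partialSum {0} {M} {lhsTerm} (suc M) (λ i _ → Represents-lhsTerm i)))

    sign : ℕ → ℤ
    sign j = ℤ.-1ℤ ℤ.^ suc j

    sign-suc² : ∀ j → sign (suc (suc j)) ≡ sign j
    sign-suc² j = ≡.trans (ℤ.-1*i≡-i (sign (suc j))) (≡.trans (≡.cong ℤ.-_ (ℤ.-1*i≡-i (sign j))) (ℤ.neg-involutive (sign j)))

    sign-odd : ∀ i → sign (2 ℕ.* i ℕ.+ 1) ≡ + 1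
    sign-odd zero    = ≡.refl
    sign-odd (suc i) = ≡.trans (≡.cong sign (≡.cong (ℕ._+ 1) (ℕ.*-suc 2 i))) (≡.trans (sign-suc² (2 ℕ.* i ℕ.+ 1)) (sign-odd i))

    sign-even : ∀ i → sign (2 ℕ.* i ℕ.+ 2) ≡ ℤ.-1ℤ
    sign-even zero    = ≡.refl
    sign-even (suc i) = ≡.trans (≡.cong sign (≡.cong (ℕ._+ 2) (ℕ.*-suc 2 i))) (≡.trans (sign-suc² (2 ℕ.* i ℕ.+ 2)) (sign-even i))

    Represents-innerTerm : ∀ j {s c} → sign (suc j) ≡ s → embed (C s) ≈ c →
      Represents (innerTerm (suc j)) (c * (E 1 ^ 2 * ε (2 ℕ.* suc j)))
    Represents-innerTerm j {s} {c} ≡.refl c≈ = Represents-≈ value≈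
      (Represents-÷ (embed-⊗ (C s) (X^ (2 ℕ.* suc j)) c≈ (embed-X^ (2 ℕ.* suc j))) (embed-^² (qint (2 ℕ.* suc j)) (embed-qint (2 ℕ.* suc j)))
        (^-NonZero 2 quotient≉0))
      where
      e = E (2 ℕ.* suc j)
      x = q ^ (2 ℕ.* suc j)
      e≉0 : NonZero e
      e≉0 = E≉0 (j ℕ.+ 1 ℕ.* suc j)
      quotient≉0 : NonZero (e ÷ E 1)
      quotient≉0 = *-NonZero e≉0 (⁻¹-NonZero E₁≉0)
      value≈ : (c * x) ÷ (e ÷ E 1) ^ 2 ≈ c * (E 1 ^ 2 * ε (2 ℕ.* suc j))
      value≈ = *-cancelʳ (^-NonZero 2 quotient≉0) (begin
        (c * x) ÷ (e ÷ E 1) ^ 2 * (e ÷ E 1) ^ 2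
          ≈⟨ ÷-cancel (^-NonZero 2 quotient≉0) ⟩
        c * x
          ≈⟨ solve 2 (λ c x → c :* x := c :* x :* :1 :^ 2) ≡.refl c x ⟩
        c * x * 1# ^ 2
          ≈⟨ *-cong (*-congˡ (÷-cancel (^-NonZero 2 e≉0))) (^-congˡ 2 (⁻¹-inverse E₁≉0)) ⟨
        c * (x ÷ e ^ 2 * e ^ 2) * (E 1 * E 1 ⁻¹) ^ 2
          ≈⟨ solve 5 (λ c y e a i → c :* (y :* e :^ 2) :* (a :* i) :^ 2 := c :* (a :^ 2 :* y) :* (e :* i) :^ 2) ≡.refl c (x ÷ e ^ 2) e (E 1) (E 1 ⁻¹) ⟩
        c * (E 1 ^ 2 * ε (2 ℕ.* suc j)) * (e ÷ E 1) ^ 2 ∎)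

    -- The 2m summands are consumed in pairs, an odd and an even j, so the alternating sign becomes
    -- the difference inside `harmonic`.
    Represents-inner : ∀ m → Represents (sumᶠ 1 (2 ℕ.* m) innerTerm) (E 1 ^ 2 * harmonic m)
    Represents-inner m = ≡.subst (λ A → Represents A (E 1 ^ 2 * harmonic m)) (≡.sym (sumᶠ≡ 1 (2 ℕ.* m) innerTerm)) (go m)
      where
      go : ∀ k → Represents (partialSum 1 (2 ℕ.* m) innerTerm (2 ℕ.* k)) (E 1 ^ 2 * harmonic k)
      go zero    = Represents-≈ (trans embed-0 (sym (zeroʳ _))) (Represents-poly [])
      go (suc k) = ≡.subst (λ l → Represents (partialSum 1 (2 ℕ.* m) innerTerm l) (E 1 ^ 2 * harmonic (suc k))) (≡.sym (ℕ.*-suc 2 k))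
        (Represents-≈ (begin
          E 1 ^ 2 * harmonic k + 1# * (E 1 ^ 2 * ε (2 ℕ.* suc (2 ℕ.* k))) + - 1# * (E 1 ^ 2 * ε (2 ℕ.* suc (suc (2 ℕ.* k))))
            ≈⟨ +-cong (+-congˡ (*-congˡ (*-congˡ (reflexive (≡.cong ε (e₁ k)))))) (*-congˡ (*-congˡ (reflexive (≡.cong ε (e₂ k))))) ⟩
          E 1 ^ 2 * harmonic k + 1# * (E 1 ^ 2 * ε (4 ℕ.* k ℕ.+ 2)) + - 1# * (E 1 ^ 2 * ε (4 ℕ.* k ℕ.+ 4))
            ≈⟨ solve 4 (λ c h a b → c :* h :+ :1 :* (c :* a) :+ :- :1 :* (c :* b) := c :* (h :+ (a :- b))) ≡.refl (E 1 ^ 2) (harmonic k) _ _ ⟩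
          E 1 ^ 2 * harmonic (suc k) ∎)
        (Represents-+ (Represents-+ (go k)
          (Represents-innerTerm (2 ℕ.* k) (≡.trans (≡.cong sign (ℕ.+-comm 1 (2 ℕ.* k))) (sign-odd k)) embed-1))
          (Represents-innerTerm (suc (2 ℕ.* k)) (≡.trans (≡.cong sign (ℕ.+-comm 2 (2 ℕ.* k))) (sign-even k)) (trans (embed-neg one) (-‿cong embed-1)))))
        where
        e₁ : ∀ k → 2 ℕ.* suc (2 ℕ.* k) ≡ 4 ℕ.* k ℕ.+ 2
        e₁ = solve-∀
        e₂ : ∀ k → 2 ℕ.* suc (suc (2 ℕ.* k)) ≡ 4 ℕ.* k ℕ.+ 4
        e₂ = solve-∀

    η-product : ∀ m → prod (η (symm 0)) m * poch 4 4 m ^ 2 ≈ poch 2 4 m ^ 2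
    η-product zero    = solve 0 (:1 :* :1 :^ 2 := :1 :^ 2) ≡.refl
    η-product (suc m) = begin
      prod (η (symm 0)) m * η (symm 0) m * (poch 4 4 m * e₄) ^ 2
        ≈⟨ solve 4 (λ p h a e → p :* h :* (a :* e) :^ 2 := p :* a :^ 2 :* (h :* e :^ 2)) ≡.refl (prod (η (symm 0)) m) (η (symm 0) m) (poch 4 4 m) e₄ ⟩
      prod (η (symm 0)) m * poch 4 4 m ^ 2 * (η (symm 0) m * e₄ ^ 2)
        ≈⟨ *-cong (η-product m) (begin
             η (symm 0) m * e₄ ^ 2
               ≈⟨ *-cong (η-0 m) (^-congˡ 2 (reflexive (≡.cong E (ℕ.+-comm 4 (4 ℕ.* m))))) ⟩
             E (4 ℕ.* m ℕ.+ 2) ^ 2 ÷ E (4 ℕ.* m ℕ.+ 4) ^ 2 * E (4 ℕ.* m ℕ.+ 4) ^ 2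
               ≈⟨ ÷-cancel (^-NonZero 2 (E-suc≉0 (4 ℕ.* m) 3)) ⟩
             E (4 ℕ.* m ℕ.+ 2) ^ 2
               ≈⟨ ^-congˡ 2 (reflexive (≡.cong E (ℕ.+-comm 2 (4 ℕ.* m)))) ⟨
             e₂ ^ 2 ∎) ⟩
      poch 2 4 m ^ 2 * e₂ ^ 2
        ≈⟨ solve 2 (λ a e → a :^ 2 :* e :^ 2 := (a :* e) :^ 2) ≡.refl (poch 2 4 m) e₂ ⟩
      (poch 2 4 m * e₂) ^ 2 ∎
      where
      e₂ = E (2 ℕ.+ 4 ℕ.* m)
      e₄ = E (4 ℕ.+ 4 ℕ.* m)

    Represents-RHS : ∀ m → Represents (RHS (4 ℕ.* m ℕ.+ 1) m) (centralValue m ÷ E 1)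
    Represents-RHS m = Represents-≈ value≈
      (Represents-*
        (Represents-* (Represents-poly (qint n))
          (Represents-÷ (embed-^² (qpoch 2 4 m) (embed-qpoch 2 4 m)) (embed-^² (qpoch 4 4 m) (embed-qpoch 4 4 m)) P₄≉0))
        (Represents-+ (Represents-poly one)
          (Represents-* (Represents-poly ((qint n ^ᵖ 2) ⊗ (C (+ 2) ⊖ X^ n))) (Represents-inner m))))
      where
      n = 4 ℕ.* m ℕ.+ 1
      P₂ = poch 2 4 m ^ 2
      P₄ = poch 4 4 m ^ 2
      P = prod (η (symm 0)) m
      P₄≉0 : NonZero P₄
      P₄≉0 = ^-NonZero 2 (poch≉0 3 4 m)
      correction≈ : embed ((qint n ^ᵖ 2) ⊗ (C (+ 2) ⊖ X^ n)) ≈ (E n ÷ E 1) ^ 2 * (2# - q ^ n)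
      correction≈ = embed-⊗ (qint n ^ᵖ 2) (C (+ 2) ⊖ X^ n) (embed-^² (qint n) (embed-qint n))
        (trans (embed-- (C (+ 2)) (X^ n)) (+-cong (trans (embed-+ one one) (+-cong embed-1 embed-1)) (-‿cong (embed-X^ n))))
      value≈ : embed (qint n) * (P₂ ÷ P₄) * (embed one + embed ((qint n ^ᵖ 2) ⊗ (C (+ 2) ⊖ X^ n)) * (E 1 ^ 2 * harmonic m))
             ≈ centralValue m ÷ E 1
      value≈ = begin
        embed (qint n) * (P₂ ÷ P₄) * (embed one + embed ((qint n ^ᵖ 2) ⊗ (C (+ 2) ⊖ X^ n)) * (E 1 ^ 2 * harmonic m))
          ≈⟨ *-cong (*-cong (embed-qint n) (sym (÷-intro P₄≉0 (η-product m)))) (+-cong embed-1 (*-congʳ correction≈)) ⟩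
        (E n ÷ E 1) * P * (1# + (E n ÷ E 1) ^ 2 * (2# - q ^ n) * (E 1 ^ 2 * harmonic m))
          ≈⟨ *-congˡ (+-congˡ (solve 5 (λ e i a y h → (e :* i) :^ 2 :* y :* (a :^ 2 :* h) := e :^ 2 :* y :* h :* (a :* i) :^ 2)
               ≡.refl (E n) (E 1 ⁻¹) (E 1) (2# - q ^ n) (harmonic m))) ⟩
        (E n ÷ E 1) * P * (1# + E n ^ 2 * (2# - q ^ n) * harmonic m * (E 1 * E 1 ⁻¹) ^ 2)
          ≈⟨ *-congˡ (+-congˡ (*-congˡ (^-congˡ 2 (⁻¹-inverse E₁≉0)))) ⟩
        (E n ÷ E 1) * P * (1# + E n ^ 2 * (2# - q ^ n) * harmonic m * 1# ^ 2)
          ≈⟨ solve 4 (λ e i p x → e :* i :* p :* (:1 :+ x :* :1 :^ 2) := e :* p :* (:1 :+ x) :* i) ≡.refl (E n) (E 1 ⁻¹) P _ ⟩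
        centralValue m ÷ E 1 ∎

    difference≈ : ∀ a b → (a - b) ÷ E 1 ≈ a ÷ E 1 - b ÷ E 1
    difference≈ a b = solve 3 (λ a b i → (a :- b) :* i := a :* i :- b :* i) ≡.refl a b (E 1 ⁻¹)

  parity : ∀ k → Σ ℕ (λ j → k ≡ 2 ℕ.* j) ⊎ Σ ℕ (λ j → k ≡ suc (2 ℕ.* j))
  parity zero    = inj₁ (0 , ≡.refl)
  parity (suc k) with parity k
  ... | inj₁ (j , ≡.refl) = inj₂ (j , ≡.refl)
  ... | inj₂ (j , ≡.refl) = inj₁ (suc j , ≡.sym (ℕ.*-suc 2 j))

  odd-factor : ∀ m a b → 4 ℕ.* m ℕ.+ 1 ≡ a ℕ.* b → Σ ℕ λ j → b ≡ suc (2 ℕ.* j)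
  odd-factor m a b eq with parity b
  ... | inj₂ odd          = odd
  ... | inj₁ (j , ≡.refl) = contradiction eq (≢-mod 2 1 0 (2 ℕ.* m) (a ℕ.* j) (e₁ m) (e₂ a j) (λ ()))
    where
    e₁ : ∀ m → 4 ℕ.* m ℕ.+ 1 ≡ 1 ℕ.+ 2 ℕ.* m ℕ.* 2
    e₁ = solve-∀
    e₂ : ∀ a j → a ℕ.* (2 ℕ.* j) ≡ 0 ℕ.+ a ℕ.* j ℕ.* 2
    e₂ = solve-∀

  multiple≡1-mod-4 : ∀ δ → Σ ℕ λ μ → Σ ℕ λ g → 4 ℕ.* μ ℕ.+ 1 ≡ suc (2 ℕ.* δ) ℕ.* g × μ < suc (2 ℕ.* δ)
  multiple≡1-mod-4 δ with parity δ
  ... | inj₁ (a , ≡.refl) = a , 1 , e a , s≤s (≡.subst (a ≤_) (e′ a) (ℕ.m≤m+n a (3 ℕ.* a)))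
    where
    e : ∀ a → 4 ℕ.* a ℕ.+ 1 ≡ suc (2 ℕ.* (2 ℕ.* a)) ℕ.* 1
    e = solve-∀
    e′ : ∀ a → a ℕ.+ 3 ℕ.* a ≡ 2 ℕ.* (2 ℕ.* a)
    e′ = solve-∀
  -- For δ = 2a + 1 the odd number is 4a + 3, and its triple is 4 (3a + 2) + 1.
  ... | inj₂ (a , ≡.refl) = 3 ℕ.* a ℕ.+ 2 , 3 , e a , s≤s (≡.subst (3 ℕ.* a ℕ.+ 2 ≤_) (e′ a) (ℕ.m≤m+n (3 ℕ.* a ℕ.+ 2) a))
    where
    e : ∀ a → 4 ℕ.* (3 ℕ.* a ℕ.+ 2) ℕ.+ 1 ≡ suc (2 ℕ.* suc (2 ℕ.* a)) ℕ.* 3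
    e = solve-∀
    e′ : ∀ a → 3 ℕ.* a ℕ.+ 2 ℕ.+ a ≡ 2 ℕ.* suc (2 ℕ.* a)
    e′ = solve-∀

  module MainCongruence (Φ : ℕ → Poly) (cyclotomic : IsCyclotomicFamily Φ) (m′ : ℕ) where

    open Translation Φ cyclotomic
    open CyclotomicTheory polyDomain cyclotomicData using (ξ)

    m n : ℕ
    m = suc m′
    n = 4 ℕ.* m ℕ.+ 1

    Admits : ℕ → Set
    Admits M = M ≡ 2 ℕ.* m ⊎ M ≡ n ℕ.∸ 1

    discrepancy : ℕ → K
    discrepancy M = sum term (suc M) ÷ E 1 - centralValue m ÷ E 1

    module Proper (d e : ℕ) (n≡ed : n ≡ e ℕ.* suc (suc d)) where

      D = suc (suc d)
      L = localRing (suc d)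
      open LocalRing L
      open LocalProperties L hiding (divides)

      δ ε′ μ g : ℕ
      δ = proj₁ (odd-factor m e D n≡ed)
      ε′ = proj₁ (odd-factor m D e (≡.trans n≡ed (ℕ.*-comm e D)))

      D≡ : D ≡ suc (2 ℕ.* δ)
      D≡ = proj₂ (odd-factor m e D n≡ed)

      e≡ : e ≡ suc (2 ℕ.* ε′)
      e≡ = proj₂ (odd-factor m D e (≡.trans n≡ed (ℕ.*-comm e D)))

      μ = proj₁ (multiple≡1-mod-4 δ)
      g = proj₁ (proj₂ (multiple≡1-mod-4 δ))

      open PeriodicSums L δ μ g D≡
        (≡.trans (proj₁ (proj₂ (proj₂ (multiple≡1-mod-4 δ)))) (≡.cong (ℕ._* g) (≡.sym D≡)))
        (≡.subst (μ <_) (≡.sym D≡) (proj₂ (proj₂ (proj₂ (multiple≡1-mod-4 δ)))))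

      n≡De : n ≡ D ℕ.* e
      n≡De = ≡.trans n≡ed (ℕ.*-comm e D)

      Int-E₁⁻¹ : Int (E 1 ⁻¹)
      Int-E₁⁻¹ = Int-E⁻¹ 1 (>⇒∤ (s≤s (s≤s z≤n)))

      -- With n = (2δ + 1)(2ε′ + 1), the (n + 1)/2 terms of the shorter sum are ε′ full blocks of
      -- length D followed by the first δ + 1 terms of another.
      half≡ : D ℕ.* ε′ ℕ.+ suc δ ≡ suc (2 ℕ.* m)
      half≡ = ≡.sym (≡.trans (≡.cong suc 2m≡) (≡.trans (lemma δ ε′) (≡.cong (λ x → x ℕ.* ε′ ℕ.+ suc δ) (≡.sym D≡))))
        where
        expand : ∀ δ ε → suc (2 ℕ.* ε) ℕ.* suc (2 ℕ.* δ) ≡ suc (2 ℕ.* (2 ℕ.* (δ ℕ.* ε) ℕ.+ δ ℕ.+ ε))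
        expand = solve-∀
        n≡ : ∀ m → 4 ℕ.* m ℕ.+ 1 ≡ suc (2 ℕ.* (2 ℕ.* m))
        n≡ = solve-∀
        lemma : ∀ δ ε → suc (2 ℕ.* (δ ℕ.* ε) ℕ.+ δ ℕ.+ ε) ≡ suc (2 ℕ.* δ) ℕ.* ε ℕ.+ suc δ
        lemma = solve-∀
        2m≡ : 2 ℕ.* m ≡ 2 ℕ.* (δ ℕ.* ε′) ℕ.+ δ ℕ.+ ε′
        2m≡ = ℕ.*-cancelˡ-≡ _ _ 2 (ℕ.suc-injective (≡.trans (≡.sym (n≡ m)) (≡.trans n≡ed (≡.trans (≡.cong₂ ℕ._*_ e≡ D≡) (expand δ ε′)))))

      Div-left : ∀ {M} → Admits M → Div 1 (sum term (suc M))
      Div-left (inj₁ ≡.refl) = Div-resp (reflexive (≡.cong (sum term) half≡)) (Div-sum-half ε′)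
      Div-left (inj₂ ≡.refl) = Div-resp (reflexive (≡.cong (sum term) (≡.sym n≡De))) (Div-sum-blocks e)

      -- The product is the square of one over `ratio₂`, whose m factors are m / D full blocks
      -- followed by m % D further ones.
      Int-prod-η : Int (prod (η (symm 0)) m)
      Int-prod-η = Int-resp (sym (begin
        prod (η (symm 0)) m                     ≈⟨ prod-cong m (λ i _ → square i) ⟩
        prod (λ i → ratio₂ i * ratio₂ i) m      ≈⟨ prod-* ratio₂ ratio₂ m ⟩
        prod ratio₂ m * prod ratio₂ m           ∎)) (Int-* Int-ratios Int-ratios)
        where
        square : ∀ i → η (symm 0) i ≈ ratio₂ i * ratio₂ i
        square i = trans (η-0 i) (trans (÷-cong (solve 1 (λ a → a :^ 2 := a :* a) ≡.refl _) (solve 1 (λ a → a :^ 2 := a :* a) ≡.refl _))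
          (sym (÷-*-÷ (E-suc≉0 (4 ℕ.* i) 3) (E-suc≉0 (4 ℕ.* i) 3))))
        Int-ratios : Int (prod ratio₂ m)
        Int-ratios = Int-resp
          (reflexive (≡.cong (prod ratio₂) (≡.trans (≡.cong₂ ℕ._+_ (ℕ.*-comm D (m / D)) ≡.refl) (≡.trans (ℕ.+-comm _ (m % D)) (≡.sym (m≡m%n+[m/n]*n m D))))))
          (Int-prod-ratio₂ (m / D) (m % D) (m%n<n m D))

      -- When D divides a + 1, `ε` alone has a double pole at Φ_D; since D divides n, the square of
      -- 1 - qⁿ removes it.
      Int-h²ε : ∀ a → Int (E n ^ 2 * ε (suc a))
      Int-h²ε a = Int-resp (begin
        (E (D ℕ.* e) ÷ E (suc a)) ^ 2 * q ^ suc a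
          ≈⟨ *-congʳ (^-congˡ 2 (*-congʳ (reflexive (≡.cong E (≡.sym n≡De))))) ⟩
        (E n ÷ E (suc a)) ^ 2 * q ^ suc a
          ≈⟨ solve 3 (λ h i x → (h :* i) :^ 2 :* x := h :^ 2 :* (x :* i :^ 2)) ≡.refl (E n) (E (suc a) ⁻¹) (q ^ suc a) ⟩
        E n ^ 2 * (q ^ suc a * (E (suc a) ⁻¹) ^ 2)
          ≈⟨ *-congˡ (*-congˡ (⁻¹-unique (^-NonZero 2 (E≉0 a)) (begin
               E (suc a) ^ 2 * (E (suc a) ⁻¹) ^ 2   ≈⟨ solve 2 (λ e i → e :^ 2 :* i :^ 2 := (e :* i) :^ 2) ≡.refl (E (suc a)) (E (suc a) ⁻¹) ⟩
               (E (suc a) * E (suc a) ⁻¹) ^ 2       ≈⟨ ^-congˡ 2 (⁻¹-inverse (E≉0 a)) ⟩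
               1# ^ 2                               ≈⟨ solve 0 (:1 :^ 2 := :1) ≡.refl ⟩
               1#                                   ∎))) ⟩
        E n ^ 2 * ε (suc a) ∎)
        (Int-* (Int-^ 2 (Int-period-ratio e a)) (Int-power (suc a)))

      Int-h²ε′ : ∀ a k → Int (E n ^ 2 * ε (a ℕ.+ suc k))
      Int-h²ε′ a k = Int-resp (*-congˡ (reflexive (≡.cong ε (≡.sym (ℕ.+-suc a k))))) (Int-h²ε (a ℕ.+ k))

      Div-right : Div 1 (centralValue m)
      Div-right = Div-*ʳ (Div-*ʳ (Multiple⇒Div (E-Multiple e n≡De)) Int-prod-η)
        (Int-+ Int-1 (Int-resp rearrange (Int-* (Int-- (Int-+ Int-1 Int-1) (Int-power n)) Int-h²harmonic)))
        where
        Int-h²harmonic : Int (E n ^ 2 * harmonic m)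
        Int-h²harmonic = Int-resp (sum-*ˡ (E n ^ 2) _ m) (Int-sum m (λ i _ → Int-resp
          (solve 3 (λ h a b → h :* a :- h :* b := h :* (a :- b)) ≡.refl (E n ^ 2) (ε (4 ℕ.* i ℕ.+ 2)) (ε (4 ℕ.* i ℕ.+ 4)))
          (Int-- (Int-h²ε′ (4 ℕ.* i) 1) (Int-h²ε′ (4 ℕ.* i) 3))))
        rearrange : (2# - q ^ n) * (E n ^ 2 * harmonic m) ≈ E n ^ 2 * (2# - q ^ n) * harmonic m
        rearrange = solve 3 (λ y h s → y :* (h :* s) := h :* y :* s) ≡.refl (2# - q ^ n) (E n ^ 2) (harmonic m)

      Div-discrepancy : ∀ {M} → Admits M → Div 1 (discrepancy M)
      Div-discrepancy {M} adm = Div-resp (difference≈ (sum term (suc M)) (centralValue m))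
        (Div-*ʳ (Div-- (Div-left adm) Div-right) Int-E₁⁻¹)

    -- Written so that its successor is definitionally `n`, as `CentralCongruence` requires of the
    -- index of the local ring. The form n - 2 used by `Moduli` agrees with it only up to
    -- commutativity of addition.
    n-1 : ℕ
    n-1 = m′ ℕ.+ 3 ℕ.* suc m′ ℕ.+ 1

    module Middle where

      L = localRing n-1
      open LocalRing L
      open LocalProperties L hiding (divides)
      open CentralCongruence m′ L using (central; central-full)

      Int-E₁⁻¹ : Int (E 1 ⁻¹)
      Int-E₁⁻¹ = Int-E⁻¹ 1 (>⇒∤ (s≤s (≡.subst (1 ≤_) (ℕ.+-comm 1 (m′ ℕ.+ 3 ℕ.* suc m′)) (s≤s z≤n))))

      Div-discrepancy : ∀ {M} → Admits M → Div 5 (discrepancy M)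
      Div-discrepancy {M} adm = Div-resp (difference≈ (sum term (suc M)) (centralValue m)) (Div-*ʳ (go adm) Int-E₁⁻¹)
        where
        go : ∀ {M} → Admits M → Div 5 (sum term (suc M) - centralValue m)
        go (inj₁ ≡.refl) = ≡.subst (λ k → Div 5 (sum term (suc (m ℕ.+ k)) - centralValue m)) (≡.sym (ℕ.+-identityʳ m)) central
        go (inj₂ ≡.refl) = central-full

    n₂ : ℕ
    n₂ = m′ ℕ.+ 3 ℕ.* suc m′

    n-1≡ : n-1 ≡ suc n₂
    n-1≡ = ℕ.+-comm n₂ 1

    n≡ : n ≡ suc (suc n₂)
    n≡ = ≡.cong suc n-1≡

    qint-ξ : ∀ k → qint k ⊗ ξ 1 ≐ ξ k
    qint-ξ k = embed-injective (begin
      embed (qint k ⊗ ξ 1)                 ≈⟨ embed-* (qint k) (ξ 1) ⟩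
      embed (qint k) * embed (ξ 1)         ≈⟨ *-congˡ (E≈′ 1) ⟨
      embed (qint k) * - E 1               ≈⟨ solve 2 (λ a b → a :* :- b := :- (a :* b)) ≡.refl (embed (qint k)) (E 1) ⟩
      - (embed (qint k) * E 1)             ≈⟨ -‿cong (embed-qint-* k) ⟩
      - E k                                ≈⟨ E≈′ k ⟩
      embed (ξ k)                          ∎)
      where
      E≈′ : ∀ i → - E i ≈ embed (ξ i)
      E≈′ i = trans (-‿cong (trans (E≈ i) (embed-neg (ξ i)))) (solve 1 (λ a → :- (:- a) := a) ≡.refl (embed (ξ i)))

    main : ∀ {M} → Admits M → CongMod (LHS M) (RHS n m) (qint n ⊗ (Φ n ^ᵖ 4))
    main {M} adm = congruence (Represents-LHS M) (Represents-RHS m)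
      (FO.Denominator-resp modulus≐ modulus≐ (Moduli.total n₂ (qint (suc (suc n₂))) (qint-ξ (suc (suc n₂))) proper middle))
      where
      proper : ∀ d → suc (suc d) ∣ suc (suc n₂) → d < n₂ → FO.Denominator (Φ (suc (suc d))) (Φ (suc (suc d))) (discrepancy M)
      proper d (divides e eq) _ = FO.Denominator-resp (P.*-identityʳ _) (P.*-identityʳ _)
        (Div⇒Denominator (suc d) 1 (Proper.Div-discrepancy d e (≡.trans n≡ eq) adm))
      middle : FO.Denominator (Φ (suc (suc n₂)) DP.^ 5) (Φ (suc (suc n₂)) DP.^ 5) (discrepancy M)
      middle = ≡.subst (λ k → FO.Denominator (Φ (suc k) DP.^ 5) (Φ (suc k) DP.^ 5) (discrepancy M)) n-1≡
        (Div⇒Denominator n-1 5 (Middle.Div-discrepancy adm))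
      modulus≐ : qint (suc (suc n₂)) ⊗ Φ (suc (suc n₂)) DP.^ 4 ≐ qint n ⊗ (Φ n ^ᵖ 4)
      modulus≐ = P.reflexive (≡.trans (≡.cong (λ k → qint k ⊗ Φ k DP.^ 4) (≡.sym n≡)) (≡.cong (qint n ⊗_) (≡.sym (^ᵖ≡^ (Φ n) 4))))

  -- The central argument finds the extra factor E n at index m - 1, so n = 1 stands apart. Both
  -- sides are then 1, and the cross-multiplied difference is zero by evaluation of closed
  -- coefficient lists.
  trivial-case : ∀ (P : Poly) → CongMod (LHS 0) (RHS 1 0) P
  trivial-case P = [] , one , [] , one , [] , + 1 ,
    (λ { (() ∷ _) }) ,
    from-yes (all? (ℤ._≟ + 0) ([] ⊖ (num (LHS 0) ⊗ den (RHS 1 0) ⊖ num (RHS 1 0) ⊗ den (LHS 0)) ⊗ one)) ,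
    ≐⇒≃ (≐-sym (⊗-zeroʳ≐ P)) ,
    from-yes (all? (ℤ._≟ + 0) (one ⊗ one ⊕ [] ⊖ C (+ 1))) , λ ()

-- The congruence for every n ≡ 1 (mod 4) and both upper limits

open import Defs
open Assembly using (trivial-case; module MainCongruence)
open import Data.Nat using (ℕ; zero; suc; _+_; _*_; _∸_)
open import Data.Sum using (_⊎_; inj₁; inj₂)
open import Relation.Binary.PropositionalEquality using (_≡_; refl)

theorem1p4 : (Φ : ℕ → Poly) → IsCyclotomicFamily Φ →
    (n m : ℕ) → n ≡ 4 * m + 1 →
    (M : ℕ) → (M ≡ 2 * m ⊎ M ≡ n ∸ 1) →
    CongMod (LHS M) (RHS n m) (qint n ⊗ (Φ n ^ᵖ 4))
theorem1p4 Φ cyclotomic n zero     refl M (inj₁ refl) = trivial-case (qint 1 ⊗ (Φ 1 ^ᵖ 4))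
theorem1p4 Φ cyclotomic n zero     refl M (inj₂ refl) = trivial-case (qint 1 ⊗ (Φ 1 ^ᵖ 4))
theorem1p4 Φ cyclotomic n (suc m′) refl M adm         = MainCongruence.main Φ cyclotomic m′ adm
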